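{- Let $p$ be a prime, let $m$ be a positive integer with $\gcd(p,m)=1$, let $k$ be a nonnegative integer, and let $n=p^km$. Then, reducing coefficients modulo $p$: (i) If $m=1$ (and $k\ge 1$), then $\Psi_n(x,y)\equiv\left(x^2+4y^2\right)^{\varphi(p^k)/2}$ in $\mathbb{Z}_p[x,y]$. (ii) If $m=2$, then $\Psi_n(x,y)\equiv x^{\varphi(p^k)}$ in $\mathbb{Z}_p[x,y]$. (iii) If $m\geq3$ and $p>2$, let $u$ be the multiplicative order of $p$ modulo $2m$ and define $\delta=u/2$ if ($p\equiv1\pmod 4$, $u$ even, and $p^{u/2}\equiv-1\pmod{2m}$) or ($p\equiv 3\pmod 4$, $u\equiv0\pmod 4$, and $p^{u/2}\equiv-1\pmod{2m}$) or ($p\equiv3\pmod4$, $u\equiv2\pmod4$, and $p^{u/2}\equiv m\pm1\pmod{2m}$); $\delta=2u$ if $p\equiv3\pmod4$ and $u$ is odd; and $\delta=u$ in all other cases. Then $\Psi_n(x,y)$ factors in $\mathbb{Z}_p[x,y]$ as a product of $\varphi(m)/\delta$ distinct irreducible polynomials, monic in $x$, of degree $\delta$, each raised to the $\varphi(p^k)$-th power. (iv) If $m\geq3$ and $p=2$, let $u'$ be the multiplicative order of $2$ modulo $m$ and define $\delta=u'/2$ if $u'$ is even and $2^{u'/2}\equiv-1\pmod m$, and $\delta=u'$ otherwise. Then $\Psi_n(x,y)$ factors in $\mathbb{Z}_2[x,y]$ as a product of $\varphi(m)/(2\delta)$ distinct irreducible polynomials, monic in $x$, of degree $\delta$, each raised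 to the $2\varphi(2^k)$-th power.
   Context: $\mathbb{Z}_p$ denotes the field with $p$ elements. The Fibonacci polynomials are defined by $F_1(x)=1$, $F_2(x)=x$, and $F_n(x)=xF_{n-1}(x)+F_{n-2}(x)$ for $n\geq 3$. For $n\geq 2$, the $n$-th fibotomic polynomial $\Psi_n(x)$ is the product of the monic irreducible factors (in $\mathbb{Z}[x]$) of $F_n(x)$ which are not factors of $F_k(x)$ for any $k<n$; also $\Psi_1(x)=1$, so that $F_n(x)=\prod_{d\mid n}\Psi_d(x)$; $\deg\Psi_n=\varphi(n)$ for $n\ge 2$, where $\varphi$ is Euler's totient function. The homogenized fibotomic polynomial is $\Psi_1(x,y)=1$ and $\Psi_n(x,y)=y^{\varphi(n)}\Psi_n(x/y)$ for $n\geq 2$. The quantity $\delta$ in (iii) (resp. (iv)) equals the degree over $\mathbb{Z}_p$ of the minimal polynomial of $\zeta_4(\zeta_{2m}^s+\zeta_{2m}^{ -s})$ (resp. $\zeta_m^s+\zeta_m^{ -s}$), $\gcd(s,m)=1$, where $\zeta_j$ denotes a root of the $j$-th cyclotomic polynomial in an algebraic closure of $\mathbb{Z}_p$.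
   Formalization: Part (i) is stated under the extra condition that φ(p^k) is even; this excludes only p=2, k=1 (n=2), where the exponent φ(p^k)/2 = 1/2 is not an integer and the displayed power is undefined. -}

module Defs where

open import Data.Nat as ℕ using (ℕ; zero; suc; _≤_; _<_; _≤?_; _≟_; z≤n; s≤s)
open import Data.Nat.Coprimality using (Coprime; coprime?)
open import Data.Nat.Divisibility using (_∣?_)
open import Data.Integer as ℤ using (ℤ; +_; 0ℤ; 1ℤ; -[1+_])
open import Data.Integer.Divisibility using () renaming (_∣_ to _∣ℤ_)
open import Data.List using (List; []; _∷_; length; filter; map; upTo; reverse; foldr)
open import Data.Product using (_×_; ∃; ∃-syntax; Σ-syntax; _,_)
open import Data.Sum using (_⊎_)
open import Relation.Nullary using (¬_; yes; no)
open import Relation.Binary.PropositionalEquality using (_≡_)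
open import Data.List.Relation.Unary.All using (All)
open import Data.List.Relation.Unary.AllPairs using (AllPairs)

φ : ℕ → ℕ
φ n = length (filter (λ k → coprime? k n) (map suc (upTo n)))

_div_ : ℕ → ℕ → ℕ
a div zero    = 0
a div (suc b) = a ℕ./ suc b

IntCong : ℕ → ℤ → ℤ → Set
IntCong n a b = (+ n) ∣ℤ (a ℤ.- b)

IsMultOrder : ℕ → ℕ → ℕ → Set
IsMultOrder a n u =
  (0 < u) × IntCong n (+ (a ℕ.^ u)) 1ℤ ×
  (∀ v → 0 < v → v < u → ¬ IntCong n (+ (a ℕ.^ v)) 1ℤ)

-- Univariate integer polynomials as coefficient lists (lowest degree first)

UPoly : Set
UPoly = List ℤ

addU : UPoly → UPoly → UPoly
addU []       q        = q
addU (a ∷ as) []       = a ∷ as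
addU (a ∷ as) (b ∷ bs) = (a ℤ.+ b) ∷ addU as bs

mulU : UPoly → UPoly → UPoly
mulU []       q = []
mulU (a ∷ as) q = addU (map (a ℤ.*_) q) (0ℤ ∷ mulU as q)

F : ℕ → UPoly
F zero          = []
F (suc zero)    = 1ℤ ∷ []
F (suc (suc n)) = addU (0ℤ ∷ F (suc n)) (F n)

subFront : List ℤ → List ℤ → List ℤ
subFront as       []       = as
subFront []       bs       = map ℤ.-_ bs
subFront (a ∷ as) (b ∷ bs) = (a ℤ.- b) ∷ subFront as bs

-- long division by a monic polynomial, coefficient lists highest degree
-- first; the divisor is given without its leading coefficient 1
divHigh : ℕ → List ℤ → List ℤ → List ℤ
divHigh zero     bt as       = []
divHigh (suc f)  bt []       = []
divHigh (suc f)  bt (q ∷ as) with length bt ≤? length as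
... | yes _ = q ∷ divHigh f bt (subFront as (map (q ℤ.*_) bt))
... | no  _ = []

divMonic : UPoly → UPoly → UPoly
divMonic A B with reverse B
... | []      = []
... | _ ∷ bt  = reverse (divHigh (length A) bt (reverse A))

properDivisors : ℕ → List ℕ
properDivisors n = filter (λ d → d ∣? n) (map suc (upTo (n ℕ.∸ 1)))

prodU : List UPoly → UPoly
prodU = foldr mulU (1ℤ ∷ [])

-- fibotomic polynomials, determined by F n = ∏_{d ∣ n} Ψ d (exact,
-- monic division in ℤ[x]); the first argument is recursion fuel
ΨF : ℕ → ℕ → UPoly
ΨF zero    n = 1ℤ ∷ []
ΨF (suc f) n with n ≤? 1
... | yes _ = 1ℤ ∷ []
... | no  _ = divMonic (F n) (prodU (map (ΨF f) (properDivisors n)))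

Ψ : ℕ → UPoly
Ψ n = ΨF n n

coeffU : UPoly → ℕ → ℤ
coeffU []       _       = 0ℤ
coeffU (a ∷ as) zero    = a
coeffU (a ∷ as) (suc i) = coeffU as i

-- Bivariate integer polynomials: coefficient functions (i ↦ x-degree,
-- j ↦ y-degree) with finite support.

Coeffs : Set
Coeffs = ℕ → ℕ → ℤ

IsPoly : Coeffs → Set
IsPoly f = ∃[ N ] (∀ i j → N < i ℕ.+ j → f i j ≡ 0ℤ)

Poly2 : Set
Poly2 = Σ[ f ∈ Coeffs ] IsPoly f

sumTo : ℕ → (ℕ → ℤ) → ℤ
sumTo zero    h = h 0
sumTo (suc n) h = sumTo n h ℤ.+ h (suc n)

infixl 7 _*P_
infixl 6 _+P_
infixr 8 _^P_
infix 4 _≡[_]_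

_*P_ : Coeffs → Coeffs → Coeffs
(f *P g) i j = sumTo i (λ a → sumTo j (λ b → f a b ℤ.* g (i ℕ.∸ a) (j ℕ.∸ b)))

_+P_ : Coeffs → Coeffs → Coeffs
(f +P g) i j = f i j ℤ.+ g i j

oneP : Coeffs
oneP zero zero = 1ℤ
oneP _    _    = 0ℤ

mono : ℤ → ℕ → ℕ → Coeffs
mono c a b i j with i ≟ a | j ≟ b
... | yes _ | yes _ = c
... | _     | _     = 0ℤ

xP : Coeffs
xP = mono 1ℤ 1 0

_^P_ : Coeffs → ℕ → Coeffs
f ^P zero  = oneP
f ^P suc e = f *P (f ^P e)

prodP : List Coeffs → Coeffs
prodP = foldr _*P_ oneP

-- homogenized fibotomic polynomial Ψ_n(x,y) = y^{φ n} Ψ_n(x/y), Ψ_1(x,y)=1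
Ψ₂ : ℕ → Coeffs
Ψ₂ n i j with n ≤? 1
... | yes _ = oneP i j
... | no  _ with i ℕ.+ j ≟ φ n
...   | yes _ = coeffU (Ψ n) i
...   | no  _ = 0ℤ

_≡[_]_ : Coeffs → ℕ → Coeffs → Set
f ≡[ p ] g = ∀ i j → IntCong p (f i j) (g i j)

IsUnitMod : ℕ → Coeffs → Set
IsUnitMod p f = ∃[ g ] (IsPoly g × (f *P g) ≡[ p ] oneP)

IrreducibleMod : ℕ → Coeffs → Set
IrreducibleMod p f =
  ¬ (f ≡[ p ] (λ _ _ → 0ℤ)) × ¬ IsUnitMod p f ×
  (∀ g h → IsPoly g → IsPoly h → f ≡[ p ] (g *P h) →
     IsUnitMod p g ⊎ IsUnitMod p h)

MonicInXMod : ℕ → Coeffs → ℕ → Set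
MonicInXMod p f d =
  (∀ i j → d < i → IntCong p (f i j) 0ℤ) ×
  IntCong p (f d 0) 1ℤ ×
  (∀ j → 0 < j → IntCong p (f d j) 0ℤ)

TotalDegMod : ℕ → Coeffs → ℕ → Set
TotalDegMod p f d =
  (∀ i j → d < i ℕ.+ j → IntCong p (f i j) 0ℤ) ×
  ∃[ i ] ∃[ j ] (i ℕ.+ j ≡ d × ¬ IntCong p (f i j) 0ℤ)

-- the quantity δ of part (iii)   (p odd, m ≥ 3, u = ord_{2m}(p))

C1 C2 C3 C4 : ℕ → ℕ → ℕ → Set
C1 p m u = p ℕ.% 4 ≡ 1 × u ℕ.% 2 ≡ 0 ×
           IntCong (2 ℕ.* m) (+ (p ℕ.^ (u ℕ./ 2))) (ℤ.- 1ℤ)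
C2 p m u = p ℕ.% 4 ≡ 3 × u ℕ.% 4 ≡ 0 ×
           IntCong (2 ℕ.* m) (+ (p ℕ.^ (u ℕ./ 2))) (ℤ.- 1ℤ)
C3 p m u = p ℕ.% 4 ≡ 3 × u ℕ.% 4 ≡ 2 ×
           (IntCong (2 ℕ.* m) (+ (p ℕ.^ (u ℕ./ 2))) (+ m ℤ.+ 1ℤ) ⊎
            IntCong (2 ℕ.* m) (+ (p ℕ.^ (u ℕ./ 2))) (+ m ℤ.- 1ℤ))
C4 p m u = p ℕ.% 4 ≡ 3 × u ℕ.% 2 ≡ 1

data Delta3 (p m u : ℕ) : ℕ → Set where
  case1 : C1 p m u → Delta3 p m u (u ℕ./ 2)
  case2 : C2 p m u → Delta3 p m u (u ℕ./ 2)
  case3 : C3 p m u → Delta3 p m u (u ℕ./ 2)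
  case4 : C4 p m u → Delta3 p m u (2 ℕ.* u)
  other : ¬ C1 p m u → ¬ C2 p m u → ¬ C3 p m u → ¬ C4 p m u → Delta3 p m u u

-- the quantity δ of part (iv)   (m ≥ 3 odd, u' = ord_m(2))
D1 : ℕ → ℕ → Set
D1 m u = u ℕ.% 2 ≡ 0 × IntCong m (+ (2 ℕ.^ (u ℕ./ 2))) (ℤ.- 1ℤ)

data Delta4 (m u : ℕ) : ℕ → Set where
  half : D1 m u → Delta4 m u (u ℕ./ 2)
  full : ¬ D1 m u → Delta4 m u u

Factorization : ℕ → ℕ → ℕ → ℕ → ℕ → Set
Factorization p n count δ e =
  ∃[ fs ] (length fs ≡ count ×
    All (λ f → IsPoly f × IrreducibleMod p f × MonicInXMod p f δ × TotalDegMod p f δ) fs ×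
    AllPairs (λ f g → ¬ (f ≡[ p ] g)) fs ×
    Ψ₂ n ≡[ p ] prodP (map (λ f → f ^P e) fs))

{-# OPTIONS --safe #-}

-- The identities behind the proof live in the ring R[a] with a² = x a + 1, where
-- b = x - a satisfies a b = -1 and F_n(x) (a - b) = a^n - b^n.
--
-- Over ℤ, the ideal generated by F_m and F_n is generated by F_gcd(m,n), and
-- F_hd / F_d is h times a unit modulo F_d.  Hence the Ψ_d are pairwise coprime
-- over ℚ, the division defining Ψ_n is exact, and F_n = ∏_{d ∣ n} Ψ_d; degrees
-- follow from Gauss's identity ∑_{d ∣ n} φ(d) = n.
--
-- Modulo p, the Frobenius map gives F_pn = F_p F_n^p, and comparing products over
-- divisors turns this into Ψ_{p^k m} = Ψ_m^φ(p^k) for m ≥ 2 prime to p.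
--
-- An irreducible factor f of Ψ_m modulo p divides F_k exactly when m ∣ k.  With
-- q = p^v = 2r + 1, x^q - x is (x² + 4) F_r F_{r+1} for even r and L_r L_{r+1} for
-- odd r, L being the Lucas sequence; for p = 2, (x^q - x)² = x² F_{q-1} F_{q+1}.
-- So f ∣ x^q - x is a congruence on q, and deg f, the least such v, is δ.  The
-- degree is read off by counting roots in the field 𝔽_p[x]/(f) twice: the
-- conjugates of x are roots of f, and every residue is a root of X^q - X.
-- Ψ_m divides some x^q - x, so it is squarefree for odd p; for p = 2 its
-- derivative vanishes, so it is a square, and its root is squarefree.
--
-- Finally a factorisation of a homogenised irreducible polynomial has leading
-- coefficients in x that are units of 𝔽_p[y]; setting y = 1 shows that one factor
-- is constant.
module Submission where

open import Algebra.Bundles using (CommutativeRing)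
import Algebra.Properties.CommutativeSemiring.Binomial as Binomial
import Algebra.Properties.Semiring.Exp as Exp
import Algebra.Properties.Semiring.Mult as Mult
import Algebra.Properties.Semiring.Sum as Sum
open import Algebra.Solver.Ring.AlmostCommutativeRing
  using (fromCommutativeRing; _-Raw-AlmostCommutative⟶_)
open import Data.Fin as Fin using (Fin; toℕ; fromℕ; inject₁; zero; suc; combine; remQuot)
import Data.Fin.Properties as Finₚ
open import Data.Integer as ℤ using (ℤ; +_; -[1+_]; _⊖_; 0ℤ; 1ℤ)
import Data.Integer.DivMod as ℤᵈ
import Data.Integer.Divisibility.Signed as Signed
import Data.Integer.Properties as ℤₚ
open import Data.List using (List; []; _∷_; length; map; replicate; foldr; _++_)
open import Data.List.Membership.Propositional using (_∈_)
open import Data.List.Membership.Propositional.Properties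
  using (∈-map⁺; ∈-map⁻; ∈-++⁺ˡ; ∈-++⁺ʳ; ∈-++⁻)
open import Data.List.Properties using (length-map; length-replicate)
open import Data.List.Relation.Binary.Permutation.Propositional using (_↭_)
open import Data.List.Relation.Unary.All as All using (All; []; _∷_)
import Data.List.Relation.Unary.All.Properties as Allₚ
open import Data.List.Relation.Unary.AllPairs as AllPairs using (AllPairs; []; _∷_)
import Data.List.Relation.Unary.AllPairs.Properties as AllPairsₚ
open import Data.List.Relation.Unary.Any using (here; there)
open import Data.List.Relation.Unary.Unique.Propositional using (Unique)
import Data.List.Relation.Unary.Unique.Propositional.Properties as Unique
open import Data.Maybe using (Maybe; just; nothing)
open import Data.Nat as ℕ using (ℕ; zero; suc; _≤_; _<_; z≤n; s≤s; _∸_)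
open import Data.Nat.Coprimality as Coprimality using (Coprime)
open import Data.Nat.DivMod using (m*n/n≡m; m/n*n≡m)
open import Data.Nat.Divisibility as ℕᵈ using (divides)
open import Data.Nat.GCD using (gcd; gcd-GCD; module Bézout; gcd[m,n]∣m; gcd[m,n]∣n)
open import Data.Nat.Induction using (<-wellFounded; Acc; acc)
open import Data.Nat.Primality
  using (Prime; euclidsLemma; prime⇒nonTrivial; prime⇒nonZero; prime⇒irreducible; prime[2])
import Data.Nat.Properties as ℕₚ
open import Data.Nat.Solver using (module +-*-Solver)
open import Data.Product using (∃; ∃-syntax; _×_; _,_; proj₁; proj₂)
open import Data.Sum using (_⊎_; inj₁; inj₂)
open import Function using (_∘_)
open import Level using (0ℓ)
open import Relation.Binary.Definitions using (tri<; tri≈; tri>; Tri)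
open import Relation.Binary.PropositionalEquality as ≡ using (_≡_; _≢_)
open import Relation.Nullary using (¬_; yes; no; Dec; contradiction)
open import Relation.Nullary.Decidable using (_×-dec_; map′)

-- Commutative rings and their quotients

-- No algebraic closure is built here: the only root of an irreducible factor f that is used is the
-- class of x modulo f, and m is recovered as its rank of apparition in the Fibonacci sequence. The
-- modulus 2m of the statement arises because q = 2r + 1 while the conditions concern r modulo m.
-- Two obstacles shape the proof. In R[a] the element a - b need not be cancellable, so Binet's
-- formula cannot simply be solved for F_n. Multiplying by a - b a second time puts every identity
-- over (a - b)² = x² + 4, which lies in R; comparing coordinates brings it down to R, where x² + 4
-- is cancelled as a monic polynomial or as a nonzero residue. Secondly, `Ψ` is defined by long
-- division of lists. Exactness over ℤ must therefore be known before anything can be said about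
-- Ψ_n, and it must hold for lists of exactly the right length. Bézout relations with cleared
-- denominators carry this induction without ever leaving ℤ[x].

CR : Set₁
CR = CommutativeRing 0ℓ 0ℓ

module ℤ-Solver (R : CR) where
  open CommutativeRing R
  open import Algebra.Properties.Semiring.Mult.TCOptimised semiring
    using (×-homo-+; ×1-homo-*; 1+×) renaming (_×_ to _×′_)
  open import Algebra.Properties.Ring ring
    using (-‿distribˡ-*; -‿distribʳ-*; -‿involutive; -‿+-comm; -0#≈0#)
  open import Relation.Binary.Reasoning.Setoid setoid

  -- With these multiples `con (+ 1)` and `con (+ 0)` compute to `1#` and `0#`, so solver equations
  -- match ring expressions literally.
  ⟦_⟧ᶻ : ℤ → Carrier
  ⟦ + n ⟧ᶻ      = n ×′ 1#
  ⟦ -[1+ n ] ⟧ᶻ = - (suc n ×′ 1#)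

  -homo : ∀ i → ⟦ ℤ.- i ⟧ᶻ ≈ - ⟦ i ⟧ᶻ
  -homo (+ zero)   = sym -0#≈0#
  -homo (+ suc n)  = refl
  -homo -[1+ n ]   = sym (-‿involutive _)

  private
    cancel-1 : ∀ a b → (1# + a) - (1# + b) ≈ a - b
    cancel-1 a b = begin
      (1# + a) - (1# + b)       ≈⟨ +-cong (+-comm 1# a) (sym (-‿+-comm 1# b)) ⟩
      (a + 1#) + (- 1# + - b)   ≈⟨ +-assoc a 1# _ ⟩
      a + (1# + (- 1# + - b))   ≈⟨ +-congˡ (+-assoc 1# (- 1#) _) ⟨
      a + ((1# - 1#) + - b)     ≈⟨ +-congˡ (+-congʳ (-‿inverseʳ 1#)) ⟩
      a + (0# + - b)            ≈⟨ +-congˡ (+-identityˡ _) ⟩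
      a - b                     ∎

  ⊖-homo : ∀ m n → ⟦ m ⊖ n ⟧ᶻ ≈ m ×′ 1# - n ×′ 1#
  ⊖-homo m       zero    = sym (trans (+-congˡ -0#≈0#) (+-identityʳ _))
  ⊖-homo zero    (suc n) = sym (+-identityˡ _)
  ⊖-homo (suc m) (suc n) = begin
    ⟦ suc m ⊖ suc n ⟧ᶻ               ≡⟨ ≡.cong ⟦_⟧ᶻ (ℤₚ.[1+m]⊖[1+n]≡m⊖n m n) ⟩
    ⟦ m ⊖ n ⟧ᶻ                       ≈⟨ ⊖-homo m n ⟩
    m ×′ 1# - n ×′ 1#                ≈⟨ cancel-1 _ _ ⟨
    (1# + m ×′ 1#) - (1# + n ×′ 1#)  ≈⟨ +-cong (1+× m 1#) (-‿cong (1+× n 1#)) ⟨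
    suc m ×′ 1# - suc n ×′ 1#        ∎

  +-homo : ∀ i j → ⟦ i ℤ.+ j ⟧ᶻ ≈ ⟦ i ⟧ᶻ + ⟦ j ⟧ᶻ
  +-homo (+ m)    (+ n)    = ×-homo-+ 1# m n
  +-homo (+ m)    -[1+ n ] = ⊖-homo m (suc n)
  +-homo -[1+ m ] (+ n)    = trans (⊖-homo n (suc m)) (+-comm _ _)
  +-homo -[1+ m ] -[1+ n ] = begin
    - (suc (suc (m ℕ.+ n)) ×′ 1#)      ≡⟨ ≡.cong (λ k → - (suc k ×′ 1#)) (ℕₚ.+-suc m n) ⟨
    - ((suc m ℕ.+ suc n) ×′ 1#)        ≈⟨ -‿cong (×-homo-+ 1# (suc m) (suc n)) ⟩
    - (suc m ×′ 1# + suc n ×′ 1#)      ≈⟨ -‿+-comm _ _ ⟨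
    - (suc m ×′ 1#) - (suc n ×′ 1#)    ∎

  private
    +*-homo : ∀ m j → ⟦ + m ℤ.* j ⟧ᶻ ≈ ⟦ + m ⟧ᶻ * ⟦ j ⟧ᶻ
    +*-homo m (+ n)    = trans (reflexive (≡.cong ⟦_⟧ᶻ (≡.sym (ℤₚ.pos-* m n)))) (×1-homo-* m n)
    +*-homo m -[1+ n ] = begin
      ⟦ + m ℤ.* -[1+ n ] ⟧ᶻ          ≡⟨ ≡.cong ⟦_⟧ᶻ (ℤₚ.neg-distribʳ-* (+ m) (+ suc n)) ⟨
      ⟦ ℤ.- (+ m ℤ.* + suc n) ⟧ᶻ     ≈⟨ -homo (+ m ℤ.* + suc n) ⟩
      - ⟦ + m ℤ.* + suc n ⟧ᶻ         ≈⟨ -‿cong (+*-homo m (+ suc n)) ⟩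
      - (⟦ + m ⟧ᶻ * ⟦ + suc n ⟧ᶻ)    ≈⟨ -‿distribʳ-* _ _ ⟩
      ⟦ + m ⟧ᶻ * ⟦ -[1+ n ] ⟧ᶻ       ∎

  *-homo : ∀ i j → ⟦ i ℤ.* j ⟧ᶻ ≈ ⟦ i ⟧ᶻ * ⟦ j ⟧ᶻ
  *-homo (+ m)    j = +*-homo m j
  *-homo -[1+ m ] j = begin
    ⟦ -[1+ m ] ℤ.* j ⟧ᶻ         ≡⟨ ≡.cong ⟦_⟧ᶻ (ℤₚ.neg-distribˡ-* (+ suc m) j) ⟨
    ⟦ ℤ.- (+ suc m ℤ.* j) ⟧ᶻ    ≈⟨ -homo (+ suc m ℤ.* j) ⟩
    - ⟦ + suc m ℤ.* j ⟧ᶻ        ≈⟨ -‿cong (+*-homo (suc m) j) ⟩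
    - (⟦ + suc m ⟧ᶻ * ⟦ j ⟧ᶻ)   ≈⟨ -‿distribˡ-* _ _ ⟩
    ⟦ -[1+ m ] ⟧ᶻ * ⟦ j ⟧ᶻ      ∎

  private
    morphism : ℤ.+-*-rawRing -Raw-AlmostCommutative⟶ fromCommutativeRing R
    morphism = record
      { ⟦_⟧ = ⟦_⟧ᶻ ; +-homo = +-homo ; *-homo = *-homo ; -‿homo = -homo
      ; 0-homo = refl ; 1-homo = refl }

    dec : ∀ i j → Maybe (⟦ i ⟧ᶻ ≈ ⟦ j ⟧ᶻ)
    dec i j with i ℤ.≟ j
    ... | yes i≡j = just (reflexive (≡.cong ⟦_⟧ᶻ i≡j))
    ... | no  _   = nothing

  open import Algebra.Solver.Ring _ _ morphism dec public
    using (solve; _:=_; _:+_; _:*_; _:-_; :-_; con)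

-- Powers, multiples of 1, sums and Fibonacci sequences only mention the raw
-- operations, so that they agree definitionally in a ring and its quotients.
module Raw {A : Set} (_+_ _*_ : A → A → A) (0# 1# : A) where

  infixr 8 _^_

  _^_ : A → ℕ → A
  a ^ zero  = 1#
  a ^ suc n = a * (a ^ n)

  ι : ℕ → A
  ι zero    = 0#
  ι (suc n) = 1# + ι n

  fib : A → ℕ → A
  fib x zero          = 0#
  fib x (suc zero)    = 1#
  fib x (suc (suc n)) = (x * fib x (suc n)) + fib x n

  ∑≤ : ℕ → (ℕ → A) → A
  ∑≤ zero    h = h 0
  ∑≤ (suc n) h = ∑≤ n h + h (suc n)

  -- fib-quot x d h is the quotient of fib x (h (d + 1)) by fib x (d + 1).
  fib-quot : A → ℕ → ℕ → A
  fib-quot x d zero    = 0#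
  fib-quot x d (suc h) = fib x (suc (h ℕ.* suc d)) + (fib-quot x d h * fib x d)

module RingTheory (R : CR) where
  open CommutativeRing R public hiding (zero)
  open ℤ-Solver R public using (solve; _:=_; _:+_; _:*_; _:-_; :-_; con)
  open Raw _+_ _*_ 0# 1# public
  open import Relation.Binary.Reasoning.Setoid setoid

  x-y≈0⇒x≈y : ∀ {a b} → a - b ≈ 0# → a ≈ b
  x-y≈0⇒x≈y {a} {b} e = begin
    a            ≈⟨ solve 2 (λ a b → a := (a :- b) :+ b) refl a b ⟩
    (a - b) + b  ≈⟨ +-congʳ e ⟩
    0# + b       ≈⟨ +-identityˡ b ⟩
    b            ∎

  x≈y⇒x-y≈0 : ∀ {a b} → a ≈ b → a - b ≈ 0#
  x≈y⇒x-y≈0 {a} {b} e = trans (+-congʳ e) (-‿inverseʳ b)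

  x-y+y : ∀ a b → (a - b) + b ≈ a
  x-y+y = solve 2 (λ a b → (a :- b) :+ b := a) refl

  x+y-y : ∀ a b → (a + b) - b ≈ a
  x+y-y = solve 2 (λ a b → (a :+ b) :- b := a) refl

  ^-congˡ : ∀ {a b} n → a ≈ b → a ^ n ≈ b ^ n
  ^-congˡ zero    e = refl
  ^-congˡ (suc n) e = *-cong e (^-congˡ n e)

  ^-homo-+ : ∀ a m n → a ^ (m ℕ.+ n) ≈ a ^ m * a ^ n
  ^-homo-+ a zero    n = sym (*-identityˡ _)
  ^-homo-+ a (suc m) n = trans (*-congˡ (^-homo-+ a m n)) (sym (*-assoc _ _ _))

  ^-distrib-* : ∀ a b n → (a * b) ^ n ≈ a ^ n * b ^ n
  ^-distrib-* a b zero    = sym (*-identityˡ _)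
  ^-distrib-* a b (suc n) = trans (*-congˡ (^-distrib-* a b n))
    (solve 4 (λ a b c d → (a :* b) :* (c :* d) := (a :* c) :* (b :* d)) refl a b _ _)

  1^ : ∀ n → 1# ^ n ≈ 1#
  1^ zero    = refl
  1^ (suc n) = trans (*-identityˡ _) (1^ n)

  ^-assoc : ∀ a m n → (a ^ m) ^ n ≈ a ^ (m ℕ.* n)
  ^-assoc a zero    n = 1^ n
  ^-assoc a (suc m) n = begin
    (a * a ^ m) ^ n        ≈⟨ ^-distrib-* a (a ^ m) n ⟩
    a ^ n * (a ^ m) ^ n    ≈⟨ *-congˡ (^-assoc a m n) ⟩
    a ^ n * a ^ (m ℕ.* n)  ≈⟨ ^-homo-+ a n (m ℕ.* n) ⟨
    a ^ (suc m ℕ.* n)      ∎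

  0^ : ∀ n → 0 < n → 0# ^ n ≈ 0#
  0^ (suc n) _ = zeroˡ _

  ι-homo-+ : ∀ m n → ι (m ℕ.+ n) ≈ ι m + ι n
  ι-homo-+ zero    n = sym (+-identityˡ _)
  ι-homo-+ (suc m) n = trans (+-congˡ (ι-homo-+ m n)) (sym (+-assoc _ _ _))

  ι-homo-* : ∀ m n → ι (m ℕ.* n) ≈ ι m * ι n
  ι-homo-* zero    n = sym (zeroˡ _)
  ι-homo-* (suc m) n = begin
    ι (n ℕ.+ m ℕ.* n)     ≈⟨ ι-homo-+ n (m ℕ.* n) ⟩
    ι n + ι (m ℕ.* n)     ≈⟨ +-congˡ (ι-homo-* m n) ⟩
    ι n + ι m * ι n       ≈⟨ solve 2 (λ a b → b :+ a :* b := (con (+ 1) :+ a) :* b) refl (ι m) (ι n) ⟩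
    (1# + ι m) * ι n      ∎

  infix 4 _∣_
  _∣_ : Carrier → Carrier → Set
  a ∣ b = ∃[ q ] b ≈ q * a

  ∣-refl : ∀ {a} → a ∣ a
  ∣-refl = 1# , sym (*-identityˡ _)

  ∣-trans : ∀ {a b c} → a ∣ b → b ∣ c → a ∣ c
  ∣-trans (q , e) (r , f) = r * q , trans f (trans (*-congˡ e) (sym (*-assoc _ _ _)))

  ∣-resp : ∀ {a b a′ b′} → a ≈ a′ → b ≈ b′ → a ∣ b → a′ ∣ b′
  ∣-resp e f (q , g) = q , trans (sym f) (trans g (*-congˡ e))

  ∣-respʳ : ∀ {a b b′} → b ≈ b′ → a ∣ b → a ∣ b′
  ∣-respʳ f (q , g) = q , trans (sym f) g

  ∣-*ˡ : ∀ {a b} c → a ∣ b → a ∣ c * b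
  ∣-*ˡ c (q , e) = c * q , trans (*-congˡ e) (sym (*-assoc _ _ _))

  ∣-*ʳ : ∀ {a b} c → a ∣ b → a ∣ b * c
  ∣-*ʳ c d = ∣-respʳ (*-comm _ _) (∣-*ˡ c d)

  -- This is F_{n+1} + F_{n-1}, in a form without a predecessor; at n = 0 it gives 2.
  lucas : Carrier → ℕ → Carrier
  lucas x n = ι 2 * fib x (suc n) - x * fib x n

  -- The discriminant of t² - x t - 1, that is, the square of the difference of its roots.
  disc : Carrier → Carrier
  disc x = x * x + ι 4

  fib-cong : ∀ {x y} n → x ≈ y → fib x n ≈ fib y n
  fib-cong zero          e = refl
  fib-cong (suc zero)    e = refl
  fib-cong (suc (suc n)) e = +-cong (*-cong e (fib-cong (suc n) e)) (fib-cong n e)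

  lucas-cong : ∀ {x y} n → x ≈ y → lucas x n ≈ lucas y n
  lucas-cong n e = +-cong (*-congˡ (fib-cong (suc n) e)) (-‿cong (*-cong e (fib-cong n e)))

module _ (R : CR) where
  open RingTheory R

  record _≈[_]_ (a f b : Carrier) : Set where
    constructor mk≈
    field
      quotient : Carrier
      equality : a ≈ b + quotient * f

  module _ {f : Carrier} where

    up : ∀ {a b} → a ≈ b → a ≈[ f ] b
    up {a} {b} e = mk≈ 0# (trans e (solve 2 (λ b f → b := b :+ con (+ 0) :* f) refl b f))

    quot-sym : ∀ {a b} → a ≈[ f ] b → b ≈[ f ] a
    quot-sym {a} {b} (mk≈ q e) = mk≈ (- q)
      (trans (solve 3 (λ b q f → b := (b :+ q :* f) :+ (:- q) :* f) refl b q f) (+-congʳ (sym e)))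

    quot-trans : ∀ {a b c} → a ≈[ f ] b → b ≈[ f ] c → a ≈[ f ] c
    quot-trans {c = c} (mk≈ q e) (mk≈ r h) = mk≈ (q + r)
      (trans e (trans (+-congʳ h)
        (solve 4 (λ c r q f → (c :+ r :* f) :+ q :* f := c :+ (q :+ r) :* f) refl c r q f)))

    quot-+-cong : ∀ {a b c d} → a ≈[ f ] b → c ≈[ f ] d → (a + c) ≈[ f ] (b + d)
    quot-+-cong {b = b} {d = d} (mk≈ q e) (mk≈ r h) = mk≈ (q + r)
      (trans (+-cong e h)
        (solve 5 (λ b d q r f → (b :+ q :* f) :+ (d :+ r :* f) := (b :+ d) :+ (q :+ r) :* f)
          refl b d q r f))

    quot-neg-cong : ∀ {a b} → a ≈[ f ] b → (- a) ≈[ f ] (- b)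
    quot-neg-cong {b = b} (mk≈ q e) = mk≈ (- q)
      (trans (-‿cong e) (solve 3 (λ b q f → :- (b :+ q :* f) := (:- b) :+ (:- q) :* f) refl b q f))

    quot-*-cong : ∀ {a b c d} → a ≈[ f ] b → c ≈[ f ] d → (a * c) ≈[ f ] (b * d)
    quot-*-cong {b = b} {d = d} (mk≈ q e) (mk≈ r h) = mk≈ (b * r + q * d + q * r * f)
      (trans (*-cong e h)
        (solve 5 (λ b d q r f → (b :+ q :* f) :* (d :+ r :* f)
            := b :* d :+ ((b :* r :+ q :* d) :+ (q :* r) :* f) :* f)
          refl b d q r f))

  -- Carrier and operations stay those of `R` and only equality coarsens. Identities of `R` pass to
  -- the quotient through `up`, and quotients can be iterated to adjoin several relations.
  Quot : Carrier → CR
  Quot f = record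
    { Carrier = Carrier ; _≈_ = _≈[ f ]_
    ; _+_ = _+_ ; _*_ = _*_ ; -_ = -_ ; 0# = 0# ; 1# = 1#
    ; isCommutativeRing = record
      { isRing = record
        { +-isAbelianGroup = record
          { isGroup = record
            { isMonoid = record
              { isSemigroup = record
                { isMagma = record
                  { isEquivalence = record { refl = up refl ; sym = quot-sym ; trans = quot-trans }
                  ; ∙-cong = quot-+-cong }
                ; assoc = λ a b c → up (+-assoc a b c) }
              ; identity = (λ a → up (+-identityˡ a)) , (λ a → up (+-identityʳ a)) }
            ; inverse = (λ a → up (-‿inverseˡ a)) , (λ a → up (-‿inverseʳ a))
            ; ⁻¹-cong = quot-neg-cong }
          ; comm = λ a b → up (+-comm a b) }
        ; *-cong = quot-*-cong
        ; *-assoc = λ a b c → up (*-assoc a b c)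
        ; *-identity = (λ a → up (*-identityˡ a)) , (λ a → up (*-identityʳ a))
        ; distrib = (λ a b c → up (distribˡ a b c)) , (λ a b c → up (distribʳ a b c)) }
      ; *-comm = λ a b → up (*-comm a b) } }

  ∣⇒≈0 : ∀ {f a} → f ∣ a → a ≈[ f ] 0#
  ∣⇒≈0 (q , e) = mk≈ q (trans e (sym (+-identityˡ _)))

  ≈0⇒∣ : ∀ {f a} → a ≈[ f ] 0# → f ∣ a
  ≈0⇒∣ (mk≈ q e) = q , trans e (+-identityˡ _)

  ≈⇒∣- : ∀ {f a b} → a ≈[ f ] b → f ∣ (a - b)
  ≈⇒∣- {f} {a} {b} (mk≈ q e) = q , trans (+-congʳ e) (solve 2 (λ b c → (b :+ c) :- b := c) refl _ _)

  ∣-⇒≈ : ∀ {f a b} → f ∣ (a - b) → a ≈[ f ] b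
  ∣-⇒≈ {f} {a} {b} (q , e) = mk≈ q (trans (solve 2 (λ a b → a := b :+ (a :- b)) refl a b) (+-congˡ e))

  -- One step of the Euclidean algorithm: modulo f, r = -q g′, so an inverse u of r makes -u q an
  -- inverse of g′, and b removes the constant c.
  euclid-inverse : ∀ {f g g′ b c q r u} → g ≈ c * g′ → b * c ≈ 1# → f ≈ q * g′ + r →
                   (u * r) ≈[ f ] 1# → ((- (u * q)) * b * g) ≈[ f ] 1#
  euclid-inverse {f} {g} {g′} {b} {c} {q} {r} {u} e bc≈1 h i = quot-trans (∣-⇒≈ ((- u) , (begin
    (- (u * q)) * b * g - u * r            ≈⟨ +-congʳ (*-congˡ e) ⟩
    (- (u * q)) * b * (c * g′) - u * r
      ≈⟨ solve 6 (λ u q b c g r → (:- (u :* q)) :* b :* (c :* g) :- u :* r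
           := (:- u) :* ((b :* c) :* (q :* g) :+ r)) refl u q b c g′ r ⟩
    - u * ((b * c) * (q * g′) + r)         ≈⟨ *-congˡ (+-congʳ (trans (*-congʳ bc≈1) (*-identityˡ _))) ⟩
    - u * (q * g′ + r)                     ≈⟨ *-congˡ h ⟨
    - u * f                                ∎))) i
    where open import Relation.Binary.Reasoning.Setoid setoid

-- Fibonacci sequences in a commutative ring

module Fibonacci (R : CR) (x : CommutativeRing.Carrier R) where
  open RingTheory R
  open import Relation.Binary.Reasoning.Setoid setoid

  F : ℕ → Carrier
  F = fib x

  F-add : ∀ m n → F (m ℕ.+ suc n) ≈ F (suc m) * F (suc n) + F m * F n
  F-add zero          n = solve 2 (λ a b → a := con (+ 1) :* a :+ con (+ 0) :* b) refl (F (suc n)) (F n)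
  F-add (suc zero)    n = solve 3 (λ x a b → x :* a :+ b := (x :* con (+ 1) :+ con (+ 0)) :* a :+ con (+ 1) :* b)
                            refl x (F (suc n)) (F n)
  F-add (suc (suc m)) n = begin
    x * F (suc m ℕ.+ suc n) + F (m ℕ.+ suc n)
      ≈⟨ +-cong (*-congˡ (F-add (suc m) n)) (F-add m n) ⟩
    x * (F (suc (suc m)) * F (suc n) + F (suc m) * F n) + (F (suc m) * F (suc n) + F m * F n)
      ≈⟨ solve 6 (λ x a b c d e → x :* (a :* d :+ b :* e) :+ (b :* d :+ c :* e)
             := (x :* a :+ b) :* d :+ (x :* b :+ c) :* e)
           refl x (F (suc (suc m))) (F (suc m)) (F m) (F (suc n)) (F n) ⟩
    F (suc (suc (suc m))) * F (suc n) + F (suc (suc m)) * F n ∎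

  -- Its value is (-1)^n by Cassini's identity. Squaring removes the sign, and a square equal to 1
  -- is enough to produce units.
  cassini : ℕ → Carrier
  cassini n = F (suc n) * F (suc n) - (x * F n * F (suc n) + F n * F n)

  cassini-suc : ∀ n → cassini (suc n) ≈ - cassini n
  cassini-suc n = solve 3 (λ x a b →
      (x :* a :+ b) :* (x :* a :+ b) :- (x :* a :* (x :* a :+ b) :+ a :* a)
        := :- (a :* a :- (x :* b :* a :+ b :* b)))
    refl x (F (suc n)) (F n)

  cassini-² : ∀ n → cassini n * cassini n ≈ 1#
  cassini-² zero    = solve 1 (λ x → let t = con (+ 1) :* con (+ 1) :- (x :* con (+ 0) :* con (+ 1) :+ con (+ 0) :* con (+ 0))
                                     in t :* t := con (+ 1)) refl x
  cassini-² (suc n) = trans (*-cong (cassini-suc n) (cassini-suc n))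
    (trans (solve 1 (λ a → (:- a) :* (:- a) := a :* a) refl (cassini n)) (cassini-² n))

  -- Where F_n vanishes, `cassini n` is F_{n+1}², so F_{n+1} is a unit with inverse F_{n+1} ·
  -- `cassini n`.
  F-suc-cancel : ∀ n {a} → F n ≈ 0# → a * F (suc n) ≈ 0# → a ≈ 0#
  F-suc-cancel n {a} Fn≈0 e = begin
    a                                    ≈⟨ *-identityʳ a ⟨
    a * 1#                               ≈⟨ *-congˡ (cassini-² n) ⟨
    a * (c * c)                          ≈⟨ *-congˡ (*-congʳ c≈) ⟩
    a * (F (suc n) * F (suc n) * c)      ≈⟨ solve 3 (λ a b c → a :* (b :* b :* c) := (a :* b) :* (b :* c)) refl a _ _ ⟩
    (a * F (suc n)) * (F (suc n) * c)    ≈⟨ *-congʳ e ⟩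
    0# * (F (suc n) * c)                 ≈⟨ zeroˡ _ ⟩
    0#                                   ∎
    where
    c = cassini n
    c≈ : c ≈ F (suc n) * F (suc n)
    c≈ = trans (+-congˡ (-‿cong (+-cong (*-congʳ (*-congˡ Fn≈0)) (*-congʳ Fn≈0))))
      (solve 4 (λ x a b d → a :- (x :* con (+ 0) :* b :+ con (+ 0) :* d) := a) refl x _ _ (F n))

  F-pred≈suc : ∀ d → F (suc d) ≈ 0# → F d ≈ F (suc (suc d))
  F-pred≈suc d e = sym (trans (+-congʳ (trans (*-congˡ e) (zeroʳ x))) (+-identityˡ _))

  F-pred-cancel : ∀ d {a} → F (suc d) ≈ 0# → a * F d ≈ 0# → a ≈ 0#
  F-pred-cancel d e h = F-suc-cancel (suc d) e (trans (*-congˡ (sym (F-pred≈suc d e))) h)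

  F-quot : ℕ → ℕ → Carrier
  F-quot = fib-quot x

  F-multiple : ∀ d h → F (h ℕ.* suc d) ≈ F-quot d h * F (suc d)
  F-multiple d zero    = sym (zeroˡ _)
  F-multiple d (suc h) = begin
    F (suc d ℕ.+ h ℕ.* suc d)    ≡⟨ ≡.cong F (ℕₚ.+-comm (suc d) _) ⟩
    F (h ℕ.* suc d ℕ.+ suc d)    ≈⟨ F-add (h ℕ.* suc d) d ⟩
    F (suc (h ℕ.* suc d)) * F (suc d) + F (h ℕ.* suc d) * F d
      ≈⟨ +-congˡ (*-congʳ (F-multiple d h)) ⟩
    F (suc (h ℕ.* suc d)) * F (suc d) + F-quot d h * F (suc d) * F d
      ≈⟨ solve 4 (λ a b c e → a :* b :+ c :* b :* e := (a :+ c :* e) :* b) refl _ _ _ _ ⟩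
    F-quot d (suc h) * F (suc d) ∎

  F-∣ : ∀ {d n} → d ℕᵈ.∣ n → F d ∣ F n
  F-∣ {zero}  (ℕᵈ.divides h ≡.refl) = 0# , trans (reflexive (≡.cong F (ℕₚ.*-zeroʳ h))) (sym (zeroʳ _))
  F-∣ {suc d} (ℕᵈ.divides h ≡.refl) = F-quot d h , F-multiple d h

  -- If F_{d+1} = 0, the addition formula makes each shift by d + 1 a multiplication by F_{d+2},
  -- which then equals F_d.
  F-suc-multiple : ∀ d h → F (suc d) ≈ 0# → F (suc (h ℕ.* suc d)) ≈ F d ^ h
  F-suc-multiple d zero    e = refl
  F-suc-multiple d (suc h) e = begin
    F (suc (suc d ℕ.+ h ℕ.* suc d))   ≡⟨ ≡.cong F (≡.cong suc (ℕₚ.+-comm (suc d) _)) ⟩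
    F (suc (h ℕ.* suc d ℕ.+ suc d))   ≡⟨ ≡.cong F (ℕₚ.+-suc (h ℕ.* suc d) (suc d)) ⟨
    F (h ℕ.* suc d ℕ.+ suc (suc d))   ≈⟨ F-add (h ℕ.* suc d) (suc d) ⟩
    F (suc (h ℕ.* suc d)) * F (suc (suc d)) + F (h ℕ.* suc d) * F (suc d)
      ≈⟨ +-cong (*-cong (F-suc-multiple d h e) (sym (F-pred≈suc d e))) (*-congˡ e) ⟩
    F d ^ h * F d + F (h ℕ.* suc d) * 0#
      ≈⟨ solve 3 (λ a b c → a :* b :+ c :* con (+ 0) := b :* a) refl _ _ _ ⟩
    F d * F d ^ h ∎

  -- The analogue of (t^h - 1)/(t - 1) being h at t = 1: unrolled, the quotient has h + 1 summands,
  -- and each equals F_d^h once F_{d+1} = 0.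
  F-quot≈ : ∀ d h → F (suc d) ≈ 0# → F-quot d (suc h) ≈ ι (suc h) * F d ^ h
  F-quot≈ d zero    e = solve 1 (λ a → con (+ 1) :+ con (+ 0) :* a := (con (+ 1) :+ con (+ 0)) :* con (+ 1)) refl (F d)
  F-quot≈ d (suc h) e = begin
    F (suc (suc h ℕ.* suc d)) + F-quot d (suc h) * F d
      ≈⟨ +-cong (F-suc-multiple d (suc h) e) (*-congʳ (F-quot≈ d h e)) ⟩
    F d * F d ^ h + ι (suc h) * F d ^ h * F d
      ≈⟨ solve 3 (λ a b c → a :* b :+ c :* b :* a := (con (+ 1) :+ c) :* (a :* b)) refl (F d) (F d ^ h) (ι (suc h)) ⟩
    ι (suc (suc h)) * (F d * F d ^ h) ∎

  -- F_d is a unit here, so only the integer h can vanish. Over ℤ this yields the constant in a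
  -- Bézout relation, and in characteristic p it yields p dividing h.
  F-quot≈0 : ∀ d h → F (suc d) ≈ 0# → F-quot d h ≈ 0# → ι h ≈ 0#
  F-quot≈0 d zero    e f = refl
  F-quot≈0 d (suc h) e f = cancel h (trans (sym (F-quot≈ d h e)) f)
    where
    cancel : ∀ k {a} → a * F d ^ k ≈ 0# → a ≈ 0#
    cancel zero    g = trans (sym (*-identityʳ _)) g
    cancel (suc k) g = F-pred-cancel d e (cancel k (trans (*-assoc _ _ _) g))

  F-+-cancel : ∀ g c → F c ≈ 0# → F (g ℕ.+ c) ≈ 0# → F g ≈ 0#
  F-+-cancel g zero    e f = trans (reflexive (≡.cong F (≡.sym (ℕₚ.+-identityʳ g)))) f
  F-+-cancel g (suc c) e f = F-pred-cancel c e (begin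
    F g * F c                              ≈⟨ +-identityˡ _ ⟨
    0# + F g * F c                         ≈⟨ +-congʳ (zeroʳ _) ⟨
    F (suc g) * 0# + F g * F c             ≈⟨ +-congʳ (*-congˡ e) ⟨
    F (suc g) * F (suc c) + F g * F c      ≈⟨ F-add g c ⟨
    F (g ℕ.+ suc c)                        ≈⟨ f ⟩
    0#                                     ∎)

  F-∣-0 : ∀ {d n} → d ℕᵈ.∣ n → F d ≈ 0# → F n ≈ 0#
  F-∣-0 d∣n e with q , f ← F-∣ d∣n = trans f (trans (*-congˡ e) (zeroʳ _))

  -- Bézout in the form g + b n = a m keeps all indices natural; `F-+-cancel` then strips the
  -- multiple, using that the neighbour of a vanishing term is a unit.
  F-gcd : ∀ m n → F m ≈ 0# → F n ≈ 0# → F (gcd m n) ≈ 0#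
  F-gcd m n e f with Bézout.identity (gcd-GCD m n)
  ... | Bézout.Identity.+- a b eq = F-+-cancel (gcd m n) (b ℕ.* n) (F-∣-0 (ℕᵈ.n∣m*n b) f)
        (trans (reflexive (≡.cong F eq)) (F-∣-0 (ℕᵈ.n∣m*n a) e))
  ... | Bézout.Identity.-+ a b eq = F-+-cancel (gcd m n) (a ℕ.* m) (F-∣-0 (ℕᵈ.n∣m*n a) e)
        (trans (reflexive (≡.cong F eq)) (F-∣-0 (ℕᵈ.n∣m*n b) f))

-- The Frobenius endomorphism in characteristic p

module BinomialCoefficients where
  open import Data.Nat.Combinatorics using (_C_; nCk+nC[k+1]≡[n+1]C[k+1])

  -- The absorption identity; for a prime upper index, Euclid's lemma turns it into divisibility of
  -- the inner binomial coefficients.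
  [1+k]*C : ∀ n k → suc k ℕ.* (suc n C suc k) ≡ suc n ℕ.* (n C k)
  [1+k]*C zero    zero    = ≡.refl
  [1+k]*C zero    (suc k) = ℕₚ.*-zeroʳ k
  [1+k]*C (suc n) zero    = begin
    1 ℕ.* (suc (suc n) C 1)              ≡⟨ ≡.cong (1 ℕ.*_) (nCk+nC[k+1]≡[n+1]C[k+1] (suc n) 0) ⟨
    1 ℕ.* (1 ℕ.+ (suc n C 1))            ≡⟨ ≡.cong suc
        (≡.trans (ℕₚ.+-identityʳ _) (≡.trans (≡.sym (ℕₚ.+-identityʳ _)) ([1+k]*C n 0))) ⟩
    1 ℕ.+ suc n ℕ.* (n C 0)              ∎
    where open ≡.≡-Reasoning
  [1+k]*C (suc n) (suc k) = begin
    suc (suc k) ℕ.* (suc (suc n) C suc (suc k))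
      ≡⟨ ≡.cong (suc (suc k) ℕ.*_) (nCk+nC[k+1]≡[n+1]C[k+1] (suc n) (suc k)) ⟨
    suc (suc k) ℕ.* (A ℕ.+ B)
      ≡⟨ S.solve 3 (λ k a b → (S.con 1 S.:+ k) S.:* (a S.:+ b) S.:= a S.:+ (k S.:* a S.:+ (S.con 1 S.:+ k) S.:* b))
           ≡.refl (suc k) A B ⟩
    A ℕ.+ (suc k ℕ.* A ℕ.+ suc (suc k) ℕ.* B)
      ≡⟨ ≡.cong (A ℕ.+_) (≡.cong₂ ℕ._+_ ([1+k]*C n k) ([1+k]*C n (suc k))) ⟩
    A ℕ.+ (suc n ℕ.* (n C k) ℕ.+ suc n ℕ.* (n C suc k))
      ≡⟨ ≡.cong (A ℕ.+_) (ℕₚ.*-distribˡ-+ (suc n) (n C k) (n C suc k)) ⟨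
    A ℕ.+ suc n ℕ.* ((n C k) ℕ.+ (n C suc k))
      ≡⟨ ≡.cong (λ c → A ℕ.+ suc n ℕ.* c) (nCk+nC[k+1]≡[n+1]C[k+1] n k) ⟩
    suc (suc n) ℕ.* A ∎
    where
    open ≡.≡-Reasoning
    module S = +-*-Solver
    A = suc n C suc k
    B = suc n C suc (suc k)

  prime∣C : ∀ {p} → Prime (suc p) → ∀ k → suc k < suc p → suc p ℕᵈ.∣ (suc p C suc k)
  prime∣C {p} pr k k<p with euclidsLemma (suc k) (suc p C suc k) pr
                              (ℕᵈ.divides (p C k) (≡.trans ([1+k]*C p k) (ℕₚ.*-comm (suc p) (p C k))))
  ... | inj₁ d = contradiction d (ℕᵈ.>⇒∤ k<p)
  ... | inj₂ d = d

module Frobenius (R : CR) {p : ℕ} (pr : Prime p)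
                 (p≈0 : CommutativeRing._≈_ R (RingTheory.ι R p) (CommutativeRing.0# R)) where
  open RingTheory R
  open import Data.Nat.Combinatorics using (_C_; nCn≡1)
  open BinomialCoefficients using (prime∣C)
  open import Relation.Binary.Reasoning.Setoid setoid
  private
    module M = Mult semiring
    module E = Exp semiring
    module S = Sum semiring

    ×≈ι : ∀ n a → n M.× a ≈ ι n * a
    ×≈ι zero    a = sym (zeroˡ a)
    ×≈ι (suc n) a = trans (+-congˡ (×≈ι n a))
      (solve 2 (λ a b → a :+ b :* a := (con (+ 1) :+ b) :* a) refl a (ι n))

    ^≈^ : ∀ a n → a E.^ n ≈ a ^ n
    ^≈^ a zero    = refl
    ^≈^ a (suc n) = *-congˡ (^≈^ a n)

  ∣⇒ι≈0 : ∀ {n} → p ℕᵈ.∣ n → ι n ≈ 0#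
  ∣⇒ι≈0 (ℕᵈ.divides q ≡.refl) = trans (ι-homo-* q p) (trans (*-congˡ p≈0) (zeroʳ _))

  private
    expand : ∀ {r} → p ≡ suc r → ∀ a b → (a + b) ^ p ≈ a ^ p + b ^ p
    expand {r} ≡.refl a b = begin
      (a + b) ^ p                        ≈⟨ ^≈^ (a + b) p ⟨
      (a + b) E.^ p                      ≈⟨ Binomial.theorem commutativeSemiring p a b ⟩
      t zero + S.sum (λ i → t (suc i))   ≈⟨ +-cong first (S.sum-init-last (λ i → t (suc i))) ⟩
      b ^ p + (S.sum {r} (λ i → t (suc (inject₁ i))) + t (suc (fromℕ r)))
        ≈⟨ +-congˡ (+-cong (trans (S.sum-cong-≋ {r} mid) (S.sum-replicate-zero r)) last′) ⟩
      b ^ p + (0# + a ^ p)               ≈⟨ solve 2 (λ a b → b :+ (con (+ 0) :+ a) := a :+ b) refl _ _ ⟩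
      a ^ p + b ^ p                      ∎
      where
      t : Fin (suc p) → Carrier
      t k = (p C toℕ k) M.× ((a E.^ toℕ k) * (b E.^ (p ℕ.∸ toℕ k)))
      first : t zero ≈ b ^ p
      first = trans (+-identityʳ _) (trans (*-identityˡ _) (^≈^ b p))
      mid : ∀ i → t (suc (inject₁ i)) ≈ 0#
      mid i = trans (×≈ι (p C suc (toℕ (inject₁ i))) _) (trans (*-congʳ (∣⇒ι≈0 (prime∣C pr (toℕ (inject₁ i))
                (s≤s (≡.subst (_< r) (≡.sym (Finₚ.toℕ-inject₁ i)) (Finₚ.toℕ<n i)))))) (zeroˡ _))
      last′ : t (suc (fromℕ r)) ≈ a ^ p
      last′ = begin
        t (suc (fromℕ r))
          ≡⟨ ≡.cong₂ (λ k l → (p C suc k) M.× ((a E.^ suc k) * (b E.^ l))) (Finₚ.toℕ-fromℕ r)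
               (≡.trans (≡.cong (r ℕ.∸_) (Finₚ.toℕ-fromℕ r)) (ℕₚ.n∸n≡0 r)) ⟩
        (p C p) M.× ((a E.^ p) * 1#)   ≡⟨ ≡.cong (M._× ((a E.^ p) * 1#)) (nCn≡1 p) ⟩
        1 M.× ((a E.^ p) * 1#)         ≈⟨ +-identityʳ _ ⟩
        (a E.^ p) * 1#                 ≈⟨ *-identityʳ _ ⟩
        a E.^ p                        ≈⟨ ^≈^ a p ⟩
        a ^ p                          ∎

  0<p : 0 < p
  0<p = ℕₚ.<-trans (s≤s z≤n) (ℕ.nonTrivial⇒n>1 p {{prime⇒nonTrivial pr}})

  frobenius-+ : ∀ a b → (a + b) ^ p ≈ a ^ p + b ^ p
  frobenius-+ = expand (≡.sym (ℕₚ.suc-pred p {{ℕ.>-nonZero 0<p}}))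

  frobenius-- : ∀ a b → (a - b) ^ p ≈ a ^ p - b ^ p
  frobenius-- a b = begin
    (a - b) ^ p                    ≈⟨ solve 2 (λ c d → c := (c :+ d) :- d) refl _ _ ⟩
    (a - b) ^ p + b ^ p - b ^ p    ≈⟨ +-congʳ (frobenius-+ (a - b) b) ⟨
    ((a - b) + b) ^ p - b ^ p      ≈⟨ +-congʳ (^-congˡ p (solve 2 (λ a b → (a :- b) :+ b := a) refl a b)) ⟩
    a ^ p - b ^ p                  ∎

  frobenius^-+ : ∀ v a b → (a + b) ^ (p ℕ.^ v) ≈ a ^ (p ℕ.^ v) + b ^ (p ℕ.^ v)
  frobenius^-+ zero    a b = distribʳ 1# a b
  frobenius^-+ (suc v) a b = begin
    (a + b) ^ (p ℕ.* q)            ≈⟨ ^-assoc (a + b) p q ⟨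
    ((a + b) ^ p) ^ q              ≈⟨ ^-congˡ q (frobenius-+ a b) ⟩
    (a ^ p + b ^ p) ^ q            ≈⟨ frobenius^-+ v (a ^ p) (b ^ p) ⟩
    (a ^ p) ^ q + (b ^ p) ^ q      ≈⟨ +-cong (^-assoc a p q) (^-assoc b p q) ⟩
    a ^ (p ℕ.* q) + b ^ (p ℕ.* q)  ∎
    where q = p ℕ.^ v

  -- Frobenius is additive and fixes 1, so induction on n replaces any count in the multiplicative
  -- group.
  fermat : ∀ n → ι n ^ p ≈ ι n
  fermat zero    = 0^ p 0<p
  fermat (suc n) = trans (frobenius-+ 1# (ι n)) (+-cong (1^ p) (fermat n))

-- Binet's formulas and their consequences in characteristic p

module Binet (T : CR) (a b : CommutativeRing.Carrier T)
             (ab≈-1 : CommutativeRing._≈_ T (CommutativeRing._*_ T a b)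
                        (CommutativeRing.-_ T (CommutativeRing.1# T))) where
  open RingTheory T
  open import Relation.Binary.Reasoning.Setoid setoid

  -- Because a b = -1, both `a` and `b` are roots of t² - (a + b) t - 1, so a^n - b^n obeys the
  -- recurrence of `fib`.
  binet : ∀ n → fib (a + b) n * (a - b) ≈ a ^ n - b ^ n
  binet zero          = solve 1 (λ c → con (+ 0) :* c := con (+ 1) :- con (+ 1)) refl (a - b)
  binet (suc zero)    = solve 2 (λ a b → con (+ 1) :* (a :- b) := a :* con (+ 1) :- b :* con (+ 1)) refl a b
  binet (suc (suc n)) = begin
    ((a + b) * fib (a + b) (suc n) + fib (a + b) n) * (a - b)
      ≈⟨ solve 4 (λ x y z w → (x :* y :+ z) :* w := x :* (y :* w) :+ z :* w) refl (a + b) _ _ (a - b) ⟩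
    (a + b) * (fib (a + b) (suc n) * (a - b)) + fib (a + b) n * (a - b)
      ≈⟨ +-cong (*-congˡ (binet (suc n))) (binet n) ⟩
    (a + b) * (a * a ^ n - b * b ^ n) + (a ^ n - b ^ n)
      ≈⟨ solve 4 (λ a b c d → (a :+ b) :* (a :* c :- b :* d) :+ (c :- d)
           := (a :* (a :* c) :- b :* (b :* d)) :+ (a :* b :+ con (+ 1)) :* (c :- d)) refl a b _ _ ⟩
    (a * (a * a ^ n) - b * (b * b ^ n)) + (a * b + 1#) * (a ^ n - b ^ n)
      ≈⟨ +-congˡ (trans (*-congʳ (trans (+-congʳ ab≈-1) (-‿inverseˡ 1#))) (zeroˡ _)) ⟩
    (a * (a * a ^ n) - b * (b * b ^ n)) + 0#
      ≈⟨ +-identityʳ _ ⟩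
    a * (a * a ^ n) - b * (b * b ^ n) ∎

  binet-lucas : ∀ n → lucas (a + b) n ≈ a ^ n + b ^ n
  -- `ι 2` unfolds to 1 + (1 + 0), which the nested constants spell out; `con (+ 2)` would denote 1
  -- + 1.
  binet-lucas zero          = solve 1 (λ x → (con (+ 1) :+ (con (+ 1) :+ con (+ 0))) :* con (+ 1) :- x :* con (+ 0)
                                := con (+ 1) :+ con (+ 1)) refl (a + b)
  binet-lucas (suc zero)    = solve 2 (λ a b → (con (+ 1) :+ (con (+ 1) :+ con (+ 0)))
                                  :* ((a :+ b) :* con (+ 1) :+ con (+ 0)) :- (a :+ b) :* con (+ 1)
                                := a :* con (+ 1) :+ b :* con (+ 1)) refl a b
  binet-lucas (suc (suc n)) = begin
    lucas x (suc (suc n))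
      ≈⟨ solve 4 (λ t x u v → t :* (x :* (x :* u :+ v) :+ u) :- x :* (x :* u :+ v)
           := x :* (t :* (x :* u :+ v) :- x :* u) :+ (t :* u :- x :* v)) refl (ι 2) x (fib x (suc n)) (fib x n) ⟩
    x * lucas x (suc n) + lucas x n
      ≈⟨ +-cong (*-congˡ (binet-lucas (suc n))) (binet-lucas n) ⟩
    (a + b) * (a * a ^ n + b * b ^ n) + (a ^ n + b ^ n)
      ≈⟨ solve 4 (λ a b c d → (a :+ b) :* (a :* c :+ b :* d) :+ (c :+ d)
           := (a :* (a :* c) :+ b :* (b :* d)) :+ (a :* b :+ con (+ 1)) :* (c :+ d)) refl a b _ _ ⟩
    (a * (a * a ^ n) + b * (b * b ^ n)) + (a * b + 1#) * (a ^ n + b ^ n)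
      ≈⟨ +-congˡ (trans (*-congʳ (trans (+-congʳ ab≈-1) (-‿inverseˡ 1#))) (zeroˡ _)) ⟩
    (a * (a * a ^ n) + b * (b * b ^ n)) + 0#
      ≈⟨ +-identityʳ _ ⟩
    a * (a * a ^ n) + b * (b * b ^ n) ∎
    where x = a + b

  -- A second factor a - b turns the left side of Binet's formula into an expression in a + b alone,
  -- which can be brought down from the extension.
  [a-b]²≈disc : (a - b) * (a - b) ≈ disc (a + b)
  [a-b]²≈disc = begin
    (a - b) * (a - b)
      ≈⟨ solve 2 (λ a b → (a :- b) :* (a :- b) := (a :+ b) :* (a :+ b) :+ con (ℤ.- (+ 4)) :* (a :* b)) refl a b ⟩
    (a + b) * (a + b) + _ * (a * b)    ≈⟨ +-congˡ (*-congˡ ab≈-1) ⟩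
    (a + b) * (a + b) + _ * - 1#
      ≈⟨ solve 1 (λ x → x :* x :+ con (ℤ.- (+ 4)) :* (:- con (+ 1))
           := x :* x :+ (con (+ 1) :+ (con (+ 1) :+ (con (+ 1) :+ (con (+ 1) :+ con (+ 0)))))) refl (a + b) ⟩
    disc (a + b) ∎

  private
    ^-comm : ∀ r → a ^ r * b ^ r ≈ (- 1#) ^ r
    ^-comm r = trans (sym (^-distrib-* a b r)) (^-congˡ r ab≈-1)

  module Char {p : ℕ} (pr : Prime p) (p≈0 : ι p ≈ 0#) where
    open Frobenius T pr p≈0

    fib-p : fib (a + b) p * (a - b) ≈ (a - b) ^ p
    fib-p = trans (binet p) (sym (frobenius-- a b))

    -- F_{pn} (a - b) = (a^n - b^n)^p = F_n^p (a - b)^p, and (a - b)^p = F_p (a - b) by `fib-p`.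
    fib-*p : ∀ n → fib (a + b) (p ℕ.* n) * disc (a + b) ≈ (fib (a + b) n ^ p * fib (a + b) p) * disc (a + b)
    fib-*p n = begin
      f (p ℕ.* n) * disc (a + b)          ≈⟨ *-congˡ [a-b]²≈disc ⟨
      f (p ℕ.* n) * (d * d)               ≈⟨ *-assoc _ _ _ ⟨
      f (p ℕ.* n) * d * d                 ≈⟨ *-congʳ (binet (p ℕ.* n)) ⟩
      (a ^ (p ℕ.* n) - b ^ (p ℕ.* n)) * d
        ≡⟨ ≡.cong (λ k → (a ^ k - b ^ k) * d) (ℕₚ.*-comm p n) ⟩
      (a ^ (n ℕ.* p) - b ^ (n ℕ.* p)) * d
        ≈⟨ *-congʳ (+-cong (^-assoc a n p) (-‿cong (^-assoc b n p))) ⟨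
      ((a ^ n) ^ p - (b ^ n) ^ p) * d     ≈⟨ *-congʳ (frobenius-- (a ^ n) (b ^ n)) ⟨
      (a ^ n - b ^ n) ^ p * d             ≈⟨ *-congʳ (^-congˡ p (binet n)) ⟨
      (f n * d) ^ p * d                   ≈⟨ *-congʳ (^-distrib-* (f n) d p) ⟩
      f n ^ p * d ^ p * d                 ≈⟨ *-congʳ (*-congˡ fib-p) ⟨
      f n ^ p * (f p * d) * d             ≈⟨ solve 3 (λ x y d → x :* (y :* d) :* d := (x :* y) :* (d :* d)) refl _ _ d ⟩
      (f n ^ p * f p) * (d * d)           ≈⟨ *-congˡ [a-b]²≈disc ⟩
      (f n ^ p * f p) * disc (a + b)      ∎
      where
      f = fib (a + b)
      d = a - b

    -- Formally F_p = (a - b)^(p-1), an even power of a - b. This is where the form x² + 4y² of the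
    -- case m = 1 comes from.
    fib-p-odd : ∀ s → p ≡ suc (2 ℕ.* s) → fib (a + b) p * disc (a + b) ≈ disc (a + b) ^ s * disc (a + b)
    fib-p-odd s ≡.refl = begin
      fib (a + b) p * disc (a + b)       ≈⟨ *-congˡ [a-b]²≈disc ⟨
      fib (a + b) p * (d * d)            ≈⟨ *-assoc _ _ _ ⟨
      fib (a + b) p * d * d              ≈⟨ *-congʳ fib-p ⟩
      d * d ^ (2 ℕ.* s) * d              ≈⟨ *-congʳ (*-congˡ (^-assoc d 2 s)) ⟨
      d * (d ^ 2) ^ s * d                ≈⟨ solve 2 (λ d e → d :* e :* d := e :* (d :* d)) refl d _ ⟩
      (d ^ 2) ^ s * (d * d)              ≈⟨ *-cong (^-congˡ s (trans (*-congˡ (*-identityʳ d)) [a-b]²≈disc)) [a-b]²≈disc ⟩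
      disc (a + b) ^ s * disc (a + b)    ∎
      where d = a - b

    private
      σ : ℕ → Carrier
      σ r = (- 1#) ^ r

      split : ∀ r v → p ℕ.^ v ≡ suc (r ℕ.+ r) → (a + b) ^ (p ℕ.^ v) ≈ a * (a ^ r * a ^ r) + b * (b ^ r * b ^ r)
      split r v eq = trans (frobenius^-+ v a b) (trans
        (reflexive (≡.cong (λ k → a ^ k + b ^ k) eq)) (+-cong (*-congˡ (^-homo-+ a r r)) (*-congˡ (^-homo-+ b r r))))

      with-fib : ∀ r → (a ^ r - b ^ r) * (a ^ suc r - b ^ suc r) ≈ disc (a + b) * (fib (a + b) r * fib (a + b) (suc r))
      with-fib r = begin
        (a ^ r - b ^ r) * (a ^ suc r - b ^ suc r)  ≈⟨ *-cong (binet r) (binet (suc r)) ⟨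
        (fib (a + b) r * (a - b)) * (fib (a + b) (suc r) * (a - b))
          ≈⟨ solve 3 (λ x y d → (x :* d) :* (y :* d) := (d :* d) :* (x :* y)) refl _ _ (a - b) ⟩
        ((a - b) * (a - b)) * (fib (a + b) r * fib (a + b) (suc r))  ≈⟨ *-congʳ [a-b]²≈disc ⟩
        disc (a + b) * (fib (a + b) r * fib (a + b) (suc r))         ∎

    -- With q = 2r + 1 and ab = -1, both products below expand to
    -- a^q + b^q ∓ (ab)^r (a + b), and a^q + b^q = (a + b)^q.
    x^q-x-even : ∀ r v → p ℕ.^ v ≡ suc (r ℕ.+ r) → σ r ≈ 1# →
                 (a + b) ^ (p ℕ.^ v) - (a + b) ≈ disc (a + b) * (fib (a + b) r * fib (a + b) (suc r))
    x^q-x-even r v eq s = begin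
      (a + b) ^ (p ℕ.^ v) - (a + b)
        ≈⟨ +-cong (split r v eq) (-‿cong (trans (sym (*-identityˡ _)) (*-congʳ (trans (sym s) (sym (^-comm r)))))) ⟩
      (a * (a ^ r * a ^ r) + b * (b ^ r * b ^ r)) - (a ^ r * b ^ r) * (a + b)
        ≈⟨ solve 4 (λ a b c d → (a :* (c :* c) :+ b :* (d :* d)) :- (c :* d) :* (a :+ b)
             := (c :- d) :* (a :* c :- b :* d)) refl a b (a ^ r) (b ^ r) ⟩
      (a ^ r - b ^ r) * (a ^ suc r - b ^ suc r)  ≈⟨ with-fib r ⟩
      disc (a + b) * (fib (a + b) r * fib (a + b) (suc r)) ∎

    x^q-x-odd : ∀ r v → p ℕ.^ v ≡ suc (r ℕ.+ r) → σ r ≈ - 1# →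
                (a + b) ^ (p ℕ.^ v) - (a + b) ≈ lucas (a + b) r * lucas (a + b) (suc r)
    x^q-x-odd r v eq s = begin
      (a + b) ^ (p ℕ.^ v) - (a + b)
        ≈⟨ +-cong (split r v eq) (trans (solve 1 (λ x → :- x := (:- con (+ 1)) :* x) refl (a + b))
            (*-congʳ (trans (sym s) (sym (^-comm r))))) ⟩
      (a * (a ^ r * a ^ r) + b * (b ^ r * b ^ r)) + (a ^ r * b ^ r) * (a + b)
        ≈⟨ solve 4 (λ a b c d → (a :* (c :* c) :+ b :* (d :* d)) :+ (c :* d) :* (a :+ b)
             := (c :+ d) :* (a :* c :+ b :* d)) refl a b (a ^ r) (b ^ r) ⟩
      (a ^ r + b ^ r) * (a ^ suc r + b ^ suc r)  ≈⟨ *-cong (binet-lucas r) (binet-lucas (suc r)) ⟨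
      lucas (a + b) r * lucas (a + b) (suc r) ∎

  fib-double : ∀ r → fib (a + b) (r ℕ.+ r) * disc (a + b) ≈ (fib (a + b) r * lucas (a + b) r) * disc (a + b)
  fib-double r = begin
    f (r ℕ.+ r) * disc (a + b)        ≈⟨ *-congˡ [a-b]²≈disc ⟨
    f (r ℕ.+ r) * (d * d)             ≈⟨ *-assoc _ _ _ ⟨
    f (r ℕ.+ r) * d * d               ≈⟨ *-congʳ (binet (r ℕ.+ r)) ⟩
    (a ^ (r ℕ.+ r) - b ^ (r ℕ.+ r)) * d
      ≈⟨ *-congʳ (+-cong (^-homo-+ a r r) (-‿cong (^-homo-+ b r r))) ⟩
    (a ^ r * a ^ r - b ^ r * b ^ r) * d
      ≈⟨ solve 3 (λ u v d → (u :* u :- v :* v) :* d := (u :- v) :* (u :+ v) :* d) refl _ _ d ⟩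
    (a ^ r - b ^ r) * (a ^ r + b ^ r) * d   ≈⟨ *-congʳ (*-cong (binet r) (binet-lucas r)) ⟨
    (f r * d) * lucas (a + b) r * d
      ≈⟨ solve 3 (λ u v d → (u :* d) :* v :* d := (u :* v) :* (d :* d)) refl _ _ d ⟩
    (f r * lucas (a + b) r) * (d * d)       ≈⟨ *-congˡ [a-b]²≈disc ⟩
    (f r * lucas (a + b) r) * disc (a + b)  ∎
    where
    f = fib (a + b)
    d = a - b

  -- Keeps F_r and L_r from vanishing together in odd characteristic, which later separates m
  -- dividing 2r from m dividing r.
  lucas²-fib² : ∀ r → lucas (a + b) r * lucas (a + b) r - disc (a + b) * (fib (a + b) r * fib (a + b) r)
                      ≈ ι 4 * (- 1#) ^ r
  lucas²-fib² r = begin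
    lucas (a + b) r * lucas (a + b) r - disc (a + b) * (fib (a + b) r * fib (a + b) r)
      ≈⟨ +-cong (*-cong (binet-lucas r) (binet-lucas r)) (-‿cong (*-congʳ (sym [a-b]²≈disc))) ⟩
    (u + v) * (u + v) - (d * d) * (fib (a + b) r * fib (a + b) r)
      ≈⟨ +-congˡ (-‿cong (trans (solve 2 (λ f d → (d :* d) :* (f :* f) := (f :* d) :* (f :* d)) refl _ d)
           (*-cong (binet r) (binet r)))) ⟩
    (u + v) * (u + v) - (u - v) * (u - v)
      ≈⟨ solve 2 (λ u v → (u :+ v) :* (u :+ v) :- (u :- v) :* (u :- v)
           := (con (+ 1) :+ (con (+ 1) :+ (con (+ 1) :+ (con (+ 1) :+ con (+ 0))))) :* (u :* v)) refl u v ⟩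
    ι 4 * (u * v)     ≈⟨ *-congˡ (^-comm r) ⟩
    ι 4 * (- 1#) ^ r  ∎
    where
    u = a ^ r
    v = b ^ r
    d = a - b

  module Char2 (2≈0 : ι 2 ≈ 0#) where
    open import Data.Nat.Primality using (prime[2])
    open Frobenius T prime[2] 2≈0

    -1≈1 : - 1# ≈ 1#
    -1≈1 = begin
      - 1#           ≈⟨ +-identityʳ _ ⟨
      - 1# + 0#      ≈⟨ +-congˡ 2≈0 ⟨
      - 1# + ι 2     ≈⟨ solve 0 (:- con (+ 1) :+ (con (+ 1) :+ (con (+ 1) :+ con (+ 0))) := con (+ 1)) refl ⟩
      1#             ∎

    -≈id : ∀ c → - c ≈ c
    -≈id c = trans (solve 1 (λ c → :- c := (:- con (+ 1)) :* c) refl c) (trans (*-congʳ -1≈1) (*-identityˡ c))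

    -- (a^(q+1) + b^(q+1)) (a^(q-1) + b^(q-1)) = a^2q + b^2q + (ab)^(q-1) (a² + b²)
    [x^q-x]² : ∀ v q′ → 2 ℕ.^ v ≡ suc q′ →
      ((a + b) ^ (2 ℕ.^ v) - (a + b)) * ((a + b) ^ (2 ℕ.^ v) - (a + b))
        ≈ ((a + b) * (a + b)) * (fib (a + b) q′ * fib (a + b) (suc (suc q′)))
    [x^q-x]² v q′ eq = begin
      (x ^ q - x) * (x ^ q - x)     ≈⟨ *-cong x^q x^q ⟩
      ((a * A - b * B) - (a - b)) * ((a * A - b * B) - (a - b))
        ≈⟨ trans (*-congˡ (sym (*-identityʳ _))) (frobenius-- (a * A - b * B) (a - b)) ⟩
      (a * A - b * B) ^ 2 - (a - b) ^ 2
        ≈⟨ +-cong (frobenius-- (a * A) (b * B)) (-‿cong (frobenius-- a b)) ⟩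
      ((a * A) ^ 2 - (b * B) ^ 2) - (a ^ 2 - b ^ 2)
        ≈⟨ +-cong (+-congˡ (-≈id _)) (trans (-‿cong (+-congˡ (-≈id _))) (trans (-≈id _) (sym (*-identityˡ _)))) ⟩
      ((a * A) ^ 2 + (b * B) ^ 2) + 1# * (a ^ 2 + b ^ 2)
        ≈⟨ +-congˡ (*-congʳ (trans (sym (-≈id 1#)) (-‿cong (sym AB≈1)))) ⟩
      ((a * A) ^ 2 + (b * B) ^ 2) + - (A * B) * (a ^ 2 + b ^ 2)
        ≈⟨ solve 4 (λ a b A B →
             ((a :* A) :* ((a :* A) :* con (+ 1)) :+ (b :* B) :* ((b :* B) :* con (+ 1)))
               :+ (:- (A :* B)) :* (a :* (a :* con (+ 1)) :+ b :* (b :* con (+ 1)))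
             := (A :- B) :* (a :* (a :* A) :- b :* (b :* B))) refl a b A B ⟩
      (A - B) * (a ^ suc (suc q′) - b ^ suc (suc q′))
        ≈⟨ *-cong (binet q′) (binet (suc (suc q′))) ⟨
      (f q′ * (a - b)) * (f (suc (suc q′)) * (a - b))
        ≈⟨ *-cong (*-congˡ (+-congˡ (-≈id b))) (*-congˡ (+-congˡ (-≈id b))) ⟩
      (f q′ * x) * (f (suc (suc q′)) * x)
        ≈⟨ solve 3 (λ u v d → (u :* d) :* (v :* d) := (d :* d) :* (u :* v)) refl _ _ x ⟩
      (x * x) * (f q′ * f (suc (suc q′))) ∎
      where
      q = 2 ℕ.^ v
      x = a + b
      A = a ^ q′
      B = b ^ q′
      f = fib (a + b)
      AB≈1 : A * B ≈ 1#
      AB≈1 = trans (^-comm q′) (trans (^-congˡ q′ -1≈1) (1^ q′))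
      x^q : x ^ q - x ≈ (a * A - b * B) - (a - b)
      x^q = +-cong (trans (frobenius^-+ v a b) (trans (reflexive (≡.cong (λ k → a ^ k + b ^ k) eq)) (+-congˡ (sym (-≈id _)))))
                   (-‿cong (+-congˡ (sym (-≈id b))))

-- The quadratic extension and the descent of identities from it

module Quadratic (R : CR) (x : CommutativeRing.Carrier R) where
  open RingTheory R
  open import Relation.Binary.Reasoning.Setoid setoid

  record _≈′_ (u v : Carrier × Carrier) : Set where
    constructor mk≈′
    field
      fst : proj₁ u ≈ proj₁ v
      snd : proj₂ u ≈ proj₂ v

  _*′_ : Carrier × Carrier → Carrier × Carrier → Carrier × Carrier
  (u , v) *′ (w , z) = u * w + v * z , (u * z + v * w) + x * (v * z)

  -- R[a] with a² = x a + 1; the pair (u , v) stands for u + v a.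
  Quad : CR
  Quad = record
    { Carrier = Carrier × Carrier ; _≈_ = _≈′_
    ; _+_ = λ (u , v) (w , z) → u + w , v + z ; _*_ = _*′_
    ; -_ = λ (u , v) → - u , - v ; 0# = 0# , 0# ; 1# = 1# , 0#
    ; isCommutativeRing = record
      { isRing = record
        { +-isAbelianGroup = record
          { isGroup = record
            { isMonoid = record
              { isSemigroup = record
                { isMagma = record
                  { isEquivalence = record
                    { refl = mk≈′ refl refl
                    ; sym = λ (mk≈′ e f) → mk≈′ (sym e) (sym f)
                    ; trans = λ (mk≈′ e f) (mk≈′ g h) → mk≈′ (trans e g) (trans f h) }
                  ; ∙-cong = λ (mk≈′ e f) (mk≈′ g h) → mk≈′ (+-cong e g) (+-cong f h) }
                ; assoc = λ (a , b) (c , d) (e , f) → mk≈′ (+-assoc a c e) (+-assoc b d f) }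
              ; identity = (λ (a , b) → mk≈′ (+-identityˡ a) (+-identityˡ b))
                         , (λ (a , b) → mk≈′ (+-identityʳ a) (+-identityʳ b)) }
            ; inverse = (λ (a , b) → mk≈′ (-‿inverseˡ a) (-‿inverseˡ b))
                      , (λ (a , b) → mk≈′ (-‿inverseʳ a) (-‿inverseʳ b))
            ; ⁻¹-cong = λ (mk≈′ e f) → mk≈′ (-‿cong e) (-‿cong f) }
          ; comm = λ (a , b) (c , d) → mk≈′ (+-comm a c) (+-comm b d) }
        ; *-cong = λ (mk≈′ e f) (mk≈′ g h) → mk≈′ (+-cong (*-cong e g) (*-cong f h))
                     (+-cong (+-cong (*-cong e h) (*-cong f g)) (*-congˡ (*-cong f h)))
        ; *-assoc = λ (a , b) (c , d) (e , f) → mk≈′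
            (solve 7 (λ x a b c d e f →
                (a :* c :+ b :* d) :* e :+ ((a :* d :+ b :* c) :+ x :* (b :* d)) :* f
                := a :* (c :* e :+ d :* f) :+ b :* ((c :* f :+ d :* e) :+ x :* (d :* f))) refl x a b c d e f)
            (solve 7 (λ x a b c d e f →
                ((a :* c :+ b :* d) :* f :+ ((a :* d :+ b :* c) :+ x :* (b :* d)) :* e)
                   :+ x :* (((a :* d :+ b :* c) :+ x :* (b :* d)) :* f)
                := (a :* ((c :* f :+ d :* e) :+ x :* (d :* f)) :+ b :* (c :* e :+ d :* f))
                   :+ x :* (b :* ((c :* f :+ d :* e) :+ x :* (d :* f)))) refl x a b c d e f)
        ; *-identity =
            (λ (a , b) → mk≈′
              (solve 2 (λ a b → con (+ 1) :* a :+ con (+ 0) :* b := a) refl a b)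
              (solve 3 (λ x a b → (con (+ 1) :* b :+ con (+ 0) :* a) :+ x :* (con (+ 0) :* b) := b) refl x a b))
          , (λ (a , b) → mk≈′
              (solve 2 (λ a b → a :* con (+ 1) :+ b :* con (+ 0) := a) refl a b)
              (solve 3 (λ x a b → (a :* con (+ 0) :+ b :* con (+ 1)) :+ x :* (b :* con (+ 0)) := b) refl x a b))
        ; distrib =
            (λ (a , b) (c , d) (e , f) → mk≈′
              (solve 6 (λ a b c d e f → a :* (c :+ e) :+ b :* (d :+ f)
                 := (a :* c :+ b :* d) :+ (a :* e :+ b :* f)) refl a b c d e f)
              (solve 7 (λ x a b c d e f → (a :* (d :+ f) :+ b :* (c :+ e)) :+ x :* (b :* (d :+ f))
                 := ((a :* d :+ b :* c) :+ x :* (b :* d)) :+ ((a :* f :+ b :* e) :+ x :* (b :* f)))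
                 refl x a b c d e f))
          , (λ (a , b) (c , d) (e , f) → mk≈′
              (solve 6 (λ a b c d e f → (c :+ e) :* a :+ (d :+ f) :* b
                 := (c :* a :+ d :* b) :+ (e :* a :+ f :* b)) refl a b c d e f)
              (solve 7 (λ x a b c d e f → ((c :+ e) :* b :+ (d :+ f) :* a) :+ x :* ((d :+ f) :* b)
                 := ((c :* b :+ d :* a) :+ x :* (d :* b)) :+ ((e :* b :+ f :* a) :+ x :* (f :* b)))
                 refl x a b c d e f)) }
      ; *-comm = λ (a , b) (c , d) → mk≈′
          (solve 4 (λ a b c d → a :* c :+ b :* d := c :* a :+ d :* b) refl a b c d)
          (solve 5 (λ x a b c d → (a :* d :+ b :* c) :+ x :* (b :* d) := (c :* b :+ d :* a) :+ x :* (d :* b))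
             refl x a b c d) } }

  private module Q = RingTheory Quad

  emb : Carrier → Carrier × Carrier
  emb u = u , 0#

  emb-cong : ∀ {u v} → u ≈ v → emb u Q.≈ emb v
  emb-cong e = mk≈′ e refl

  -- Since 1 and a form a basis by construction, an identity between images of elements of `R` holds
  -- in `R`; nothing is assumed about zero divisors.
  emb-injective : ∀ {u v} → emb u Q.≈ emb v → u ≈ v
  emb-injective = _≈′_.fst

  emb-* : ∀ u v → emb (u * v) Q.≈ emb u Q.* emb v
  emb-* u v = mk≈′ (solve 2 (λ u v → u :* v := u :* v :+ con (+ 0) :* con (+ 0)) refl u v)
    (solve 3 (λ x u v → con (+ 0) := (u :* con (+ 0) :+ con (+ 0) :* v) :+ x :* (con (+ 0) :* con (+ 0))) refl x u v)

  emb-+ : ∀ u v → emb (u + v) Q.≈ emb u Q.+ emb v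
  emb-+ u v = mk≈′ refl (sym (+-identityˡ 0#))

  emb-neg : ∀ u → emb (- u) Q.≈ Q.- emb u
  emb-neg u = mk≈′ refl (solve 0 (con (+ 0) := :- con (+ 0)) refl)

  emb-- : ∀ u v → emb (u - v) Q.≈ emb u Q.- emb v
  emb-- u v = Q.trans (emb-+ u (- v)) (Q.+-congˡ (emb-neg v))

  emb-ι : ∀ n → emb (ι n) Q.≈ Q.ι n
  emb-ι zero    = Q.refl
  emb-ι (suc n) = Q.trans (emb-+ 1# (ι n)) (Q.+-congˡ (emb-ι n))

  emb-^ : ∀ u n → emb (u ^ n) Q.≈ emb u Q.^ n
  emb-^ u zero    = Q.refl
  emb-^ u (suc n) = Q.trans (emb-* u (u ^ n)) (Q.*-congˡ (emb-^ u n))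

  emb-fib : ∀ u n → emb (fib u n) Q.≈ Q.fib (emb u) n
  emb-fib u zero          = Q.refl
  emb-fib u (suc zero)    = Q.refl
  emb-fib u (suc (suc n)) = Q.trans (emb-+ _ _)
    (Q.+-cong (Q.trans (emb-* u _) (Q.*-congˡ (emb-fib u (suc n)))) (emb-fib u n))

  emb-lucas : ∀ u n → emb (lucas u n) Q.≈ Q.lucas (emb u) n
  emb-lucas u n = Q.trans (emb-- _ _) (Q.+-cong
    (Q.trans (emb-* (ι 2) _) (Q.*-cong (emb-ι 2) (emb-fib u (suc n))))
    (Q.-‿cong (Q.trans (emb-* u _) (Q.*-congˡ (emb-fib u n)))))

  emb-disc : ∀ u → emb (disc u) Q.≈ Q.disc (emb u)
  emb-disc u = Q.trans (emb-+ _ _) (Q.+-cong (emb-* u u) (emb-ι 4))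

  a b : Carrier × Carrier
  a = 0# , 1#
  b = x , - 1#

  ab≈-1 : a Q.* b Q.≈ Q.- Q.1#
  ab≈-1 = mk≈′
    (solve 1 (λ x → con (+ 0) :* x :+ con (+ 1) :* (:- con (+ 1)) := :- con (+ 1)) refl x)
    (solve 1 (λ x → (con (+ 0) :* (:- con (+ 1)) :+ con (+ 1) :* x) :+ x :* (con (+ 1) :* (:- con (+ 1))) := :-
        con (+ 0)) refl x)

  x≈a+b : emb x Q.≈ a Q.+ b
  x≈a+b = mk≈′ (sym (+-identityˡ x)) (sym (-‿inverseʳ 1#))

  emb-fib′ : ∀ n → emb (fib x n) Q.≈ Q.fib (a Q.+ b) n
  emb-fib′ n = Q.trans (emb-fib x n) (Q.fib-cong n x≈a+b)

  emb-lucas′ : ∀ n → emb (lucas x n) Q.≈ Q.lucas (a Q.+ b) n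
  emb-lucas′ n = Q.trans (emb-lucas x n) (Q.lucas-cong n x≈a+b)

  emb-disc′ : emb (disc x) Q.≈ Q.disc (a Q.+ b)
  emb-disc′ = Q.trans (emb-disc x) (Q.+-congʳ (Q.*-cong x≈a+b x≈a+b))

  open Binet Quad a b ab≈-1

  private
    infixr 3 _∙_
    infixr 5 _⊛_
    _∙_ : ∀ {u v w} → u Q.≈ v → v Q.≈ w → u Q.≈ w
    _∙_ = Q.trans

    _⊛_ : ∀ {u v u′ v′} → emb u Q.≈ u′ → emb v Q.≈ v′ → emb (u * v) Q.≈ u′ Q.* v′
    e ⊛ f = emb-* _ _ ∙ Q.*-cong e f

    pow : ∀ {u u′} n → emb u Q.≈ u′ → emb (u ^ n) Q.≈ u′ Q.^ n
    pow n e = emb-^ _ n ∙ Q.^-congˡ n e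

    minus : ∀ {u v u′ v′} → emb u Q.≈ u′ → emb v Q.≈ v′ → emb (u - v) Q.≈ u′ Q.- v′
    minus e f = emb-- _ _ ∙ Q.+-cong e (Q.-‿cong f)

    descend : ∀ {u v u′ v′} → emb u Q.≈ u′ → emb v Q.≈ v′ → u′ Q.≈ v′ → u ≈ v
    descend e f g = emb-injective (e ∙ g ∙ Q.sym f)

  fib-double′ : ∀ r → fib x (r ℕ.+ r) * disc x ≈ (fib x r * lucas x r) * disc x
  fib-double′ r = descend (emb-fib′ (r ℕ.+ r) ⊛ emb-disc′) ((emb-fib′ r ⊛ emb-lucas′ r) ⊛ emb-disc′) (fib-double r)

  lucas²-fib²′ : ∀ r → lucas x r * lucas x r - disc x * (fib x r * fib x r) ≈ ι 4 * (- 1#) ^ r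
  lucas²-fib²′ r = descend (minus (emb-lucas′ r ⊛ emb-lucas′ r) (emb-disc′ ⊛ (emb-fib′ r ⊛ emb-fib′ r)))
    (emb-ι 4 ⊛ pow r (emb-neg 1#)) (lucas²-fib² r)

  module _ {p : ℕ} (pr : Prime p) (p≈0 : ι p ≈ 0#) where
    open Char pr (Q.trans (Q.sym (emb-ι p)) (emb-cong p≈0))

    fib-*p′ : ∀ n → fib x (p ℕ.* n) * disc x ≈ (fib x n ^ p * fib x p) * disc x
    fib-*p′ n = descend (emb-fib′ (p ℕ.* n) ⊛ emb-disc′) ((pow p (emb-fib′ n) ⊛ emb-fib′ p) ⊛ emb-disc′) (fib-*p n)

    fib-p-odd′ : ∀ s → p ≡ suc (2 ℕ.* s) → fib x p * disc x ≈ disc x ^ s * disc x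
    fib-p-odd′ s eq = descend (emb-fib′ p ⊛ emb-disc′) (pow s emb-disc′ ⊛ emb-disc′) (fib-p-odd s eq)

    x^q-x-even′ : ∀ r v → p ℕ.^ v ≡ suc (r ℕ.+ r) → (- 1#) ^ r ≈ 1# →
                  x ^ (p ℕ.^ v) - x ≈ disc x * (fib x r * fib x (suc r))
    x^q-x-even′ r v eq s = descend (minus (pow (p ℕ.^ v) x≈a+b) x≈a+b) (emb-disc′ ⊛ (emb-fib′ r ⊛ emb-fib′ (suc r)))
      (x^q-x-even r v eq (Q.sym (pow r (emb-neg 1#)) ∙ emb-cong s))

    x^q-x-odd′ : ∀ r v → p ℕ.^ v ≡ suc (r ℕ.+ r) → (- 1#) ^ r ≈ - 1# →
                 x ^ (p ℕ.^ v) - x ≈ lucas x r * lucas x (suc r)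
    x^q-x-odd′ r v eq s = descend (minus (pow (p ℕ.^ v) x≈a+b) x≈a+b) (emb-lucas′ r ⊛ emb-lucas′ (suc r))
      (x^q-x-odd r v eq (Q.sym (pow r (emb-neg 1#)) ∙ emb-cong s ∙ emb-neg 1#))

  [x^q-x]²′ : ι 2 ≈ 0# → ∀ v q′ → 2 ℕ.^ v ≡ suc q′ →
    (x ^ (2 ℕ.^ v) - x) * (x ^ (2 ℕ.^ v) - x) ≈ (x * x) * (fib x q′ * fib x (suc (suc q′)))
  [x^q-x]²′ 2≈0 v q′ eq = descend
    (minus (pow (2 ℕ.^ v) x≈a+b) x≈a+b ⊛ minus (pow (2 ℕ.^ v) x≈a+b) x≈a+b)
    ((x≈a+b ⊛ x≈a+b) ⊛ (emb-fib′ q′ ⊛ emb-fib′ (suc (suc q′))))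
    (Char2.[x^q-x]² (Q.trans (Q.sym (emb-ι 2)) (emb-cong 2≈0)) v q′ eq)

-- Polynomials as coefficient lists, lowest degree first

module RawPoly {A : Set} (_+_ _*_ : A → A → A) (0# : A) where

  add : List A → List A → List A
  add []       q        = q
  add (a ∷ as) []       = a ∷ as
  add (a ∷ as) (b ∷ bs) = (a + b) ∷ add as bs

  mul : List A → List A → List A
  mul []       q = []
  mul (a ∷ as) q = add (map (a *_) q) (0# ∷ mul as q)

  coeff : List A → ℕ → A
  coeff []       _       = 0#
  coeff (a ∷ as) zero    = a
  coeff (a ∷ as) (suc i) = coeff as i

module Polynomial (R : CR) where
  open RingTheory R
  open RawPoly _+_ _*_ 0# public
  open import Relation.Binary.Reasoning.Setoid setoid

  Poly : Set
  Poly = List Carrier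

  infix 4 _≋_
  -- Equality ignores trailing zeros, so the length of a list only bounds its degree.
  record _≋_ (p q : Poly) : Set where
    constructor ext
    field
      at : ∀ i → coeff p i ≈ coeff q i
  open _≋_ public

  neg : Poly → Poly
  neg = map (λ a → - a)

  const : Carrier → Poly
  const c = c ∷ []

  X : Poly
  X = 0# ∷ 1# ∷ []

  ≋-refl : ∀ {p} → p ≋ p
  ≋-refl = ext λ i → refl

  ≋-sym : ∀ {p q} → p ≋ q → q ≋ p
  ≋-sym e = ext λ i → sym (at e i)

  ≋-trans : ∀ {p q r} → p ≋ q → q ≋ r → p ≋ r
  ≋-trans e f = ext λ i → trans (at e i) (at f i)

  ∷-cong : ∀ {a b p q} → a ≈ b → p ≋ q → (a ∷ p) ≋ (b ∷ q)
  ∷-cong e f = ext λ { zero → e ; (suc i) → at f i }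

  coeff-[0] : ∀ i → coeff (0# ∷ []) i ≈ 0#
  coeff-[0] zero    = refl
  coeff-[0] (suc i) = refl

  coeff-add : ∀ p q i → coeff (add p q) i ≈ coeff p i + coeff q i
  coeff-add []       q        i       = sym (+-identityˡ _)
  coeff-add (a ∷ as) []       i       = sym (+-identityʳ _)
  coeff-add (a ∷ as) (b ∷ bs) zero    = refl
  coeff-add (a ∷ as) (b ∷ bs) (suc i) = coeff-add as bs i

  coeff-scale : ∀ a q i → coeff (map (a *_) q) i ≈ a * coeff q i
  coeff-scale a []       i       = sym (zeroʳ a)
  coeff-scale a (b ∷ bs) zero    = refl
  coeff-scale a (b ∷ bs) (suc i) = coeff-scale a bs i

  coeff-neg : ∀ q i → coeff (neg q) i ≈ - coeff q i
  coeff-neg []       i       = solve 0 (con (+ 0) := :- con (+ 0)) refl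
  coeff-neg (b ∷ bs) zero    = refl
  coeff-neg (b ∷ bs) (suc i) = coeff-neg bs i

  shift-add : ∀ p q i → coeff (0# ∷ add p q) i ≈ coeff (0# ∷ p) i + coeff (0# ∷ q) i
  shift-add p q zero    = sym (+-identityˡ _)
  shift-add p q (suc i) = coeff-add p q i

  shift-scale : ∀ a q i → coeff (0# ∷ map (a *_) q) i ≈ a * coeff (0# ∷ q) i
  shift-scale a q zero    = sym (zeroʳ a)
  shift-scale a q (suc i) = coeff-scale a q i

  coeff-mul : ∀ a p q i → coeff (mul (a ∷ p) q) i ≈ a * coeff q i + coeff (0# ∷ mul p q) i
  coeff-mul a p q i = trans (coeff-add (map (a *_) q) _ i) (+-congʳ (coeff-scale a q i))

  mul-shift : ∀ p q → mul (0# ∷ p) q ≋ 0# ∷ mul p q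
  mul-shift p q = ext λ i → trans (coeff-mul 0# p q i) (trans (+-congʳ (zeroˡ _)) (+-identityˡ _))

  mul-zeroʳ : ∀ p → mul p [] ≋ []
  mul-zeroʳ []      = ≋-refl
  mul-zeroʳ (a ∷ p) = ext λ { zero → refl ; (suc i) → at (mul-zeroʳ p) i }

  mul-∷ʳ : ∀ p b q i → coeff (mul p (b ∷ q)) i ≈ b * coeff p i + coeff (0# ∷ mul p q) i
  mul-∷ʳ []      b q zero    = solve 1 (λ b → con (+ 0) := b :* con (+ 0) :+ con (+ 0)) refl b
  mul-∷ʳ []      b q (suc i) = solve 1 (λ b → con (+ 0) := b :* con (+ 0) :+ con (+ 0)) refl b
  mul-∷ʳ (a ∷ p) b q zero    = trans (+-identityʳ _) (trans (*-comm a b) (sym (+-identityʳ _)))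
  mul-∷ʳ (a ∷ p) b q (suc i) = begin
    coeff (mul (a ∷ p) (b ∷ q)) (suc i)                    ≈⟨ coeff-mul a p (b ∷ q) (suc i) ⟩
    a * coeff q i + coeff (mul p (b ∷ q)) i                ≈⟨ +-congˡ (mul-∷ʳ p b q i) ⟩
    a * coeff q i + (b * coeff p i + coeff (0# ∷ mul p q) i)
      ≈⟨ solve 3 (λ u v w → u :+ (v :+ w) := v :+ (u :+ w)) refl _ _ _ ⟩
    b * coeff p i + (a * coeff q i + coeff (0# ∷ mul p q) i)  ≈⟨ +-congˡ (coeff-mul a p q i) ⟨
    b * coeff p i + coeff (mul (a ∷ p) q) i ∎

  mul-comm : ∀ p q → mul p q ≋ mul q p
  mul-comm []      q = ≋-sym (mul-zeroʳ q)
  mul-comm (a ∷ p) q = ext λ i → trans (coeff-mul a p q i)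
    (trans (+-congˡ (at (∷-cong refl (mul-comm p q)) i)) (sym (mul-∷ʳ q a p i)))

  mul-congˡ : ∀ p {q r} → q ≋ r → mul p q ≋ mul p r
  mul-congˡ []      e = ≋-refl
  mul-congˡ (a ∷ p) e = ext λ i → trans (coeff-mul a p _ i)
    (trans (+-cong (*-congˡ (at e i)) (at (∷-cong refl (mul-congˡ p e)) i)) (sym (coeff-mul a p _ i)))

  mul-cong : ∀ {p q r s} → p ≋ q → r ≋ s → mul p r ≋ mul q s
  mul-cong {p} {q} {r} {s} e f = ≋-trans (mul-congˡ p f)
    (≋-trans (mul-comm p s) (≋-trans (mul-congˡ s e) (mul-comm s q)))

  mul-distribʳ : ∀ r p q → mul (add p q) r ≋ add (mul p r) (mul q r)
  mul-distribʳ r []      q       = ≋-refl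
  mul-distribʳ r (a ∷ p) []      = ext λ i → sym (trans (coeff-add (mul (a ∷ p) r) [] i) (+-identityʳ _))
  mul-distribʳ r (a ∷ p) (b ∷ q) = ext λ i → begin
    coeff (mul ((a + b) ∷ add p q) r) i                     ≈⟨ coeff-mul (a + b) (add p q) r i ⟩
    (a + b) * coeff r i + coeff (0# ∷ mul (add p q) r) i
      ≈⟨ +-congˡ (trans (at (∷-cong refl (mul-distribʳ r p q)) i) (shift-add _ _ i)) ⟩
    (a + b) * coeff r i + (coeff (0# ∷ mul p r) i + coeff (0# ∷ mul q r) i)
      ≈⟨ solve 5 (λ a b c d e → (a :+ b) :* c :+ (d :+ e) := (a :* c :+ d) :+ (b :* c :+ e)) refl a b _ _ _ ⟩
    (a * coeff r i + coeff (0# ∷ mul p r) i) + (b * coeff r i + coeff (0# ∷ mul q r) i)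
      ≈⟨ +-cong (coeff-mul a p r i) (coeff-mul b q r i) ⟨
    coeff (mul (a ∷ p) r) i + coeff (mul (b ∷ q) r) i       ≈⟨ coeff-add (mul (a ∷ p) r) _ i ⟨
    coeff (add (mul (a ∷ p) r) (mul (b ∷ q) r)) i           ∎

  mul-scale : ∀ a p q → mul (map (a *_) p) q ≋ map (a *_) (mul p q)
  mul-scale a []      q = ≋-refl
  mul-scale a (b ∷ p) q = ext λ i → begin
    coeff (mul ((a * b) ∷ map (a *_) p) q) i    ≈⟨ coeff-mul (a * b) (map (a *_) p) q i ⟩
    a * b * coeff q i + coeff (0# ∷ mul (map (a *_) p) q) i
      ≈⟨ +-congˡ (trans (at (∷-cong refl (mul-scale a p q)) i) (shift-scale a _ i)) ⟩
    a * b * coeff q i + a * coeff (0# ∷ mul p q) i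
      ≈⟨ solve 4 (λ a b c d → a :* b :* c :+ a :* d := a :* (b :* c :+ d)) refl a b _ _ ⟩
    a * (b * coeff q i + coeff (0# ∷ mul p q) i)  ≈⟨ *-congˡ (coeff-mul b p q i) ⟨
    a * coeff (mul (b ∷ p) q) i                   ≈⟨ coeff-scale a (mul (b ∷ p) q) i ⟨
    coeff (map (a *_) (mul (b ∷ p) q)) i          ∎

  add-cong : ∀ {p q r s} → p ≋ q → r ≋ s → add p r ≋ add q s
  add-cong {p} {q} e f = ext λ i → trans (coeff-add p _ i) (trans (+-cong (at e i) (at f i)) (sym (coeff-add q _ i)))

  mul-assoc : ∀ p q r → mul (mul p q) r ≋ mul p (mul q r)
  mul-assoc []      q r = ≋-refl
  mul-assoc (a ∷ p) q r = ≋-trans (mul-distribʳ r (map (a *_) q) _)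
    (add-cong (mul-scale a q r) (≋-trans (mul-shift (mul p q) r) (∷-cong refl (mul-assoc p q r))))

  add-comm : ∀ p q → add p q ≋ add q p
  add-comm p q = ext λ i → trans (coeff-add p q i) (trans (+-comm _ _) (sym (coeff-add q p i)))

  mul-identityˡ : ∀ p → mul (1# ∷ []) p ≋ p
  mul-identityˡ p = ext λ i → trans (coeff-mul 1# [] p i)
    (trans (+-cong (*-identityˡ _) (coeff-[0] i)) (+-identityʳ _))

  polyRing : CR
  polyRing = record
    { Carrier = Poly ; _≈_ = _≋_ ; _+_ = add ; _*_ = mul ; -_ = neg ; 0# = [] ; 1# = 1# ∷ []
    ; isCommutativeRing = record
      { isRing = record
        { +-isAbelianGroup = record
          { isGroup = record
            { isMonoid = record
              { isSemigroup = record
                { isMagma = record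
                  { isEquivalence = record { refl = ≋-refl ; sym = ≋-sym ; trans = ≋-trans }
                  ; ∙-cong = add-cong }
                ; assoc = λ p q r → ext λ i → begin
                    coeff (add (add p q) r) i               ≈⟨ coeff-add (add p q) r i ⟩
                    coeff (add p q) i + coeff r i           ≈⟨ +-congʳ (coeff-add p q i) ⟩
                    (coeff p i + coeff q i) + coeff r i     ≈⟨ +-assoc _ _ _ ⟩
                    coeff p i + (coeff q i + coeff r i)     ≈⟨ +-congˡ (coeff-add q r i) ⟨
                    coeff p i + coeff (add q r) i           ≈⟨ coeff-add p (add q r) i ⟨
                    coeff (add p (add q r)) i               ∎ }
              ; identity = (λ p → ≋-refl) , (λ p → add-comm p []) }
            ; inverse = (λ p → ≋-trans (add-comm (neg p) p) (inverseʳ′ p)) , inverseʳ′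
            ; ⁻¹-cong = λ {p} {q} e → ext λ i → trans (coeff-neg p i) (trans (-‿cong (at e i)) (sym (coeff-neg q i))) }
          ; comm = add-comm }
        ; *-cong = mul-cong
        ; *-assoc = mul-assoc
        ; *-identity = mul-identityˡ , (λ p → ≋-trans (mul-comm p _) (mul-identityˡ p))
        ; distrib = (λ r p q → ≋-trans (mul-comm r _) (≋-trans (mul-distribʳ r p q)
                        (add-cong (mul-comm p r) (mul-comm q r))))
                  , mul-distribʳ }
      ; *-comm = mul-comm } }
    where
    inverseʳ′ : ∀ p → add p (neg p) ≋ []
    inverseʳ′ p = ext λ i → trans (coeff-add p (neg p) i) (trans (+-congˡ (coeff-neg p i)) (-‿inverseʳ _))

  X*≋∷ : ∀ p → mul X p ≋ 0# ∷ p
  X*≋∷ p = ≋-trans (mul-shift (1# ∷ []) p) (∷-cong refl (mul-identityˡ p))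

  const-* : ∀ a p → mul (const a) p ≋ map (a *_) p
  const-* a p = ext λ i → trans (coeff-mul a [] p i)
    (trans (+-congˡ (coeff-[0] i)) (trans (+-identityʳ _) (sym (coeff-scale a p i))))

  const-cong : ∀ {a b} → a ≈ b → const a ≋ const b
  const-cong e = ∷-cong e ≋-refl

  const-*-const : ∀ a b → const (a * b) ≋ mul (const a) (const b)
  const-*-const a b = ≋-sym (const-* a (const b))

  private module P = RingTheory polyRing

  const-ι : ∀ n → P.ι n ≋ const (ι n)
  const-ι zero    = ext λ { zero → refl ; (suc i) → refl }
  const-ι (suc n) = add-cong (≋-refl {1# ∷ []}) (const-ι n)

  const-^ : ∀ a n → const (a ^ n) ≋ const a P.^ n
  const-^ a zero    = ≋-refl
  const-^ a (suc n) = ≋-trans (const-*-const a (a ^ n)) (mul-congˡ (const a) (const-^ a n))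

  -- A bound instead of a degree function: finding the degree would require deciding whether
  -- coefficients vanish, and the zero polynomial needs no exception.
  Deg< : Poly → ℕ → Set
  Deg< p n = ∀ i → n ≤ i → coeff p i ≈ 0#

  Deg<-cong : ∀ {p q n} → p ≋ q → Deg< p n → Deg< q n
  Deg<-cong e d i n≤i = trans (sym (at e i)) (d i n≤i)

  Deg<-mono : ∀ {p m n} → m ≤ n → Deg< p m → Deg< p n
  Deg<-mono m≤n d i n≤i = d i (ℕₚ.≤-trans m≤n n≤i)

  Deg<-length : ∀ p → Deg< p (length p)
  Deg<-length []      i       _       = refl
  Deg<-length (a ∷ p) (suc i) (s≤s l) = Deg<-length p i l

  Deg<-0 : ∀ {p} → Deg< p 0 → p ≋ []
  Deg<-0 d = ext λ i → d i z≤n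

  Deg<-[] : ∀ n → Deg< [] n
  Deg<-[] n i _ = refl

  Deg<-add : ∀ {p q n} → Deg< p n → Deg< q n → Deg< (add p q) n
  Deg<-add {p} {q} d e i l = trans (coeff-add p q i) (trans (+-cong (d i l) (e i l)) (+-identityˡ _))

  Deg<-neg : ∀ {p n} → Deg< p n → Deg< (neg p) n
  Deg<-neg {p} d i l = trans (coeff-neg p i) (trans (-‿cong (d i l)) (solve 0 (:- con (+ 0) := con (+ 0)) refl))

  Deg<-scale : ∀ {p n} a → Deg< p n → Deg< (map (a *_) p) n
  Deg<-scale {p} a d i l = trans (coeff-scale a p i) (trans (*-congˡ (d i l)) (zeroʳ a))

  Deg<-pred : ∀ {p n} → Deg< p (suc n) → coeff p n ≈ 0# → Deg< p n
  Deg<-pred {p} {n} d e i n≤i with n ℕ.≟ i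
  ... | yes ≡.refl = e
  ... | no  n≢i    = d i (ℕₚ.≤∧≢⇒< n≤i n≢i)

  Deg<-tail : ∀ {a p n} → Deg< (a ∷ p) (suc n) → Deg< p n
  Deg<-tail d i l = d (suc i) (s≤s l)

  Deg<-mul : ∀ p q m n → Deg< p (suc m) → Deg< q (suc n) → Deg< (mul p q) (suc (m ℕ.+ n))
  Deg<-mul []      q m       n d e i l = refl
  Deg<-mul (a ∷ p) q zero    n d e (suc i) l = trans (coeff-mul a p q (suc i)) (begin
    a * coeff q (suc i) + coeff (mul p q) i
      ≈⟨ +-cong (*-congˡ (e (suc i) l)) (at (mul-cong (Deg<-0 {p} (Deg<-tail d)) (≋-refl {q})) i) ⟩
    a * 0# + 0#  ≈⟨ solve 1 (λ a → a :* con (+ 0) :+ con (+ 0) := con (+ 0)) refl a ⟩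
    0#           ∎)
  Deg<-mul (a ∷ p) q (suc m) n d e (suc i) (s≤s l) = trans (coeff-mul a p q (suc i)) (begin
    a * coeff q (suc i) + coeff (mul p q) i
      ≈⟨ +-cong (*-congˡ (e (suc i) (ℕₚ.≤-trans (s≤s (ℕₚ.m≤n+m n (suc m))) (s≤s l)))) (Deg<-mul p q m n (Deg<-tail d) e i l) ⟩
    a * 0# + 0#  ≈⟨ solve 1 (λ a → a :* con (+ 0) :+ con (+ 0) := con (+ 0)) refl a ⟩
    0#           ∎)

  coeff-mul-top : ∀ p q m n → Deg< p (suc m) → Deg< q (suc n) → coeff (mul p q) (m ℕ.+ n) ≈ coeff p m * coeff q n
  coeff-mul-top []      q m       n d e = sym (zeroˡ _)
  coeff-mul-top (a ∷ p) q zero    n d e = begin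
    coeff (mul (a ∷ p) q) n              ≈⟨ coeff-mul a p q n ⟩
    a * coeff q n + coeff (0# ∷ mul p q) n
      ≈⟨ +-congˡ (at (∷-cong refl (mul-cong (Deg<-0 {p} (Deg<-tail d)) (≋-refl {q}))) n) ⟩
    a * coeff q n + coeff (0# ∷ []) n    ≈⟨ +-congˡ (coeff-[0] n) ⟩
    a * coeff q n + 0#                   ≈⟨ +-identityʳ _ ⟩
    a * coeff q n                        ∎
  coeff-mul-top (a ∷ p) q (suc m) n d e = begin
    coeff (mul (a ∷ p) q) (suc m ℕ.+ n)  ≈⟨ coeff-mul a p q (suc m ℕ.+ n) ⟩
    a * coeff q (suc m ℕ.+ n) + coeff (mul p q) (m ℕ.+ n)
      ≈⟨ +-cong (*-congˡ (e _ (s≤s (ℕₚ.m≤n+m n m)))) (coeff-mul-top p q m n (Deg<-tail d) e) ⟩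
    a * 0# + coeff p m * coeff q n       ≈⟨ solve 2 (λ a b → a :* con (+ 0) :+ b := b) refl a _ ⟩
    coeff p m * coeff q n                ∎

  record Monic (d : ℕ) (f : Poly) : Set where
    constructor monic
    field
      deg : Deg< f (suc d)
      top : coeff f d ≈ 1#

  Monic-cong : ∀ {d f g} → f ≋ g → Monic d f → Monic d g
  Monic-cong {d} {f} e (monic D t) = monic (Deg<-cong {f} e D) (trans (sym (at e d)) t)

  Monic-1 : Monic 0 (1# ∷ [])
  Monic-1 = monic (λ { (suc i) _ → refl }) refl

  Monic-mul : ∀ {d e f g} → Monic d f → Monic e g → Monic (d ℕ.+ e) (mul f g)
  Monic-mul {d} {e} {f} {g} (monic D t) (monic E u) = monic (Deg<-mul f g d e D E)
    (trans (coeff-mul-top f g d e D E) (trans (*-cong t u) (*-identityˡ 1#)))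

  Monic-^ : ∀ {d f} n → Monic d f → Monic (n ℕ.* d) (f P.^ n)
  Monic-^ zero    M = Monic-1
  Monic-^ (suc n) M = Monic-mul M (Monic-^ n M)

  Monic-0 : ∀ {f} → Monic 0 f → f ≋ 1# ∷ []
  Monic-0 (monic D t) = ext λ { zero → t ; (suc i) → D (suc i) (s≤s z≤n) }

  Monic-X : Monic 1 X
  Monic-X = monic (λ { (suc zero) (s≤s ()) ; (suc (suc i)) _ → refl }) refl

  record Division (f : Poly) (d : ℕ) (g : Poly) : Set where
    constructor division
    field
      quot rem : Poly
      equality : g ≋ add (mul quot f) rem
      rem-deg  : Deg< rem d

  -- Recursion on the dividend: if g = q f + r, then a + x g = (x q) f + (a + x r). The new
  -- remainder has degree at most d, and its coefficient c at d is removed by one multiple of f.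
  divide : ∀ {d f} → Monic d f → ∀ g → Division f d g
  divide M []      = division [] [] ≋-refl (Deg<-[] _)
  divide {d} {f} M@(monic D t) (a ∷ g) with divide M g
  ... | division q r e dr = division (c ∷ q) (add (a ∷ r) (neg (map (c *_) f))) eq
          (Deg<-pred {r′} (Deg<-add {a ∷ r} {neg (map (c *_) f)} (λ { (suc i) (s≤s l) → dr i l })
              (Deg<-neg {map (c *_) f} (Deg<-scale {f} c D)))
            (begin
              coeff r′ d                          ≈⟨ coeff-add (a ∷ r) (neg (map (c *_) f)) d ⟩
              c + coeff (neg (map (c *_) f)) d    ≈⟨ +-congˡ
                  (trans (coeff-neg (map (c *_) f) d) (-‿cong (coeff-scale c f d))) ⟩
              c - c * coeff f d                   ≈⟨ +-congˡ (-‿cong (*-congˡ t)) ⟩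
              c - c * 1#                          ≈⟨ solve 1 (λ c → c :- c :* con (+ 1) := con (+ 0)) refl c ⟩
              0#                                  ∎))
    where
    c = coeff (a ∷ r) d
    r′ = add (a ∷ r) (neg (map (c *_) f))
    eq : a ∷ g ≋ add (mul (c ∷ q) f) r′
    eq = ext λ i → begin
      coeff (a ∷ g) i                                                   ≈⟨ at (∷-cong refl e) i ⟩
      coeff (a ∷ add (mul q f) r) i                                     ≈⟨ at (∷-cong (sym (+-identityˡ a)) ≋-refl) i ⟩
      coeff (add (0# ∷ mul q f) (a ∷ r)) i                              ≈⟨ coeff-add (0# ∷ mul q f) (a ∷ r) i ⟩
      coeff (0# ∷ mul q f) i + coeff (a ∷ r) i
        ≈⟨ solve 3 (λ u v w → u :+ v := (w :+ u) :+ (v :- w)) refl _ _ (c * coeff f i) ⟩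
      (c * coeff f i + coeff (0# ∷ mul q f) i) + (coeff (a ∷ r) i - c * coeff f i)
        ≈⟨ +-cong (coeff-mul c q f i) (trans (coeff-add (a ∷ r) (neg (map (c *_) f)) i)
             (+-congˡ (trans (coeff-neg (map (c *_) f) i) (-‿cong (coeff-scale c f i))))) ⟨
      coeff (mul (c ∷ q) f) i + coeff r′ i                              ≈⟨ coeff-add (mul (c ∷ q) f) r′ i ⟨
      coeff (add (mul (c ∷ q) f) r′) i                                  ∎

  -- As f is monic, the top coefficient of q reappears in q f. A bound on q that is too large can
  -- thus be lowered step by step, starting from the length of the list, over any coefficient ring.
  Monic-multiple-deg : ∀ {d f} → Monic d f → ∀ {q r e} → mul q f ≋ r → Deg< r (e ℕ.+ d) → Deg< q e
  Monic-multiple-deg {d} {f} (monic D t) {q} {r} {e} eq dr = go (length q)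
      (Deg<-mono {q} (ℕₚ.m≤m+n (length q) e) (Deg<-length q))
    where
    go : ∀ k → Deg< q (k ℕ.+ e) → Deg< q e
    go zero    dq = dq
    go (suc k) dq = go k (Deg<-pred {q} dq (begin
      coeff q (k ℕ.+ e)                    ≈⟨ *-identityʳ _ ⟨
      coeff q (k ℕ.+ e) * 1#               ≈⟨ *-congˡ t ⟨
      coeff q (k ℕ.+ e) * coeff f d        ≈⟨ coeff-mul-top q f (k ℕ.+ e) d dq D ⟨
      coeff (mul q f) (k ℕ.+ e ℕ.+ d)      ≈⟨ at eq _ ⟩
      coeff r (k ℕ.+ e ℕ.+ d)              ≈⟨ dr _ (ℕₚ.+-monoˡ-≤ d (ℕₚ.m≤n+m e k)) ⟩
      0#                                   ∎))

  Monic-multiple-small : ∀ {d f} → Monic d f → ∀ {q r} → mul q f ≋ r → Deg< r d → q ≋ []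
  Monic-multiple-small M {q} {r} eq dr = Deg<-0 {q} (Monic-multiple-deg M {q} {r} {0} eq dr)

  Monic-cancelʳ : ∀ {d f} → Monic d f → ∀ {p q} → mul p f ≋ mul q f → p ≋ q
  Monic-cancelʳ {d} {f} M {p} {q} e = P.x-y≈0⇒x≈y (Monic-multiple-small M {add p (neg q)} {[]}
    (P.trans (P.solve 3 (λ p q f → (p P.:- q) P.:* f P.:= p P.:* f P.:- q P.:* f) P.refl p q f) (P.x≈y⇒x-y≈0 e))
    (Deg<-[] d))

  module _ (1≉0 : ¬ 1# ≈ 0#) where

    Monic-unique : ∀ {d e f} → Monic d f → Monic e f → d ≡ e
    Monic-unique {d} {e} (monic D t) (monic E u) with ℕₚ.<-cmp d e
    ... | tri< d<e _ _ = contradiction (trans (sym u) (D e d<e)) 1≉0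
    ... | tri≈ _ d≡e _ = d≡e
    ... | tri> _ _ e<d = contradiction (trans (sym t) (E d e<d)) 1≉0

    Monic-quotient : ∀ {d e f g q} → Monic d f → Monic e g → g ≋ mul q f → ∃[ c ] e ≡ c ℕ.+ d × Monic c q
    Monic-quotient {d} {e} {f} {g} {q} M (monic E u) eq with ℕₚ.<-≤-connex e d
    ... | inj₁ e<d = contradiction (trans (sym u) (trans (at eq e) (at (mul-cong {q} {[]} {f} {f}
            (Monic-multiple-small M {q} {g} (≋-sym eq) (Deg<-mono {g} e<d E)) ≋-refl) e))) 1≉0
    ... | inj₂ d≤e = e ℕ.∸ d , ≡.sym (ℕₚ.m∸n+n≡m d≤e) , monic dq (begin
            coeff q c                         ≈⟨ *-identityʳ _ ⟨
            coeff q c * 1#                    ≈⟨ *-congˡ (Monic.top M) ⟨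
            coeff q c * coeff f d             ≈⟨ coeff-mul-top q f c d dq (Monic.deg M) ⟨
            coeff (mul q f) (c ℕ.+ d)         ≈⟨ at eq _ ⟨
            coeff g (c ℕ.+ d)                 ≡⟨ ≡.cong (coeff g) (ℕₚ.m∸n+n≡m d≤e) ⟩
            coeff g e                         ≈⟨ u ⟩
            1#                                ∎)
      where
      c = e ℕ.∸ d
      dq : Deg< q (suc c)
      dq = Monic-multiple-deg M {q} {g} (≋-sym eq) (≡.subst (Deg< g) (≡.cong suc (≡.sym (ℕₚ.m∸n+n≡m d≤e))) E)

  -- Pads with zeros as well as truncating, so that the length is exactly n. This yields lists that
  -- can be compared literally, and lists of lower coefficients of a monic polynomial.
  take : ℕ → Poly → Poly
  take zero    p       = []
  take (suc n) []      = 0# ∷ take n []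
  take (suc n) (a ∷ p) = a ∷ take n p

  length-take : ∀ n p → length (take n p) ≡ n
  length-take zero    p       = ≡.refl
  length-take (suc n) []      = ≡.cong suc (length-take n [])
  length-take (suc n) (a ∷ p) = ≡.cong suc (length-take n p)

  take-≋ : ∀ n p → Deg< p n → take n p ≋ p
  take-≋ zero    p       d = ≋-sym (Deg<-0 {p} d)
  take-≋ (suc n) []      d = ext λ { zero → refl ; (suc i) → at (take-≋ n [] (Deg<-[] n)) i }
  take-≋ (suc n) (a ∷ p) d = ∷-cong refl (take-≋ n p (Deg<-tail d))

-- Roots of monic polynomials

module Evaluation (L : CR) where
  open RingTheory L
  open import Relation.Binary.Reasoning.Setoid setoid

  -- A list of length n stands for the monic polynomial of degree n with
  -- these lower coefficients.
  evalMonic : List Carrier → Carrier → Carrier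
  evalMonic []       r = 1#
  evalMonic (c ∷ cs) r = c + r * evalMonic cs r

  syntheticQuotient : Carrier → List Carrier → List Carrier
  syntheticQuotient r []           = []
  syntheticQuotient r (c ∷ [])     = []
  syntheticQuotient r (c ∷ d ∷ cs) = evalMonic (d ∷ cs) r ∷ syntheticQuotient r (d ∷ cs)

  length-syntheticQuotient : ∀ r c cs → length (syntheticQuotient r (c ∷ cs)) ≡ length cs
  length-syntheticQuotient r c []       = ≡.refl
  length-syntheticQuotient r c (d ∷ cs) = ≡.cong suc (length-syntheticQuotient r d cs)

  synthetic-division : ∀ r c cs s →
    evalMonic (c ∷ cs) s - evalMonic (c ∷ cs) r ≈ (s - r) * evalMonic (syntheticQuotient r (c ∷ cs)) s
  synthetic-division r c []       s = solve 3 (λ r c s →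
    (c :+ s :* con (+ 1)) :- (c :+ r :* con (+ 1)) := (s :- r) :* con (+ 1)) refl r c s
  synthetic-division r c (d ∷ cs) s = begin
    (c + s * m s) - (c + r * m r)
      ≈⟨ solve 5 (λ r c s u v → (c :+ s :* u) :- (c :+ r :* v) := s :* (u :- v) :+ (s :- r) :* v) refl r c s (m s) (m r) ⟩
    s * (m s - m r) + (s - r) * m r
      ≈⟨ +-congʳ (*-congˡ (synthetic-division r d cs s)) ⟩
    s * ((s - r) * w) + (s - r) * m r
      ≈⟨ solve 4 (λ s t w v → s :* (t :* w) :+ t :* v := t :* (v :+ s :* w)) refl s (s - r) w (m r) ⟩
    (s - r) * (m r + s * w) ∎
    where
    m = evalMonic (d ∷ cs)
    w = evalMonic (syntheticQuotient r (d ∷ cs)) s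

  evalMonic-replicate-0 : ∀ n r → evalMonic (replicate n 0#) r ≈ r ^ n
  evalMonic-replicate-0 zero    r = refl
  evalMonic-replicate-0 (suc n) r = trans (+-identityˡ _) (*-congˡ (evalMonic-replicate-0 n r))

  module _ (cancel : ∀ {a b} → ¬ a ≈ 0# → a * b ≈ 0# → b ≈ 0#) (1≉0 : ¬ 1# ≈ 0#) where

    -- Dividing out the first root leaves a monic polynomial of degree one less, and cancellation of
    -- ρ i - ρ 0 shows that it vanishes at all the other roots.
    root-bound : ∀ {n k} cs → length cs ≡ n → (ρ : Fin k → Carrier) → (∀ i → evalMonic cs (ρ i) ≈ 0#) →
                 (∀ i j → ρ i ≈ ρ j → i ≡ j) → k ≤ n
    root-bound {n} {zero}  cs       len    ρ root inj = z≤n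
    root-bound {n} {suc k} []       len    ρ root inj = contradiction (root zero) 1≉0
    root-bound {suc n} {suc k} (c ∷ cs) len ρ root inj =
      s≤s (root-bound (syntheticQuotient (ρ zero) (c ∷ cs))
        (≡.trans (length-syntheticQuotient (ρ zero) c cs) (ℕₚ.suc-injective len)) (ρ ∘ suc)
        (λ i → cancel (λ e → Finₚ.0≢1+n (≡.sym (inj (suc i) zero (x-y≈0⇒x≈y e))))
          (trans (sym (synthetic-division (ρ zero) c cs (ρ (suc i)))) (x≈y⇒x-y≈0 (trans (root (suc i)) (sym (root zero))))))
        (λ i j e → Finₚ.suc-injective (inj (suc i) (suc j) e)))

-- Irreducible polynomials over a prime field

record PrimeField (p : ℕ) : Set₁ where
  field
    R : CR
  open RingTheory R
  field
    prime       : Prime p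
    _≟_         : ∀ a b → Dec (a ≈ b)
    1≉0         : ¬ 1# ≈ 0#
    inverse     : ∀ a → ¬ a ≈ 0# → ∃[ b ] b * a ≈ 1#
    p≈0         : ι p ≈ 0#
    -- Identifying the field with `Fin p` makes the polynomials of bounded degree enumerable, both
    -- for searching divisors and for counting residues.
    index       : Carrier → Fin p
    ι-index     : ∀ a → ι (toℕ (index a)) ≈ a
    ι-injective : ∀ (i j : Fin p) → ι (toℕ i) ≈ ι (toℕ j) → i ≡ j

-- Formal derivatives

module Derivative (R : CR) where
  open RingTheory R
  open Polynomial R
  private module P = RingTheory polyRing
  open import Relation.Binary.Reasoning.Setoid P.setoid

  ∷≋ : ∀ a p → (a ∷ p) P.≈ const a P.+ X P.* p
  ∷≋ a p = P.sym (P.trans (P.+-congˡ {const a} (X*≋∷ p)) (∷-cong (+-identityʳ a) P.refl))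

  -- The Leibniz rule for a + X p taken as the definition, so no coefficient has to be multiplied by
  -- its index.
  D : Poly → Poly
  D []      = []
  D (a ∷ p) = p P.+ (0# ∷ D p)

  D-∷ : ∀ a p → D (a ∷ p) P.≈ p P.+ X P.* D p
  D-∷ a p = P.+-congˡ {p} (P.sym (X*≋∷ (D p)))

  D-[] : ∀ {p} → p P.≈ [] → D p P.≈ []
  D-[] {[]}    e = P.refl
  D-[] {a ∷ p} e = begin
    D (a ∷ p)          ≈⟨ D-∷ a p ⟩
    p P.+ X P.* D p    ≈⟨ P.+-cong p≋ (P.*-congˡ {X} (D-[] p≋)) ⟩
    [] P.+ X P.* []    ≈⟨ P.zeroʳ X ⟩
    []                 ∎
    where
    p≋ : p P.≈ []
    p≋ = ext λ i → at e (suc i)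

  D-cong : ∀ {p q} → p P.≈ q → D p P.≈ D q
  D-cong {[]}    {q}     e = P.sym (D-[] (P.sym e))
  D-cong {a ∷ p} {[]}    e = D-[] e
  D-cong {a ∷ p} {b ∷ q} e = P.trans (D-∷ a p) (P.trans (P.+-cong p≋q (P.*-congˡ {X} (D-cong p≋q))) (P.sym (D-∷ b q)))
    where
    p≋q : p P.≈ q
    p≋q = ext λ i → at e (suc i)

  D-+ : ∀ p q → D (p P.+ q) P.≈ D p P.+ D q
  D-+ []      q       = P.refl
  D-+ (a ∷ p) []      = P.sym (P.+-identityʳ (D (a ∷ p)))
  D-+ (a ∷ p) (b ∷ q) = begin
    D ((a + b) ∷ (p P.+ q))                       ≈⟨ D-∷ (a + b) (p P.+ q) ⟩
    (p P.+ q) P.+ X P.* D (p P.+ q)               ≈⟨ P.+-congˡ {p P.+ q} (P.*-congˡ {X} (D-+ p q)) ⟩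
    (p P.+ q) P.+ X P.* (D p P.+ D q)
      ≈⟨ P.solve 5 (λ p q x u v → (p P.:+ q) P.:+ x P.:* (u P.:+ v) P.:= (p P.:+ x P.:* u) P.:+ (q P.:+ x P.:* v))
           P.refl p q X (D p) (D q) ⟩
    (p P.+ X P.* D p) P.+ (q P.+ X P.* D q)       ≈⟨ P.+-cong (D-∷ a p) (D-∷ b q) ⟨
    D (a ∷ p) P.+ D (b ∷ q)                       ∎

  D-scale : ∀ a q → D (map (a *_) q) P.≈ const a P.* D q
  D-scale a []      = P.sym (P.zeroʳ (const a))
  D-scale a (b ∷ q) = begin
    D ((a * b) ∷ map (a *_) q)                           ≈⟨ D-∷ (a * b) (map (a *_) q) ⟩
    map (a *_) q P.+ X P.* D (map (a *_) q)              ≈⟨ P.+-cong (P.sym (const-* a q)) (P.*-congˡ {X} (D-scale a q)) ⟩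
    const a P.* q P.+ X P.* (const a P.* D q)
      ≈⟨ P.solve 4 (λ a q x u → a P.:* q P.:+ x P.:* (a P.:* u) P.:= a P.:* (q P.:+ x P.:* u)) P.refl (const a) q X (D q) ⟩
    const a P.* (q P.+ X P.* D q)                        ≈⟨ P.*-congˡ {const a} (D-∷ b q) ⟨
    const a P.* D (b ∷ q)                                ∎

  D-* : ∀ p q → D (p P.* q) P.≈ D p P.* q P.+ p P.* D q
  D-* []      q = P.refl
  D-* (a ∷ p) q = begin
    D (map (a *_) q P.+ (0# ∷ p P.* q))             ≈⟨ D-+ (map (a *_) q) (0# ∷ p P.* q) ⟩
    D (map (a *_) q) P.+ D (0# ∷ p P.* q)           ≈⟨ P.+-cong (D-scale a q) (D-∷ 0# (p P.* q)) ⟩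
    const a P.* D q P.+ (p P.* q P.+ X P.* D (p P.* q))
      ≈⟨ P.+-congˡ {const a P.* D q} (P.+-congˡ {p P.* q} (P.*-congˡ {X} (D-* p q))) ⟩
    const a P.* D q P.+ (p P.* q P.+ X P.* (D p P.* q P.+ p P.* D q))
      ≈⟨ P.solve 6 (λ a p q x u v → a P.:* v P.:+ (p P.:* q P.:+ x P.:* (u P.:* q P.:+ p P.:* v))
           P.:= (p P.:+ x P.:* u) P.:* q P.:+ (a P.:+ x P.:* p) P.:* v) P.refl (const a) p q X (D p) (D q) ⟩
    (p P.+ X P.* D p) P.* q P.+ (const a P.+ X P.* p) P.* D q
      ≈⟨ P.+-cong (P.*-congʳ {q} (D-∷ a p)) (P.*-congʳ {D q} (∷≋ a p)) ⟨
    D (a ∷ p) P.* q P.+ (a ∷ p) P.* D q             ∎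

  D-^ : ∀ p n → D (p P.^ suc n) P.≈ P.ι (suc n) P.* (p P.^ n P.* D p)
  D-^ p zero    = P.trans (D-cong (P.*-identityʳ p))
      (P.solve 1 (λ d → d P.:= (P.con (+ 1) P.:+ P.con (+ 0)) P.:* (P.con (+ 1) P.:* d)) P.refl (D p))
  D-^ p (suc n) = begin
    D (p P.* p P.^ suc n)                              ≈⟨ D-* p (p P.^ suc n) ⟩
    D p P.* p P.^ suc n P.+ p P.* D (p P.^ suc n)      ≈⟨ P.+-congˡ {D p P.* p P.^ suc n} (P.*-congˡ {p} (D-^ p n)) ⟩
    D p P.* (p P.* p P.^ n) P.+ p P.* (P.ι (suc n) P.* (p P.^ n P.* D p))
      ≈⟨ P.solve 4 (λ p q d i → d P.:* (p P.:* q) P.:+ p P.:* (i P.:* (q P.:* d)) P.:= (P.con (+ 1) P.:+ i) P.:*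
          ((p P.:* q) P.:* d))
           P.refl p (p P.^ n) (D p) (P.ι (suc n)) ⟩
    P.ι (suc (suc n)) P.* (p P.^ suc n P.* D p)        ∎

  D-X : D X P.≈ P.1#
  D-X = ext λ { zero → +-identityʳ _ ; (suc zero) → refl ; (suc (suc i)) → refl }

-- Factorisation over a prime field and residue fields

module FieldPolynomial {p : ℕ} (K : PrimeField p) where
  open PrimeField K public using (1≉0; _≟_; inverse; prime; p≈0; index; ι-index; ι-injective)
  open RingTheory (PrimeField.R K) hiding (_∣_)
  open Polynomial (PrimeField.R K) public
  open Derivative (PrimeField.R K) public
  module P = RingTheory polyRing
  open P using (_∣_)

  P-p≈0 : P.ι p ≋ []
  P-p≈0 = ≋-trans (const-ι p) (ext λ { zero → p≈0 ; (suc i) → refl })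

  module FrobP = Frobenius polyRing prime P-p≈0
  module FrobK = Frobenius (PrimeField.R K) prime p≈0

  1<p : 1 < p
  1<p = ℕ.nonTrivial⇒n>1 p {{prime⇒nonTrivial prime}}

  zero? : ∀ g → Dec (g ≋ [])
  zero? []      = yes ≋-refl
  zero? (a ∷ g) = map′ (λ (e , f) → ext λ { zero → e ; (suc i) → at f i })
    (λ e → at e 0 , ext λ i → at e (suc i)) (a ≟ 0# ×-dec zero? g)

  record Normalised (g : Poly) : Set where
    constructor normalised
    field
      {degree}    : ℕ
      lead        : Carrier
      lead≉0      : ¬ lead ≈ 0#
      {monicPart} : Poly
      isMonic     : Monic degree monicPart
      factor      : g ≋ const lead P.* monicPart

  normalise : ∀ g n → Deg< g n → ¬ g ≋ [] → ∃[ N ] Normalised.degree {g} N < n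
  normalise g zero    d g≉0 = contradiction (Deg<-0 {g} d) g≉0
  normalise g (suc n) d g≉0 with coeff g n ≟ 0#
  ... | yes e with N , l ← normalise g n (Deg<-pred {g} d e) g≉0 = N , ℕₚ.m<n⇒m<1+n l
  ... | no  c≉0 with b , bc≈1 ← inverse (coeff g n) c≉0 =
        normalised (coeff g n) c≉0 (monic (Deg<-scale {g} b d) (trans (coeff-scale b g n) bc≈1)) eq , ℕₚ.≤-refl
    where
    eq : g ≋ const (coeff g n) P.* map (b *_) g
    eq = ≋-sym (≋-trans (const-* (coeff g n) (map (b *_) g)) (ext λ i →
      trans (coeff-scale _ (map (b *_) g) i) (trans (*-congˡ (coeff-scale b g i))
        (trans (solve 3 (λ c b x → c :* (b :* x) := (b :* c) :* x) refl _ b _)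
          (trans (*-congʳ bc≈1) (*-identityˡ _))))))

  divides? : ∀ {d f} → Monic d f → ∀ g → Dec (f ∣ g)
  divides? {d} {f} M g with divide M g
  ... | division q r e dr with zero? r
  ...   | yes r≋0 = yes (q , ≋-trans e (≋-trans (P.+-congˡ {q P.* f} r≋0) (P.+-identityʳ (q P.* f))))
  ...   | no  r≉0 = no λ (h , e′) → r≉0 (let
            eq : (h P.- q) P.* f ≋ r
            eq = P.trans (P.solve 3 (λ h q f → (h P.:- q) P.:* f P.:= h P.:* f P.:- q P.:* f) P.refl h q f)
              (P.trans (P.+-congʳ {P.- (q P.* f)} (P.trans (P.sym e′) e))
                  (P.solve 2 (λ u r → (u P.:+ r) P.:- u P.:= r) P.refl (q P.* f) r))
          in P.trans (P.sym eq) (P.*-congʳ {f} {h P.- q} {[]} (Monic-multiple-small M {h P.- q} {r} eq dr)))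

  tl : Poly → Poly
  tl []      = []
  tl (a ∷ g) = g

  tl-≋ : ∀ g → g ≋ coeff g 0 ∷ tl g
  tl-≋ []      = ext λ { zero → refl ; (suc i) → refl }
  tl-≋ (a ∷ g) = ≋-refl

  coeff-tl : ∀ g i → coeff (tl g) i ≈ coeff g (suc i)
  coeff-tl []      i = refl
  coeff-tl (a ∷ g) i = refl

  Monic-tl : ∀ {d g} → Monic (suc d) g → Monic d (tl g)
  Monic-tl {d} {g} (monic D t) = monic (λ i l → trans (coeff-tl g i) (D (suc i) (s≤s l))) (trans (coeff-tl g d) t)

  -- The base-p digits of the index become d coefficients placed below `e`: with `e` = `[]` this
  -- lists the polynomials of degree less than d, with `e` = `P.1#` the monic ones of degree d.
  digits : ∀ d → Fin (p ℕ.^ d) → Poly → Poly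
  digits zero    i e = e
  digits (suc d) i e = ι (toℕ (proj₁ (remQuot {p} (p ℕ.^ d) i))) ∷ digits d (proj₂ (remQuot {p} (p ℕ.^ d) i)) e

  Deg<-digits : ∀ d i → Deg< (digits d i []) d
  Deg<-digits zero    i j       _       = refl
  Deg<-digits (suc d) i (suc j) (s≤s l) = Deg<-digits d _ j l

  Monic-digits : ∀ d i → Monic d (digits d i P.1#)
  Monic-digits zero    i = Monic-1
  Monic-digits (suc d) i = monic (λ { (suc j) (s≤s l) → Monic.deg (Monic-digits d _) j l }) (Monic.top (Monic-digits d _))

  digits-injective : ∀ d i j → digits d i [] ≋ digits d j [] → i ≡ j
  digits-injective zero    zero zero e = ≡.refl
  digits-injective (suc d) i    j    e = ≡.trans (≡.sym (Finₚ.combine-remQuot {p} (p ℕ.^ d) i)) (≡.trans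
    (≡.cong₂ combine (ι-injective _ _ (at e 0)) (digits-injective d _ _ (ext λ k → at e (suc k))))
    (Finₚ.combine-remQuot {p} (p ℕ.^ d) j))

  code : ∀ d → Poly → Fin (p ℕ.^ d)
  code zero    g = zero
  code (suc d) g = combine (index (coeff g 0)) (code d (tl g))

  digits-code : ∀ d g → Monic d g → digits d (code d g) P.1# ≋ g
  digits-code zero    g M = ≋-sym (Monic-0 M)
  digits-code (suc d) g M = ≋-trans (∷-cong
      (trans (reflexive (≡.cong (λ c → ι (toℕ (proj₁ c))) rq)) (ι-index _))
      (≋-trans (P.reflexive (≡.cong (λ c → digits d (proj₂ c) P.1#) rq)) (digits-code d (tl g) (Monic-tl M))))
    (≋-sym (tl-≋ g))
    where
    rq : remQuot {p} (p ℕ.^ d) (code (suc d) g) ≡ (index (coeff g 0) , code d (tl g))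
    rq = Finₚ.remQuot-combine {p} {p ℕ.^ d} (index (coeff g 0)) (code d (tl g))

  record Irreducible (d : ℕ) (f : Poly) : Set where
    constructor irreducible
    field
      isMonic    : Monic d f
      positive   : 0 < d
      no-divisor : ∀ {e g} → Monic e g → 0 < e → e < d → ¬ g ∣ f

  -- Decided by exhaustion: below degree d there are finitely many monic candidates, indexed by
  -- `digits`.
  find-divisor : ∀ {d f} → 0 < d → Monic d f →
    (∃[ e ] ∃[ g ] 0 < e × e < d × Monic e g × g ∣ f) ⊎ Irreducible d f
  find-divisor {d} {f} 0<d M with
    Finₚ.any? {n = d} (λ e → (0 ℕ.<? toℕ e) ×-dec Finₚ.any? {n = p ℕ.^ toℕ e}
                               (λ i → divides? (Monic-digits (toℕ e) i) f))
  ... | yes (e , 0<e , i , g∣f) = inj₁ (toℕ e , digits (toℕ e) i P.1# , 0<e , Finₚ.toℕ<n e , Monic-digits (toℕ e) i , g∣f)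
  ... | no none = inj₂ (irreducible M 0<d λ {e} {g} N 0<e e<d g∣f →
          none (Fin.fromℕ< e<d , ≡.subst (λ e → 0 < e × ∃[ i ] digits e i P.1# ∣ f) (≡.sym (Finₚ.toℕ-fromℕ< e<d))
            (0<e , code e g , P.∣-resp (≋-sym (digits-code e g N)) ≋-refl g∣f)))

  product : List Poly → Poly
  product = foldr P._*_ P.1#

  product-++ : ∀ fs gs → product (fs ++ gs) ≋ product fs P.* product gs
  product-++ []       gs = P.sym (P.*-identityˡ (product gs))
  product-++ (f ∷ fs) gs = P.trans (P.*-congˡ {f} (product-++ fs gs)) (P.sym (P.*-assoc f (product fs) (product gs)))

  factorise : ∀ {d f} → Monic d f → ∃[ fs ] All (λ g → ∃[ e ] Irreducible e g) fs × f ≋ product fs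
  factorise {d} M = go M (<-wellFounded d)
    where
    go : ∀ {d f} → Monic d f → Acc _<_ d → ∃[ fs ] All (λ g → ∃[ e ] Irreducible e g) fs × f ≋ product fs
    go {zero}      M _ = [] , [] , Monic-0 M
    go {suc d} {f} M (acc rec) with find-divisor (s≤s z≤n) M
    ... | inj₂ irr = f ∷ [] , (suc d , irr) ∷ [] , P.sym (P.*-identityʳ f)
    ... | inj₁ (e , g , 0<e , e<d , N , h , eq) with Monic-quotient 1≉0 {g = f} {q = h} N M eq
    ...   | c , d≡ , H with go N (rec e<d) | go H (rec (≡.subst (c <_) (≡.sym d≡) (ℕₚ.m<m+n c 0<e)))
    ...     | gs , allg , eg | hs , allh , eh = hs ++ gs , Allₚ.++⁺ allh allg ,
              P.trans eq (P.trans (P.*-cong eh eg) (P.sym (product-++ hs gs)))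

  module Residue {d : ℕ} {f : Poly} (irr : Irreducible d f) where
    open Irreducible irr

    L : CR
    L = Quot polyRing f
    module L = RingTheory L

    private
      ↑ : ∀ {g h} → g ≋ h → g L.≈ h
      ↑ = up polyRing

    _≈0? : ∀ g → Dec (g L.≈ [])
    g ≈0? = map′ (∣⇒≈0 polyRing) (≈0⇒∣ polyRing) (divides? isMonic g)

    small≈0 : ∀ {g} → Deg< g d → g L.≈ [] → g ≋ []
    small≈0 {g} dg e with q , eq ← ≈0⇒∣ polyRing e =
      P.trans eq (P.*-congʳ {f} {q} {[]} (Monic-multiple-small isMonic {q} {g} (P.sym eq) dg))

    1≉0ᴸ : ¬ L.1# L.≈ L.0#
    1≉0ᴸ e = 1≉0 (at (small≈0 {P.1#} (Deg<-mono {P.1#} positive (Deg<-length P.1#)) e) 0)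

    private
      const-inverse : ∀ {c b} → b * c ≈ 1# → const b P.* const c ≋ P.1#
      const-inverse {c} {b} e = P.trans (P.sym (const-*-const b c)) (const-cong e)

      Invertible : Poly → Set
      Invertible g = ∃[ u ] u L.* g L.≈ L.1#

      inv-const : ∀ {g c g′} → ¬ c ≈ 0# → g ≋ const c P.* g′ → Monic 0 g′ → Invertible g
      inv-const {g} {c} {g′} c≉0 eq M = const (proj₁ (inverse c c≉0)) , ↑ (P.trans (P.*-congˡ {const (proj₁ (inverse c c≉0))}
        (P.trans eq (P.trans (P.*-congˡ {const c} (Monic-0 M)) (P.*-identityʳ (const c)))))
        (const-inverse (proj₂ (inverse c c≉0))))

      -- Dividing f by the monic multiple g′ of g leaves a remainder of smaller
      -- degree, which is not 0 because g′ does not divide f.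
      rem≉0 : ∀ {m g′ q r} → Monic m g′ → ¬ m ≡ 0 → m < d → f ≋ q P.* g′ P.+ r → ¬ r ≋ []
      rem≉0 {m} {g′} {q} {r} M m≢0 m<d e r≋0 = no-divisor M (ℕₚ.n≢0⇒n>0 m≢0) m<d
        (q , P.trans e (P.trans (P.+-congˡ {q P.* g′} r≋0) (P.+-identityʳ (q P.* g′))))

      inv-step : ∀ {g c g′ q r} → ¬ c ≈ 0# → g ≋ const c P.* g′ → f ≋ q P.* g′ P.+ r → Invertible r → Invertible g
      inv-step {g} {c} {g′} {q} {r} c≉0 eq e (u , ur≈1) =
        (P.- (u P.* q)) P.* const (proj₁ (inverse c c≉0)) ,
        euclid-inverse polyRing {f} {g} {g′} {const (proj₁ (inverse c c≉0))} {const c} {q} {r} {u} eq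
          (const-inverse (proj₂ (inverse c c≉0))) e ur≈1

      -- Each round divides f itself by the current divisor, so the remainder is related to it
      -- modulo f alone; degrees drop until a nonzero constant is reached.
      inv : ∀ n g → Acc _<_ n → n ≤ d → Deg< g n → ¬ g ≋ [] → Invertible g
      inv n g (acc rec) n≤d dg g≉0 = go (proj₁ N) (proj₂ N) (Normalised.degree (proj₁ N) ℕ.≟ 0)
        where
        N = normalise g n dg g≉0
        go : (N : Normalised g) → Normalised.degree N < n → Dec (Normalised.degree N ≡ 0) → Invertible g
        go (normalised c c≉0 M eq) m<n (yes ≡.refl) = inv-const c≉0 eq M
        go (normalised {m} c c≉0 {g′} M eq) m<n (no m≢0) = inv-step {q = Division.quot Dv} c≉0 eq (Division.equality Dv)
          (inv m (Division.rem Dv) (rec m<n) (ℕₚ.≤-trans (ℕₚ.<⇒≤ m<n) n≤d) (Division.rem-deg Dv)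
            (rem≉0 {q = Division.quot Dv} M m≢0 (ℕₚ.<-≤-trans m<n n≤d) (Division.equality Dv)))
          where Dv = divide M f

    inverseᴸ : ∀ g → ¬ g L.≈ [] → ∃[ u ] u L.* g L.≈ L.1#
    inverseᴸ g g≉0 = proj₁ I , L.trans {proj₁ I P.* g} {proj₁ I P.* r} {P.1#} (L.*-congˡ {proj₁ I} {g} {r} g≈r) (proj₂ I)
      where
      Dv = divide isMonic g
      r = Division.rem Dv
      g≈r : g L.≈ r
      g≈r = mk≈ (Division.quot Dv) (P.trans (Division.equality Dv) (P.+-comm (Division.quot Dv P.* f) r))
      I : Invertible r
      I = inv d r (<-wellFounded d) ℕₚ.≤-refl (Division.rem-deg Dv) (λ r≋0 → g≉0 (L.trans g≈r (↑ r≋0)))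

    cancelᴸ : ∀ {g h} → ¬ g L.≈ [] → g L.* h L.≈ [] → h L.≈ []
    cancelᴸ {g} {h} g≉0 gh≈0 = begin
      h                ≈⟨ L.*-identityˡ h ⟨
      P.1# P.* h       ≈⟨ L.*-congʳ {h} (proj₂ I) ⟨
      u P.* g P.* h    ≈⟨ L.*-assoc u g h ⟩
      u P.* (g P.* h)  ≈⟨ L.*-congˡ {u} gh≈0 ⟩
      u P.* []         ≈⟨ L.zeroʳ u ⟩
      []               ∎
      where
      open import Relation.Binary.Reasoning.Setoid L.setoid
      I = inverseᴸ g g≉0
      u = proj₁ I

    prime-∣ : ∀ {g h} → f ∣ (g P.* h) → f ∣ g ⊎ f ∣ h
    prime-∣ {g} {h} d with g ≈0?
    ... | yes e = inj₁ (≈0⇒∣ polyRing e)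
    ... | no  n = inj₂ (≈0⇒∣ polyRing (cancelᴸ n (∣⇒≈0 polyRing d)))

    prime-∣-^ : ∀ {g} n → f ∣ g P.^ n → f ∣ g
    prime-∣-^ zero    d = contradiction (∣⇒≈0 polyRing d) 1≉0ᴸ
    prime-∣-^ (suc n) d with prime-∣ d
    ... | inj₁ e = e
    ... | inj₂ e = prime-∣-^ n e

    pᴸ≈0 : L.ι p L.≈ []
    pᴸ≈0 = ↑ P-p≈0

    module FrobL = Frobenius L prime pᴸ≈0

    const-frobenius : ∀ v c → const c P.^ (p ℕ.^ v) ≋ const c
    const-frobenius v c = P.trans (P.sym (const-^ c (p ℕ.^ v))) (const-cong (go v))
      where
      fermat′ : c ^ p ≈ c
      fermat′ = trans (^-congˡ p (sym (ι-index c))) (trans (FrobK.fermat (toℕ (index c))) (ι-index c))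
      go : ∀ v → c ^ (p ℕ.^ v) ≈ c
      go zero    = *-identityʳ c
      go (suc v) = trans (sym (^-assoc c p (p ℕ.^ v))) (trans (^-congˡ (p ℕ.^ v) fermat′) (go v))

    -- Says that f divides X^(p^v) - X, equivalently that the v-th power of Frobenius is the
    -- identity on the residue field.
    Fixed : ℕ → Set
    Fixed v = X L.^ (p ℕ.^ v) L.≈ X

    -- The v-th power of Frobenius is a ring homomorphism that fixes the constants by Fermat; fixing
    -- X, it fixes every polynomial in X.
    fixed-all : ∀ v → Fixed v → ∀ g → g L.^ (p ℕ.^ v) L.≈ g
    fixed-all v fix []      = L.0^ (p ℕ.^ v) (ℕₚ.m^n>0 p {{ℕ.>-nonZero (ℕₚ.<⇒≤ 1<p)}} v)
    fixed-all v fix (a ∷ g) = L.trans (L.^-congˡ (p ℕ.^ v) (↑ (∷≋ a g))) (L.trans (FrobL.frobenius^-+ v (const a) (X P.* g))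
      (L.trans (L.+-cong (↑ (const-frobenius v a)) (L.trans (L.^-distrib-* X g (p ℕ.^ v)) (L.*-cong fix (fixed-all v fix g))))
        (↑ (P.sym (∷≋ a g)))))

    open Evaluation L

    private
      evalMonic-frobenius : ∀ v cs r →
        evalMonic (map const cs) r L.^ (p ℕ.^ v) L.≈ evalMonic (map const cs) (r L.^ (p ℕ.^ v))
      evalMonic-frobenius v []       r = L.1^ (p ℕ.^ v)
      evalMonic-frobenius v (c ∷ cs) r = L.trans (FrobL.frobenius^-+ v (const c) (r P.* evalMonic (map const cs) r))
        (L.+-cong (↑ (const-frobenius v c)) (L.trans (L.^-distrib-* r _ (p ℕ.^ v))
          (L.*-congˡ {r L.^ (p ℕ.^ v)} (evalMonic-frobenius v cs r))))

      evalMonic-X : ∀ d g → Monic d g → evalMonic (map const (take d g)) X ≋ g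
      evalMonic-X zero    g       M = P.sym (Monic-0 M)
      evalMonic-X (suc d) []      M = contradiction (sym (Monic.top M)) 1≉0
      evalMonic-X (suc d) (a ∷ g) M = P.trans (P.+-congˡ {const a}
          (P.*-congˡ {X} (evalMonic-X d g (Monic-tl M)))) (P.sym (∷≋ a g))

      conjugate-root : ∀ v → evalMonic (map const (take d f)) (X L.^ (p ℕ.^ v)) L.≈ []
      conjugate-root v = L.trans (L.sym (evalMonic-frobenius v (take d f) X))
        (L.trans (L.^-congˡ (p ℕ.^ v) (L.trans (↑ (evalMonic-X d f isMonic)) (∣⇒≈0 polyRing P.∣-refl)))
          (L.0^ (p ℕ.^ v) (ℕₚ.m^n>0 p {{ℕ.>-nonZero (ℕₚ.<⇒≤ 1<p)}} v)))

    nilpotent : ∀ g n → g L.^ n L.≈ [] → g L.≈ []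
    nilpotent g n e = ∣⇒≈0 polyRing (prime-∣-^ n (≈0⇒∣ polyRing e))

    frobenius-injective : ∀ v g h → g L.^ (p ℕ.^ v) L.≈ h L.^ (p ℕ.^ v) → g L.≈ h
    frobenius-injective v g h e = L.x-y≈0⇒x≈y (nilpotent (g P.- h) q (L.trans
      (L.trans (L.trans (↑ (P.solve 2 (λ u w → u P.:= (u P.:+ w) P.:- w) P.refl ((g P.- h) P.^ q) (h P.^ q)))
        (L.+-congʳ {P.- (h P.^ q)} (L.sym (FrobL.frobenius^-+ v (g P.- h) h))))
        (L.+-congʳ {P.- (h P.^ q)} (L.^-congˡ q (↑ (P.solve 2 (λ g h → (g P.:- h) P.:+ h P.:= g) P.refl g h)))))
      (L.x≈y⇒x-y≈0 e)))
      where q = p ℕ.^ v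

    fixed⇒deg≤ : ∀ v → 0 < v → Fixed v → d ≤ v
    fixed⇒deg≤ v 0<v fix = ℕₚ.≮⇒≥ λ v<d → ℕₚ.<⇒≱ (ℕₚ.^-monoʳ-< p 1<p v<d)
      (root-bound cancelᴸ 1≉0ᴸ cs len (λ i → digits d i []) root inj)
      where
      q = p ℕ.^ v
      1<q : 1 < q
      1<q = ℕₚ.<-≤-trans (≡.subst (1 <_) (≡.sym (ℕₚ.^-identityʳ p)) 1<p) (ℕₚ.^-monoʳ-≤ p {{ℕ.>-nonZero (ℕₚ.<⇒≤ 1<p)}} 0<v)
      -- The lower coefficients of T^q - T, its leading 1 being implicit; 1 < q leaves room for the
      -- linear term.
      cs = [] ∷ P.- P.1# ∷ replicate (q ℕ.∸ 2) []
      len : length cs ≡ q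
      len = ≡.trans (≡.cong (λ k → suc (suc k)) (length-replicate (q ℕ.∸ 2))) (ℕₚ.m+[n∸m]≡n 1<q)
      root : ∀ i → evalMonic cs (digits d i []) L.≈ []
      root i = L.trans (↑ (P.*-congˡ {g} (P.+-congˡ {P.- P.1#} (P.*-congˡ {g} P.refl))))
        (L.trans (L.*-congˡ {g} (L.+-congˡ {P.- P.1#} (L.*-congˡ {g} (evalMonic-replicate-0 (q ℕ.∸ 2) g))))
        (L.trans (↑ (P.solve 2 (λ g h → g P.:* (P.:- P.con (+ 1) P.:+ g P.:* h) P.:= g P.:* (g P.:* h) P.:- g)
            P.refl g (g P.^ (q ℕ.∸ 2))))
          (L.x≈y⇒x-y≈0 (L.trans (↑ (P.reflexive (≡.cong (g P.^_) (ℕₚ.m+[n∸m]≡n 1<q)))) (fixed-all v fix g)))))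
        where g = digits d i []
      inj : ∀ i j → digits d i [] L.≈ digits d j [] → i ≡ j
      inj i j e = digits-injective d i j (P.x-y≈0⇒x≈y (small≈0
        (Deg<-add {digits d i []} {P.- digits d j []} (Deg<-digits d i) (Deg<-neg {digits d j []} (Deg<-digits d j)))
        (L.x≈y⇒x-y≈0 e)))

    least-fixed≤deg : ∀ v → (∀ w → 0 < w → w < v → ¬ Fixed w) → v ≤ d
    least-fixed≤deg v least = root-bound cancelᴸ 1≉0ᴸ (map const (take d f))
      (≡.trans (length-map const (take d f)) (length-take d f)) (λ i → X L.^ (p ℕ.^ toℕ {v} i))
          (λ i → conjugate-root (toℕ i)) inj
      where
      -- Two equal conjugates would, by injectivity of Frobenius, give `Fixed (j ∸ i)` with an
      -- exponent below v.
      no-repeat : ∀ i j → i < j → j < v → ¬ X L.^ (p ℕ.^ i) L.≈ X L.^ (p ℕ.^ j)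
      no-repeat i j i<j j<v e = least (j ℕ.∸ i) (ℕₚ.m<n⇒0<n∸m i<j) (ℕₚ.≤-<-trans (ℕₚ.m∸n≤m j i) j<v)
        (frobenius-injective i _ _ (L.trans (L.^-assoc X (p ℕ.^ (j ℕ.∸ i)) (p ℕ.^ i)) (L.trans
          (L.reflexive (≡.cong (X P.^_) (≡.trans (≡.sym (ℕₚ.^-distribˡ-+-* p (j ℕ.∸ i) i))
            (≡.cong (p ℕ.^_) (ℕₚ.m∸n+n≡m (ℕₚ.<⇒≤ i<j)))))) (L.sym e))))
      inj : ∀ i j → X L.^ (p ℕ.^ toℕ i) L.≈ X L.^ (p ℕ.^ toℕ j) → i ≡ j
      inj i j e with ℕₚ.<-cmp (toℕ i) (toℕ j)
      ... | tri< i<j _ _ = contradiction e (no-repeat _ _ i<j (Finₚ.toℕ<n j))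
      ... | tri≈ _ i≡j _ = Finₚ.toℕ-injective i≡j
      ... | tri> _ _ j<i = contradiction (L.sym e) (no-repeat _ _ j<i (Finₚ.toℕ<n i))

    degree-is-least-fixed : ∀ v → 0 < v → Fixed v → (∀ w → 0 < w → w < v → ¬ Fixed w) → d ≡ v
    degree-is-least-fixed v 0<v fix least = ℕₚ.≤-antisym (fixed⇒deg≤ v 0<v fix) (least-fixed≤deg v least)

    -- The derivative of X^q - X is -1.
    x^q-x-squarefree : ∀ v → 0 < v → ¬ f P.* f ∣ (X P.^ (p ℕ.^ v) P.- X)
    x^q-x-squarefree (suc v) _ (h , e) = 1≉0ᴸ (∣⇒≈0 polyRing (
      P.- (D h P.* f P.+ h P.* (D f P.+ D f)) , P.trans
          (P.sym (P.trans (P.-‿cong (P.trans (P.sym (D-cong e)) D-lhs))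
          (P.solve 0 (P.:- (P.:- P.con (+ 1)) P.:= P.con (+ 1)) P.refl)))
        (P.trans (P.-‿cong (P.trans (D-* h (f P.* f)) (P.+-congˡ {D h P.* (f P.* f)} (P.*-congˡ {h} (D-* f f)))))
          (P.solve 4 (λ h f dh df → P.:- (dh P.:* (f P.:* f) P.:+ h P.:* (df P.:* f P.:+ f P.:* df))
             P.:= (P.:- (dh P.:* f P.:+ h P.:* (df P.:+ df))) P.:* f) P.refl h f (D h) (D f)))))
      where
      q = p ℕ.^ suc v
      q≡ : suc (ℕ.pred q) ≡ q
      q≡ = ℕₚ.suc-pred q {{ℕ.>-nonZero (ℕₚ.m^n>0 p {{ℕ.>-nonZero (ℕₚ.<⇒≤ 1<p)}} (suc v))}}
      q≈0 : P.ι q ≋ []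
      q≈0 = P.trans (P.ι-homo-* p (p ℕ.^ v)) (P.*-congʳ {P.ι (p ℕ.^ v)} P-p≈0)
      D-neg : ∀ g → D (P.- g) ≋ P.- D g
      D-neg g = P.trans (P.solve 2 (λ u w → u P.:= (u P.:+ w) P.:- w) P.refl (D (P.- g)) (D g))
        (P.trans (P.+-congʳ (P.trans (P.sym (D-+ (P.- g) g)) (D-[] (P.-‿inverseˡ g)))) P.refl)
      D-lhs : D (X P.^ q P.- X) ≋ P.- P.1#
      D-lhs = P.trans (D-+ (X P.^ q) (P.- X)) (P.+-cong
        (P.trans (P.reflexive (≡.cong (λ k → D (X P.^ k)) (≡.sym q≡))) (P.trans (D-^ X (ℕ.pred q))
          (P.*-congʳ {X P.^ ℕ.pred q P.* D X} (P.trans (P.reflexive (≡.cong P.ι q≡)) q≈0))))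
        (P.trans (D-neg X) (P.-‿cong D-X)))

open import Defs

-- Divisors

module DivisorSums where
  open import Algebra.Bundles using (CommutativeMonoid)
  open import Data.List using (filter; upTo)
  open import Data.List.Membership.Propositional using (_∉_)
  open import Data.List.Membership.Propositional.Properties
    using (∈-filter⁺; ∈-filter⁻; ∈-upTo⁺; ∈-upTo⁻)
  open import Data.List.Membership.Propositional.Properties.WithK using (unique∧set⇒bag)
  open import Data.List.Properties using (length-upTo; filter-accept; filter-reject)
  open import Data.List.Relation.Binary.BagAndSetEquality using (∼bag⇒↭)
  import Data.List.Relation.Binary.Permutation.Propositional as Perm
  open import Data.List.Relation.Binary.Permutation.Propositional.Properties using (↭-length)
  open import Data.Nat using (_+_; _*_; NonZero; _≟_; >-nonZero; >-nonZero⁻¹)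
  open import Data.Nat.Coprimality using (coprime?)
  open import Data.Nat.Divisibility
  open import Data.Nat.GCD using (c*gcd[m,n]≡gcd[cm,cn])
  open import Data.Nat.Properties
  open import Function using (mk⇔)
  open import Relation.Binary.PropositionalEquality hiding (setoid)
  open import Relation.Nullary using (¬?)

  unique-↭ : {A : Set} {xs ys : List A} → Unique xs → Unique ys →
             (∀ {x} → x ∈ xs → x ∈ ys) → (∀ {x} → x ∈ ys → x ∈ xs) → xs ↭ ys
  unique-↭ u v f g = ∼bag⇒↭ (unique∧set⇒bag u v (mk⇔ f g))

  module ListProduct (M : CommutativeMonoid 0ℓ 0ℓ) where
    open CommutativeMonoid M using (Carrier; _≈_; _∙_; ε; setoid; ∙-cong; ∙-congˡ; ∙-congʳ; assoc; comm; identityˡ)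
      renaming (refl to ≈-refl; sym to ≈-sym; trans to ≈-trans)
    open import Relation.Binary.Reasoning.Setoid setoid

    -- Kept over any commutative monoid: it serves both for sums of `φ` and for products of `Ψ` over
    -- divisors.
    ∏ : {A : Set} → (A → Carrier) → List A → Carrier
    ∏ f xs = foldr _∙_ ε (map f xs)

    swap-∙ : ∀ a b c → a ∙ (b ∙ c) ≈ b ∙ (a ∙ c)
    swap-∙ a b c = begin
      a ∙ (b ∙ c)  ≈⟨ assoc a b c ⟨
      (a ∙ b) ∙ c  ≈⟨ ∙-congʳ (comm a b) ⟩
      (b ∙ a) ∙ c  ≈⟨ assoc b a c ⟩
      b ∙ (a ∙ c)  ∎

    ∏-↭ : {A : Set} (f : A → Carrier) {xs ys : List A} → xs ↭ ys → ∏ f xs ≈ ∏ f ys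
    ∏-↭ f Perm.refl         = ≈-refl
    ∏-↭ f (Perm.prep x p)   = ∙-congˡ (∏-↭ f p)
    ∏-↭ f (Perm.swap {xs} {ys} x y p) = ≈-trans (swap-∙ (f x) (f y) (∏ f xs)) (∙-congˡ (∙-congˡ (∏-↭ f p)))
    ∏-↭ f (Perm.trans p q)  = ≈-trans (∏-↭ f p) (∏-↭ f q)

    ∏-++ : {A : Set} (f : A → Carrier) (xs ys : List A) → ∏ f (xs ++ ys) ≈ ∏ f xs ∙ ∏ f ys
    ∏-++ f []       ys = ≈-sym (identityˡ _)
    ∏-++ f (x ∷ xs) ys = ≈-trans (∙-congˡ (∏-++ f xs ys)) (≈-sym (assoc _ _ _))

    ∏-cong : {A : Set} {f g : A → Carrier} (xs : List A) → (∀ {x} → x ∈ xs → f x ≈ g x) → ∏ f xs ≈ ∏ g xs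
    ∏-cong []       e = ≈-refl
    ∏-cong (x ∷ xs) e = ∙-cong (e (here refl)) (∏-cong xs (e ∘ there))

    ∏-∙ : {A : Set} (f g : A → Carrier) (xs : List A) → ∏ (λ x → f x ∙ g x) xs ≈ ∏ f xs ∙ ∏ g xs
    ∏-∙ f g []       = ≈-sym (identityˡ ε)
    ∏-∙ f g (x ∷ xs) = begin
      (f x ∙ g x) ∙ ∏ (λ x → f x ∙ g x) xs  ≈⟨ ∙-congˡ (∏-∙ f g xs) ⟩
      (f x ∙ g x) ∙ (∏ f xs ∙ ∏ g xs)       ≈⟨ assoc _ _ _ ⟩
      f x ∙ (g x ∙ (∏ f xs ∙ ∏ g xs))       ≈⟨ ∙-congˡ (swap-∙ _ _ _) ⟩
      f x ∙ (∏ f xs ∙ (g x ∙ ∏ g xs))       ≈⟨ assoc _ _ _ ⟨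
      (f x ∙ ∏ f xs) ∙ (g x ∙ ∏ g xs)       ∎

    ∏-map : {A B : Set} (f : B → Carrier) (h : A → B) (xs : List A) → ∏ f (map h xs) ≈ ∏ (f ∘ h) xs
    ∏-map f h []       = ≈-refl
    ∏-map f h (x ∷ xs) = ∙-congˡ (∏-map f h xs)

    -- Carries the corrections at the divisor 1, where deg Ψ_1 = 0 differs from φ(1) = 1 and where
    -- Ψ_{p^k} is not a power of Ψ_1.
    atOne : Carrier → ℕ → Carrier
    atOne c 1 = c
    atOne c _ = ε

    atOne->1 : ∀ c {n} → 1 < n → atOne c n ≡ ε
    atOne->1 c {suc zero}    (s≤s ())
    atOne->1 c {suc (suc n)} _ = refl

    ∏-atOne : ∀ c {xs} → Unique xs → 1 ∈ xs → ∏ (atOne c) xs ≈ c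
    ∏-atOne c {0 ∷ xs}           (_ ∷ u)  (there i) = ≈-trans (identityˡ _) (∏-atOne c u i)
    ∏-atOne c {1 ∷ xs}           (1∉ ∷ u) _         = ≈-trans (∙-congˡ (none xs (λ i → All.lookup 1∉ i refl)))
        (≈-trans (comm c ε) (identityˡ c))
      where
      none : ∀ xs → 1 ∉ xs → ∏ (atOne c) xs ≈ ε
      none []                 1∉ = ≈-refl
      none (0 ∷ xs)           1∉ = ≈-trans (identityˡ _) (none xs (1∉ ∘ there))
      none (1 ∷ xs)           1∉ = contradiction (here refl) 1∉
      none (suc (suc x) ∷ xs) 1∉ = ≈-trans (identityˡ _) (none xs (1∉ ∘ there))
    ∏-atOne c {suc (suc x) ∷ xs} (_ ∷ u)  (there i) = ≈-trans (identityˡ _) (∏-atOne c u i)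

  open ListProduct +-0-commutativeMonoid public using ()
    renaming (∏ to ∑; ∏-↭ to ∑-↭; ∏-cong to ∑-cong; ∏-∙ to ∑-+; ∏-++ to ∑-++; atOne to ∑-atOne; ∏-atOne to ∑-atOne≡)

  [1‥_] : ℕ → List ℕ
  [1‥ n ] = map suc (upTo n)

  ∈-[1‥]⁺ : ∀ {k n} → 0 < k → k ≤ n → k ∈ [1‥ n ]
  ∈-[1‥]⁺ {suc k} _ k≤n = ∈-map⁺ suc (∈-upTo⁺ k≤n)

  ∈-[1‥]⁻ : ∀ {k n} → k ∈ [1‥ n ] → 0 < k × k ≤ n
  ∈-[1‥]⁻ i with j , j∈ , refl ← ∈-map⁻ suc i = s≤s z≤n , ∈-upTo⁻ j∈

  unique-[1‥] : ∀ n → Unique [1‥ n ]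
  unique-[1‥] n = Unique.map⁺ suc-injective (Unique.upTo⁺ n)

  ∈-properDivisors⁺ : ∀ {d n} → 0 < n → d ∣ n → d ≢ n → d ∈ properDivisors n
  ∈-properDivisors⁺ {zero}  {n}     0<n d∣n d≢n = contradiction (sym (0∣⇒≡0 d∣n)) d≢n
  ∈-properDivisors⁺ {suc d} {suc n} 0<n d∣n d≢n = ∈-filter⁺ (_∣? suc n)
    (∈-[1‥]⁺ (s≤s z≤n) (≤-pred (≤∧≢⇒< (∣⇒≤ d∣n) d≢n))) d∣n

  ∈-properDivisors⁻ : ∀ {d n} → d ∈ properDivisors n → 0 < d × d ∣ n × d < n
  ∈-properDivisors⁻ {d} {zero}  ()
  ∈-properDivisors⁻ {d} {suc n} i with j , d∣n ← ∈-filter⁻ (_∣? suc n) {xs = [1‥ n ]} i with 0<d , d≤n ← ∈-[1‥]⁻ j =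
    0<d , d∣n , s≤s d≤n

  unique-properDivisors : ∀ n → Unique (properDivisors n)
  unique-properDivisors n = Unique.filter⁺ (_∣? n) (unique-[1‥] (n ∸ 1))

  -- With n at the head, a product over all divisors unfolds to the factor at n times the product
  -- over the proper divisors.
  divisors : ℕ → List ℕ
  divisors n = n ∷ properDivisors n

  ∈-divisors⁺ : ∀ {d n} → 0 < n → d ∣ n → d ∈ divisors n
  ∈-divisors⁺ {d} {n} 0<n d∣n with d ≟ n
  ... | yes refl = here refl
  ... | no  d≢n  = there (∈-properDivisors⁺ 0<n d∣n d≢n)

  ∈-divisors⁻ : ∀ {d n} → 0 < n → d ∈ divisors n → 0 < d × d ∣ n
  ∈-divisors⁻ 0<n (here refl) = 0<n , ∣-refl
  ∈-divisors⁻ 0<n (there i) with 0<d , d∣n , _ ← ∈-properDivisors⁻ i = 0<d , d∣n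

  unique-divisors : ∀ n → Unique (divisors n)
  unique-divisors n = All.tabulate (λ i n≡d → <-irrefl (sym n≡d) (proj₂ (proj₂ (∈-properDivisors⁻ i)))) ∷
      unique-properDivisors n

  coDivisors : ℕ → ℕ → List ℕ
  coDivisors g n = filter (λ d → ¬? (d ∣? g)) (properDivisors n)

  divisors-split : ∀ {g n} → 0 < n → g ∣ n → g < n → divisors n ↭ n ∷ (divisors g ++ coDivisors g n)
  divisors-split {g} {n} 0<n g∣n g<n = unique-↭ (unique-divisors n)
    (All.tabulate n∉ ∷ Unique.++⁺ (unique-divisors g) (Unique.filter⁺ P? (unique-properDivisors n)) disjoint) to from
    where
    P? = λ d → ¬? (d ∣? g)
    0<g : 0 < g
    0<g = n≢0⇒n>0 (λ { refl → <-irrefl (sym (0∣⇒≡0 g∣n)) 0<n })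
    cod⁻ : ∀ {x} → x ∈ coDivisors g n → x ∈ properDivisors n × ¬ x ∣ g
    cod⁻ = ∈-filter⁻ P? {xs = properDivisors n}
    n∉ : ∀ {x} → x ∈ divisors g ++ coDivisors g n → n ≢ x
    n∉ i refl with ∈-++⁻ (divisors g) i
    ... | inj₁ j = <⇒≱ g<n (∣⇒≤ {{>-nonZero 0<g}} (proj₂ (∈-divisors⁻ 0<g j)))
    ... | inj₂ j = <-irrefl refl (proj₂ (proj₂ (∈-properDivisors⁻ (proj₁ (cod⁻ j)))))
    disjoint : ∀ {x} → ¬ (x ∈ divisors g × x ∈ coDivisors g n)
    disjoint (i , j) = proj₂ (cod⁻ j) (proj₂ (∈-divisors⁻ 0<g i))
    to : ∀ {x} → x ∈ divisors n → x ∈ n ∷ (divisors g ++ coDivisors g n)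
    to (here e) = here e
    to {x} (there i) with x ∣? g
    ... | yes x∣g = there (∈-++⁺ˡ (∈-divisors⁺ 0<g x∣g))
    ... | no  x∤g = there (∈-++⁺ʳ (divisors g) (∈-filter⁺ P? i x∤g))
    from : ∀ {x} → x ∈ n ∷ (divisors g ++ coDivisors g n) → x ∈ divisors n
    from (here e) = here e
    from (there i) with ∈-++⁻ (divisors g) i
    ... | inj₁ j = ∈-divisors⁺ 0<n (∣-trans (proj₂ (∈-divisors⁻ 0<g j)) g∣n)
    ... | inj₂ j = there (proj₁ (cod⁻ j))

  module _ (h : ℕ → ℕ) where

    fibre : ℕ → List ℕ → List ℕ
    fibre d xs = filter (λ x → h x ≟ d) xs

    private
      length-fibre-∷ : ∀ x xs {ds} → Unique ds → h x ∈ ds →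
        ∑ (λ d → length (fibre d (x ∷ xs))) ds ≡ suc (∑ (λ d → length (fibre d xs)) ds)
      length-fibre-∷ x xs {d ∷ ds} (d∉ ∷ u) i with h x ≟ d
      ... | yes refl = cong₂ _+_ (cong length (filter-accept (λ x → h x ≟ d) refl))
          (∑-cong ds λ {e} j → cong length (filter-reject (λ x → h x ≟ e) λ e≡ → All.lookup d∉ j e≡))
      length-fibre-∷ x xs {d ∷ ds} (d∉ ∷ u) (here e)  | no n = contradiction e n
      length-fibre-∷ x xs {d ∷ ds} (d∉ ∷ u) (there i) | no n =
        trans (cong₂ _+_ (cong length (filter-reject (λ x → h x ≟ d) n)) (length-fibre-∷ x xs u i)) (+-suc _ _)

    length-fibres : ∀ xs {ds} → Unique ds → All (λ x → h x ∈ ds) xs → length xs ≡ ∑ (λ d → length (fibre d xs)) ds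
    length-fibres []       {ds} u [] = sym (zeros ds)
      where
      zeros : ∀ ds → ∑ (λ d → 0) ds ≡ 0
      zeros []       = refl
      zeros (d ∷ ds) = zeros ds
    length-fibres (x ∷ xs) {ds} u (i ∷ is) = trans (cong suc (length-fibres xs u is)) (sym (length-fibre-∷ x xs u i))

  -- The fibre over d of k ↦ n / gcd k n on 1, …, n has φ d elements.
  gauss : ∀ n → 0 < n → ∑ φ (divisors n) ≡ n
  gauss n 0<n = begin
    ∑ φ (divisors n)                                    ≡⟨ ∑-cong (divisors n) (λ i → count (∈-divisors⁻ 0<n i)) ⟩
    ∑ (λ d → length (fibre h d [1‥ n ])) (divisors n)   ≡⟨ length-fibres h [1‥ n ] (unique-divisors n)
        (All.tabulate λ {x} _ → ∈-divisors⁺ 0<n (h∣n x)) ⟨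
    length [1‥ n ]                                      ≡⟨ trans (length-map suc (upTo n)) (length-upTo n) ⟩
    n                                                   ∎
    where
    open ≡-Reasoning
    instance
      nz : NonZero n
      nz = >-nonZero 0<n
    h : ℕ → ℕ
    h x = quotient (gcd[m,n]∣n x n)
    n≡ : ∀ x → n ≡ h x * gcd x n
    n≡ x = _∣_.equality (gcd[m,n]∣n x n)
    h∣n : ∀ x → h x ∣ n
    h∣n x = divides (gcd x n) (trans (n≡ x) (*-comm (h x) _))
    units : ℕ → List ℕ
    units d = filter (λ k → coprime? k d) [1‥ d ]
    -- With n = g d, multiplication by g carries the numbers up to d that are prime to d bijectively
    -- onto the x ≤ n with gcd x n = g.
    count : ∀ {d} → 0 < d × d ∣ n → φ d ≡ length (fibre h d [1‥ n ])
    count {d} (0<d , divides g refl) = trans (sym (length-map (λ k → k * g) (units d)))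
      (↭-length (unique-↭ (Unique.map⁺ (*-cancelʳ-≡ _ _ g) (Unique.filter⁺ (λ k → coprime? k d) (unique-[1‥] d)))
        (Unique.filter⁺ (λ x → h x ≟ d) (unique-[1‥] n)) to from))
      where
      instance
        gz : NonZero g
        gz = m*n≢0⇒m≢0 g {d}
        dz : NonZero d
        dz = >-nonZero 0<d
      gcd-*g : ∀ k → gcd (k * g) (g * d) ≡ g * gcd k d
      gcd-*g k = trans (cong (λ z → gcd z (g * d)) (*-comm k g)) (sym (c*gcd[m,n]≡gcd[cm,cn] g k d))
      to : ∀ {x} → x ∈ map (λ k → k * g) (units d) → x ∈ fibre h d [1‥ n ]
      to i with k , k∈ , refl ← ∈-map⁻ (λ k → k * g) i
              with j , c ← ∈-filter⁻ (λ k → coprime? k d) {xs = [1‥ d ]} k∈ with 0<k , k≤d ← ∈-[1‥]⁻ j =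
        ∈-filter⁺ (λ x → h x ≟ d) (∈-[1‥]⁺ (*-mono-≤ 0<k (>-nonZero⁻¹ g)) (subst (k * g ≤_) (*-comm d g) (*-monoˡ-≤ g k≤d)))
          (*-cancelʳ-≡ (h (k * g)) d g (begin
            h (k * g) * g                        ≡⟨ cong (h (k * g) *_) (*-identityʳ g) ⟨
            h (k * g) * (g * 1)                  ≡⟨ cong (λ z → h (k * g) * (g * z)) (Coprimality.coprime⇒gcd≡1 c) ⟨
            h (k * g) * (g * gcd k d)            ≡⟨ cong (h (k * g) *_) (gcd-*g k) ⟨
            h (k * g) * gcd (k * g) (g * d)      ≡⟨ n≡ (k * g) ⟨
            g * d                                ≡⟨ *-comm g d ⟩
            d * g                                ∎))
      from : ∀ {x} → x ∈ fibre h d [1‥ n ] → x ∈ map (λ k → k * g) (units d)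
      from {x} i with j , hx≡d ← ∈-filter⁻ (λ x → h x ≟ d) {xs = [1‥ n ]} i | 0<x , x≤n ← ∈-[1‥]⁻ {x} {n}
          (proj₁ (∈-filter⁻ (λ x → h x ≟ d) {xs = [1‥ n ]} i))
        = found (subst (_∣ x) g≡ (gcd[m,n]∣m x n))
        where
        g≡ : gcd x n ≡ g
        g≡ = *-cancelˡ-≡ (gcd x n) g d (trans (cong (_* gcd x n) (sym hx≡d)) (trans (sym (n≡ x)) (*-comm g d)))
        found : g ∣ x → x ∈ map (λ k → k * g) (units d)
        found (divides k refl) = ∈-map⁺ (λ k → k * g) (∈-filter⁺ (λ k → coprime? k d)
          (∈-[1‥]⁺ (n≢0⇒n>0 (λ { refl → <-irrefl refl 0<x })) (*-cancelʳ-≤ k d g (subst (k * g ≤_) (*-comm g d) x≤n)))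
          (Coprimality.gcd≡1⇒coprime (*-cancelˡ-≡ (gcd k d) 1 g (trans (sym (gcd-*g k)) (trans g≡ (sym (*-identityʳ g)))))))

  -- The uniqueness half of Möbius inversion: strong induction makes the sums over proper divisors
  -- equal, and they cancel.
  ∑-divisors-injective : ∀ (f g : ℕ → ℕ) → (∀ n → 0 < n → ∑ f (divisors n) ≡ ∑ g (divisors n)) → ∀ n → 0 < n → f n ≡ g n
  ∑-divisors-injective f g e n 0<n = go n 0<n (<-wellFounded n)
    where
    go : ∀ n → 0 < n → Acc _<_ n → f n ≡ g n
    go n 0<n (acc rec) = +-cancelʳ-≡ (∑ g (properDivisors n)) (f n) (g n) (trans
      (cong (λ z → f n + z) (sym (∑-cong (properDivisors n) λ i → let (0<d , _ , d<n) = ∈-properDivisors⁻ i in go _ 0<d (rec d<n))))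
      (e n 0<n))

  [n≡1] : ℕ → ℕ
  [n≡1] = ∑-atOne 1

  ∑-[n≡1] : ∀ n → 0 < n → ∑ [n≡1] (divisors n) ≡ 1
  ∑-[n≡1] n 0<n = ∑-atOne≡ 1 (unique-divisors n) (∈-divisors⁺ 0<n (1∣ n))

-- Fibotomic polynomials over the integers

module ExactDivision where
  open import Data.List using (reverse; _ʳ++_)
  open import Data.List.Properties using (length-reverse; reverse-involutive)
  open DivisorSums

  ℤR : CR
  ℤR = ℤₚ.+-*-commutativeRing

  module ℤR = RingTheory ℤR
  open Polynomial ℤR
  module Z = RingTheory polyRing
  open ListProduct Z.*-commutativeMonoid

  addU≡add : ∀ p q → addU p q ≡ add p q
  addU≡add []      q       = ≡.refl
  addU≡add (a ∷ p) []      = ≡.refl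
  addU≡add (a ∷ p) (b ∷ q) = ≡.cong (a ℤ.+ b ∷_) (addU≡add p q)

  mulU≡mul : ∀ p q → mulU p q ≡ mul p q
  mulU≡mul []      q = ≡.refl
  mulU≡mul (a ∷ p) q = ≡.trans (addU≡add (map (a ℤ.*_) q) _) (≡.cong (λ r → add (map (a ℤ.*_) q) (0ℤ ∷ r)) (mulU≡mul p q))

  coeffU≡coeff : ∀ p i → coeffU p i ≡ coeff p i
  coeffU≡coeff []      i       = ≡.refl
  coeffU≡coeff (a ∷ p) zero    = ≡.refl
  coeffU≡coeff (a ∷ p) (suc i) = coeffU≡coeff p i

  F≋fib : ∀ n → F n ≋ Z.fib X n
  F≋fib zero          = ≋-refl
  F≋fib (suc zero)    = ≋-refl
  F≋fib (suc (suc n)) = Z.trans (Z.reflexive (addU≡add (0ℤ ∷ F (suc n)) (F n)))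
    (Z.+-cong (Z.trans (∷-cong ≡.refl (F≋fib (suc n))) (Z.sym (X*≋∷ (Z.fib X (suc n))))) (F≋fib n))

  length-add : ∀ p q → length (add p q) ≡ length p ℕ.⊔ length q
  length-add []      q       = ≡.refl
  length-add (a ∷ p) []      = ≡.refl
  length-add (a ∷ p) (b ∷ q) = ≡.cong suc (length-add p q)

  length-mul : ∀ a p b q → length (mul (a ∷ p) (b ∷ q)) ≡ suc (length p ℕ.+ length q)
  length-mul a []      b q = ≡.cong suc (≡.trans (length-add (map (a ℤ.*_) q) [])
      (≡.trans (ℕₚ.⊔-identityʳ _) (length-map _ q)))
  length-mul a (c ∷ p) b q = ≡.cong suc (≡.trans (length-add (map (a ℤ.*_) q) (mul (c ∷ p) (b ∷ q)))
    (≡.trans (≡.cong₂ ℕ._⊔_ (length-map (a ℤ.*_) q) (length-mul c p b q))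
      (ℕₚ.m≤n⇒m⊔n≡n (ℕₚ.m≤n⇒m≤1+n (ℕₚ.m≤n+m (length q) (length p))))))

  -- The division that defines `Ψ` inspects lists entry by entry, so being monic up to trailing
  -- zeros is not enough: the list itself must end in its leading 1.
  record LiterallyMonic (d : ℕ) (p : Poly) : Set where
    constructor literallyMonic
    field
      len : length p ≡ suc d
      top : coeff p d ≡ 1ℤ

    isMonic : Monic d p
    isMonic = monic (≡.subst (Deg< p) len (Deg<-length p)) top
  open LiterallyMonic

  LiterallyMonic-mul : ∀ {d e p q} → LiterallyMonic d p → LiterallyMonic e q → LiterallyMonic (d ℕ.+ e) (mul p q)
  LiterallyMonic-mul {p = a ∷ p} {b ∷ q} (literallyMonic ≡.refl t) (literallyMonic ≡.refl u) =
    literallyMonic (length-mul a p b q)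
      (Monic.top (Monic-mul (isMonic (literallyMonic {p = a ∷ p} ≡.refl t)) (isMonic (literallyMonic {p = b ∷ q} ≡.refl u))))

  LiterallyMonic-F : ∀ n → LiterallyMonic n (F (suc n))
  LiterallyMonic-F n = literallyMonic (len′ n) (≡.trans (≡.sym (coeffU≡coeff (F (suc n)) n)) (top′ n))
    where
    lenU : ∀ p q → length (addU p q) ≡ length p ℕ.⊔ length q
    lenU p q = ≡.trans (≡.cong length (addU≡add p q)) (length-add p q)
    len′ : ∀ n → length (F (suc n)) ≡ suc n
    len′ zero          = ≡.refl
    len′ (suc zero)    = ≡.refl
    len′ (suc (suc n)) = ≡.trans (lenU (0ℤ ∷ F (suc (suc n))) (F (suc n)))
      (≡.trans (≡.cong₂ (λ a b → suc a ℕ.⊔ b) (len′ (suc n)) (len′ n)) (ℕₚ.m≥n⇒m⊔n≡m (ℕₚ.m≤n⇒m≤1+n (ℕₚ.n≤1+n (suc n)))))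
    top′ : ∀ n → coeffU (F (suc n)) n ≡ 1ℤ
    top′ zero          = ≡.refl
    top′ (suc zero)    = ≡.refl
    top′ (suc (suc n)) = begin
      coeffU (addU (0ℤ ∷ F (suc (suc n))) (F (suc n))) (suc (suc n))  ≡⟨ coeffU≡coeff
          (addU (0ℤ ∷ F (suc (suc n))) (F (suc n))) (suc (suc n)) ⟩
      coeff (addU (0ℤ ∷ F (suc (suc n))) (F (suc n))) (suc (suc n))
        ≡⟨ ≡.trans (≡.cong (λ p → coeff p (suc (suc n))) (addU≡add (0ℤ ∷ F (suc (suc n))) (F (suc n))))
             (coeff-add (0ℤ ∷ F (suc (suc n))) (F (suc n)) (suc (suc n))) ⟩
      coeff (F (suc (suc n))) (suc n) ℤ.+ coeff (F (suc n)) (suc (suc n))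
        ≡⟨ ≡.cong₂ ℤ._+_ (≡.trans (≡.sym (coeffU≡coeff (F (suc (suc n))) (suc n))) (top′ (suc n)))
             (Deg<-length (F (suc n)) (suc (suc n)) (ℕₚ.≤-trans (ℕₚ.≤-reflexive (len′ n)) (ℕₚ.n≤1+n (suc n)))) ⟩
      1ℤ ∎
      where open ≡.≡-Reasoning

  ≋⇒≡ : ∀ p q → length p ≡ length q → p ≋ q → p ≡ q
  ≋⇒≡ []      []      l e = ≡.refl
  ≋⇒≡ (a ∷ p) (b ∷ q) l e = ≡.cong₂ _∷_ (at e 0) (≋⇒≡ p q (ℕₚ.suc-injective l) (ext λ i → at e (suc i)))

  module HighFirst where
    open import Relation.Binary.Reasoning.Setoid Z.setoid

    -- Long division works highest degree first. This turns the reversal between the two orders into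
    -- polynomial arithmetic, where the ring solver applies.
    ʳ++-≋ : ∀ p ac → p ʳ++ ac ≋ X Z.^ length p Z.* ac Z.+ reverse p
    ʳ++-≋ []      ac = Z.sym (Z.trans (Z.+-identityʳ (Z.1# Z.* ac)) (Z.*-identityˡ ac))
    ʳ++-≋ (a ∷ p) ac = begin
      p ʳ++ (a ∷ ac)                                   ≈⟨ ʳ++-≋ p (a ∷ ac) ⟩
      Xⁿ Z.* (a ∷ ac) Z.+ reverse p                    ≈⟨ Z.+-congʳ {reverse p} (Z.*-congˡ {Xⁿ} (split ac)) ⟩
      Xⁿ Z.* (const a Z.+ X Z.* ac) Z.+ reverse p
        ≈⟨ Z.solve 5 (λ n a x c r → n Z.:* (a Z.:+ x Z.:* c) Z.:+ r Z.:= (x Z.:* n) Z.:* c Z.:+ (n Z.:* a Z.:+ r))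
             Z.refl Xⁿ (const a) X ac (reverse p) ⟩
      (X Z.* Xⁿ) Z.* ac Z.+ (Xⁿ Z.* const a Z.+ reverse p)  ≈⟨ Z.+-congˡ {(X Z.* Xⁿ) Z.* ac} (ʳ++-≋ p (a ∷ [])) ⟨
      (X Z.* Xⁿ) Z.* ac Z.+ reverse (a ∷ p)            ∎
      where
      Xⁿ = X Z.^ length p
      split : ∀ q → a ∷ q ≋ const a Z.+ X Z.* q
      split q = Z.sym (Z.trans (Z.+-congˡ {const a} (X*≋∷ q)) (∷-cong (ℤₚ.+-identityʳ a) Z.refl))

    reverse-∷ : ∀ a p → reverse (a ∷ p) ≋ X Z.^ length p Z.* const a Z.+ reverse p
    reverse-∷ a p = ʳ++-≋ p (a ∷ [])

    -- Adding high-first lists aligns their leading ends, so after reversal the shorter one appears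
    -- shifted by the difference k of the lengths.
    reverse-add : ∀ s p k → k ℕ.+ length s ≡ length p → reverse (add s p) ≋ reverse p Z.+ X Z.^ k Z.* reverse s
    reverse-add []      p       k l = Z.sym (Z.trans (Z.+-congˡ {reverse p} (Z.zeroʳ (X Z.^ k))) (Z.+-identityʳ (reverse p)))
    reverse-add (b ∷ s) []      k l = contradiction (≡.trans (≡.sym (ℕₚ.+-suc k (length s))) l) λ ()
    reverse-add (b ∷ s) (y ∷ p) k l = begin
      reverse (b ℤ.+ y ∷ add s p)                               ≈⟨ reverse-∷ (b ℤ.+ y) (add s p) ⟩
      X Z.^ length (add s p) Z.* const (b ℤ.+ y) Z.+ reverse (add s p)
        ≈⟨ Z.+-cong (Z.*-congʳ {const (b ℤ.+ y)} (Z.reflexive (≡.cong (X Z.^_) len′))) (reverse-add s p k l′) ⟩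
      Xⁿ Z.* (const b Z.+ const y) Z.+ (reverse p Z.+ X Z.^ k Z.* reverse s)
        ≈⟨ Z.+-congʳ {reverse p Z.+ X Z.^ k Z.* reverse s} (Z.*-congʳ {const b Z.+ const y} Xⁿ≋) ⟩
      (X Z.^ k Z.* X Z.^ length s) Z.* (const b Z.+ const y) Z.+ (reverse p Z.+ X Z.^ k Z.* reverse s)
        ≈⟨ Z.solve 6 (λ k m b y p s → (k Z.:* m) Z.:* (b Z.:+ y) Z.:+ (p Z.:+ k Z.:* s)
             Z.:= ((k Z.:* m) Z.:* y Z.:+ p) Z.:+ k Z.:* (m Z.:* b Z.:+ s))
             Z.refl (X Z.^ k) (X Z.^ length s) (const b) (const y) (reverse p) (reverse s) ⟩
      ((X Z.^ k Z.* X Z.^ length s) Z.* const y Z.+ reverse p) Z.+ X Z.^ k Z.* (X Z.^ length s Z.* const b Z.+ reverse s)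
        ≈⟨ Z.+-congʳ {X Z.^ k Z.* (X Z.^ length s Z.* const b Z.+ reverse s)}
            (Z.+-congʳ {reverse p} (Z.*-congʳ {const y} Xⁿ≋)) ⟨
      (Xⁿ Z.* const y Z.+ reverse p) Z.+ X Z.^ k Z.* (X Z.^ length s Z.* const b Z.+ reverse s)
        ≈⟨ Z.+-cong (reverse-∷ y p) (Z.*-congˡ {X Z.^ k} (reverse-∷ b s)) ⟨
      reverse (y ∷ p) Z.+ X Z.^ k Z.* reverse (b ∷ s)           ∎
      where
      Xⁿ = X Z.^ length p
      l′ : k ℕ.+ length s ≡ length p
      l′ = ℕₚ.suc-injective (≡.trans (≡.sym (ℕₚ.+-suc k (length s))) l)
      len′ : length (add s p) ≡ length p
      len′ = ≡.trans (length-add s p) (ℕₚ.m≤n⇒m⊔n≡n (≡.subst (length s ≤_) l′ (ℕₚ.m≤n+m (length s) k)))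
      Xⁿ≋ : Xⁿ ≋ X Z.^ k Z.* X Z.^ length s
      Xⁿ≋ = Z.trans (Z.reflexive (≡.cong (X Z.^_) (≡.sym l′))) (Z.^-homo-+ X k (length s))

    reverse-map : ∀ a p → reverse (map (a ℤ.*_) p) ≋ const a Z.* reverse p
    reverse-map a []      = Z.sym (Z.zeroʳ (const a))
    reverse-map a (b ∷ p) = begin
      reverse (a ℤ.* b ∷ map (a ℤ.*_) p)
        ≈⟨ reverse-∷ (a ℤ.* b) (map (a ℤ.*_) p) ⟩
      X Z.^ length (map (a ℤ.*_) p) Z.* const (a ℤ.* b) Z.+ reverse (map (a ℤ.*_) p)
        ≈⟨ Z.+-cong (Z.*-cong (Z.reflexive (≡.cong (X Z.^_) (length-map (a ℤ.*_) p))) (const-*-const a b)) (reverse-map a p) ⟩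
      X Z.^ length p Z.* (const a Z.* const b) Z.+ const a Z.* reverse p
        ≈⟨ Z.solve 4 (λ n a b r → n Z.:* (a Z.:* b) Z.:+ a Z.:* r Z.:= a Z.:* (n Z.:* b Z.:+ r)) Z.refl
            (X Z.^ length p) (const a) (const b) (reverse p) ⟩
      const a Z.* (X Z.^ length p Z.* const b Z.+ reverse p)   ≈⟨ Z.*-congˡ {const a} (reverse-∷ b p) ⟨
      const a Z.* reverse (b ∷ p)                              ∎

    -- The product of Q and 1 ∷ bt, all coefficient lists highest degree first.
    mulHigh : List ℤ → List ℤ → List ℤ
    mulHigh bt []      = map (λ _ → 0ℤ) bt
    mulHigh bt (q ∷ Q) = q ∷ add (map (q ℤ.*_) bt) (mulHigh bt Q)

    length-mulHigh : ∀ bt Q → length (mulHigh bt Q) ≡ length Q ℕ.+ length bt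
    length-mulHigh bt []      = length-map _ bt
    length-mulHigh bt (q ∷ Q) = ≡.cong suc (≡.trans (length-add (map (q ℤ.*_) bt) _)
      (≡.trans (≡.cong₂ ℕ._⊔_ (length-map (q ℤ.*_) bt) (length-mulHigh bt Q))
          (ℕₚ.m≤n⇒m⊔n≡n (ℕₚ.m≤n+m (length bt) (length Q)))))

    reverse-mulHigh : ∀ bt Q → reverse (mulHigh bt Q) ≋ reverse Q Z.* reverse (1ℤ ∷ bt)
    reverse-mulHigh bt []      = zeros bt
      where
      zeros : ∀ bt → reverse (map (λ _ → 0ℤ) bt) ≋ []
      zeros []       = Z.refl
      zeros (b ∷ bt) = Z.trans (reverse-∷ 0ℤ (map (λ _ → 0ℤ) bt)) (Z.trans
        (Z.+-cong (Z.trans (Z.*-congˡ {X Z.^ n} (ext λ { zero → ≡.refl ; (suc i) → ≡.refl }))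
            (Z.zeroʳ (X Z.^ n))) (zeros bt)) Z.refl)
        where n = length (map (λ _ → 0ℤ) bt)
    reverse-mulHigh bt (q ∷ Q) = begin
      reverse (q ∷ add s M)                                       ≈⟨ reverse-∷ q (add s M) ⟩
      X Z.^ length (add s M) Z.* const q Z.+ reverse (add s M)
        ≈⟨ Z.+-cong (Z.*-congʳ {const q} (Z.trans (Z.reflexive (≡.cong (X Z.^_) len′)) (Z.^-homo-+ X (length Q) (length bt))))
             (reverse-add s M (length Q) (≡.trans (≡.cong (length Q ℕ.+_) (length-map (q ℤ.*_) bt))
                 (≡.sym (length-mulHigh bt Q)))) ⟩
      (XQ Z.* Xb) Z.* const q Z.+ (reverse M Z.+ XQ Z.* reverse s)
        ≈⟨ Z.+-congˡ {(XQ Z.* Xb) Z.* const q} (Z.+-cong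
            (Z.trans (reverse-mulHigh bt Q) (Z.*-congˡ {reverse Q} B≋)) (Z.*-congˡ {XQ} (reverse-map q bt))) ⟩
      (XQ Z.* Xb) Z.* const q Z.+ (reverse Q Z.* (Xb Z.* Z.1# Z.+ reverse bt) Z.+ XQ Z.* (const q Z.* reverse bt))
        ≈⟨ Z.solve 5 (λ m n q b Q → (m Z.:* n) Z.:* q Z.:+ (Q Z.:* (n Z.:* Z.con (+ 1) Z.:+ b) Z.:+ m Z.:* (q Z.:* b))
             Z.:= (m Z.:* q Z.:+ Q) Z.:* (n Z.:* Z.con (+ 1) Z.:+ b)) Z.refl XQ Xb (const q) (reverse bt) (reverse Q) ⟩
      (XQ Z.* const q Z.+ reverse Q) Z.* (Xb Z.* Z.1# Z.+ reverse bt)  ≈⟨ Z.*-cong (reverse-∷ q Q) B≋ ⟨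
      reverse (q ∷ Q) Z.* reverse (1ℤ ∷ bt)                       ∎
      where
      s = map (q ℤ.*_) bt
      M = mulHigh bt Q
      XQ = X Z.^ length Q
      Xb = X Z.^ length bt
      len′ : length (add s M) ≡ length Q ℕ.+ length bt
      len′ = ℕₚ.suc-injective (length-mulHigh bt (q ∷ Q))
      B≋ : reverse (1ℤ ∷ bt) ≋ Xb Z.* Z.1# Z.+ reverse bt
      B≋ = reverse-∷ 1ℤ bt

    subFront-add : ∀ s M → length s ≤ length M → subFront (add s M) s ≡ M
    subFront-add []      []      l       = ≡.refl
    subFront-add []      (y ∷ M) l       = ≡.refl
    subFront-add (b ∷ s) (y ∷ M) (s≤s l) = ≡.cong₂ _∷_ (ℤR.trans (ℤR.+-congʳ (ℤₚ.+-comm b y)) (ℤR.x+y-y y b))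
        (subFront-add s M l)

    -- The head of the product is the next coefficient of the quotient, and subtracting its multiple
    -- of `bt` leaves the product for the remaining quotient.
    divHigh-mulHigh : ∀ fuel bt Q → length Q ≤ fuel → divHigh fuel bt (mulHigh bt Q) ≡ Q
    divHigh-mulHigh zero       bt       []      l = ≡.refl
    divHigh-mulHigh (suc fuel) []       []      l = ≡.refl
    -- Only the zero remainder is left, one entry too short to yield a further quotient coefficient.
    divHigh-mulHigh (suc fuel) (b ∷ bt) []      l with length (b ∷ bt) ℕ.≤? length (map (λ _ → 0ℤ) bt)
    ... | yes le = contradiction (≡.subst (length (b ∷ bt) ≤_) (length-map (λ _ → 0ℤ) bt) le) (ℕₚ.<-irrefl ≡.refl)
    ... | no  _  = ≡.refl
    divHigh-mulHigh (suc fuel) bt (q ∷ Q) (s≤s l) with length bt ℕ.≤? length (add (map (q ℤ.*_) bt) (mulHigh bt Q))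
    ... | no ¬le = contradiction (≡.subst (length bt ≤_) (≡.sym (ℕₚ.suc-injective (length-mulHigh bt (q ∷ Q))))
        (ℕₚ.m≤n+m (length bt) (length Q))) ¬le
    ... | yes _  = ≡.cong (q ∷_) (≡.trans (≡.cong (divHigh fuel bt) (subFront-add (map (q ℤ.*_) bt) (mulHigh bt Q)
        (≡.subst₂ _≤_ (≡.sym (length-map (q ℤ.*_) bt)) (≡.sym (length-mulHigh bt Q)) (ℕₚ.m≤n+m (length bt) (length Q)))))
        (divHigh-mulHigh fuel bt Q l))

  open HighFirst

  divMonic-exact : ∀ {d e A B Q} → LiterallyMonic d B → length Q ≡ suc e → length A ≡ suc (e ℕ.+ d) → A ≋ mul Q
      B → divMonic A B ≡ Q
  divMonic-exact {d} {e} {A} {B} {Q} M lQ lA eq = go (reverse B) ≡.refl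
    where
    go : ∀ rB → reverse B ≡ rB → divMonic A B ≡ Q
    go []       r = contradiction (≡.trans (≡.sym (length-reverse B)) (≡.cong length r))
        (λ l → contradiction (≡.trans (≡.sym (len M)) l) λ ())
    go (b ∷ bt) r = ≡.trans (unfold r) (begin
      reverse (divHigh (length A) bt (reverse A))               ≡⟨ ≡.cong (λ a → reverse (divHigh (length A) bt a)) rev-A ⟩
      reverse (divHigh (length A) bt (mulHigh bt (reverse Q)))
        ≡⟨ ≡.cong reverse (divHigh-mulHigh (length A) bt (reverse Q)
            (≡.subst₂ _≤_ (≡.sym (≡.trans (length-reverse Q) lQ)) (≡.sym lA) (s≤s (ℕₚ.m≤m+n e d)))) ⟩
      reverse (reverse Q)                                       ≡⟨ reverse-involutive Q ⟩
      Q                                                         ∎)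
      where
      open ≡.≡-Reasoning
      unfold : ∀ {b bt} → reverse B ≡ b ∷ bt → divMonic A B ≡ reverse (divHigh (length A) bt (reverse A))
      unfold e with reverse B | e
      ... | _ ∷ _ | ≡.refl = ≡.refl
      B≡ : B ≡ reverse (b ∷ bt)
      B≡ = ≡.trans (≡.sym (reverse-involutive B)) (≡.cong reverse r)
      length-bt : length bt ≡ d
      length-bt = ℕₚ.suc-injective (≡.trans (≡.sym (≡.cong length r)) (≡.trans (length-reverse B) (len M)))
      b≡1 : b ≡ 1ℤ
      b≡1 = ≡.trans (≡.sym (last bt (b ∷ []))) (≡.trans (≡.cong (λ p → coeff p (length bt ℕ.+ 0)) (≡.sym B≡))
              (≡.trans (≡.cong (coeff B) (≡.trans (ℕₚ.+-identityʳ _) length-bt)) (top M)))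
        where
        last : ∀ p ac → coeff (p ʳ++ ac) (length p ℕ.+ 0) ≡ coeff ac 0
        last p ac = go′ p ac 0
          where
          go′ : ∀ p ac i → coeff (p ʳ++ ac) (length p ℕ.+ i) ≡ coeff ac i
          go′ []      ac i = ≡.refl
          go′ (a ∷ p) ac i = ≡.trans (≡.cong (coeff (p ʳ++ (a ∷ ac))) (≡.sym (ℕₚ.+-suc (length p) i)))
              (go′ p (a ∷ ac) (suc i))
      -- Equal lengths promote the coefficientwise identity A = Q B to an equality of lists, on
      -- which the division can compute.
      rev-A : reverse A ≡ mulHigh bt (reverse Q)
      rev-A = ≡.trans (≡.cong reverse (≋⇒≡ A (reverse (mulHigh bt (reverse Q)))
        (≡.trans lA (≡.sym (≡.trans (length-reverse (mulHigh bt (reverse Q))) (≡.trans (length-mulHigh bt (reverse Q))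
          (≡.cong₂ ℕ._+_ (≡.trans (length-reverse Q) lQ) length-bt)))))
        (Z.trans eq (Z.sym (Z.trans (reverse-mulHigh bt (reverse Q)) (Z.reflexive (≡.cong₂ mul (reverse-involutive Q)
          (≡.trans (≡.cong (λ c → reverse (c ∷ bt)) (≡.sym b≡1)) (≡.sym B≡)))))))))
        (reverse-involutive (mulHigh bt (reverse Q)))

-- The product formula and the degrees of the fibotomic polynomials

module Fibotomic where
  open import Data.List.Properties using (map-cong-local)
  open DivisorSums
  open ExactDivision

  open Polynomial ℤR
  open ListProduct Z.*-commutativeMonoid
  open LiterallyMonic

  -- The recursion visits only proper divisors, each smaller than its predecessor, so fuel beyond n
  -- changes nothing.
  ΨF-fuel : ∀ {f g n} → 0 < n → n ≤ f → n ≤ g → ΨF f n ≡ ΨF g n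
  ΨF-fuel {n = n} = go (<-wellFounded n)
    where
    go : ∀ {f g n} → Acc _<_ n → 0 < n → n ≤ f → n ≤ g → ΨF f n ≡ ΨF g n
    go {zero}            _         (s≤s _) ()
    go {suc f} {zero}    _         (s≤s _) _  ()
    go {suc f} {suc g} {n} (acc rec) 0<n n≤f n≤g with n ℕ.≤? 1
    ... | yes _ = ≡.refl
    ... | no  _ = ≡.cong (λ l → divMonic (F n) (prodU l)) (map-cong-local (All.tabulate λ i →
            let 0<d , _ , d<n = ∈-properDivisors⁻ i
            in go (rec d<n) 0<d (ℕₚ.≤-pred (ℕₚ.≤-trans d<n n≤f)) (ℕₚ.≤-pred (ℕₚ.≤-trans d<n n≤g))))

  prodU≡∏ : ∀ {A : Set} (f : A → UPoly) xs → prodU (map f xs) ≡ ∏ f xs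
  prodU≡∏ f []       = ≡.refl
  prodU≡∏ f (x ∷ xs) = ≡.trans (mulU≡mul (f x) (prodU (map f xs))) (≡.cong (mul (f x)) (prodU≡∏ f xs))

  Ψ-divMonic : ∀ {n} → 1 < n → Ψ n ≡ divMonic (F n) (∏ Ψ (properDivisors n))
  Ψ-divMonic {suc n} 1<n with suc n ℕ.≤? 1
  ... | yes n≤1 = contradiction n≤1 (ℕₚ.<⇒≱ 1<n)
  ... | no  _   = ≡.cong (divMonic (F (suc n))) (≡.trans
          (≡.cong prodU (map-cong-local {xs = properDivisors (suc n)} (All.tabulate {P = λ d → ΨF n d ≡ Ψ d} λ i →
            let 0<d , _ , d<n = ∈-properDivisors⁻ {n = suc n} i in ΨF-fuel 0<d (ℕₚ.≤-pred d<n) ℕₚ.≤-refl)))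
          (prodU≡∏ Ψ (properDivisors (suc n))))

  ∏-Monic : ∀ {A : Set} (f : A → Poly) (g : A → ℕ) xs → (∀ {x} → x ∈ xs → LiterallyMonic (g x) (f x)) →
            LiterallyMonic (∑ g xs) (∏ f xs)
  ∏-Monic f g []       m = literallyMonic ≡.refl ≡.refl
  ∏-Monic f g (x ∷ xs) m = LiterallyMonic-mul (m (here ≡.refl)) (∏-Monic f g xs (m ∘ there))

  -- Coprimality of two polynomials over ℚ, with the denominators cleared.
  Coprimeℚ : Poly → Poly → Set
  Coprimeℚ A B = ∃[ N ] 0 < N × ∃[ u ] ∃[ v ] Z.ι N ≋ u Z.* A Z.+ v Z.* B

  Coprimeℚ-sym : ∀ {A B} → Coprimeℚ A B → Coprimeℚ B A
  Coprimeℚ-sym {A} {B} (N , 0<N , u , v , e) = N , 0<N , v , u , Z.trans e (Z.+-comm (u Z.* A) (v Z.* B))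

  Coprimeℚ-* : ∀ {A B C} → Coprimeℚ A B → Coprimeℚ A C → Coprimeℚ A (B Z.* C)
  Coprimeℚ-* {A} {B} {C} (M , 0<M , u , v , e) (N , 0<N , w , z , f) = M ℕ.* N , ℕₚ.*-mono-≤ 0<M 0<N ,
    u Z.* (w Z.* A Z.+ z Z.* C) Z.+ v Z.* B Z.* w , v Z.* z ,
    Z.trans (Z.ι-homo-* M N) (Z.trans (Z.*-cong e f)
      (Z.solve 7 (λ A B C u v w z → (u Z.:* A Z.:+ v Z.:* B) Z.:* (w Z.:* A Z.:+ z Z.:* C)
         Z.:= (u Z.:* (w Z.:* A Z.:+ z Z.:* C) Z.:+ v Z.:* B Z.:* w) Z.:* A Z.:+ (v Z.:* z) Z.:* (B Z.:* C))
             Z.refl A B C u v w z))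

  Coprimeℚ-1 : ∀ A → Coprimeℚ A Z.1#
  Coprimeℚ-1 A = 1 , s≤s z≤n , [] , Z.1# , Z.solve 1 (λ A → Z.con (+ 1) Z.:+ Z.con (+ 0)
    Z.:= Z.con (+ 0) Z.:* A Z.:+ Z.con (+ 1) Z.:* Z.con (+ 1)) Z.refl A

  ι≡+ : ∀ n → ℤR.ι n ≡ + n
  ι≡+ zero    = ≡.refl
  ι≡+ (suc n) = ≡.cong (ℤ.suc) (ι≡+ n)

  ι*-cancel : ∀ {N p} → 0 < N → Z.ι N Z.* p ≋ [] → p ≋ []
  ι*-cancel {suc N} {p} _ e = ext λ i → ℤₚ.*-cancelˡ-≡ (+ suc N) (coeff p i) 0ℤ (≡.trans
    (≡.trans (≡.cong (ℤ._* coeff p i) (≡.sym (ι≡+ (suc N)))) (≡.trans (≡.sym (coeff-scale (ℤR.ι (suc N)) p i))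
      (≡.trans (≡.sym (at (const-* (ℤR.ι (suc N)) p) i))
          (≡.trans (≡.sym (at (Z.*-congʳ {p} (const-ι (suc N))) i)) (at e i)))))
    (≡.sym (ℤₚ.*-zeroʳ (+ suc N))))

  -- Multiplying N = u A + v B by G shows that A B divides N G. Hence it divides N r for the
  -- remainder r of G modulo A B; the degree forces N r = 0, and N cancels over ℤ.
  Coprimeℚ-∣ : ∀ {d A B G} → Monic d (A Z.* B) → Coprimeℚ A B → A Z.∣ G → B Z.∣ G → (A Z.* B) Z.∣ G
  Coprimeℚ-∣ {d} {A} {B} {G} M (N , 0<N , u , v , e) (a , f) (b , g) = q ,
    Z.trans (Division.equality Dv) (Z.trans (Z.+-congˡ {q Z.* (A Z.* B)} r≋0) (Z.+-identityʳ (q Z.* (A Z.* B))))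
    where
    Dv = divide M G
    q = Division.quot Dv
    r = Division.rem Dv
    N*r : (u Z.* b Z.+ v Z.* a Z.- Z.ι N Z.* q) Z.* (A Z.* B) ≋ Z.ι N Z.* r
    N*r = Z.trans (Z.trans (Z.solve 8 (λ A B u v a b n q → (u Z.:* b Z.:+ v Z.:* a Z.:- n Z.:* q) Z.:* (A Z.:* B)
          Z.:= u Z.:* A Z.:* (b Z.:* B) Z.:+ v Z.:* B Z.:* (a Z.:* A) Z.:- n Z.:* (q Z.:* (A Z.:* B))) Z.refl A
              B u v a b (Z.ι N) q)
        (Z.+-congʳ {Z.- (Z.ι N Z.* (q Z.* (A Z.* B)))}
            (Z.+-cong (Z.*-congˡ {u Z.* A} (Z.sym g)) (Z.*-congˡ {v Z.* B} (Z.sym f)))))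
      (Z.trans (Z.trans (Z.solve 6 (λ A B u v G w → u Z.:* A Z.:* G Z.:+ v Z.:* B Z.:* G Z.:- w
          Z.:= (u Z.:* A Z.:+ v Z.:* B) Z.:* G Z.:- w) Z.refl A B u v G (Z.ι N Z.* (q Z.* (A Z.* B))))
        (Z.+-congʳ {Z.- (Z.ι N Z.* (q Z.* (A Z.* B)))} (Z.*-cong (Z.sym e) (Division.equality Dv))))
      (Z.solve 3 (λ n w r → n Z.:* (w Z.:+ r) Z.:- n Z.:* w Z.:= n Z.:* r) Z.refl (Z.ι N) (q Z.* (A Z.* B)) r))
    Deg<-N*r : Deg< (Z.ι N Z.* r) d
    Deg<-N*r = Deg<-cong {map (ℤR.ι N ℤ.*_) r} (Z.trans (Z.sym (const-* (ℤR.ι N) r)) (Z.*-congʳ {r} (Z.sym (const-ι N))))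
      (Deg<-scale {r} (ℤR.ι N) (Division.rem-deg Dv))
    r≋0 : r ≋ []
    r≋0 = ι*-cancel {N} 0<N (Z.trans (Z.sym N*r) (Z.*-congʳ {A Z.* B} {u Z.* b Z.+ v Z.* a Z.- Z.ι N Z.* q} {[]}
        (Monic-multiple-small M N*r Deg<-N*r)))

  ∏-∣ : ∀ {A : Set} (f : A → Poly) (g : A → ℕ) xs {G} → (∀ {x} → x ∈ xs → LiterallyMonic (g x) (f x)) →
        (∀ {x} → x ∈ xs → f x Z.∣ G) → AllPairs (λ x y → Coprimeℚ (f x) (f y)) xs → ∏ f xs Z.∣ G
  ∏-∣ f g []       {G} m d c        = G , Z.sym (Z.*-identityʳ G)
  ∏-∣ f g (x ∷ xs) {G} m d (cx ∷ c) =
    Coprimeℚ-∣ (isMonic (∏-Monic f g (x ∷ xs) m)) (coprime-∏ xs cx) (d (here ≡.refl)) (∏-∣ f g xs (m ∘ there) (d ∘ there) c)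
    where
    coprime-∏ : ∀ ys → All (λ y → Coprimeℚ (f x) (f y)) ys → Coprimeℚ (f x) (∏ f ys)
    coprime-∏ []       []       = Coprimeℚ-1 (f x)
    coprime-∏ (y ∷ ys) (p ∷ ps) = Coprimeℚ-* {f x} {f y} {∏ f ys} p (coprime-∏ ys ps)

  Unique⇒AllPairs : ∀ {A : Set} {R : A → A → Set} xs → Unique xs → (∀ {x y} → x ∈ xs → y ∈ xs → x ≢ y → R x y) → AllPairs R xs
  Unique⇒AllPairs []       []       r = []
  Unique⇒AllPairs (x ∷ xs) (x∉ ∷ u) r = All.tabulate (λ i → r (here ≡.refl) (there i) (All.lookup x∉ i))
    ∷ Unique⇒AllPairs xs u (λ i j → r (there i) (there j))

  -- These facts go through one strong induction: the division for n is exact only because the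
  -- product formula holds at smaller indices.
  record IsFibotomic (n : ℕ) : Set where
    constructor fibotomic
    field
      deg     : ℕ
      monic-Ψ : LiterallyMonic deg (Ψ n)
      F≋∏Ψ    : Z.fib X n ≋ ∏ Ψ (divisors n)
  open IsFibotomic

  module FibZ = Fibonacci polyRing X

  Monic-fib : ∀ n → Monic n (Z.fib X (suc n))
  Monic-fib n = Monic-cong (F≋fib (suc n)) (isMonic (LiterallyMonic-F n))

  Ψ∣fib : ∀ {n} → IsFibotomic n → Ψ n Z.∣ Z.fib X n
  Ψ∣fib {n} I = ∏ Ψ (properDivisors n) , Z.trans (F≋∏Ψ I) (Z.*-comm (Ψ n) _)

  -- Cancel fib g in fib-quot · fib g = fib n = Ψ n · fib g · (rest).
  Ψ∣fib-quot : ∀ {g h} → 1 < h → IsFibotomic (suc g) → IsFibotomic (h ℕ.* suc g) → Ψ (h ℕ.* suc g) Z.∣ Z.fib-quot X g h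
  Ψ∣fib-quot {g} {h} 1<h G I = rest , Monic-cancelʳ (Monic-fib g) {Z.fib-quot X g h} {rest Z.* Ψ n} (begin
    Z.fib-quot X g h Z.* Z.fib X (suc g)                ≈⟨ FibZ.F-multiple g h ⟨
    Z.fib X n                                           ≈⟨ F≋∏Ψ I ⟩
    ∏ Ψ (divisors n)                                    ≈⟨ ∏-↭ Ψ (divisors-split 0<n (ℕᵈ.n∣m*n h) g<n) ⟩
    Ψ n Z.* ∏ Ψ (divisors (suc g) ++ coDivisors (suc g) n)
      ≈⟨ Z.*-congˡ {Ψ n} (∏-++ Ψ (divisors (suc g)) (coDivisors (suc g) n)) ⟩
    Ψ n Z.* (∏ Ψ (divisors (suc g)) Z.* rest)           ≈⟨ Z.*-congˡ {Ψ n} (Z.*-congʳ {rest} (F≋∏Ψ G)) ⟨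
    Ψ n Z.* (Z.fib X (suc g) Z.* rest)
      ≈⟨ Z.solve 3 (λ a b c → a Z.:* (b Z.:* c) Z.:= (c Z.:* a) Z.:* b) Z.refl (Ψ n) (Z.fib X (suc g)) rest ⟩
    rest Z.* Ψ n Z.* Z.fib X (suc g)                    ∎)
    where
    open import Relation.Binary.Reasoning.Setoid Z.setoid
    n = h ℕ.* suc g
    rest = ∏ Ψ (coDivisors (suc g) n)
    g<n : suc g < n
    g<n = ≡.subst (_< n) (ℕₚ.*-identityˡ (suc g)) (ℕₚ.*-monoˡ-< (suc g) 1<h)
    0<n : 0 < n
    0<n = ℕₚ.<-trans (s≤s z≤n) g<n

  -- In ℤ[x] / (Ψ d , Ψ e) both F d and F e vanish, hence so do F (gcd d e)
  -- and F e / F (gcd d e); the latter is then e / gcd d e times a unit.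
  Ψ-coprime-< : ∀ {d e} → 0 < d → d < e → (∀ c → 0 < c → c ≤ d → IsFibotomic c) → IsFibotomic d → IsFibotomic e →
                Coprimeℚ (Ψ d) (Ψ e)
  Ψ-coprime-< {d} {e} 0<d d<e fibs Id Ie = unpack (gcd[m,n]∣n d e) (g≡ (gcd d e) ≡.refl)
    where
    T₁ = Quot polyRing (Ψ d)
    T = Quot T₁ (Ψ e)
    module T₁ = RingTheory T₁
    module T = RingTheory T
    module FibT = Fibonacci T X
    Fd≈0 : T.fib X d T.≈ T.0#
    Fd≈0 = up T₁ (∣⇒≈0 polyRing (Ψ∣fib Id))
    ∣e⇒≈0 : ∀ {a} → Ψ e Z.∣ a → a T.≈ T.0#
    ∣e⇒≈0 {a} (q , eq) = ∣⇒≈0 T₁ (q , up polyRing eq)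
    Fg≈0 : T.fib X (gcd d e) T.≈ T.0#
    Fg≈0 = FibT.F-gcd d e Fd≈0 (∣e⇒≈0 (Ψ∣fib Ie))
    g≤d : gcd d e ≤ d
    g≤d = ℕᵈ.∣⇒≤ {{ℕ.>-nonZero 0<d}} (gcd[m,n]∣m d e)
    g≡ : ∀ g → gcd d e ≡ g → ∃[ g′ ] gcd d e ≡ suc g′
    g≡ (suc g) eq = g , eq
    g≡ zero    eq = contradiction (≡.subst (ℕᵈ._∣ d) eq (gcd[m,n]∣m d e)) (λ z → ℕₚ.<-irrefl (≡.sym (ℕᵈ.0∣⇒≡0 z)) 0<d)
    unpack : gcd d e ℕᵈ.∣ e → ∃[ g′ ] gcd d e ≡ suc g′ → Coprimeℚ (Ψ d) (Ψ e)
    unpack (divides h e≡) (g , eq) = h , ℕₚ.<⇒≤ 1<h , result ι≈0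
      where
      e≡′ : e ≡ h ℕ.* suc g
      e≡′ = ≡.trans e≡ (≡.cong (h ℕ.*_) eq)
      1<h : 1 < h
      1<h = ℕₚ.≰⇒> λ h≤1 → ℕₚ.<⇒≱ d<e (ℕₚ.≤-trans (≡.subst (_≤ gcd d e) (≡.sym e≡)
        (≡.subst (h ℕ.* gcd d e ≤_) (ℕₚ.*-identityˡ _) (ℕₚ.*-monoˡ-≤ (gcd d e) h≤1))) g≤d)
      ι≈0 : T.ι h T.≈ T.0#
      ι≈0 = FibT.F-quot≈0 g h (T.trans (T.reflexive (≡.cong (Z.fib X) (≡.sym eq))) Fg≈0)
        (∣e⇒≈0 (≡.subst (λ n → Ψ n Z.∣ Z.fib-quot X g h) (≡.sym e≡′)
          (Ψ∣fib-quot 1<h (fibs (suc g) (s≤s z≤n) (≡.subst (_≤ d) eq g≤d)) (≡.subst IsFibotomic e≡′ Ie))))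
      -- Vanishing in the iterated quotient is by definition a Bézout relation, its two quotients
      -- being the coefficients of Ψ d and Ψ e.
      result : T.ι h T.≈ T.0# → ∃[ u ] ∃[ v ] Z.ι h ≋ u Z.* Ψ d Z.+ v Z.* Ψ e
      result (mk≈ v (mk≈ u eq′)) = u , v , Z.trans eq′
        (Z.solve 2 (λ a b → (Z.con (+ 0) Z.:+ a) Z.:+ b Z.:= b Z.:+ a) Z.refl (v Z.* Ψ e) (u Z.* Ψ d))

  isFibotomic : ∀ n → 0 < n → IsFibotomic n
  isFibotomic n 0<n = go n 0<n (<-wellFounded n)
    where
    go : ∀ n → 0 < n → Acc _<_ n → IsFibotomic n
    go 1 _ _ = fibotomic 0 (literallyMonic ≡.refl ≡.refl) (Z.sym (Z.*-identityʳ Z.1#))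
    go n@(suc (suc k)) 0<n (acc rec) = build quotient-exists
      where
      IH : ∀ {d} → d ∈ properDivisors n → IsFibotomic d
      IH {d} i = go d (proj₁ (∈-properDivisors⁻ {n = n} i)) (rec (proj₂ (proj₂ (∈-properDivisors⁻ {n = n} i))))
      degΨ : ℕ → ℕ
      degΨ d = ℕ.pred (length (Ψ d))
      lm : ∀ {d} → d ∈ properDivisors n → LiterallyMonic (degΨ d) (Ψ d)
      lm {d} i = ≡.subst (λ e → LiterallyMonic e (Ψ d)) (≡.sym (≡.cong ℕ.pred (len (monic-Ψ (IH i))))) (monic-Ψ (IH i))
      Π = ∏ Ψ (properDivisors n)
      coprime : ∀ {d e} → d ∈ properDivisors n → e ∈ properDivisors n → d ≢ e → Coprimeℚ (Ψ d) (Ψ e)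
      coprime {d} {e} i j d≢e with ℕₚ.<-cmp d e
      ... | tri< d<e _ _ = Ψ-coprime-< (proj₁ (∈-properDivisors⁻ {n = n} i)) d<e
              (λ c 0<c c≤d → go c 0<c (rec (ℕₚ.≤-<-trans c≤d (proj₂ (proj₂ (∈-properDivisors⁻ {n = n} i)))))) (IH i) (IH j)
      ... | tri≈ _ d≡e _ = contradiction d≡e d≢e
      ... | tri> _ _ e<d = Coprimeℚ-sym {Ψ e} {Ψ d} (Ψ-coprime-< (proj₁ (∈-properDivisors⁻ {n = n} j)) e<d
              (λ c 0<c c≤e → go c 0<c (rec (ℕₚ.≤-<-trans c≤e (proj₂ (proj₂ (∈-properDivisors⁻ {n = n} j)))))) (IH j) (IH i))
      quotient-exists : Π Z.∣ Z.fib X n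
      quotient-exists = ∏-∣ Ψ degΨ (properDivisors n) lm
        (λ i → Z.∣-trans (Ψ∣fib (IH i)) (FibZ.F-∣ (proj₁ (proj₂ (∈-properDivisors⁻ {n = n} i)))))
        (Unique⇒AllPairs (properDivisors n) (unique-properDivisors n) coprime)
      build : Π Z.∣ Z.fib X n → IsFibotomic n
      build (Q , eq) = fibotomic c (≡.subst (LiterallyMonic c) (≡.sym Ψ≡) lmQ)
          (Z.trans eq (Z.*-congʳ {Π} (Z.trans (Z.sym Q′≋Q) (Z.reflexive (≡.sym Ψ≡)))))
        where
        D = ∑ degΨ (properDivisors n)
        lmΠ : LiterallyMonic D Π
        lmΠ = ∏-Monic Ψ degΨ (properDivisors n) lm
        MQ = Monic-quotient (λ ()) {g = Z.fib X n} {q = Q} (isMonic lmΠ) (Monic-fib (suc k)) eq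
        c = proj₁ MQ
        -- The quotient found by divisibility is normalised to length c + 1, the length of the list
        -- that `Ψ n` computes to.
        Q′ = take (suc c) Q
        Q′≋Q : Q′ ≋ Q
        Q′≋Q = take-≋ (suc c) Q (Monic.deg (proj₂ (proj₂ MQ)))
        lmQ : LiterallyMonic c Q′
        lmQ = literallyMonic (length-take (suc c) Q) (≡.trans (at Q′≋Q c) (Monic.top (proj₂ (proj₂ MQ))))
        Ψ≡ : Ψ n ≡ Q′
        Ψ≡ = ≡.trans (Ψ-divMonic {n} (s≤s (s≤s z≤n))) (divMonic-exact lmΠ (length-take (suc c) Q)
          (≡.trans (len (LiterallyMonic-F (suc k))) (≡.cong suc (proj₁ (proj₂ MQ))))
          (Z.trans (F≋fib n) (Z.trans eq (Z.*-congʳ {Π} (Z.sym Q′≋Q)))))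

  -- The constant polynomial Ψ 1 accounts for the correction at n = 1.
  deg-Ψ : ∀ n (0<n : 0 < n) → deg (isFibotomic n 0<n) ℕ.+ [n≡1] n ≡ φ n
  deg-Ψ n 0<n = ≡.trans (≡.cong (ℕ._+ [n≡1] n) (≡.sym (degΨ≡ n 0<n)))
    (∑-divisors-injective (λ n → degΨ n ℕ.+ [n≡1] n) φ total n 0<n)
    where
    degΨ : ℕ → ℕ
    degΨ n = ℕ.pred (length (Ψ n))
    degΨ≡ : ∀ n (0<n : 0 < n) → degΨ n ≡ deg (isFibotomic n 0<n)
    degΨ≡ n 0<n = ≡.cong ℕ.pred (len (monic-Ψ (isFibotomic n 0<n)))
    total : ∀ n → 0 < n → ∑ (λ n → degΨ n ℕ.+ [n≡1] n) (divisors n) ≡ ∑ φ (divisors n)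
    total (suc n) 0<n = begin
      ∑ (λ n → degΨ n ℕ.+ [n≡1] n) (divisors (suc n))        ≡⟨ ∑-+ degΨ [n≡1] (divisors (suc n)) ⟩
      ∑ degΨ (divisors (suc n)) ℕ.+ ∑ [n≡1] (divisors (suc n))
        ≡⟨ ≡.cong₂ ℕ._+_ (Monic-unique (λ ()) (isMonic (∏-Monic Ψ degΨ (divisors (suc n)) lm))
             (Monic-cong (F≋∏Ψ (isFibotomic (suc n) 0<n)) (Monic-fib n))) (∑-[n≡1] (suc n) 0<n) ⟩
      n ℕ.+ 1                                                 ≡⟨ ℕₚ.+-comm n 1 ⟩
      suc n                                                   ≡⟨ gauss (suc n) 0<n ⟨
      ∑ φ (divisors (suc n))                                  ∎
      where
      open ≡.≡-Reasoning
      lm : ∀ {d} → d ∈ divisors (suc n) → LiterallyMonic (degΨ d) (Ψ d)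
      lm {d} i = ≡.subst (λ e → LiterallyMonic e (Ψ d)) (≡.sym (degΨ≡ d 0<d)) (monic-Ψ (isFibotomic d 0<d))
        where 0<d = proj₁ (∈-divisors⁻ 0<n i)

  Monic-Ψ : ∀ {n} → 1 < n → Monic (φ n) (Ψ n)
  Monic-Ψ {suc zero}    (s≤s ())
  Monic-Ψ {suc (suc n)} 1<n = ≡.subst (λ d → Monic d (Ψ (suc (suc n))))
    (≡.trans (≡.sym (ℕₚ.+-identityʳ _)) (deg-Ψ (suc (suc n)) (s≤s z≤n)))
        (isMonic (monic-Ψ (isFibotomic (suc (suc n)) (s≤s z≤n))))

open DivisorSums
open ExactDivision
open Fibotomic

-- Reduction modulo a prime

≈⇒IntCong : ∀ {n a b} → _≈[_]_ ℤR a (+ n) b → IntCong n a b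
≈⇒IntCong {n} {a} {b} e with q , eq ← ≈⇒∣- ℤR e = Signed.∣⇒∣ᵤ (Signed.divides q eq)

IntCong⇒≈ : ∀ {n a b} → IntCong n a b → _≈[_]_ ℤR a (+ n) b
IntCong⇒≈ {n} {a} {b} c with Signed.divides q eq ← Signed.∣ᵤ⇒∣ {+ n} {a ℤ.- b} c = ∣-⇒≈ ℤR (q , eq)

module _ {p : ℕ} (pr : Prime p) where
  private
    R = Quot ℤR (+ p)
    module R = RingTheory R
    instance
      p≢0 = prime⇒nonZero pr

    ι≡ : ∀ n → R.ι n ≡ + n
    ι≡ = ι≡+

    p≈0′ : R.ι p R.≈ R.0#
    p≈0′ = mk≈ 1ℤ (≡.trans (ι≡ p) (≡.sym (≡.trans (ℤₚ.+-identityˡ _) (ℤₚ.*-identityˡ (+ p)))))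

    dec : ∀ a b → Dec (a R.≈ b)
    dec a b = map′ IntCong⇒≈ ≈⇒IntCong (p ℕᵈ.∣? ℤ.∣ a ℤ.- b ∣)

    ι≈0⇒∣ : ∀ n → R.ι n R.≈ R.0# → p ℕᵈ.∣ n
    ι≈0⇒∣ n e = ≡.subst (λ z → p ℕᵈ.∣ ℤ.∣ z ∣) (ℤₚ.+-identityʳ (+ n)) (≈⇒IntCong (R.trans (R.reflexive (≡.sym (ι≡ n))) e))

    index′ : ℤ → Fin p
    index′ a = Fin.fromℕ< (ℤᵈ.n%ℕd<d a p)

    ι-index′ : ∀ a → R.ι (toℕ (index′ a)) R.≈ a
    ι-index′ a = R.sym (mk≈ (a ℤᵈ./ℕ p) (≡.trans (ℤᵈ.a≡a%ℕn+[a/ℕn]*n a p) (≡.cong (ℤ._+ (a ℤᵈ./ℕ p) ℤ.* + p)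
      (≡.trans (≡.cong +_ (≡.sym (Finₚ.toℕ-fromℕ< (ℤᵈ.n%ℕd<d a p)))) (≡.sym (ι≡ (toℕ (index′ a))))))))

    small : ∀ c → c < p → p ℕᵈ.∣ c → c ≡ 0
    small zero    _   _ = ≡.refl
    small (suc c) c<p d = contradiction d (ℕᵈ.>⇒∤ c<p)

    close : ∀ {a b} → b ≤ a → a < p → R.ι a R.≈ R.ι b → a ≡ b
    close {a} {b} b≤a a<p e = ℕₚ.≤-antisym (ℕₚ.m∸n≡0⇒m≤n (small (a ℕ.∸ b) (ℕₚ.≤-<-trans (ℕₚ.m∸n≤m a b) a<p) (ι≈0⇒∣ (a ℕ.∸ b)
      (R.trans (R.sym (R.x+y-y (R.ι (a ℕ.∸ b)) (R.ι b))) (R.trans (R.+-congʳ (R.trans (R.sym (R.ι-homo-+ (a ℕ.∸ b) b))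
        (R.reflexive (≡.cong R.ι (ℕₚ.m∸n+n≡m b≤a))))) (R.x≈y⇒x-y≈0 e)))))) b≤a

    ι-injective′ : ∀ (i j : Fin p) → R.ι (toℕ i) R.≈ R.ι (toℕ j) → i ≡ j
    ι-injective′ i j e with ℕₚ.≤-total (toℕ i) (toℕ j)
    ... | inj₁ i≤j = Finₚ.toℕ-injective (≡.sym (close i≤j (Finₚ.toℕ<n j) (R.sym e)))
    ... | inj₂ j≤i = Finₚ.toℕ-injective (close j≤i (Finₚ.toℕ<n i) e)

    invertible : ∀ i → i < p → i ≢ 0 → ∃[ b ] b R.* R.ι i R.≈ R.1#
    invertible i i<p i≢0 with Coprimality.coprime-Bézout
        (Coprimality.sym (Coprimality.prime⇒coprime pr {{ℕ.≢-nonZero i≢0}} i<p))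
    ... | Bézout.Identity.+- x y eq = R.ι x , (begin
            R.ι x R.* R.ι i               ≈⟨ R.ι-homo-* x i ⟨
            R.ι (x ℕ.* i)                 ≡⟨ ≡.cong R.ι eq ⟨
            R.ι (1 ℕ.+ y ℕ.* p)           ≈⟨ R.+-congˡ {R.1#} (y*p y) ⟩
            R.1# R.+ R.0#                 ≈⟨ R.+-identityʳ R.1# ⟩
            R.1#                          ∎)
      where
      open import Relation.Binary.Reasoning.Setoid R.setoid
      y*p : ∀ y → R.ι (y ℕ.* p) R.≈ R.0#
      y*p y = R.trans (R.ι-homo-* y p) (R.trans (R.*-congˡ {R.ι y} p≈0′) (R.zeroʳ (R.ι y)))
    ... | Bézout.Identity.-+ x y eq = R.- R.ι x , (begin
            R.- R.ι x R.* R.ι i        ≈⟨ R.solve 2 (λ a b → (R.:- a) R.:* b R.:= R.con 1ℤ R.:-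
                (R.con 1ℤ R.:+ a R.:* b)) R.refl (R.ι x) (R.ι i) ⟩
            R.1# R.- (R.1# R.+ R.ι x R.* R.ι i)
              ≈⟨ R.+-congˡ {R.1#} (R.-‿cong (R.+-congˡ {R.1#} (R.ι-homo-* x i))) ⟨
            R.1# R.- R.ι (1 ℕ.+ x ℕ.* i)   ≡⟨ ≡.cong (λ k → R.1# R.- R.ι k) eq ⟩
            R.1# R.- R.ι (y ℕ.* p)        ≈⟨ R.+-congˡ {R.1#}
                (R.-‿cong (R.trans (R.ι-homo-* y p) (R.trans (R.*-congˡ {R.ι y} p≈0′) (R.zeroʳ (R.ι y))))) ⟩
            R.1# R.- R.0#                 ≈⟨ R.solve 0 (R.con 1ℤ R.:- R.con 0ℤ R.:= R.con 1ℤ) R.refl ⟩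
            R.1#                          ∎)
      where
      open import Relation.Binary.Reasoning.Setoid R.setoid

    inverse′ : ∀ a → ¬ a R.≈ R.0# → ∃[ b ] b R.* a R.≈ R.1#
    inverse′ a a≉0 = proj₁ I , R.trans (R.*-congˡ {proj₁ I} (R.sym (ι-index′ a))) (proj₂ I)
      where
      I = invertible (toℕ (index′ a)) (Finₚ.toℕ<n (index′ a))
        (λ e → a≉0 (R.trans (R.sym (ι-index′ a)) (R.reflexive (≡.cong R.ι e))))

  ZMod : PrimeField p
  ZMod = record
    { R = R ; prime = pr ; _≟_ = dec
    ; 1≉0 = λ e → ℕₚ.<⇒≢ (ℕ.nonTrivial⇒n>1 p {{prime⇒nonTrivial pr}}) (≡.sym (ℕᵈ.∣1⇒≡1 (≈⇒IntCong e)))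
    ; inverse = inverse′ ; p≈0 = p≈0′ ; index = index′ ; ι-index = ι-index′ ; ι-injective = ι-injective′ }

  ι≈0⇒p∣ : ∀ n → R.ι n R.≈ R.0# → p ℕᵈ.∣ n
  ι≈0⇒p∣ = ι≈0⇒∣

-- Separates, inside F_{p^(j+1) n}, the factors Ψ_{p^(j+1) d} with d dividing n from those already
-- present in F_{p^j n}.
divisors-p^ : ∀ {p} → Prime p → ∀ j n → 0 < n → Coprime p n →
  divisors (p ℕ.^ suc j ℕ.* n) ↭ map (p ℕ.^ suc j ℕ.*_) (divisors n) ++ divisors (p ℕ.^ j ℕ.* n)
divisors-p^ {p} pr j n 0<n cop = unique-↭ (unique-divisors (P ℕ.* n))
  (Unique.++⁺ (Unique.map⁺ (λ {x} {y} → ℕₚ.*-cancelˡ-≡ x y P) (unique-divisors n))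
      (unique-divisors (p ℕ.^ j ℕ.* n)) disjoint) to from
  where
  P = p ℕ.^ suc j
  instance
    p≢0 = prime⇒nonZero pr
    P≢0 : ℕ.NonZero P
    P≢0 = ℕ.>-nonZero (ℕₚ.m^n>0 p (suc j))
    n≢0 : ℕ.NonZero n
    n≢0 = ℕ.>-nonZero 0<n
    q≢0 : ℕ.NonZero (p ℕ.^ j)
    q≢0 = ℕ.>-nonZero (ℕₚ.m^n>0 p j)
  0<Pn : 0 < P ℕ.* n
  0<Pn = ℕₚ.*-mono-≤ (ℕₚ.m^n>0 p (suc j)) 0<n
  0<qn : 0 < p ℕ.^ j ℕ.* n
  0<qn = ℕₚ.*-mono-≤ (ℕₚ.m^n>0 p j) 0<n
  disjoint : ∀ {x} → ¬ (x ∈ map (P ℕ.*_) (divisors n) × x ∈ divisors (p ℕ.^ j ℕ.* n))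
  disjoint (a , b) with d , d∈ , ≡.refl ← ∈-map⁻ (P ℕ.*_) a = ℕₚ.<⇒≢ (ℕ.nonTrivial⇒n>1 p {{prime⇒nonTrivial pr}})
    (≡.sym (cop (ℕᵈ.∣-refl , ℕᵈ.*-cancelˡ-∣ (p ℕ.^ j)
        (ℕᵈ.∣-trans (ℕᵈ.∣-trans (ℕᵈ.∣-reflexive (ℕₚ.*-comm (p ℕ.^ j) p)) (ℕᵈ.m∣m*n d))
        (proj₂ (∈-divisors⁻ 0<qn b))))))
  -- If x = y e divides p^(j+1) n and p ∤ e, then x divides p^j n or p^(j+1) ∣ x.
  dichotomy : ∀ j x → x ℕᵈ.∣ p ℕ.^ suc j ℕ.* n → (∃[ d ] d ℕᵈ.∣ n × x ≡ p ℕ.^ suc j ℕ.* d) ⊎ x ℕᵈ.∣ p ℕ.^ j ℕ.* n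
  dichotomy j x x∣ with p ℕᵈ.∣? x
  ... | no p∤x = inj₂ (Coprimality.coprime-divisor (Coprimality.sym cop′)
          (≡.subst (x ℕᵈ.∣_) (ℕₚ.*-assoc p (p ℕ.^ j) n) x∣))
    where
    cop′ : Coprime p x
    cop′ {d} (d∣p , d∣x) with prime⇒irreducible pr d∣p
    ... | inj₁ d≡1 = d≡1
    ... | inj₂ ≡.refl = contradiction d∣x p∤x
  dichotomy zero x x∣ | yes (divides y ≡.refl) = inj₁
      (y , ℕᵈ.*-cancelˡ-∣ p (≡.subst₂ ℕᵈ._∣_ (ℕₚ.*-comm y p) (≡.cong (ℕ._* n) (ℕₚ.*-identityʳ p)) x∣)
      , ≡.trans (ℕₚ.*-comm y p) (≡.cong (ℕ._* y) (≡.sym (ℕₚ.*-identityʳ p))))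
  dichotomy (suc j) x x∣ | yes (divides y ≡.refl)
    with dichotomy j y (ℕᵈ.*-cancelˡ-∣ p (≡.subst₂ ℕᵈ._∣_ (ℕₚ.*-comm y p) (ℕₚ.*-assoc p (p ℕ.^ suc j) n) x∣))
  ... | inj₁ (d , d∣n , ≡.refl) = inj₁ (d , d∣n , ≡.trans (ℕₚ.*-comm _ p) (≡.sym (ℕₚ.*-assoc p (p ℕ.^ suc j) d)))
  ... | inj₂ y∣ = inj₂ (≡.subst₂ ℕᵈ._∣_ (ℕₚ.*-comm p y) (≡.sym (ℕₚ.*-assoc p (p ℕ.^ j) n)) (ℕᵈ.*-monoʳ-∣ p y∣))
  to : ∀ {x} → x ∈ divisors (P ℕ.* n) → x ∈ map (P ℕ.*_) (divisors n) ++ divisors (p ℕ.^ j ℕ.* n)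
  to {x} i with dichotomy j x (proj₂ (∈-divisors⁻ 0<Pn i))
  ... | inj₁ (d , d∣n , ≡.refl) = ∈-++⁺ˡ (∈-map⁺ (P ℕ.*_) (∈-divisors⁺ 0<n d∣n))
  ... | inj₂ x∣ = ∈-++⁺ʳ (map (P ℕ.*_) (divisors n)) (∈-divisors⁺ 0<qn x∣)
  from : ∀ {x} → x ∈ map (P ℕ.*_) (divisors n) ++ divisors (p ℕ.^ j ℕ.* n) → x ∈ divisors (P ℕ.* n)
  from i with ∈-++⁻ (map (P ℕ.*_) (divisors n)) i
  ... | inj₁ a with d , d∈ , ≡.refl ← ∈-map⁻ (P ℕ.*_) a = ∈-divisors⁺ 0<Pn (ℕᵈ.*-monoʳ-∣ P (proj₂ (∈-divisors⁻ 0<n d∈)))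
  ... | inj₂ b = ∈-divisors⁺ 0<Pn (ℕᵈ.∣-trans (proj₂ (∈-divisors⁻ 0<qn b)) (ℕᵈ.*-monoˡ-∣ n (ℕᵈ.n∣m*n p)))

-- The difference of Gauss's identities for p^(j+1) and p^j, written as a sum to avoid truncated
-- subtraction.
φ-p^ : ∀ {p} → Prime p → ∀ j → φ (p ℕ.^ suc j) ℕ.+ p ℕ.^ j ≡ p ℕ.^ suc j
φ-p^ {p} pr j = ≡.trans (≡.cong (φ P ℕ.+_) (≡.sym gauss-j)) (≡.trans (≡.sym split) (gauss P 0<P))
  where
  P = p ℕ.^ suc j
  instance p≢0 = prime⇒nonZero pr
  0<P : 0 < P
  0<P = ℕₚ.m^n>0 p (suc j)
  *1 : ∀ k → k ℕ.* 1 ≡ k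
  *1 = ℕₚ.*-identityʳ
  gauss-j : ∑ φ (divisors (p ℕ.^ j)) ≡ p ℕ.^ j
  gauss-j = gauss (p ℕ.^ j) (ℕₚ.m^n>0 p j)
  split : ∑ φ (divisors P) ≡ φ P ℕ.+ ∑ φ (divisors (p ℕ.^ j))
  split = ≡.trans (≡.cong (λ k → ∑ φ (divisors k)) (≡.sym (*1 P)))
    (≡.trans (∑-↭ φ (divisors-p^ pr j 1 (s≤s z≤n) (λ (_ , d∣1) → ℕᵈ.∣1⇒≡1 d∣1)))
      (≡.cong₂ (λ a b → φ a ℕ.+ ∑ φ (divisors b)) (*1 P) (*1 (p ℕ.^ j))))

module ModP {p : ℕ} (pr : Prime p) where
  K : PrimeField p
  K = ZMod pr
  module K = RingTheory (PrimeField.R K)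
  open FieldPolynomial K public
  open ListProduct P.*-commutativeMonoid public

  private
    instance
      p≢0 = prime⇒nonZero pr

  -- Polynomials modulo p are the same integer lists under a coarser equality. Reduction is
  -- therefore the identity on lists, and `Ψ n` also denotes its own reduction.
  reduce : ∀ {f g} → Polynomial._≋_ ℤR f g → f ≋ g
  reduce e = ext λ i → K.reflexive (Polynomial.at e i)

  reduce-Monic : ∀ {d f} → Polynomial.Monic ℤR d f → Monic d f
  reduce-Monic (Polynomial.monic D t) = monic (λ i l → K.reflexive (D i l)) (K.reflexive t)

  reduce-∣ : ∀ {f g} → Z._∣_ f g → f P.∣ g
  reduce-∣ (q , e) = q , reduce e

  ∏-^ : ∀ {A : Set} (f : A → Poly) n xs → ∏ (λ x → f x P.^ n) xs ≋ ∏ f xs P.^ n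
  ∏-^ f n []       = P.sym (P.1^ n)
  ∏-^ f n (x ∷ xs) = P.trans (P.*-congˡ {f x P.^ n} (∏-^ f n xs)) (P.sym (P.^-distrib-* (f x) (∏ f xs) n))

  fib : ℕ → Poly
  fib = P.fib X

  Monic-fibₚ : ∀ n → Monic n (fib (suc n))
  Monic-fibₚ n = reduce-Monic (Monic-fib n)

  module Fibₚ = Fibonacci polyRing X
  module Quadₚ = Quadratic polyRing X

  disc : Poly
  disc = P.disc X

  Monic-disc : Monic 2 disc
  Monic-disc = Monic-cong (P.+-comm (P.ι 4) (X P.* X)) (monic
      (λ i 3≤i → K.trans (coeff-add (P.ι 4) (X P.* X) i)
          (K.trans (K.+-cong (const-high i (ℕₚ.<⇒≤ 3≤i)) (Monic.deg XX i 3≤i)) (K.+-identityˡ K.0#)))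
      (K.trans (coeff-add (P.ι 4) (X P.* X) 2) (K.trans (K.+-cong (const-high 2 (s≤s (s≤s z≤n))) (Monic.top XX))
          (K.+-identityˡ K.1#))))
    where
    XX = Monic-mul Monic-X Monic-X
    const-high : ∀ i → 2 ≤ i → coeff (P.ι 4) i K.≈ K.0#
    const-high (suc zero)    (s≤s ())
    const-high (suc (suc i)) _ = at (const-ι 4) (suc (suc i))

  -- The factor `disc` left over from the descent is monic, hence cancellable, also in
  -- characteristic 2.
  fib-*p : ∀ n → fib (p ℕ.* n) ≋ fib n P.^ p P.* fib p
  fib-*p n = Monic-cancelʳ Monic-disc {fib (p ℕ.* n)} {fib n P.^ p P.* fib p} (Quadₚ.fib-*p′ pr P-p≈0 n)

  fib-p-odd : ∀ s → p ≡ suc (2 ℕ.* s) → fib p ≋ disc P.^ s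
  fib-p-odd s eq = Monic-cancelʳ Monic-disc {fib p} {disc P.^ s} (Quadₚ.fib-p-odd′ pr P-p≈0 s eq)

  fib-*p^ : ∀ k n → fib (p ℕ.^ k ℕ.* n) ≋ fib n P.^ (p ℕ.^ k) P.* fib (p ℕ.^ k)
  fib-*p^ zero    n = P.trans (P.reflexive (≡.cong fib (ℕₚ.*-identityˡ n)))
    (P.solve 1 (λ a → a P.:= (a P.:* P.con 1ℤ) P.:* P.con 1ℤ) P.refl (fib n))
  fib-*p^ (suc k) n = begin
    fib (p ℕ.* q ℕ.* n)                                      ≡⟨ ≡.cong fib (ℕₚ.*-assoc p q n) ⟩
    fib (p ℕ.* (q ℕ.* n))                                    ≈⟨ fib-*p (q ℕ.* n) ⟩
    fib (q ℕ.* n) P.^ p P.* fib p                            ≈⟨ P.*-congʳ {fib p} (P.^-congˡ p (fib-*p^ k n)) ⟩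
    (fib n P.^ q P.* fib q) P.^ p P.* fib p                  ≈⟨ P.*-congʳ {fib p} (P.^-distrib-* (fib n P.^ q) (fib q) p) ⟩
    (fib n P.^ q) P.^ p P.* fib q P.^ p P.* fib p            ≈⟨ P.*-assoc ((fib n P.^ q) P.^ p) (fib q P.^ p) (fib p) ⟩
    (fib n P.^ q) P.^ p P.* (fib q P.^ p P.* fib p)
      ≈⟨ P.*-cong (P.trans (P.^-assoc (fib n) q p) (P.reflexive (≡.cong (fib n P.^_) (ℕₚ.*-comm q p)))) (P.sym (fib-*p q)) ⟩
    fib n P.^ (p ℕ.* q) P.* fib (p ℕ.* q)                    ∎
    where
    open import Relation.Binary.Reasoning.Setoid P.setoid
    q = p ℕ.^ k

  F≋∏Ψₚ : ∀ {n} → 0 < n → fib n ≋ ∏ Ψ (divisors n)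
  F≋∏Ψₚ {n} 0<n = reduce (IsFibotomic.F≋∏Ψ (isFibotomic n 0<n))

  Monic-Ψ′ : ∀ {n} → 0 < n → ∃[ d ] Monic d (Ψ n)
  Monic-Ψ′ {n} 0<n = _ , reduce-Monic (LiterallyMonic.isMonic (IsFibotomic.monic-Ψ (isFibotomic n 0<n)))

  ∏-Monicₚ : ∀ {A : Set} (f : A → Poly) xs → (∀ {x} → x ∈ xs → ∃[ d ] Monic d (f x)) → ∃[ d ] Monic d (∏ f xs)
  ∏-Monicₚ f []       m = 0 , Monic-1
  ∏-Monicₚ f (x ∷ xs) m = _ , Monic-mul (proj₂ (m (here ≡.refl))) (proj₂ (∏-Monicₚ f xs (m ∘ there)))

  fib-p^-suc : ∀ j n → 0 < n → Coprime p n →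
    fib (p ℕ.^ suc j ℕ.* n) ≋ ∏ (λ d → Ψ (p ℕ.^ suc j ℕ.* d)) (divisors n) P.* fib (p ℕ.^ j ℕ.* n)
  fib-p^-suc j n 0<n cop = begin
    fib (P ℕ.* n)                                            ≈⟨ F≋∏Ψₚ (ℕₚ.*-mono-≤ (ℕₚ.m^n>0 p (suc j)) 0<n) ⟩
    ∏ Ψ (divisors (P ℕ.* n))                                 ≈⟨ ∏-↭ Ψ (divisors-p^ pr j n 0<n cop) ⟩
    ∏ Ψ (map (P ℕ.*_) (divisors n) ++ divisors (p ℕ.^ j ℕ.* n))
      ≈⟨ ∏-++ Ψ (map (P ℕ.*_) (divisors n)) (divisors (p ℕ.^ j ℕ.* n)) ⟩
    ∏ Ψ (map (P ℕ.*_) (divisors n)) P.* ∏ Ψ (divisors (p ℕ.^ j ℕ.* n))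
      ≈⟨ P.*-cong (∏-map Ψ (P ℕ.*_) (divisors n)) (P.sym (F≋∏Ψₚ (ℕₚ.*-mono-≤ (ℕₚ.m^n>0 p j) 0<n))) ⟩
    ∏ (λ d → Ψ (P ℕ.* d)) (divisors n) P.* fib (p ℕ.^ j ℕ.* n) ∎
    where
    open import Relation.Binary.Reasoning.Setoid P.setoid
    P = p ℕ.^ suc j

  Ψ-p^ : ∀ j → fib (p ℕ.^ suc j) ≋ Ψ (p ℕ.^ suc j) P.* fib (p ℕ.^ j)
  Ψ-p^ j = P.trans (P.reflexive (≡.cong fib (≡.sym (*1 (p ℕ.^ suc j)))))
      (P.trans (fib-p^-suc j 1 (s≤s z≤n) (λ (_ , d∣1) → ℕᵈ.∣1⇒≡1 d∣1))
    (P.*-cong (P.trans (P.*-identityʳ (Ψ (p ℕ.^ suc j ℕ.* 1))) (P.reflexive (≡.cong Ψ (*1 (p ℕ.^ suc j)))))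
        (P.reflexive (≡.cong fib (*1 (p ℕ.^ j))))))
    where
    *1 : ∀ k → k ℕ.* 1 ≡ k
    *1 = ℕₚ.*-identityʳ

  -- Dividing F_n^(p^(j+1)) F_{p^(j+1)} by F_n^(p^j) F_{p^j} leaves F_n^φ(p^(j+1)) Ψ_{p^(j+1)}. The
  -- first factor spreads over the divisors of n, and the second is booked at the divisor 1.
  ∏Ψ-p^ : ∀ j n → 0 < n → Coprime p n → ∏ (λ d → Ψ (p ℕ.^ suc j ℕ.* d)) (divisors n)
            ≋ ∏ (λ d → Ψ d P.^ φ (p ℕ.^ suc j) P.* atOne (Ψ (p ℕ.^ suc j)) d) (divisors n)
  ∏Ψ-p^ j n@(suc n′) 0<n cop = Monic-cancelʳ (Monic-mul (Monic-^ q (Monic-fibₚ n′)) Mq) {LHS} {RHS} (begin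
    LHS P.* (fib n P.^ q P.* fib q)               ≈⟨ P.*-congˡ {LHS} (fib-*p^ j n) ⟨
    LHS P.* fib (q ℕ.* n)                         ≈⟨ fib-p^-suc j n 0<n cop ⟨
    fib (p ℕ.^ suc j ℕ.* n)                       ≈⟨ fib-*p^ (suc j) n ⟩
    fib n P.^ (p ℕ.^ suc j) P.* fib (p ℕ.^ suc j)
      ≈⟨ P.*-cong (P.trans (P.reflexive (≡.cong (fib n P.^_) (≡.sym (φ-p^ pr j))))
          (P.^-homo-+ (fib n) (φ (p ℕ.^ suc j)) q)) (Ψ-p^ j) ⟩
    (fib n P.^ φ (p ℕ.^ suc j) P.* fib n P.^ q) P.* (Ψ (p ℕ.^ suc j) P.* fib q)
      ≈⟨ P.solve 4 (λ a b c d → (a P.:* b) P.:* (c P.:* d) P.:= (a P.:* c) P.:* (b P.:* d)) P.refl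
           (fib n P.^ φ (p ℕ.^ suc j)) (fib n P.^ q) (Ψ (p ℕ.^ suc j)) (fib q) ⟩
    (fib n P.^ φ (p ℕ.^ suc j) P.* Ψ (p ℕ.^ suc j)) P.* (fib n P.^ q P.* fib q)
      ≈⟨ P.*-congʳ {fib n P.^ q P.* fib q} (P.trans (P.*-cong
           (P.trans (P.^-congˡ (φ (p ℕ.^ suc j)) (F≋∏Ψₚ 0<n)) (P.sym (∏-^ Ψ (φ (p ℕ.^ suc j)) (divisors n))))
           (P.sym (∏-atOne (Ψ (p ℕ.^ suc j)) (unique-divisors n) (∈-divisors⁺ 0<n (ℕᵈ.1∣ n)))))
           (P.sym (∏-∙ (λ d → Ψ d P.^ φ (p ℕ.^ suc j)) (atOne (Ψ (p ℕ.^ suc j))) (divisors n)))) ⟩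
    RHS P.* (fib n P.^ q P.* fib q)               ∎)
    where
    open import Relation.Binary.Reasoning.Setoid P.setoid
    q = p ℕ.^ j
    LHS = ∏ (λ d → Ψ (p ℕ.^ suc j ℕ.* d)) (divisors n)
    RHS = ∏ (λ d → Ψ d P.^ φ (p ℕ.^ suc j) P.* atOne (Ψ (p ℕ.^ suc j)) d) (divisors n)
    Mq : Monic (ℕ.pred q) (fib q)
    Mq = ≡.subst (λ k → Monic (ℕ.pred q) (fib k)) (ℕₚ.suc-pred q {{ℕ.>-nonZero (ℕₚ.m^n>0 p j)}}) (Monic-fibₚ (ℕ.pred q))

  -- Both sides, as functions of m, have the same products over the divisors
  -- of every number prime to p.
  Ψ-p^-reduction : ∀ k m → 1 < m → Coprime p m → Ψ (p ℕ.^ k ℕ.* m) ≋ Ψ m P.^ φ (p ℕ.^ k)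
  Ψ-p^-reduction zero    m 1<m cop = P.trans (P.reflexive (≡.cong Ψ (ℕₚ.*-identityˡ m))) (P.sym (P.*-identityʳ (Ψ m)))
  Ψ-p^-reduction (suc j) m 1<m cop = P.trans (go m (ℕₚ.<⇒≤ 1<m) cop (<-wellFounded m)) (B≋ m 1<m)
    where
    A B : ℕ → Poly
    A d = Ψ (p ℕ.^ suc j ℕ.* d)
    B d = Ψ d P.^ φ (p ℕ.^ suc j) P.* atOne (Ψ (p ℕ.^ suc j)) d
    B≋ : ∀ m → 1 < m → B m ≋ Ψ m P.^ φ (p ℕ.^ suc j)
    B≋ m 1<m = P.trans (P.*-congˡ {Ψ m P.^ φ (p ℕ.^ suc j)} (P.reflexive (atOne->1 (Ψ (p ℕ.^ suc j)) 1<m)))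
      (P.*-identityʳ (Ψ m P.^ φ (p ℕ.^ suc j)))
    go : ∀ n → 0 < n → Coprime p n → Acc _<_ n → A n ≋ B n
    go n 0<n cop (acc rec) = Monic-cancelʳ (proj₂ MA) {A n} {B n} (P.trans (∏Ψ-p^ j n 0<n cop)
        (P.*-congˡ {B n} (P.sym (∏-cong (properDivisors n) below))))
      where
      MA : ∃[ d ] Monic d (∏ A (properDivisors n))
      MA = ∏-Monicₚ A (properDivisors n) λ i → Monic-Ψ′
          (ℕₚ.*-mono-≤ (ℕₚ.m^n>0 p (suc j)) (proj₁ (∈-properDivisors⁻ {n = n} i)))
      below : ∀ {d} → d ∈ properDivisors n → A d ≋ B d
      below {d} i = go d (proj₁ I) (λ (a , b) → cop (a , ℕᵈ.∣-trans b (proj₁ (proj₂ I)))) (rec (proj₂ (proj₂ I)))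
        where I = ∈-properDivisors⁻ {n = n} i

  Monic-Ψₚ : ∀ {n} → 1 < n → Monic (φ n) (Ψ n)
  Monic-Ψₚ 1<n = reduce-Monic (Monic-Ψ 1<n)

  1<p^k*m : ∀ k {m} → 1 < m → 1 < p ℕ.^ k ℕ.* m
  1<p^k*m k 1<m = ℕₚ.*-mono-≤ (ℕₚ.m^n>0 p k) 1<m

  -- This case of the multiplicativity of φ falls out of comparing degrees in `Ψ-p^-reduction`.
  φ-p^-* : ∀ k m → 1 < m → Coprime p m → φ (p ℕ.^ k ℕ.* m) ≡ φ (p ℕ.^ k) ℕ.* φ m
  φ-p^-* k m 1<m cop = Monic-unique 1≉0 (Monic-cong (Ψ-p^-reduction k m 1<m cop) (Monic-Ψₚ (1<p^k*m k 1<m)))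
      (Monic-^ (φ (p ℕ.^ k)) (Monic-Ψₚ 1<m))

  fib-p^-odd : ∀ s → p ≡ suc (2 ℕ.* s) → ∀ k → ∃[ t ] p ℕ.^ k ≡ suc (2 ℕ.* t) × fib (p ℕ.^ k) ≋ disc P.^ t
  fib-p^-odd s p≡ zero    = 0 , ≡.refl , P.refl
  fib-p^-odd s p≡ (suc k) = t ℕ.* p ℕ.+ s , eq , (begin
      fib (p ℕ.* q)                       ≈⟨ fib-*p q ⟩
      fib q P.^ p P.* fib p               ≈⟨ P.*-cong (P.^-congˡ p e) (fib-p-odd s p≡) ⟩
      (disc P.^ t) P.^ p P.* disc P.^ s   ≈⟨ P.*-congʳ {disc P.^ s} (P.^-assoc disc t p) ⟩
      disc P.^ (t ℕ.* p) P.* disc P.^ s   ≈⟨ P.^-homo-+ disc (t ℕ.* p) s ⟨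
      disc P.^ (t ℕ.* p ℕ.+ s)            ∎)
    where
    open import Relation.Binary.Reasoning.Setoid P.setoid
    q = p ℕ.^ k
    IH = fib-p^-odd s p≡ k
    t = proj₁ IH
    q≡ : q ≡ suc (2 ℕ.* t)
    q≡ = proj₁ (proj₂ IH)
    e : fib q ≋ disc P.^ t
    e = proj₂ (proj₂ IH)
    eq : p ℕ.* q ≡ suc (2 ℕ.* (t ℕ.* p ℕ.+ s))
    eq = ≡.trans (≡.cong (p ℕ.*_) q≡) (≡.trans (N.solve 2
        (λ p t → p N.:* (N.con 1 N.:+ N.con 2 N.:* t) N.:= p N.:+ N.con 2 N.:* (t N.:* p)) ≡.refl p t)
      (≡.trans (≡.cong (ℕ._+ 2 ℕ.* (t ℕ.* p)) p≡) (N.solve 3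
          (λ p t s → (N.con 1 N.:+ N.con 2 N.:* s) N.:+ N.con 2 N.:* (t N.:* p)
         N.:= N.con 1 N.:+ N.con 2 N.:* (t N.:* p N.:+ s)) ≡.refl p t s)))
      where module N = +-*-Solver

  cancel-power : ∀ {a d f} → Monic d f → ∀ m n → f P.^ (m ℕ.+ n) ≋ a P.* f P.^ n → f P.^ m ≋ a
  cancel-power {a} {d} {f} M m n e = Monic-cancelʳ (Monic-^ n M) {f P.^ m} {a} (P.trans (P.sym (P.^-homo-+ f m n)) e)

  Ψ-prime-power-odd : ∀ s → p ≡ suc (2 ℕ.* s) → ∀ j → ∃[ c ] φ (p ℕ.^ suc j) ≡ 2 ℕ.* c × Ψ (p ℕ.^ suc j) ≋ disc P.^ c
  Ψ-prime-power-odd s p≡ j =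
    u ℕ.∸ t , φ≡ , P.sym (cancel-power {Ψ (p ℕ.^ suc j)} Monic-disc (u ℕ.∸ t) t
      (P.trans (P.reflexive (≡.cong (disc P.^_) (ℕₚ.m∸n+n≡m t≤u)))
          (P.trans (P.sym f) (P.trans (Ψ-p^ j) (P.*-congˡ {Ψ (p ℕ.^ suc j)} e)))))
    where
    lower = fib-p^-odd s p≡ j
    upper = fib-p^-odd s p≡ (suc j)
    t = proj₁ lower
    u = proj₁ upper
    q≡ = proj₁ (proj₂ lower)
    r≡ = proj₁ (proj₂ upper)
    e = proj₂ (proj₂ lower)
    f = proj₂ (proj₂ upper)
    φ+ : φ (p ℕ.^ suc j) ℕ.+ 2 ℕ.* t ≡ 2 ℕ.* u
    φ+ = ℕₚ.suc-injective (≡.trans (≡.sym (ℕₚ.+-suc _ (2 ℕ.* t)))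
        (≡.trans (≡.cong (φ (p ℕ.^ suc j) ℕ.+_) (≡.sym q≡)) (≡.trans (φ-p^ pr j) r≡)))
    t≤u : t ≤ u
    t≤u = ℕₚ.*-cancelˡ-≤ 2 (≡.subst (2 ℕ.* t ≤_) φ+ (ℕₚ.m≤n+m (2 ℕ.* t) (φ (p ℕ.^ suc j))))
    φ≡ : φ (p ℕ.^ suc j) ≡ 2 ℕ.* (u ℕ.∸ t)
    φ≡ = ≡.trans (≡.sym (ℕₚ.m+n∸n≡m _ (2 ℕ.* t))) (≡.trans (≡.cong (ℕ._∸ 2 ℕ.* t) φ+) (≡.sym (ℕₚ.*-distribˡ-∸ 2 u t)))

module Mod2 where
  open ModP prime[2]

  fib-2^ : ∀ k → fib (2 ℕ.^ k) ≋ X P.^ ℕ.pred (2 ℕ.^ k)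
  fib-2^ zero    = P.refl
  fib-2^ (suc k) = begin
    fib (2 ℕ.* q)                        ≈⟨ fib-*p q ⟩
    fib q P.^ 2 P.* fib 2                ≈⟨ P.*-cong (P.^-congˡ 2 (fib-2^ k)) fib2 ⟩
    (X P.^ r) P.^ 2 P.* X P.^ 1          ≈⟨ P.*-congʳ {X P.^ 1} (P.^-assoc X r 2) ⟩
    X P.^ (r ℕ.* 2) P.* X P.^ 1          ≈⟨ P.^-homo-+ X (r ℕ.* 2) 1 ⟨
    X P.^ (r ℕ.* 2 ℕ.+ 1)                ≡⟨ ≡.cong (X P.^_) exponent ⟩
    X P.^ ℕ.pred (2 ℕ.* q)               ∎
    where
    open import Relation.Binary.Reasoning.Setoid P.setoid
    q = 2 ℕ.^ k
    r = ℕ.pred q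
    fib2 : fib 2 ≋ X P.^ 1
    fib2 = P.+-identityʳ (X P.* P.1#)
    q≡ : suc r ≡ q
    q≡ = ℕₚ.suc-pred q {{ℕ.>-nonZero (ℕₚ.m^n>0 2 k)}}
    exponent : r ℕ.* 2 ℕ.+ 1 ≡ ℕ.pred (2 ℕ.* q)
    exponent = ≡.trans (N.solve 1 (λ r → r N.:* N.con 2 N.:+ N.con 1 N.:= r N.:+ (N.con 1 N.:+ (r N.:+ N.con 0))) ≡.refl r)
      (≡.cong (λ q → ℕ.pred (2 ℕ.* q)) q≡)
      where module N = +-*-Solver

  Ψ-2^ : ∀ j → Ψ (2 ℕ.^ suc j) ≋ X P.^ φ (2 ℕ.^ suc j)
  Ψ-2^ j = P.sym (cancel-power {Ψ (2 ℕ.^ suc j)} Monic-X (φ (2 ℕ.^ suc j)) r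
      (P.trans (P.reflexive (≡.cong (X P.^_) φ+)) (P.trans (P.sym (fib-2^ (suc j)))
          (P.trans (Ψ-p^ j) (P.*-congˡ {Ψ (2 ℕ.^ suc j)} (fib-2^ j))))))
    where
    q = 2 ℕ.^ j
    r = ℕ.pred q
    φ+ : φ (2 ℕ.^ suc j) ℕ.+ r ≡ ℕ.pred (2 ℕ.^ suc j)
    φ+ = ≡.cong ℕ.pred (≡.trans (≡.sym (ℕₚ.+-suc (φ (2 ℕ.^ suc j)) r))
        (≡.trans (≡.cong (φ (2 ℕ.^ suc j) ℕ.+_) (ℕₚ.suc-pred q {{ℕ.>-nonZero (ℕₚ.m^n>0 2 j)}}))
        (φ-p^ prime[2] j)))

  -- As 4 = 0 modulo 2, powers of X of even exponent become powers of `disc`, so the prime 2 fits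
  -- the formula for odd primes.
  disc≋X² : disc ≋ X P.^ 2
  disc≋X² = P.trans (P.+-congˡ {X P.* X} (FrobP.∣⇒ι≈0 {4} (divides 2 ≡.refl)))
    (P.trans (P.+-identityʳ (X P.* X)) (P.*-congˡ {X} (P.sym (P.*-identityʳ X))))

-- Irreducible factors modulo p

module Splitting {p : ℕ} (pr : Prime p) where
  open ModP pr

  record Split (δ : ℕ) (G : Poly) (n : ℕ) : Set where
    field
      factors  : List Poly
      irr      : All (Irreducible δ) factors
      distinct : AllPairs (λ f g → ¬ f ≋ g) factors
      splits   : G ≋ product factors
      degree   : n ≡ length factors ℕ.* δ

  private
    ∣-product : ∀ {f} fs → f ∈ fs → f P.∣ product fs
    ∣-product (f ∷ fs) (here ≡.refl) = P.∣-*ʳ (product fs) P.∣-refl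
    ∣-product (g ∷ fs) (there i)     = P.∣-*ˡ g (∣-product fs i)

    Monic-product : ∀ {δ fs} → All (Irreducible δ) fs → Monic (length fs ℕ.* δ) (product fs)
    Monic-product []       = Monic-1
    Monic-product (i ∷ is) = Monic-mul (Irreducible.isMonic i) (Monic-product is)

  -- A factor listed twice would have its square dividing G, so the hypothesis on squares makes the
  -- list distinct.
  split : ∀ {n δ G} → Monic n G → (∀ {d f} → Irreducible d f → f P.∣ G → d ≡ δ × ¬ f P.* f P.∣ G) → Split δ G n
  split {n} {δ} {G} M h = record
    { factors = fs ; irr = irr′ ; splits = G≋
    ; distinct = distinct′ fs irr′ (P.∣-respʳ (P.sym G≋) P.∣-refl)
    ; degree = Monic-unique 1≉0 (Monic-cong G≋ M) (Monic-product irr′) }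
    where
    FS = factorise M
    fs = proj₁ FS
    G≋ : G ≋ product fs
    G≋ = proj₂ (proj₂ FS)
    degree-δ : ∀ {f} → ∃[ d ] Irreducible d f → f P.∣ G → Irreducible δ f
    degree-δ {f} (d , i) f∣G = ≡.subst (λ d → Irreducible d f) (proj₁ (h i f∣G)) i
    irr′ : All (Irreducible δ) fs
    irr′ = All.tabulate λ i → degree-δ (All.lookup (proj₁ (proj₂ FS)) i) (P.∣-respʳ (P.sym G≋) (∣-product fs i))
    distinct′ : ∀ gs → All (Irreducible δ) gs → product gs P.∣ G → AllPairs (λ f g → ¬ f ≋ g) gs
    distinct′ []       []       _ = []
    distinct′ (f ∷ gs) (i ∷ is) d = All.tabulate (λ {g} j f≋g →
        proj₂ (h i (P.∣-trans (P.∣-*ʳ (product gs) P.∣-refl) d))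
          (P.∣-trans (P.∣-respʳ (P.*-comm (product gs) f) (square gs j f≋g)) d))
      ∷ distinct′ gs is (P.∣-trans (P.∣-*ˡ f P.∣-refl) d)
      where
      square : ∀ gs {g} → g ∈ gs → f ≋ g → f P.* f P.∣ product gs P.* f
      square gs {g} j f≋g = proj₁ E , P.trans (P.*-congʳ {f} (P.trans (proj₂ E) (P.*-congˡ {proj₁ E} (P.sym f≋g))))
          (P.*-assoc (proj₁ E) f f)
        where E = ∣-product gs j

-- The rank of apparition of an irreducible factor

module Rank {p : ℕ} (pr : Prime p) {m : ℕ} (1<m : 1 < m) (cop : Coprime p m)
            {d : ℕ} {f : _} (irr : ModP.Irreducible pr d f) (f∣Ψ : RingTheory._∣_ (ModP.polyRing pr) f (Ψ m)) where
  open ModP pr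
  open Residue irr public
  module FibL = Fibonacci L X
  module QuadL = Quadratic L X

  private
    0<m : 0 < m
    0<m = ℕₚ.<⇒≤ 1<m
    instance
      m≢0 : ℕ.NonZero m
      m≢0 = ℕ.>-nonZero 0<m

  ιᴸ≈0⇒p∣ : ∀ h → L.ι h L.≈ [] → p ℕᵈ.∣ h
  ιᴸ≈0⇒p∣ h e = ι≈0⇒p∣ pr h (at (small≈0 {const (K.ι h)}
      (Deg<-mono {const (K.ι h)} (Irreducible.positive irr) (Deg<-length (const (K.ι h))))
    (L.trans (up polyRing (P.sym (const-ι h))) e)) 0)

  Ψ∣⇒≈0 : ∀ {g} → Ψ m P.∣ g → g L.≈ []
  Ψ∣⇒≈0 e = ∣⇒≈0 polyRing (P.∣-trans f∣Ψ e)

  fib-m≈0 : L.fib X m L.≈ []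
  fib-m≈0 = Ψ∣⇒≈0 (reduce-∣ (Ψ∣fib (isFibotomic m 0<m)))

  m∣⇒fib≈0 : ∀ {k} → m ℕᵈ.∣ k → L.fib X k L.≈ []
  m∣⇒fib≈0 m∣k = FibL.F-∣-0 m∣k fib-m≈0

  -- F_k = F_m = 0 gives F_g = 0 for g = gcd k m. If m = h g with h > 1, then Ψ_m divides F_m / F_g,
  -- which also vanishes; so h = 0 in the field and p divides h, hence m. Thus h = 1 and m = g
  -- divides k.
  fib≈0⇒m∣ : ∀ k → L.fib X k L.≈ [] → m ℕᵈ.∣ k
  fib≈0⇒m∣ k e = go (gcd k m) ≡.refl (gcd[m,n]∣n k m)
    where
    go : ∀ g → gcd k m ≡ g → g ℕᵈ.∣ m → m ℕᵈ.∣ k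
    go zero    eq 0∣m = contradiction (≡.sym (ℕᵈ.0∣⇒≡0 0∣m)) (ℕₚ.<⇒≢ 0<m)
    go (suc g) eq (divides h m≡) = decide (h ℕ.≤? 1)
      where
      decide : Dec (h ≤ 1) → m ℕᵈ.∣ k
      decide (yes h≤1) = ≡.subst (ℕᵈ._∣ k) (≡.trans eq
          (≡.sym (≡.trans m≡ (≡.trans (≡.cong (ℕ._* suc g) h≡1) (ℕₚ.*-identityˡ (suc g)))))) (gcd[m,n]∣m k m)
        where
        h≡1 : h ≡ 1
        h≡1 = ℕₚ.≤-antisym h≤1 (ℕₚ.n≢0⇒n>0 λ h≡0 → ℕₚ.<⇒≢ 0<m (≡.sym (≡.trans m≡ (≡.cong (ℕ._* suc g) h≡0))))
      decide (no h≰1) = contradiction (cop (ℕᵈ.∣-refl , ℕᵈ.∣-trans p∣h (divides (suc g) (≡.trans m≡ (ℕₚ.*-comm h (suc g))))))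
          (λ p≡1 → ℕₚ.<⇒≢ 1<p (≡.sym p≡1))
        where
        p∣h : p ℕᵈ.∣ h
        p∣h = ιᴸ≈0⇒p∣ h (FibL.F-quot≈0 g h (≡.subst (λ g → L.fib X g L.≈ []) eq (FibL.F-gcd k m e fib-m≈0))
          (∣⇒≈0 polyRing (P.∣-trans f∣Ψ (reduce-∣ (≡.subst (λ n → Z._∣_ (Ψ n) (Z.fib-quot X g h)) (≡.sym m≡)
            (Ψ∣fib-quot (ℕₚ.≰⇒> h≰1) (isFibotomic (suc g) (s≤s z≤n)) (isFibotomic (h ℕ.* suc g) (≡.subst (0 <_) m≡ 0<m))))))))

  -- The condition for L_r = 0: F_{2r} = F_r L_r vanishes although F_r does not.
  Half : ℕ → Set
  Half r = m ℕᵈ.∣ r ℕ.+ r × ¬ m ℕᵈ.∣ r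

  product≈0 : ∀ {g h} → g L.* h L.≈ [] → g L.≈ [] ⊎ h L.≈ []
  product≈0 {g} {h} e = split′ (g ≈0?)
    where
    split′ : Dec (g L.≈ []) → g L.≈ [] ⊎ h L.≈ []
    split′ (yes z) = inj₁ z
    split′ (no n)  = inj₂ (cancelᴸ n e)

  ≈0*ˡ : ∀ g {h} → h L.≈ [] → g L.* h L.≈ []
  ≈0*ˡ g e = L.trans (L.*-congˡ {g} e) (L.zeroʳ g)

  ≈0*ʳ : ∀ {g} h → g L.≈ [] → g L.* h L.≈ []
  ≈0*ʳ {g} h e = L.trans (L.*-comm g h) (≈0*ˡ h e)

  module Odd (s : ℕ) (p≡ : p ≡ suc (2 ℕ.* s)) where

    -- F_p is a positive power of `disc`, so if `disc` vanished, m would divide p.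
    disc≉0 : ¬ disc L.≈ []
    disc≉0 e = contradiction (fib≈0⇒m∣ p (L.trans (up polyRing (fib-p-odd s p≡))
        (L.trans (L.^-congˡ s e) (L.0^ s 0<s)))) λ m∣p →
      ℕₚ.<⇒≢ 1<m (≡.sym (cop (m∣p , ℕᵈ.∣-refl)))
      where
      0<s : 0 < s
      0<s = ℕₚ.n≢0⇒n>0 λ s≡0 → ℕₚ.<⇒≢ 1<p (≡.sym (≡.trans p≡ (≡.cong (λ s → suc (2 ℕ.* s)) s≡0)))

    cancel-disc : ∀ {g} → g L.* disc L.≈ [] → g L.≈ []
    cancel-disc {g} e = cancelᴸ disc≉0 (L.trans (L.*-comm disc g) e)

    -- If F_r vanished together with L_r, then L_r² - disc F_r² = 4 (-1)^r would force p to divide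
    -- 4.
    lucas⇒Half : ∀ r → L.lucas X r L.≈ [] → Half r
    lucas⇒Half r e = fib≈0⇒m∣ (r ℕ.+ r) (cancel-disc (L.trans (QuadL.fib-double′ r)
        (≈0*ʳ disc (≈0*ˡ (L.fib X r) e)))) , λ m∣r → p∤4 (ιᴸ≈0⇒p∣ 4 (ι4≈0 (m∣⇒fib≈0 m∣r)))
      where
      p∤4 : ¬ p ℕᵈ.∣ 4
      p∤4 p∣4 = absurd (euclidsLemma 2 2 pr p∣4)
        where
        p∤2 : ¬ p ℕᵈ.∣ 2
        p∤2 p∣2 = ℕₚ.<⇒≱ 2<′p (ℕᵈ.∣⇒≤ p∣2)
          where
          2<′p : 2 < p
          2<′p = ℕₚ.≤∧≢⇒< 1<p λ 2≡p → 2≢ s (≡.trans 2≡p p≡)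
            where
            2≢ : ∀ s → 2 ≢ suc (2 ℕ.* s)
            2≢ zero    ()
            2≢ (suc s) eq = ℕₚ.0≢1+n (ℕₚ.suc-injective (ℕₚ.suc-injective (≡.trans eq (≡.cong suc (ℕₚ.*-suc 2 s)))))
        absurd : ¬ (p ℕᵈ.∣ 2 ⊎ p ℕᵈ.∣ 2)
        absurd (inj₁ p∣2) = p∤2 p∣2
        absurd (inj₂ p∣2) = p∤2 p∣2
      -1^-cancel : ∀ r {g} → g L.* (L.- L.1#) L.^ r L.≈ [] → g L.≈ []
      -1^-cancel zero    {g} e = L.trans (L.sym (L.*-identityʳ g)) e
      -1^-cancel (suc r) {g} e = -1^-cancel r (L.trans
          (up polyRing (P.solve 2 (λ g h → g P.:* h P.:= P.:- (g P.:* ((P.:- P.con 1ℤ) P.:* h))) P.refl g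
          ((P.- P.1#) P.^ r)))
        (L.trans (L.-‿cong e) (up polyRing (P.solve 0 (P.:- P.con 0ℤ P.:= P.con 0ℤ) P.refl))))
      ι4≈0 : L.fib X r L.≈ [] → L.ι 4 L.≈ []
      ι4≈0 fr = -1^-cancel r (L.trans (L.sym (QuadL.lucas²-fib²′ r)) (L.trans
        (L.+-cong (≈0*ʳ (L.lucas X r) e) (L.-‿cong (≈0*ˡ disc (≈0*ʳ (L.fib X r) fr))))
        (up polyRing (P.solve 0 (P.con 0ℤ P.:- P.con 0ℤ P.:= P.con 0ℤ) P.refl))))

    Half⇒lucas : ∀ r → Half r → L.lucas X r L.≈ []
    Half⇒lucas r (m∣2r , m∤r) = cancelᴸ (λ e → m∤r (fib≈0⇒m∣ r e))
      (cancel-disc (L.trans (L.sym (QuadL.fib-double′ r)) (≈0*ʳ disc (m∣⇒fib≈0 m∣2r))))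

    private
      -1²≈1 : (L.- L.1#) L.* (L.- L.1#) L.≈ L.1#
      -1²≈1 = up polyRing (P.solve 0 ((P.:- P.con 1ℤ) P.:* (P.:- P.con 1ℤ) P.:= P.con 1ℤ) P.refl)

    -1^even : ∀ t → (L.- L.1#) L.^ (2 ℕ.* t) L.≈ L.1#
    -1^even t = L.trans (L.sym (L.^-assoc (L.- L.1#) 2 t))
        (L.trans (L.^-congˡ t (L.trans (L.*-congˡ {L.- L.1#} (L.*-identityʳ (L.- L.1#))) -1²≈1)) (L.1^ t))

    module _ (v r t : ℕ) (q≡ : p ℕ.^ v ≡ suc (r ℕ.+ r)) where

      fixed⇒even : r ≡ 2 ℕ.* t → Fixed v → m ℕᵈ.∣ r ⊎ m ℕᵈ.∣ suc r
      fixed⇒even ≡.refl fix = conclude (product≈0 (cancelᴸ disc≉0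
          (L.trans (L.sym (QuadL.x^q-x-even′ pr pᴸ≈0 r v q≡ (-1^even t))) (L.x≈y⇒x-y≈0 fix))))
        where
        conclude : L.fib X r L.≈ [] ⊎ L.fib X (suc r) L.≈ [] → m ℕᵈ.∣ r ⊎ m ℕᵈ.∣ suc r
        conclude (inj₁ e) = inj₁ (fib≈0⇒m∣ r e)
        conclude (inj₂ e) = inj₂ (fib≈0⇒m∣ (suc r) e)

      even⇒fixed : r ≡ 2 ℕ.* t → m ℕᵈ.∣ r ⊎ m ℕᵈ.∣ suc r → Fixed v
      even⇒fixed ≡.refl c = L.x-y≈0⇒x≈y (L.trans (QuadL.x^q-x-even′ pr pᴸ≈0 r v q≡ (-1^even t)) (≈0*ˡ disc (zero-product c)))
        where
        zero-product : m ℕᵈ.∣ r ⊎ m ℕᵈ.∣ suc r → L.fib X r L.* L.fib X (suc r) L.≈ []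
        zero-product (inj₁ e) = ≈0*ʳ (L.fib X (suc r)) (m∣⇒fib≈0 e)
        zero-product (inj₂ e) = ≈0*ˡ (L.fib X r) (m∣⇒fib≈0 e)

      private
        -1^odd : r ≡ suc (2 ℕ.* t) → (L.- L.1#) L.^ r L.≈ L.- L.1#
        -1^odd ≡.refl = L.trans (L.*-congˡ {L.- L.1#} (-1^even t)) (L.*-identityʳ (L.- L.1#))

      fixed⇒odd : r ≡ suc (2 ℕ.* t) → Fixed v → Half r ⊎ Half (suc r)
      fixed⇒odd r≡ fix = conclude (product≈0 (L.trans (L.sym (QuadL.x^q-x-odd′ pr pᴸ≈0 r v q≡ (-1^odd r≡)))
          (L.x≈y⇒x-y≈0 fix)))
        where
        conclude : L.lucas X r L.≈ [] ⊎ L.lucas X (suc r) L.≈ [] → Half r ⊎ Half (suc r)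
        conclude (inj₁ e) = inj₁ (lucas⇒Half r e)
        conclude (inj₂ e) = inj₂ (lucas⇒Half (suc r) e)

      odd⇒fixed : r ≡ suc (2 ℕ.* t) → Half r ⊎ Half (suc r) → Fixed v
      odd⇒fixed r≡ c = L.x-y≈0⇒x≈y (L.trans (QuadL.x^q-x-odd′ pr pᴸ≈0 r v q≡ (-1^odd r≡)) (zero-product c))
        where
        zero-product : Half r ⊎ Half (suc r) → L.lucas X r L.* L.lucas X (suc r) L.≈ []
        zero-product (inj₁ e) = ≈0*ʳ (L.lucas X (suc r)) (Half⇒lucas r e)
        zero-product (inj₂ e) = ≈0*ˡ (L.lucas X r) (Half⇒lucas (suc r) e)

  module Two (p≡2 : p ≡ 2) (2<m : 2 < m) where

    private
      2ᴸ≈0 : L.ι 2 L.≈ []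
      2ᴸ≈0 = ≡.subst (λ p → L.ι p L.≈ []) p≡2 pᴸ≈0

    -- X is F_2, so its vanishing would make m divide 2.
    X≉0 : ¬ X L.≈ []
    X≉0 e = ℕₚ.<⇒≱ 2<m (ℕᵈ.∣⇒≤ (fib≈0⇒m∣ 2 (L.trans (L.+-identityʳ (X P.* P.1#)) (L.trans (L.*-identityʳ X) e))))

    module _ (v q′ : ℕ) (q≡ : 2 ℕ.^ v ≡ suc q′) where
      private
        eq : (X L.^ (p ℕ.^ v) L.- X) L.* (X L.^ (p ℕ.^ v) L.- X) L.≈ (X L.* X) L.* (L.fib X q′ L.* L.fib X (suc (suc q′)))
        eq = ≡.subst (λ b → (X L.^ (b ℕ.^ v) L.- X) L.* (X L.^ (b ℕ.^ v) L.- X) L.≈ (X L.* X) L.*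
            (L.fib X q′ L.* L.fib X (suc (suc q′))))
          (≡.sym p≡2) (QuadL.[x^q-x]²′ 2ᴸ≈0 v q′ q≡)

      fixed⇒two : Fixed v → m ℕᵈ.∣ q′ ⊎ m ℕᵈ.∣ suc (suc q′)
      fixed⇒two fix = conclude (product≈0 (cancelᴸ X≉0
          (cancelᴸ X≉0 (L.trans (L.sym (L.*-assoc X X (L.fib X q′ L.* L.fib X (suc (suc q′)))))
          (L.trans (L.sym eq) (≈0*ʳ (X L.^ (p ℕ.^ v) L.- X) (L.x≈y⇒x-y≈0 fix)))))))
        where
        conclude : L.fib X q′ L.≈ [] ⊎ L.fib X (suc (suc q′)) L.≈ [] → m ℕᵈ.∣ q′ ⊎ m ℕᵈ.∣ suc (suc q′)
        conclude (inj₁ e) = inj₁ (fib≈0⇒m∣ q′ e)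
        conclude (inj₂ e) = inj₂ (fib≈0⇒m∣ (suc (suc q′)) e)

      two⇒fixed : m ℕᵈ.∣ q′ ⊎ m ℕᵈ.∣ suc (suc q′) → Fixed v
      two⇒fixed c = L.x-y≈0⇒x≈y (nilpotent (X L.^ (p ℕ.^ v) L.- X) 2
          (L.trans (L.*-congˡ {X L.^ (p ℕ.^ v) L.- X} (L.*-identityʳ (X L.^ (p ℕ.^ v) L.- X)))
              (L.trans eq (≈0*ˡ (X L.* X) (zero-product c)))))
        where
        zero-product : m ℕᵈ.∣ q′ ⊎ m ℕᵈ.∣ suc (suc q′) → L.fib X q′ L.* L.fib X (suc (suc q′)) L.≈ []
        zero-product (inj₁ e) = ≈0*ʳ (L.fib X (suc (suc q′))) (m∣⇒fib≈0 e)
        zero-product (inj₂ e) = ≈0*ˡ (L.fib X q′) (m∣⇒fib≈0 e)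

-- Squarefreeness, and the square root in characteristic 2

module SquarefreeOdd {p : ℕ} (pr : Prime p) {m : ℕ} (1<m : 1 < m) where
  open ModP pr

  private
    -1^even : ∀ t → (P.- P.1#) P.^ (2 ℕ.* t) ≋ P.1#
    -1^even t = P.trans (P.sym (P.^-assoc (P.- P.1#) 2 t)) (P.trans (P.^-congˡ t
      (P.solve 0 ((P.:- P.con 1ℤ) P.:* ((P.:- P.con 1ℤ) P.:* P.con 1ℤ) P.:= P.con 1ℤ) P.refl)) (P.1^ t))

  -- Squaring p^u = 1 + 2mt gives p^2u = 1 + 2r with r even and divisible by m.
  Ψ∣x^q-x : ∀ u t → p ℕ.^ u ≡ suc (2 ℕ.* (m ℕ.* t)) → Ψ m P.∣ (X P.^ (p ℕ.^ (u ℕ.+ u)) P.- X)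
  Ψ∣x^q-x u t pᵘ≡ = P.∣-respʳ (P.sym (Quadₚ.x^q-x-even′ pr P-p≈0 r (u ℕ.+ u) q≡ (-1^even w)))
      (P.∣-*ˡ disc (P.∣-*ʳ (fib (suc r)) (P.∣-trans (reduce-∣ (Ψ∣fib (isFibotomic m (ℕₚ.<⇒≤ 1<m)))) (Fibₚ.F-∣ m∣r))))
    where
    w = m ℕ.* t ℕ.* (1 ℕ.+ m ℕ.* t)
    r = 2 ℕ.* w
    module N = +-*-Solver
    q≡ : p ℕ.^ (u ℕ.+ u) ≡ suc (r ℕ.+ r)
    q≡ = ≡.trans (ℕₚ.^-distribˡ-+-* p u u) (≡.trans (≡.cong₂ ℕ._*_ pᵘ≡ pᵘ≡)
      (N.solve 1 (λ x → (N.con 1 N.:+ N.con 2 N.:* x) N.:* (N.con 1 N.:+ N.con 2 N.:* x)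
        N.:= N.con 1 N.:+ (N.con 2 N.:* (x N.:* (N.con 1 N.:+ x)) N.:+ N.con 2 N.:* (x N.:* (N.con 1 N.:+ x))))
            ≡.refl (m ℕ.* t)))
    m∣r : m ℕᵈ.∣ r
    m∣r = ℕᵈ.∣-trans (ℕᵈ.∣-trans (ℕᵈ.m∣m*n t) (ℕᵈ.m∣m*n (1 ℕ.+ m ℕ.* t))) (ℕᵈ.n∣m*n 2)

  squarefree : ∀ u t → 0 < u → p ℕ.^ u ≡ suc (2 ℕ.* (m ℕ.* t)) → ∀ {d f} → Irreducible d f → ¬ f P.* f P.∣ Ψ m
  squarefree u t 0<u pᵘ≡ irr d = Residue.x^q-x-squarefree irr (u ℕ.+ u) (ℕₚ.≤-trans 0<u (ℕₚ.m≤m+n u u))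
      (P.∣-trans d (Ψ∣x^q-x u t pᵘ≡))

module SquareRoot where
  open ModP prime[2]

  private
    2≈0 : P.ι 2 ≋ []
    2≈0 = P-p≈0

    double≈0 : ∀ g → g P.+ g ≋ []
    double≈0 g = P.trans (P.solve 1 (λ g → g P.:+ g P.:= (P.con 1ℤ P.:+ (P.con 1ℤ P.:+ P.con 0ℤ)) P.:* g) P.refl
        g) (P.*-congʳ {g} 2≈0)

  D-square : ∀ g → D (g P.* g) ≋ []
  D-square g = P.trans (D-* g g) (P.trans (P.+-congˡ {D g P.* g} (P.*-comm g (D g))) (double≈0 (D g P.* g)))

  -- F_{2r+1} = F_{r+1}² + F_r² is a sum of squares, whose derivative vanishes in characteristic 2.
  D-fib-odd : ∀ r → D (fib (suc (r ℕ.+ r))) ≋ []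
  D-fib-odd r = P.trans (D-cong (P.trans (P.reflexive (≡.cong fib (≡.sym (ℕₚ.+-suc r r)))) (Fibₚ.F-add r r)))
    (P.trans (D-+ (fib (suc r) P.* fib (suc r)) (fib r P.* fib r)) (P.+-cong (D-square (fib (suc r))) (D-square (fib r))))

  D-∏ : ∀ {A : Set} (f : A → Poly) xs → (∀ {x} → x ∈ xs → D (f x) ≋ []) → D (∏ f xs) ≋ []
  D-∏ f []       h = ext λ { zero → K.refl ; (suc i) → K.refl }
  D-∏ f (x ∷ xs) h = P.trans (D-* (f x) (∏ f xs)) (P.+-cong (P.*-congʳ {∏ f xs} (h (here ≡.refl)))
    (P.trans (P.*-congˡ {f x} (D-∏ f xs (h ∘ there))) (P.zeroʳ (f x))))

  private
    odd-form : ∀ n → ¬ 2 ℕᵈ.∣ n → ∃[ r ] n ≡ suc (r ℕ.+ r)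
    odd-form zero          odd = contradiction (2 ℕᵈ.∣0) odd
    odd-form (suc zero)    odd = 0 , ≡.refl
    odd-form (suc (suc n)) odd = suc (proj₁ IH) , ≡.cong suc
        (≡.cong suc (≡.trans (proj₂ IH) (≡.sym (ℕₚ.+-suc (proj₁ IH) (proj₁ IH)))))
      where IH = odd-form n λ 2∣n → odd (ℕᵈ.∣m∣n⇒∣m+n ℕᵈ.∣-refl 2∣n)

  -- Differentiate F_n = Ψ_n Π, where Π collects the proper divisors, all odd. By induction the
  -- derivative of Π is 0, so D Ψ_n · Π = 0, and Π is monic.
  D-Ψ-odd : ∀ n → ¬ 2 ℕᵈ.∣ n → D (Ψ n) ≋ []
  D-Ψ-odd n odd = go n odd (<-wellFounded n)
    where
    go : ∀ n → ¬ 2 ℕᵈ.∣ n → Acc _<_ n → D (Ψ n) ≋ []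
    go zero    odd _         = contradiction (2 ℕᵈ.∣0) odd
    go n@(suc n′) odd (acc rec) = Monic-cancelʳ (proj₂ MΠ) {D (Ψ n)} {[]} (P.trans (P.sym (P.trans (D-* (Ψ n) Π)
        (P.trans (P.+-congˡ {D (Ψ n) P.* Π} (P.trans (P.*-congˡ {Ψ n} DΠ) (P.zeroʳ (Ψ n)))) (P.+-identityʳ (D (Ψ n) P.* Π)))))
        (P.trans (D-cong (P.sym (F≋∏Ψₚ {n} (s≤s z≤n))))
            (P.trans (P.reflexive (≡.cong (λ k → D (fib k)) (proj₂ R))) (D-fib-odd (proj₁ R)))))
      where
      R = odd-form n odd
      Π = ∏ Ψ (properDivisors n)
      MΠ : ∃[ d ] Monic d Π
      MΠ = ∏-Monicₚ Ψ (properDivisors n) λ i → Monic-Ψ′ (proj₁ (∈-properDivisors⁻ {n = n} i))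
      DΠ : D Π ≋ []
      DΠ = D-∏ Ψ (properDivisors n) λ {d} i → go d
        (λ 2∣d → odd (ℕᵈ.∣-trans 2∣d (proj₁ (proj₂ (∈-properDivisors⁻ {n = n} i)))))
            (rec (proj₂ (proj₂ (∈-properDivisors⁻ {n = n} i))))

  const-square : ∀ a → const a P.* const a ≋ const a
  const-square a = P.trans (P.sym (const-*-const a a)) (const-cong (K.trans (K.*-congˡ {a} (K.sym (K.*-identityʳ a)))
    (K.trans (K.^-congˡ 2 (K.sym (ι-index a))) (K.trans (FrobK.fermat (toℕ (index a))) (ι-index a)))))

  -- a + b X + g X² has derivative b + g′ X², and a = a² in the field with two elements.
  square-root : ∀ g → D g ≋ [] → ∃[ h ] g ≋ h P.* h
  square-root []          e = [] , P.refl
  square-root (a ∷ [])    e = const a , P.sym (const-square a)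
  square-root (a ∷ b ∷ g) e = const a P.+ X P.* h , (begin
      a ∷ b ∷ g                                          ≈⟨ ∷≋ a (b ∷ g) ⟩
      const a P.+ X P.* (b ∷ g)                          ≈⟨ P.+-congˡ {const a} (P.*-congˡ {X} bg≋) ⟩
      const a P.+ X P.* (X P.* (h P.* h))                ≈⟨ P.+-congʳ {X P.* (X P.* (h P.* h))} (P.sym (const-square a)) ⟩
      const a P.* const a P.+ X P.* (X P.* (h P.* h))
        ≈⟨ P.+-identityʳ (const a P.* const a P.+ X P.* (X P.* (h P.* h))) ⟨
      const a P.* const a P.+ X P.* (X P.* (h P.* h)) P.+ []
        ≈⟨ P.+-congˡ {const a P.* const a P.+ X P.* (X P.* (h P.* h))} (double≈0 (const a P.* (X P.* h))) ⟨
      const a P.* const a P.+ X P.* (X P.* (h P.* h)) P.+ (const a P.* (X P.* h) P.+ const a P.* (X P.* h))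
        ≈⟨ P.solve 3 (λ a x h → a P.:* a P.:+ x P.:* (x P.:* (h P.:* h)) P.:+ (a P.:* (x P.:* h) P.:+ a P.:* (x P.:* h))
             P.:= (a P.:+ x P.:* h) P.:* (a P.:+ x P.:* h)) P.refl (const a) X h ⟩
      (const a P.+ X P.* h) P.* (const a P.+ X P.* h)    ∎)
    where
    open import Relation.Binary.Reasoning.Setoid P.setoid
    D-expand : D (a ∷ b ∷ g) ≋ b ∷ 0ℤ ∷ D g
    D-expand = begin
      D (a ∷ b ∷ g)                                      ≈⟨ D-∷ a (b ∷ g) ⟩
      (b ∷ g) P.+ X P.* D (b ∷ g)                        ≈⟨ P.+-cong (∷≋ b g) (P.*-congˡ {X} (D-∷ b g)) ⟩
      (const b P.+ X P.* g) P.+ X P.* (g P.+ X P.* D g)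
        ≈⟨ P.solve 4 (λ b x g d → (b P.:+ x P.:* g) P.:+ x P.:* (g P.:+ x P.:* d)
             P.:= (b P.:+ x P.:* (x P.:* d)) P.:+ (x P.:* g P.:+ x P.:* g)) P.refl (const b) X g (D g) ⟩
      (const b P.+ X P.* (X P.* D g)) P.+ (X P.* g P.+ X P.* g)
        ≈⟨ P.+-congˡ {const b P.+ X P.* (X P.* D g)} (double≈0 (X P.* g)) ⟩
      (const b P.+ X P.* (X P.* D g)) P.+ []             ≈⟨ P.+-identityʳ (const b P.+ X P.* (X P.* D g)) ⟩
      const b P.+ X P.* (X P.* D g)                      ≈⟨ P.+-congˡ {const b} (P.*-congˡ {X} (X*≋∷ (D g))) ⟩
      const b P.+ X P.* (0ℤ ∷ D g)                       ≈⟨ ∷≋ b (0ℤ ∷ D g) ⟨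
      b ∷ 0ℤ ∷ D g                                       ∎
    e′ : b ∷ 0ℤ ∷ D g ≋ []
    e′ = P.trans (P.sym D-expand) e
    IH = square-root g (ext λ i → at e′ (suc (suc i)))
    h = proj₁ IH
    bg≋ : b ∷ g ≋ X P.* (h P.* h)
    bg≋ = P.trans (∷-cong (at e′ 0) (proj₂ IH)) (P.sym (X*≋∷ (h P.* h)))

  Monic-associate : ∀ {n k c G M} → Monic n G → Monic k M → ¬ c K.≈ K.0# → G ≋ const c P.* M → c K.≈ K.1# × n ≡ k
  Monic-associate {n} {k} {c} {G} {M} (monic DG tG) (monic DM tM) c≉0 e = cases (ℕₚ.<-cmp n k)
    where
    coeff-G : ∀ i → coeff G i K.≈ c K.* coeff M i
    coeff-G i = K.trans (at e i) (K.trans (at (const-* c M) i) (coeff-scale c M i))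
    cases : Tri (n < k) (n ≡ k) (k < n) → c K.≈ K.1# × n ≡ k
    cases (tri< n<k _ _) = contradiction (K.trans (K.sym (K.trans (K.*-congˡ {c} tM) (K.*-identityʳ c)))
        (K.trans (K.sym (coeff-G k)) (DG k n<k))) c≉0
    cases (tri≈ _ ≡.refl _) = K.trans (K.sym (K.*-identityʳ c))
        (K.trans (K.*-congˡ {c} (K.sym tM)) (K.trans (K.sym (coeff-G n)) tG)) , ≡.refl
    cases (tri> _ _ k<n) = contradiction (K.trans (K.sym tG)
        (K.trans (coeff-G n) (K.trans (K.*-congˡ {c} (DM n k<n)) (K.zeroʳ c)))) 1≉0

  -- The leading coefficient a of a square root satisfies a² = a; comparison with the monic G then
  -- forces a = 1, so the monic part of the root is itself a root.
  Monic-square-root : ∀ {n G} → Monic n G → D G ≋ [] → ∃[ c ] ∃[ h ] n ≡ c ℕ.+ c × Monic c h × G ≋ h P.* h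
  Monic-square-root {n} {G} M e = build (normalise h (length h) (Deg<-length h) h≉0)
    where
    S = square-root G e
    h = proj₁ S
    h≉0 : ¬ h ≋ []
    h≉0 z = 1≉0 (K.trans (K.sym (Monic.top M)) (at (P.trans (proj₂ S) (P.*-congʳ {h} {h} {[]} z)) n))
    build : ∃[ N ] Normalised.degree {h} N < length h → ∃[ c ] ∃[ h ] n ≡ c ℕ.+ c × Monic c h × G ≋ h P.* h
    build (normalised {k} a a≉0 {h′} M′ h≋ , _) = k , h′ , proj₂ A , M′ ,
        P.trans G≋ (P.trans (P.*-congʳ {h′ P.* h′} (const-cong (proj₁ A))) (P.*-identityˡ (h′ P.* h′)))
      where
      G≋ : G ≋ const a P.* (h′ P.* h′)
      G≋ = P.trans (proj₂ S) (P.trans (P.*-cong h≋ h≋)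
          (P.trans (P.solve 2 (λ a h → (a P.:* h) P.:* (a P.:* h) P.:= (a P.:* a) P.:* (h P.:* h)) P.refl
          (const a) h′)
        (P.*-congʳ {h′ P.* h′} (const-square a))))
      A = Monic-associate M (Monic-mul M′ M′) a≉0 G≋

  -- For G = X^q - X only G² has a product formula, so Φ² divides G² rather than Φ dividing G.
  -- Suppose Φ = T f² and write G = h f. Then h² is a multiple of f², so f divides h and f² divides
  -- G, which is squarefree.
  squarefree-root : ∀ {m Φ} → (2<m : 2 < m) (cop : Coprime 2 m) → Ψ m ≋ Φ P.* Φ → ∀ u q′ → 0 < u → 2 ℕ.^ u ≡ suc
      q′ → m ℕᵈ.∣ q′ →
    ∀ {d f} → Irreducible d f → f P.∣ Φ → ¬ f P.* f P.∣ Φ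
  squarefree-root {m} {Φ} 2<m cop Ψ≋ u q′ 0<u q≡ m∣q′ {d} {f} irr f∣Φ (T , Φ≋) =
    Residue.x^q-x-squarefree irr u 0<u (proj₁ f∣h , P.trans G≋
        (P.trans (P.*-congʳ {f} (proj₂ f∣h)) (P.*-assoc (proj₁ f∣h) f f)))
    where
    1<m = ℕₚ.<⇒≤ 2<m
    G = X P.^ (2 ℕ.^ u) P.- X
    f∣Ψ : f P.∣ Ψ m
    f∣Ψ = P.∣-respʳ (P.sym Ψ≋) (P.∣-*ˡ Φ f∣Φ)
    module Rk = Rank prime[2] 1<m cop irr f∣Ψ
    f∣G : f P.∣ G
    f∣G = ≈0⇒∣ polyRing (Rk.L.x≈y⇒x-y≈0 (Rk.Two.two⇒fixed ≡.refl 2<m u q′ q≡ (inj₁ m∣q′)))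
    h = proj₁ f∣G
    G≋ : G ≋ h P.* f
    G≋ = proj₂ f∣G
    Ψ∣G² : Ψ m P.∣ G P.* G
    Ψ∣G² = P.∣-respʳ (P.sym (Quadₚ.[x^q-x]²′ P-p≈0 u q′ q≡)) (P.∣-*ˡ (X P.* X) (P.∣-*ʳ (fib (suc (suc q′)))
      (P.∣-trans (reduce-∣ (Ψ∣fib (isFibotomic m (ℕₚ.<⇒≤ 1<m)))) (Fibₚ.F-∣ m∣q′))))
    S = proj₁ Ψ∣G²
    Mf = Irreducible.isMonic irr
    h²≋ : h P.* h ≋ (S P.* (T P.* T) P.* f) P.* f
    h²≋ = Monic-cancelʳ (Monic-mul Mf Mf) {h P.* h} {(S P.* (T P.* T) P.* f) P.* f} (begin
      (h P.* h) P.* (f P.* f)      ≈⟨ P.solve 2 (λ h f → (h P.:* h) P.:* (f P.:* f) P.:= (h P.:* f) P.:*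
          (h P.:* f)) P.refl h f ⟩
      (h P.* f) P.* (h P.* f)      ≈⟨ P.*-cong G≋ G≋ ⟨
      G P.* G                      ≈⟨ proj₂ Ψ∣G² ⟩
      S P.* Ψ m                    ≈⟨ P.*-congˡ {S} (P.trans Ψ≋ (P.*-cong Φ≋ Φ≋)) ⟩
      S P.* ((T P.* (f P.* f)) P.* (T P.* (f P.* f)))
        ≈⟨ P.solve 3 (λ s t f → s P.:* ((t P.:* (f P.:* f)) P.:* (t P.:* (f P.:* f)))
             P.:= ((s P.:* (t P.:* t) P.:* f) P.:* f) P.:* (f P.:* f)) P.refl S T f ⟩
      ((S P.* (T P.* T) P.* f) P.* f) P.* (f P.* f) ∎)
      where open import Relation.Binary.Reasoning.Setoid P.setoid
    f∣h : f P.∣ h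
    f∣h = conclude (Residue.prime-∣ irr (S P.* (T P.* T) P.* f , h²≋))
      where
      conclude : f P.∣ h ⊎ f P.∣ h → f P.∣ h
      conclude (inj₁ e) = e
      conclude (inj₂ e) = e

-- The exponent δ

module Congruences where
  open import Data.Nat using (_+_; _*_; _^_; _/_; _%_; NonZero)
  open import Data.Nat.DivMod using (m≡m%n+[m/n]*n; m%n<n)
  open import Data.Nat.Divisibility
  open import Data.Nat.Properties
  open import Relation.Binary.PropositionalEquality hiding ([_])
  open ExactDivision using (ℤR)

  private
    module N = +-*-Solver

  pos-^ : ∀ a n → + (a ^ n) ≡ (+ a) ℤR.^ n
  pos-^ a zero    = refl
  pos-^ a (suc n) = trans (ℤₚ.pos-* a (a ^ n)) (cong (+ a ℤ.*_) (pos-^ a n))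

  order-∣ : ∀ {a N u} → IsMultOrder a N u → ∀ w → IntCong N (+ (a ^ w)) 1ℤ → u ∣ w
  order-∣ {a} {N} {u} (0<u , aᵘ≡1 , least) w aʷ≡1 = m%n≡0⇒n∣m w u (n≤0⇒n≡0 (≮⇒≥ λ 0<r → least (w % u) 0<r (m%n<n w u)
      (≈⇒IntCong (R.trans (R.reflexive (pos-^ a (w % u))) rem))))
    where
    instance
      u≢0 : NonZero u
      u≢0 = ℕ.>-nonZero 0<u
    module R = RingTheory (Quot ℤR (+ N))
    one : ∀ n → IntCong N (+ (a ^ n)) 1ℤ → (+ a) R.^ n R.≈ R.1#
    one n c = R.trans (R.reflexive (sym (pos-^ a n))) (IntCong⇒≈ c)
    rem : (+ a) R.^ (w % u) R.≈ R.1#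
    rem = begin
      (+ a) R.^ (w % u)                                  ≈⟨ R.*-identityʳ ((+ a) R.^ (w % u)) ⟨
      (+ a) R.^ (w % u) R.* R.1#                         ≈⟨ R.*-congˡ {(+ a) R.^ (w % u)}
          (R.trans (R.^-congˡ (w / u) (one u aᵘ≡1)) (R.1^ (w / u))) ⟨
      (+ a) R.^ (w % u) R.* ((+ a) R.^ u) R.^ (w / u)
        ≈⟨ R.*-congˡ {(+ a) R.^ (w % u)} (R.trans (R.^-assoc (+ a) u (w / u))
            (R.reflexive (cong ((+ a) R.^_) (*-comm u (w / u))))) ⟩
      (+ a) R.^ (w % u) R.* (+ a) R.^ (w / u * u)        ≈⟨ R.^-homo-+ (+ a) (w % u) (w / u * u) ⟨
      (+ a) R.^ (w % u + w / u * u)                      ≡⟨ cong ((+ a) R.^_) (m≡m%n+[m/n]*n w u) ⟨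
      (+ a) R.^ w                                        ≈⟨ one w aʷ≡1 ⟩
      R.1#                                               ∎
      where open import Relation.Binary.Reasoning.Setoid R.setoid

  cong-1⇒∣ : ∀ {N n} → IntCong N (+ suc n) 1ℤ → N ∣ n
  cong-1⇒∣ d = d

  cong--1⇒∣ : ∀ {N n} → IntCong N (+ n) (ℤ.- 1ℤ) → N ∣ suc n
  cong--1⇒∣ {N} {n} d = subst (N ∣_) (+-comm n 1) d

  ∣⇒cong--1 : ∀ {N n} → N ∣ suc n → IntCong N (+ n) (ℤ.- 1ℤ)
  ∣⇒cong--1 {N} {n} d = subst (N ∣_) (+-comm 1 n) d

  parity : ∀ n → (∃[ c ] n ≡ c + c) ⊎ (∃[ c ] n ≡ suc (c + c))
  parity zero    = inj₁ (0 , refl)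
  parity (suc n) with parity n
  ... | inj₁ (c , refl) = inj₂ (c , refl)
  ... | inj₂ (c , refl) = inj₁ (suc c , cong suc (sym (+-suc c c)))

  module _ (m : ℕ) where

    HalfMultiple : ℕ → Set
    HalfMultiple r = m ∣ r + r × ¬ m ∣ r

    -- Writing r + r = c m, the number c is odd exactly when m ∤ r.
    half⇒∣ : ∀ {r} → HalfMultiple r → Signed._∣_ (+ (2 * m)) (+ (r + r) ℤ.- + m)
    half⇒∣ {r} (divides c eq , m∤r) = go c eq (parity c)
      where
      go : ∀ c → r + r ≡ c * m → (∃[ e ] c ≡ e + e) ⊎ (∃[ e ] c ≡ suc (e + e)) → Signed._∣_ (+ (2 * m)) (+ (r + r) ℤ.- + m)
      go c eq (inj₁ (e , refl)) = contradiction (divides e (*-cancelˡ-≡ r (e * m) 2 (begin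
          2 * r          ≡⟨ cong (λ z → r + z) (+-identityʳ r) ⟩
          r + r          ≡⟨ eq ⟩
          (e + e) * m    ≡⟨ N.solve 2 (λ e m → (e N.:+ e) N.:* m N.:= N.con 2 N.:* (e N.:* m)) refl e m ⟩
          2 * (e * m)    ∎))) m∤r
        where open ≡-Reasoning
      go c eq (inj₂ (e , refl)) = Signed.divides (+ e) (begin
          + (r + r) ℤ.- + m                ≡⟨ cong (λ z → + z ℤ.- + m)
              (trans eq (N.solve 2 (λ e m → (N.con 1 N.:+ (e N.:+ e)) N.:* m N.:= e N.:* (N.con 2 N.:* m) N.:+
              m) refl e m)) ⟩
          + (e * (2 * m) + m) ℤ.- + m      ≡⟨ cong (ℤ._- + m) (ℤₚ.pos-+ (e * (2 * m)) m) ⟩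
          + (e * (2 * m)) ℤ.+ + m ℤ.- + m  ≡⟨ ℤR.x+y-y (+ (e * (2 * m))) (+ m) ⟩
          + (e * (2 * m))                  ≡⟨ ℤₚ.pos-* e (2 * m) ⟩
          + e ℤ.* + (2 * m)                ∎)
        where open ≡-Reasoning

    -- From 2r - m = k · 2m one gets 2r = (2k + 1) m, and m dividing r would make 2k + 1 even.
    ∣⇒half : .{{_ : NonZero m}} → ∀ {r} → Signed._∣_ (+ (2 * m)) (+ (r + r) ℤ.- + m) → HalfMultiple r
    ∣⇒half {r} (Signed.divides k eq) = Signed.∣⇒∣ᵤ {+ m} {+ (r + r)} (Signed.divides (+ 2 ℤ.* k ℤ.+ 1ℤ) r+r≡) ,
        λ { (divides j refl) → odd≢even k (+ j) (halve j refl) }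
      where
      r+r≡ : + (r + r) ≡ (+ 2 ℤ.* k ℤ.+ 1ℤ) ℤ.* + m
      r+r≡ = trans (sym (ℤR.x-y+y (+ (r + r)) (+ m))) (trans (cong (ℤ._+ + m) (trans eq (cong (k ℤ.*_) (ℤₚ.pos-* 2 m))))
        (ℤR.solve 2 (λ k m → k ℤR.:* (ℤR.con (+ 2) ℤR.:* m) ℤR.:+ m ℤR.:= (ℤR.con (+ 2) ℤR.:* k ℤR.:+ ℤR.con 1ℤ)
            ℤR.:* m) refl k (+ m)))
      halve : ∀ j → r ≡ j * m → + 2 ℤ.* k ℤ.+ 1ℤ ≡ + 2 ℤ.* + j
      halve j refl = ℤₚ.*-cancelʳ-≡ _ _ (+ m) (trans (sym r+r≡) (begin
        + (j * m + j * m)           ≡⟨ ℤₚ.pos-+ (j * m) (j * m) ⟩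
        + (j * m) ℤ.+ + (j * m)     ≡⟨ cong (λ z → z ℤ.+ z) (ℤₚ.pos-* j m) ⟩
        + j ℤ.* + m ℤ.+ + j ℤ.* + m ≡⟨ ℤR.solve 2 (λ j m → j ℤR.:* m ℤR.:+ j ℤR.:* m ℤR.:=
            (ℤR.con (+ 2) ℤR.:* j) ℤR.:* m) refl (+ j) (+ m) ⟩
        + 2 ℤ.* + j ℤ.* + m         ∎))
        where open ≡-Reasoning
      odd≢even : ∀ a b → ¬ + 2 ℤ.* a ℤ.+ 1ℤ ≡ + 2 ℤ.* b
      odd≢even a b e = contradiction (∣1⇒≡1 (Signed.∣⇒∣ᵤ {+ 2} {1ℤ} (Signed.divides (b ℤ.- a) (begin
        1ℤ                                  ≡⟨ ℤR.solve 1
            (λ a → ℤR.con 1ℤ ℤR.:= (ℤR.con (+ 2) ℤR.:* a ℤR.:+ ℤR.con 1ℤ) ℤR.:- ℤR.con (+ 2) ℤR.:* a) refl a ⟩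
        + 2 ℤ.* a ℤ.+ 1ℤ ℤ.- + 2 ℤ.* a      ≡⟨ cong (ℤ._- + 2 ℤ.* a) e ⟩
        + 2 ℤ.* b ℤ.- + 2 ℤ.* a             ≡⟨ ℤR.solve 2
            (λ a b → ℤR.con (+ 2) ℤR.:* b ℤR.:- ℤR.con (+ 2) ℤR.:* a ℤR.:= (b ℤR.:- a) ℤR.:* ℤR.con (+ 2)) refl
            a b ⟩
        (b ℤ.- a) ℤ.* + 2                   ∎)))) λ ()
        where open ≡-Reasoning

    private
      shift+ : ∀ r → + suc (r + r) ℤ.- (+ m ℤ.+ 1ℤ) ≡ + (r + r) ℤ.- + m
      shift+ r = trans (cong (ℤ._- (+ m ℤ.+ 1ℤ)) (ℤₚ.pos-+ 1 (r + r)))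
        (ℤR.solve 2 (λ x m → (ℤR.con 1ℤ ℤR.:+ x) ℤR.:- (m ℤR.:+ ℤR.con 1ℤ) ℤR.:= x ℤR.:- m) refl (+ (r + r)) (+ m))

      shift- : ∀ r → + suc (r + r) ℤ.- (+ m ℤ.- 1ℤ) ≡ + (suc r + suc r) ℤ.- + m
      shift- r = trans (cong (ℤ._- (+ m ℤ.- 1ℤ)) (ℤₚ.pos-+ 1 (r + r)))
        (trans (ℤR.solve 2 (λ x m → (ℤR.con 1ℤ ℤR.:+ x) ℤR.:- (m ℤR.:- ℤR.con 1ℤ) ℤR.:= (ℤR.con (+ 2) ℤR.:+ x)
            ℤR.:- m) refl (+ (r + r)) (+ m))
          (cong (ℤ._- + m) (trans (sym (ℤₚ.pos-+ 2 (r + r))) (cong (λ z → + suc z) (sym (+-suc r r))))))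

    module _ .{{_ : NonZero m}} where

      -- For q = 2r + 1, q - (m + 1) = 2r - m and q - (m - 1) = 2(r + 1) - m. The congruences q ≡ m
      -- ± 1 thus say that 2r, respectively 2(r + 1), is an odd multiple of m.
      cong-m+1⇒half : ∀ {r} → IntCong (2 * m) (+ suc (r + r)) (+ m ℤ.+ 1ℤ) → HalfMultiple r
      cong-m+1⇒half {r} c = ∣⇒half (subst (Signed._∣_ (+ (2 * m))) (shift+ r) (Signed.∣ᵤ⇒∣ c))

      half⇒cong-m+1 : ∀ {r} → HalfMultiple r → IntCong (2 * m) (+ suc (r + r)) (+ m ℤ.+ 1ℤ)
      half⇒cong-m+1 {r} h = Signed.∣⇒∣ᵤ (subst (Signed._∣_ (+ (2 * m))) (sym (shift+ r)) (half⇒∣ h))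

      cong-m-1⇒half : ∀ {r} → IntCong (2 * m) (+ suc (r + r)) (+ m ℤ.- 1ℤ) → HalfMultiple (suc r)
      cong-m-1⇒half {r} c = ∣⇒half (subst (Signed._∣_ (+ (2 * m))) (shift- r) (Signed.∣ᵤ⇒∣ c))

      half⇒cong-m-1 : ∀ {r} → HalfMultiple (suc r) → IntCong (2 * m) (+ suc (r + r)) (+ m ℤ.- 1ℤ)
      half⇒cong-m-1 {r} h = Signed.∣⇒∣ᵤ (subst (Signed._∣_ (+ (2 * m))) (sym (shift- r)) (half⇒∣ h))

    2m∣2r⇒m∣r : ∀ {r} → 2 * m ∣ r + r → m ∣ r
    2m∣2r⇒m∣r {r} d = *-cancelˡ-∣ 2 (subst (2 * m ∣_) (cong (λ z → r + z) (sym (+-identityʳ r))) d)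

    m∣r⇒2m∣2r : ∀ {r} → m ∣ r → 2 * m ∣ r + r
    m∣r⇒2m∣2r {r} d = subst (2 * m ∣_) (cong (λ z → r + z) (+-identityʳ r)) (*-monoʳ-∣ 2 d)

    -- The conditions on q = 2r + 1 under which x^q = x for a root x of Ψ m.
    data Condition (q : ℕ) : Set where
      even : ∀ r t → q ≡ suc (r + r) → r ≡ 2 * t → m ∣ r ⊎ m ∣ suc r → Condition q
      odd  : ∀ r t → q ≡ suc (r + r) → r ≡ suc (2 * t) → HalfMultiple r ⊎ HalfMultiple (suc r) → Condition q

    private
      q²-1 : ∀ r → suc (r + r) * suc (r + r) ≡ suc ((r + r) * (suc r + suc r))
      q²-1 r = N.solve 1 (λ r → (N.con 1 N.:+ (r N.:+ r)) N.:* (N.con 1 N.:+ (r N.:+ r))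
        N.:= N.con 1 N.:+ (r N.:+ r) N.:* ((N.con 1 N.:+ r) N.:+ (N.con 1 N.:+ r))) refl r

      2∣double : ∀ r → 2 ∣ r + r
      2∣double r = divides r (N.solve 1 (λ r → r N.:+ r N.:= r N.:* N.con 2) refl r)

      2m∣ : ∀ {a b} → m ∣ a → 2 ∣ b → 2 * m ∣ a * b
      2m∣ {a} {b} ma 2b = subst (2 * m ∣_) (*-comm b a) (∣-trans (*-monoʳ-∣ 2 ma) (*-monoˡ-∣ a 2b))

    -- q² - 1 = 2r (2r + 2): each alternative makes one factor a multiple of m while the other is
    -- even. Hence the order of p modulo 2m divides 2w.
    condition⇒cong : ∀ {p w} → Condition (p ^ w) → IntCong (2 * m) (+ (p ^ (w + w))) 1ℤ
    condition⇒cong {p} {w} c = goal c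
      where
      square : ∀ {r} → p ^ w ≡ suc (r + r) → 2 * m ∣ (r + r) * (suc r + suc r) → IntCong (2 * m) (+ (p ^ (w + w))) 1ℤ
      square {r} q≡ d = subst (λ k → IntCong (2 * m) (+ k) 1ℤ)
          (sym (trans (^-distribˡ-+-* p w w) (trans (cong₂ _*_ q≡ q≡) (q²-1 r)))) d
      from-r : ∀ {r} → m ∣ r + r → 2 * m ∣ (r + r) * (suc r + suc r)
      from-r {r} d = 2m∣ d (2∣double (suc r))
      from-suc : ∀ {r} → m ∣ suc r + suc r → 2 * m ∣ (r + r) * (suc r + suc r)
      from-suc {r} d = subst (2 * m ∣_) (*-comm (suc r + suc r) (r + r)) (2m∣ d (2∣double r))
      goal : Condition (p ^ w) → IntCong (2 * m) (+ (p ^ (w + w))) 1ℤ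
      goal (even r t q≡ _ (inj₁ d))       = square {r} q≡ (from-r {r} (∣m∣n⇒∣m+n d d))
      goal (even r t q≡ _ (inj₂ d))       = square {r} q≡ (from-suc {r} (∣m∣n⇒∣m+n d d))
      goal (odd r t q≡ _ (inj₁ (d , _)))  = square {r} q≡ (from-r {r} d)
      goal (odd r t q≡ _ (inj₂ (d , _)))  = square {r} q≡ (from-suc {r} d)

  -- Written as q = 1 + r + r with r even or odd, the shape in which `Condition` and the
  -- factorisations of x^q - x take q.
  Is1Mod4 Is3Mod4 : ℕ → Set
  Is1Mod4 q = ∃[ t ] q ≡ suc (2 * t + 2 * t)
  Is3Mod4 q = ∃[ t ] q ≡ suc (suc (2 * t) + suc (2 * t))

  1mod4⇒ : ∀ {q} → q % 4 ≡ 1 → Is1Mod4 q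
  1mod4⇒ {q} e = q / 4 , trans (m≡m%n+[m/n]*n q 4) (trans (cong (_+ q / 4 * 4) e)
    (N.solve 1 (λ t → N.con 1 N.:+ t N.:* N.con 4 N.:= N.con 1 N.:+ (N.con 2 N.:* t N.:+ N.con 2 N.:* t)) refl (q / 4)))

  3mod4⇒ : ∀ {q} → q % 4 ≡ 3 → Is3Mod4 q
  3mod4⇒ {q} e = q / 4 , trans (m≡m%n+[m/n]*n q 4) (trans (cong (_+ q / 4 * 4) e)
    (N.solve 1 (λ t → N.con 3 N.:+ t N.:* N.con 4 N.:= N.con 1 N.:+
        ((N.con 1 N.:+ N.con 2 N.:* t) N.:+ (N.con 1 N.:+ N.con 2 N.:* t))) refl (q / 4)))

  1*1mod4 : ∀ {a b} → Is1Mod4 a → Is1Mod4 b → Is1Mod4 (a * b)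
  1*1mod4 (s , refl) (t , refl) = s + t + 4 * s * t , N.solve 2 (λ s t →
    (N.con 1 N.:+ (N.con 2 N.:* s N.:+ N.con 2 N.:* s)) N.:* (N.con 1 N.:+ (N.con 2 N.:* t N.:+ N.con 2 N.:* t))
    N.:= N.con 1 N.:+ (N.con 2 N.:* (s N.:+ t N.:+ N.con 4 N.:* s N.:* t) N.:+ N.con 2 N.:*
        (s N.:+ t N.:+ N.con 4 N.:* s N.:* t))) refl s t

  3*1mod4 : ∀ {a b} → Is3Mod4 a → Is1Mod4 b → Is3Mod4 (a * b)
  3*1mod4 (s , refl) (t , refl) = s + 3 * t + 4 * s * t , N.solve 2 (λ s t →
    (N.con 1 N.:+ ((N.con 1 N.:+ N.con 2 N.:* s) N.:+ (N.con 1 N.:+ N.con 2 N.:* s))) N.:*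
        (N.con 1 N.:+ (N.con 2 N.:* t N.:+ N.con 2 N.:* t))
    N.:= N.con 1 N.:+ ((N.con 1 N.:+ N.con 2 N.:* (s N.:+ N.con 3 N.:* t N.:+ N.con 4 N.:* s N.:* t)) N.:+
        (N.con 1 N.:+ N.con 2 N.:* (s N.:+ N.con 3 N.:* t N.:+ N.con 4 N.:* s N.:* t)))) refl s t

  3*3mod4 : ∀ {a b} → Is3Mod4 a → Is3Mod4 b → Is1Mod4 (a * b)
  3*3mod4 (s , refl) (t , refl) = 2 + 3 * s + 3 * t + 4 * s * t , N.solve 2 (λ s t →
    (N.con 1 N.:+ ((N.con 1 N.:+ N.con 2 N.:* s) N.:+ (N.con 1 N.:+ N.con 2 N.:* s))) N.:*
        (N.con 1 N.:+ ((N.con 1 N.:+ N.con 2 N.:* t) N.:+ (N.con 1 N.:+ N.con 2 N.:* t)))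
    N.:= N.con 1 N.:+ (N.con 2 N.:* (N.con 2 N.:+ N.con 3 N.:* s N.:+ N.con 3 N.:* t N.:+ N.con 4 N.:* s N.:* t)
        N.:+ N.con 2 N.:* (N.con 2 N.:+ N.con 3 N.:* s N.:+ N.con 3 N.:* t N.:+ N.con 4 N.:* s N.:* t))) refl s
        t

  1mod4^ : ∀ {p} → Is1Mod4 p → ∀ w → Is1Mod4 (p ^ w)
  1mod4^ h zero    = 0 , refl
  1mod4^ h (suc w) = 1*1mod4 h (1mod4^ h w)

  3mod4^even : ∀ {p} → Is3Mod4 p → ∀ c → Is1Mod4 (p ^ (c + c))
  3mod4^even h zero    = 0 , refl
  3mod4^even {p} h (suc c) = subst (λ k → Is1Mod4 (p ^ suc k)) (sym (+-suc c c))
    (subst Is1Mod4 (*-assoc p p (p ^ (c + c))) (1*1mod4 (3*3mod4 h h) (3mod4^even h c)))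

  3mod4^odd : ∀ {p} → Is3Mod4 p → ∀ c → Is3Mod4 (p ^ suc (c + c))
  3mod4^odd h c = 3*1mod4 h (3mod4^even h c)

  1≢3mod4 : ∀ {q} → Is1Mod4 q → ¬ Is3Mod4 q
  1≢3mod4 (s , refl) (t , e) = odd≢ s t (*-cancelˡ-≡ (2 * s) (suc (2 * t)) 2
      (trans (cong (λ z → 2 * s + z) (+-identityʳ _))
      (trans (suc-injective e) (cong (λ z → suc (2 * t) + z) (sym (+-identityʳ _))))))
    where
    odd≢ : ∀ s t → 2 * s ≢ suc (2 * t)
    odd≢ s t e = contradiction (∣1⇒≡1 (∣m+n∣m⇒∣n (subst (2 ∣_) (trans e (+-comm 1 (2 * t))) (m∣m*n s)) (m∣m*n t))) λ ()

-- δ as the least exponent satisfying the congruence conditions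

module LeastExponents where
  open import Data.Nat using (_+_; _*_; _^_; _/_; _%_; NonZero)
  open import Data.Nat.Coprimality using (coprime-divisor)
  open import Data.Nat.DivMod using (m≡m%n+[m/n]*n; m%n<n; m*n%n≡0; [m+kn]%n≡m%n)
  open import Data.Nat.Divisibility
  open import Data.Nat.Properties
  open import Relation.Binary.PropositionalEquality hiding ([_])
  open Congruences

  private
    module N = +-*-Solver

    double : ∀ k → k * 2 ≡ k + k
    double k = N.solve 1 (λ k → k N.:* N.con 2 N.:= k N.:+ k) refl k

  even-halves : ∀ {u} → u % 2 ≡ 0 → u ≡ u / 2 + u / 2
  even-halves {u} e = trans (m≡m%n+[m/n]*n u 2) (trans (cong (_+ u / 2 * 2) e) (double (u / 2)))

  half-double : ∀ w → (w + w) / 2 ≡ w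
  half-double w = trans (cong (_/ 2) (sym (double w))) (m*n/n≡m w 2)

  0mod4-half : ∀ {u} → u % 4 ≡ 0 → ∃[ c ] u / 2 ≡ c + c × u ≡ u / 2 + u / 2
  0mod4-half {u} e = u / 4 , h , trans u≡ (cong₂ _+_ (sym h) (sym h))
    where
    c = u / 4
    u≡ : u ≡ (c + c) + (c + c)
    u≡ = trans (m≡m%n+[m/n]*n u 4) (trans (cong (_+ c * 4) e)
        (N.solve 1 (λ c → c N.:* N.con 4 N.:= (c N.:+ c) N.:+ (c N.:+ c)) refl c))
    h : u / 2 ≡ c + c
    h = trans (cong (_/ 2) u≡) (half-double (c + c))

  2mod4-half : ∀ {u} → u % 4 ≡ 2 → ∃[ c ] u / 2 ≡ suc (c + c) × u ≡ u / 2 + u / 2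
  2mod4-half {u} e = u / 4 , h , trans u≡ (cong₂ _+_ (sym h) (sym h))
    where
    c = u / 4
    u≡ : u ≡ suc (c + c) + suc (c + c)
    u≡ = trans (m≡m%n+[m/n]*n u 4) (trans (cong (_+ c * 4) e)
      (N.solve 1 (λ c → N.con 2 N.:+ c N.:* N.con 4 N.:= (N.con 1 N.:+ (c N.:+ c)) N.:+ (N.con 1 N.:+ (c N.:+ c))) refl c))
    h : u / 2 ≡ suc (c + c)
    h = trans (cong (_/ 2) u≡) (half-double (suc (c + c)))

  double%2 : ∀ w → (w + w) % 2 ≡ 0
  double%2 w = trans (cong (_% 2) (sym (double w))) (m*n%n≡0 w 2)

  quadruple%4 : ∀ c → ((c + c) + (c + c)) % 4 ≡ 0
  quadruple%4 c = trans (cong (_% 4) (N.solve 1 (λ c → (c N.:+ c) N.:+ (c N.:+ c) N.:= c N.:* N.con 4) refl c)) (m*n%n≡0 c 4)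

  quadruple+2%4 : ∀ c → (suc (c + c) + suc (c + c)) % 4 ≡ 2
  quadruple+2%4 c = trans (cong (_% 4) (N.solve 1
      (λ c → (N.con 1 N.:+ (c N.:+ c)) N.:+ (N.con 1 N.:+ (c N.:+ c)) N.:= N.con 2 N.:+ c N.:* N.con 4) refl c))
    ([m+kn]%n≡m%n 2 c 4)

  -- From 0 < 2w < 2u, the only multiple of u left for 2w is u itself.
  multiple-below-double : ∀ {u w} → 0 < w → w < u → u ∣ w + w → u ≡ w + w
  multiple-below-double {u} {w} 0<w w<u (divides zero e) = contradiction (sym e) (<⇒≢ (≤-trans 0<w (m≤m+n w w)))
  multiple-below-double {u} {w} 0<w w<u (divides (suc zero) e) = sym (trans e (+-identityʳ u))
  multiple-below-double {u} {w} 0<w w<u (divides (suc (suc k)) e) =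
    contradiction (subst (2 * u ≤_) (sym e) (*-monoˡ-≤ u (s≤s (s≤s (z≤n {k})))))
      (<⇒≱ (subst (w + w <_) (cong (λ z → u + z) (sym (+-identityʳ u))) (+-mono-< w<u w<u)))

  odd-prime-form : ∀ {p} → Prime p → 2 < p → ∃[ s ] p ≡ suc (2 * s)
  odd-prime-form {p} pr 2<p with parity p
  ... | inj₂ (c , e) = c , trans e (cong (λ z → suc (c + z)) (sym (+-identityʳ c)))
  ... | inj₁ (c , e) with prime⇒irreducible pr (divides {2} c (trans e (sym (double c))))
  ...   | inj₂ 2≡p = contradiction 2≡p (<⇒≢ 2<p)

  private
    1+2c%2 : ∀ c → suc (c + c) % 2 ≡ 1
    1+2c%2 c = trans (cong (λ k → suc k % 2) (sym (double c))) ([m+kn]%n≡m%n 1 c 2)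

    %2≡1⇒ : ∀ {u} → u % 2 ≡ 1 → ∃[ c ] u ≡ suc (c + c)
    %2≡1⇒ {u} e with parity u
    ... | inj₁ (c , refl) = contradiction (trans (sym (double%2 c)) e) λ ()
    ... | inj₂ o          = o

    %2≢1⇒ : ∀ {u} → ¬ u % 2 ≡ 1 → ∃[ c ] u ≡ c + c
    %2≢1⇒ {u} n with parity u
    ... | inj₁ ev         = ev
    ... | inj₂ (c , refl) = contradiction (1+2c%2 c) n

  odd-prime-mod4 : ∀ {p} → Prime p → 2 < p → p % 4 ≡ 1 ⊎ p % 4 ≡ 3
  odd-prime-mod4 {p} pr 2<p = cases (p % 4) refl (m%n<n p 4)
    where
    even⇒⊥ : ¬ 2 ∣ p
    even⇒⊥ d with prime⇒irreducible pr d
    ... | inj₁ ()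
    ... | inj₂ 2≡p = <-irrefl 2≡p 2<p
    p≡ : ∀ r → p % 4 ≡ r → p ≡ r + p / 4 * 4
    p≡ r e = trans (m≡m%n+[m/n]*n p 4) (cong (_+ p / 4 * 4) e)
    cases : ∀ r → p % 4 ≡ r → r < 4 → p % 4 ≡ 1 ⊎ p % 4 ≡ 3
    cases 0 e _ = contradiction (subst (2 ∣_) (sym (p≡ 0 e)) (divides (p / 4 * 2) (sym (*-assoc (p / 4) 2 2)))) even⇒⊥
    cases 1 e _ = inj₁ e
    cases 2 e _ = contradiction (subst (2 ∣_) (sym (p≡ 2 e))
        (divides (suc (p / 4 * 2)) (cong (λ z → 2 + z) (sym (*-assoc (p / 4) 2 2))))) even⇒⊥
    cases 3 e _ = inj₂ e
    cases (suc (suc (suc (suc r)))) e (s≤s (s≤s (s≤s (s≤s ()))))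

  LeastWith : (ℕ → Set) → ℕ → Set
  LeastWith C δ = 0 < δ × C δ × (∀ w → 0 < w → w < δ → ¬ C w)

  module _ {p m u : ℕ} (pr : Prime p) (2<p : 2 < p) (2<m : 2 < m) (ord : IsMultOrder p (2 * m) u) where

    private
      0<m : 0 < m
      0<m = <-trans (s≤s z≤n) 2<m
      instance
        m≢0 : NonZero m
        m≢0 = ℕ.>-nonZero 0<m
      C : ℕ → Set
      C w = Condition m (p ^ w)
      0<u : 0 < u
      0<u = proj₁ ord

      u∣2w : ∀ w → C w → u ∣ w + w
      u∣2w w c = order-∣ ord (w + w) (condition⇒cong m {p} {w} c)

      u≤2w : ∀ {w} → 0 < w → C w → u ≤ w + w
      u≤2w {w} 0<w c = ∣⇒≤ {{ℕ.>-nonZero (≤-trans 0<w (m≤m+n w w))}} (u∣2w w c)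

      -- Every solution w has u dividing 2w, so none lies below u/2.
      half-least : ∀ {δ} → u ≡ δ + δ → C δ → LeastWith C δ
      half-least {δ} u≡ c = n≢0⇒n>0 (λ { refl → <-irrefl (sym u≡) 0<u }) , c ,
        λ w 0<w w<δ cw → <⇒≱ (subst (w + w <_) (sym u≡) (+-mono-< w<δ w<δ)) (u≤2w 0<w cw)

      neg⇒ : ∀ {r} → IntCong (2 * m) (+ suc (r + r)) (ℤ.- 1ℤ) → m ∣ suc r
      neg⇒ {r} c = 2m∣2r⇒m∣r m (subst (2 * m ∣_) (cong suc (sym (+-suc r r))) (cong--1⇒∣ {2 * m} {suc (r + r)} c))

      ⇒neg : ∀ {r} → m ∣ suc r → IntCong (2 * m) (+ suc (r + r)) (ℤ.- 1ℤ)
      ⇒neg {r} d = ∣⇒cong--1 {2 * m} {suc (r + r)} (subst (2 * m ∣_) (cong suc (+-suc r r)) (m∣r⇒2m∣2r m d))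

      at-≡ : ∀ {q q′ x} → q ≡ q′ → IntCong (2 * m) (+ q) x → IntCong (2 * m) (+ q′) x
      at-≡ {x = x} e = subst (λ q → IntCong (2 * m) (+ q) x) e

      one : ∀ {q r} → q ≡ suc (r + r) → IntCong (2 * m) (+ q) 1ℤ → m ∣ r
      one {q} {r} q≡ c = 2m∣2r⇒m∣r m (cong-1⇒∣ {2 * m} {r + r} (at-≡ {q} {suc (r + r)} {1ℤ} q≡ c))

      condition-one : ∀ {q} → Is1Mod4 q → IntCong (2 * m) (+ q) 1ℤ → Condition m q
      condition-one (t , q≡) c = even (2 * t) t q≡ refl (inj₁ (one {r = 2 * t} q≡ c))

      condition-neg : ∀ {q} → Is1Mod4 q → IntCong (2 * m) (+ q) (ℤ.- 1ℤ) → Condition m q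
      condition-neg {q} (t , q≡) c = even (2 * t) t q≡ refl
          (inj₂ (neg⇒ {2 * t} (at-≡ {q} {suc (2 * t + 2 * t)} {ℤ.- 1ℤ} q≡ c)))

      condition-half : ∀ {q} → Is3Mod4 q → IntCong (2 * m) (+ q) (+ m ℤ.+ 1ℤ) ⊎ IntCong (2 * m) (+ q)
          (+ m ℤ.- 1ℤ) → Condition m q
      condition-half {q} (t , q≡) (inj₁ c) = odd (suc (2 * t)) t q≡ refl
          (inj₁ (cong-m+1⇒half m {suc (2 * t)} (at-≡ {q} {x = + m ℤ.+ 1ℤ} q≡ c)))
      condition-half {q} (t , q≡) (inj₂ c) = odd (suc (2 * t)) t q≡ refl
          (inj₂ (cong-m-1⇒half m {suc (2 * t)} (at-≡ {q} {x = + m ℤ.- 1ℤ} q≡ c)))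

      module _ {q : ℕ} where

        1mod4-condition : Is1Mod4 q → Condition m q → IntCong (2 * m) (+ q) 1ℤ ⊎ IntCong (2 * m) (+ q) (ℤ.- 1ℤ)
        1mod4-condition h (even r t q≡ _ (inj₁ d)) = inj₁ (at-≡ {suc (r + r)} {q} {1ℤ} (sym q≡) (m∣r⇒2m∣2r m d))
        1mod4-condition h (even r t q≡ _ (inj₂ d)) = inj₂ (at-≡ {suc (r + r)} {q} {ℤ.- 1ℤ} (sym q≡) (⇒neg {r} d))
        1mod4-condition h (odd r t q≡ refl _)      = contradiction (t , q≡) (1≢3mod4 h)

        3mod4-condition : Is3Mod4 q → Condition m q → ∃[ r ] q ≡ suc (r + r) × (HalfMultiple m r ⊎ HalfMultiple m (suc r))
        3mod4-condition h (even r t q≡ refl _) = contradiction h (1≢3mod4 (t , q≡))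
        3mod4-condition h (odd r t q≡ _ c)     = r , q≡ , c

        3mod4-cong : Is3Mod4 q → Condition m q → IntCong (2 * m) (+ q) (+ m ℤ.+ 1ℤ) ⊎ IntCong (2 * m) (+ q) (+ m ℤ.- 1ℤ)
        3mod4-cong h c with 3mod4-condition h c
        ... | r , q≡ , inj₁ hr = inj₁ (at-≡ {suc (r + r)} {q} {+ m ℤ.+ 1ℤ} (sym q≡) (half⇒cong-m+1 m {r} hr))
        ... | r , q≡ , inj₂ hr = inj₂ (at-≡ {suc (r + r)} {q} {+ m ℤ.- 1ℤ} (sym q≡) (half⇒cong-m-1 m {r} hr))

      m∤2 : ¬ m ∣ 2
      m∤2 d = <⇒≱ 2<m (∣⇒≤ d)

      -- As u is odd and divides 2w, it divides w, so the only candidate below 2u is u. There p^u ≡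
      -- 3 modulo 4 demands an odd multiple of m at 2r or 2(r + 1), whereas p^u ≡ 1 modulo 2m gives
      -- m dividing r; this excludes the first, and the second would make m divide 2.
      case4-least : C4 p m u → LeastWith C (2 * u)
      case4-least (p%4 , u%2) = ≤-trans 0<u (m≤m+n u (u + 0)) ,
          subst C (cong (λ z → u + z) (sym (+-identityʳ u))) (condition-one (3mod4^even p3 u) (order-double)) , least
        where
        p3 = 3mod4⇒ {p} p%4
        order-double : IntCong (2 * m) (+ (p ^ (u + u))) 1ℤ
        order-double = from-q (p ^ u) refl
          where
          from-q : ∀ q → p ^ u ≡ q → IntCong (2 * m) (+ (p ^ (u + u))) 1ℤ
          from-q zero    e = contradiction e (m^n≢0′ u)
            where
            m^n≢0′ : ∀ u → p ^ u ≢ 0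
            m^n≢0′ u e = <-irrefl (sym e) (m^n>0 p {{prime⇒nonZero pr}} u)
          from-q (suc q) e = at-≡ {suc q * suc q} {p ^ (u + u)} {1ℤ} (sym (trans (^-distribˡ-+-* p u u) (cong₂ _*_ e e)))
            (∣m∣n⇒∣m+n d (∣-trans d (m∣m*n (suc q))))
            where
            d : 2 * m ∣ q
            d = cong-1⇒∣ {2 * m} {q} (at-≡ {p ^ u} {suc q} {1ℤ} e (proj₁ (proj₂ ord)))
        least : ∀ w → 0 < w → w < 2 * u → ¬ C w
        least w 0<w w<2u c = multiples u∣w
          where
          u-odd : ¬ 2 ∣ u
          u-odd 2∣u = contradiction (trans (sym (n∣m⇒m%n≡0 u 2 2∣u)) u%2) λ ()
          u∣w : u ∣ w
          u∣w = coprime-divisor {u} {2} {w} (λ (d∣u , d∣2) → two (∣⇒≤ d∣2) d∣u d∣2)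
              (subst (u ∣_) (cong (λ z → w + z) (sym (+-identityʳ w))) (u∣2w w c))
            where
            two : ∀ {d} → d ≤ 2 → d ∣ u → d ∣ 2 → d ≡ 1
            two {zero} _ _ 0∣2 = contradiction (0∣⇒≡0 0∣2) λ ()
            two {suc zero} _ _ _ = refl
            two {suc (suc zero)} _ d∣u _ = contradiction d∣u u-odd
            two {suc (suc (suc d))} (s≤s (s≤s ())) _ _
          3mod4-u : Is3Mod4 (p ^ u)
          3mod4-u = subst (λ k → Is3Mod4 (p ^ k)) (sym (proj₂ (%2≡1⇒ {u} u%2))) (3mod4^odd p3 (proj₁ (%2≡1⇒ {u} u%2)))
          not-half : ¬ (∃[ r ] p ^ u ≡ suc (r + r) × (HalfMultiple m r ⊎ HalfMultiple m (suc r)))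
          not-half (r , q≡ , inj₁ (_ , m∤r)) = m∤r (one {r = r} q≡ (proj₁ (proj₂ ord)))
          not-half (r , q≡ , inj₂ (d , _))   = m∤2 (∣m+n∣m⇒∣n
              (subst (m ∣_) (N.solve 1 (λ r → (N.con 1 N.:+ r) N.:+ (N.con 1 N.:+ r) N.:= (r N.:+ r) N.:+ N.con
                  2) refl r) d) (∣m∣n⇒∣m+n m∣r m∣r))
            where
            m∣r : m ∣ r
            m∣r = one {r = r} q≡ (proj₁ (proj₂ ord))
          multiples : ¬ u ∣ w
          multiples (divides zero          w≡) = <-irrefl (sym w≡) 0<w
          multiples (divides (suc (suc k)) w≡) = <⇒≱ w<2u (subst (2 * u ≤_) (sym w≡) (*-monoˡ-≤ u (s≤s (s≤s (z≤n {k})))))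
          multiples (divides (suc zero)    w≡) = not-half (3mod4-condition 3mod4-u (subst C (trans w≡ (+-identityʳ u)) c))

      -- A smaller solution w would satisfy 2w = u, hence one of C1, C2, C3.
      other-least : ¬ C1 p m u → ¬ C2 p m u → ¬ C3 p m u → ¬ C4 p m u → LeastWith C u
      other-least ¬1 ¬2 ¬3 ¬4 = 0<u , Cu (odd-prime-mod4 pr 2<p) , least
        where
        Cu : p % 4 ≡ 1 ⊎ p % 4 ≡ 3 → C u
        Cu (inj₁ p1) = condition-one (1mod4^ (1mod4⇒ {p} p1) u) (proj₁ (proj₂ ord))
        Cu (inj₂ p3) with %2≢1⇒ {u} (λ e → ¬4 (p3 , e))
        ... | c , u≡ = condition-one (subst (λ k → Is1Mod4 (p ^ k)) (sym u≡) (3mod4^even (3mod4⇒ {p} p3) c))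
            (proj₁ (proj₂ ord))
        least : ∀ w → 0 < w → w < u → ¬ C w
        least w 0<w w<u c = cases (odd-prime-mod4 pr 2<p) (parity w)
          where
          u≡ : u ≡ w + w
          u≡ = multiple-below-double 0<w w<u (u∣2w w c)
          w≡u/2 : w ≡ u / 2
          w≡u/2 = sym (trans (cong (_/ 2) u≡) (half-double w))
          to-half : ∀ {x} → IntCong (2 * m) (+ (p ^ w)) x → IntCong (2 * m) (+ (p ^ (u / 2))) x
          to-half {x} = at-≡ {p ^ w} {p ^ (u / 2)} {x} (cong (p ^_) w≡u/2)
          minimal : ¬ IntCong (2 * m) (+ (p ^ w)) 1ℤ
          minimal = proj₂ (proj₂ ord) w 0<w w<u
          cases : p % 4 ≡ 1 ⊎ p % 4 ≡ 3 → (∃[ c ] w ≡ c + c) ⊎ (∃[ c ] w ≡ suc (c + c)) → _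
          cases (inj₁ p1) _ with 1mod4-condition (1mod4^ (1mod4⇒ {p} p1) w) c
          ... | inj₁ e = minimal e
          ... | inj₂ e = ¬1 (p1 , trans (cong (_% 2) u≡) (double%2 w) , to-half {ℤ.- 1ℤ} e)
          cases (inj₂ p3) (inj₁ (k , refl)) with 1mod4-condition (3mod4^even (3mod4⇒ {p} p3) k) c
          ... | inj₁ e = minimal e
          ... | inj₂ e = ¬2 (p3 , trans (cong (_% 4) u≡) (quadruple%4 k) , to-half {ℤ.- 1ℤ} e)
          cases (inj₂ p3) (inj₂ (k , refl)) with 3mod4-cong (3mod4^odd (3mod4⇒ {p} p3) k) c
          ... | inj₁ e = ¬3 (p3 , trans (cong (_% 4) u≡) (quadruple+2%4 k) , inj₁ (to-half {+ m ℤ.+ 1ℤ} e))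
          ... | inj₂ e = ¬3 (p3 , trans (cong (_% 4) u≡) (quadruple+2%4 k) , inj₂ (to-half {+ m ℤ.- 1ℤ} e))

    Delta3-least : ∀ {δ} → Delta3 p m u δ → LeastWith C δ
    Delta3-least (case1 (p1 , u2 , c)) = half-least (even-halves {u} u2) (condition-neg (1mod4^ (1mod4⇒ {p} p1) (u / 2)) c)
    Delta3-least (case2 (p3 , u4 , c)) with 0mod4-half {u} u4
    ... | k , h , u≡ = half-least u≡ (condition-neg (subst (λ w → Is1Mod4 (p ^ w)) (sym h) (3mod4^even (3mod4⇒ {p} p3) k)) c)
    Delta3-least (case3 (p3 , u4 , c)) with 2mod4-half {u} u4
    ... | k , h , u≡ = half-least u≡ (condition-half (subst (λ w → Is3Mod4 (p ^ w)) (sym h) (3mod4^odd (3mod4⇒ {p} p3) k)) c)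
    Delta3-least (case4 c)           = case4-least c
    Delta3-least (other a b c d)     = other-least a b c d

    order-witness : ∃[ t ] p ^ u ≡ suc (2 * (m * t))
    order-witness = from-q (p ^ u) refl (proj₁ (proj₂ ord))
      where
      from-q : ∀ q → p ^ u ≡ q → IntCong (2 * m) (+ q) 1ℤ → ∃[ t ] q ≡ suc (2 * (m * t))
      from-q zero    e _ = contradiction (sym e) (<⇒≢ (m^n>0 p {{prime⇒nonZero pr}} u))
      from-q (suc q) e c with cong-1⇒∣ {2 * m} {q} c
      ... | divides t q≡ = t , cong suc (trans q≡ (N.solve 2
          (λ t m → t N.:* (N.con 2 N.:* m) N.:= N.con 2 N.:* (m N.:* t)) refl t m))

  -- Here `q` is 2^w - 1, so the alternatives are 2^w ≡ 1 and 2^w ≡ -1 modulo m, matching the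
  -- indices of F_{2^w - 1} and F_{2^w + 1}.
  TwoCondition : ℕ → ℕ → Set
  TwoCondition m w = ∃[ q ] 2 ^ w ≡ suc q × (m ∣ q ⊎ m ∣ suc (suc q))

  module _ {m u : ℕ} (ord : IsMultOrder 2 m u) where

    private
      0<u : 0 < u
      0<u = proj₁ ord

      2^≡ : ∀ w → 2 ^ w ≡ suc (ℕ.pred (2 ^ w))
      2^≡ w = sym (suc-pred (2 ^ w) {{ℕ.>-nonZero (m^n>0 2 w)}})

      at-≡ : ∀ {q q′ x} → q ≡ q′ → IntCong m (+ q) x → IntCong m (+ q′) x
      at-≡ {x = x} e = subst (λ q → IntCong m (+ q) x) e

      u∣2w : ∀ w → TwoCondition m w → u ∣ w + w
      u∣2w w (q , q≡ , c) = order-∣ ord (w + w) (at-≡ {suc q * suc q} {2 ^ (w + w)} {1ℤ}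
          (sym (trans (^-distribˡ-+-* 2 w w) (cong₂ _*_ q≡ q≡)))
              (subst (m ∣_) (N.solve 1 (λ q → q N.:* (N.con 2 N.:+ q) N.:= q N.:+ q N.:* (N.con 1 N.:+ q)) refl
              q) (factor c)))
        where
        factor : m ∣ q ⊎ m ∣ suc (suc q) → m ∣ q * suc (suc q)
        factor (inj₁ d) = ∣-trans d (m∣m*n (suc (suc q)))
        factor (inj₂ d) = ∣-trans d (n∣m*n q)

    two-order-witness : m ∣ ℕ.pred (2 ^ u)
    two-order-witness = cong-1⇒∣ {m} {ℕ.pred (2 ^ u)} (at-≡ {2 ^ u} {suc (ℕ.pred (2 ^ u))} {1ℤ} (2^≡ u) (proj₁ (proj₂ ord)))

    Delta4-least : ∀ {δ} → Delta4 m u δ → LeastWith (TwoCondition m) δ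
    Delta4-least (half (u2 , c)) = n≢0⇒n>0 (λ e → <-irrefl (sym (trans u≡ (cong₂ _+_ e e))) 0<u) ,
        (ℕ.pred (2 ^ δ) , 2^≡ δ , inj₂ (cong--1⇒∣ {m} {suc (ℕ.pred (2 ^ δ))}
            (at-≡ {2 ^ δ} {suc (ℕ.pred (2 ^ δ))} {ℤ.- 1ℤ} (2^≡ δ) c))) ,
        λ w 0<w w<δ cw → <⇒≱ (subst (w + w <_) (sym u≡) (+-mono-< w<δ w<δ))
          (∣⇒≤ {{ℕ.>-nonZero (≤-trans 0<w (m≤m+n w w))}} (u∣2w w cw))
      where
      δ = u / 2
      u≡ : u ≡ δ + δ
      u≡ = even-halves {u} u2
    Delta4-least (full ¬D) = 0<u , (ℕ.pred (2 ^ u) , 2^≡ u , inj₁ two-order-witness) , least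
      where
      least : ∀ w → 0 < w → w < u → ¬ TwoCondition m w
      least w 0<w w<u cw@(q , q≡ , c) = conclude c
        where
        u≡ : u ≡ w + w
        u≡ = multiple-below-double 0<w w<u (u∣2w w cw)
        conclude : ¬ (m ∣ q ⊎ m ∣ suc (suc q))
        conclude (inj₁ d) = proj₂ (proj₂ ord) w 0<w w<u (at-≡ {suc q} {2 ^ w} {1ℤ} (sym q≡) d)
        conclude (inj₂ d) = ¬D (trans (cong (_% 2) u≡) (double%2 w) ,
          at-≡ {suc q} {2 ^ (u / 2)} {ℤ.- 1ℤ} (trans (sym q≡)
              (cong (2 ^_) (sym (trans (cong (_/ 2) u≡) (half-double w))))) (∣⇒cong--1 {m} {suc q} d))

open Congruences
open LeastExponents

-- Homogenisation

module Summation (R : CR) where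
  open RingTheory R
  open Polynomial R
  open import Relation.Binary.Reasoning.Setoid setoid

  ∑≤-cong : ∀ n {g h} → (∀ a → a ≤ n → g a ≈ h a) → ∑≤ n g ≈ ∑≤ n h
  ∑≤-cong zero    e = e 0 z≤n
  ∑≤-cong (suc n) e = +-cong (∑≤-cong n λ a l → e a (ℕₚ.m≤n⇒m≤1+n l)) (e (suc n) ℕₚ.≤-refl)

  ∑≤-zero : ∀ n {h} → (∀ a → a ≤ n → h a ≈ 0#) → ∑≤ n h ≈ 0#
  ∑≤-zero zero    e = e 0 z≤n
  ∑≤-zero (suc n) e = trans (+-cong (∑≤-zero n λ a l → e a (ℕₚ.m≤n⇒m≤1+n l)) (e (suc n) ℕₚ.≤-refl)) (+-identityˡ 0#)

  ∑≤-single : ∀ n {h} c → c ≤ n → (∀ a → a ≤ n → a ≢ c → h a ≈ 0#) → ∑≤ n h ≈ h c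
  ∑≤-single zero    zero _ e = refl
  ∑≤-single (suc n) {h} c l e with c ℕ.≟ suc n
  ... | yes ≡.refl = trans (+-congʳ (∑≤-zero n λ a k → e a (ℕₚ.m≤n⇒m≤1+n k) (ℕₚ.<⇒≢ (s≤s k)))) (+-identityˡ _)
  ... | no  c≢     = trans (+-cong (∑≤-single n c (ℕₚ.≤-pred (ℕₚ.≤∧≢⇒< l c≢)) λ a k → e a (ℕₚ.m≤n⇒m≤1+n k))
          (e (suc n) ℕₚ.≤-refl (c≢ ∘ ≡.sym))) (+-identityʳ _)

  ∑≤-suc : ∀ n h → ∑≤ (suc n) h ≈ h 0 + ∑≤ n (h ∘ suc)
  ∑≤-suc zero    h = refl
  ∑≤-suc (suc n) h = trans (+-congʳ (∑≤-suc n h)) (+-assoc _ _ _)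

  coeff-mul-∑≤ : ∀ p q i → coeff (mul p q) i ≈ ∑≤ i (λ a → coeff p a * coeff q (i ∸ a))
  coeff-mul-∑≤ []      q i       = sym (∑≤-zero i λ a _ → zeroˡ _)
  coeff-mul-∑≤ (a ∷ p) q zero    = trans (coeff-mul a p q 0) (+-identityʳ _)
  coeff-mul-∑≤ (a ∷ p) q (suc i) = trans (coeff-mul a p q (suc i)) (trans (+-congˡ (coeff-mul-∑≤ p q i))
    (sym (∑≤-suc i (λ b → coeff (a ∷ p) b * coeff q (suc i ∸ b)))))

  tabulate : ℕ → (ℕ → Carrier) → Poly
  tabulate zero    h = []
  tabulate (suc n) h = h 0 ∷ tabulate n (h ∘ suc)

  coeff-tabulate : ∀ n h i → i < n → coeff (tabulate n h) i ≡ h i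
  coeff-tabulate (suc n) h zero    l       = ≡.refl
  coeff-tabulate (suc n) h (suc i) (s≤s l) = coeff-tabulate n (h ∘ suc) i l

  coeff-tabulate-≥ : ∀ n h i → n ≤ i → coeff (tabulate n h) i ≡ 0#
  coeff-tabulate-≥ zero    h i       l       = ≡.refl
  coeff-tabulate-≥ (suc n) h (suc i) (s≤s l) = coeff-tabulate-≥ n (h ∘ suc) i l

  -- Evaluation at 1, used to dehomogenise; `sumCoeffs-+` and `sumCoeffs-*` make it a ring
  -- homomorphism.
  sumCoeffs : Poly → Carrier
  sumCoeffs []      = 0#
  sumCoeffs (a ∷ p) = a + sumCoeffs p

  sumCoeffs-tabulate : ∀ n h → sumCoeffs (tabulate (suc n) h) ≈ ∑≤ n h
  sumCoeffs-tabulate zero    h = +-identityʳ _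
  sumCoeffs-tabulate (suc n) h = trans (+-congˡ (sumCoeffs-tabulate n (h ∘ suc))) (sym (∑≤-suc n h))

  private
    sumCoeffs-0 : ∀ p → p ≋ [] → sumCoeffs p ≈ 0#
    sumCoeffs-0 []      e = refl
    sumCoeffs-0 (a ∷ p) e = trans (+-cong (at e 0) (sumCoeffs-0 p (ext λ i → at e (suc i)))) (+-identityˡ 0#)

  sumCoeffs-cong : ∀ {p q} → p ≋ q → sumCoeffs p ≈ sumCoeffs q
  sumCoeffs-cong {[]}    {q}     e = sym (sumCoeffs-0 q (≋-sym e))
  sumCoeffs-cong {a ∷ p} {[]}    e = sumCoeffs-0 (a ∷ p) e
  sumCoeffs-cong {a ∷ p} {b ∷ q} e = +-cong (at e 0) (sumCoeffs-cong {p} {q} (ext λ i → at e (suc i)))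

  sumCoeffs-+ : ∀ p q → sumCoeffs (add p q) ≈ sumCoeffs p + sumCoeffs q
  sumCoeffs-+ []      q       = sym (+-identityˡ _)
  sumCoeffs-+ (a ∷ p) []      = sym (+-identityʳ _)
  sumCoeffs-+ (a ∷ p) (b ∷ q) = trans (+-congˡ (sumCoeffs-+ p q))
    (solve 4 (λ a b u v → (a :+ b) :+ (u :+ v) := (a :+ u) :+ (b :+ v)) refl a b (sumCoeffs p) (sumCoeffs q))

  private
    sumCoeffs-scale : ∀ a q → sumCoeffs (map (a *_) q) ≈ a * sumCoeffs q
    sumCoeffs-scale a []      = sym (zeroʳ a)
    sumCoeffs-scale a (b ∷ q) = trans (+-congˡ (sumCoeffs-scale a q)) (sym (distribˡ a b _))

  sumCoeffs-* : ∀ p q → sumCoeffs (mul p q) ≈ sumCoeffs p * sumCoeffs q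
  sumCoeffs-* []      q = sym (zeroˡ _)
  sumCoeffs-* (a ∷ p) q = begin
    sumCoeffs (add (map (a *_) q) (0# ∷ mul p q))              ≈⟨ sumCoeffs-+ (map (a *_) q) (0# ∷ mul p q) ⟩
    sumCoeffs (map (a *_) q) + (0# + sumCoeffs (mul p q))      ≈⟨ +-cong (sumCoeffs-scale a q)
        (trans (+-identityˡ _) (sumCoeffs-* p q)) ⟩
    a * sumCoeffs q + sumCoeffs p * sumCoeffs q                ≈⟨ distribʳ (sumCoeffs q) a (sumCoeffs p) ⟨
    (a + sumCoeffs p) * sumCoeffs q                            ∎

record DecidableDomain (R : CR) : Set where
  open RingTheory R
  field
    0?               : ∀ a → Dec (a ≈ 0#)
    1≉0              : ¬ 1# ≈ 0#
    no-zero-divisors : ∀ {a b} → a * b ≈ 0# → a ≈ 0# ⊎ b ≈ 0#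

module DomainPolynomial {R : CR} (dom : DecidableDomain R) where
  open RingTheory R
  open Polynomial R
  open DecidableDomain dom

  HasDegree : Poly → ℕ → Set
  HasDegree A a = Deg< A (suc a) × ¬ coeff A a ≈ 0#

  degree : ∀ A → A ≋ [] ⊎ ∃ (HasDegree A)
  degree A = go (length A) (Deg<-length A)
    where
    go : ∀ n → Deg< A n → A ≋ [] ⊎ ∃ (HasDegree A)
    go zero    d = inj₁ (Deg<-0 {A} d)
    go (suc n) d with 0? (coeff A n)
    ... | yes e = go n (Deg<-pred {A} d e)
    ... | no ne = inj₂ (n , d , ne)

  coeff-top≉0 : ∀ {A B a b} → HasDegree A a → HasDegree B b → ¬ coeff A a * coeff B b ≈ 0#
  coeff-top≉0 {A} {B} {a} {b} (_ , na) (_ , nb) e = [na,nb] (no-zero-divisors e)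
    where
    [na,nb] : ¬ (coeff A a ≈ 0# ⊎ coeff B b ≈ 0#)
    [na,nb] (inj₁ x) = na x
    [na,nb] (inj₂ y) = nb y

  poly-no-zero-divisors : ∀ {A B} → mul A B ≋ [] → A ≋ [] ⊎ B ≋ []
  poly-no-zero-divisors {A} {B} e with degree A | degree B
  ... | inj₁ z       | _            = inj₁ z
  ... | inj₂ _       | inj₁ z       = inj₂ z
  ... | inj₂ (a , h) | inj₂ (b , k) = contradiction
          (trans (sym (coeff-mul-top A B a b (proj₁ h) (proj₁ k))) (at e (a ℕ.+ b))) (coeff-top≉0 {A} {B} h k)

  record MonicFactors (A B : Poly) (δ : ℕ) : Set where
    field
      a b    : ℕ
      deg-A  : Deg< A (suc a)
      deg-B  : Deg< B (suc b)
      a+b≡δ  : a ℕ.+ b ≡ δ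
      tops   : coeff A a * coeff B b ≈ 1#

  -- In a domain the product of the leading coefficients is nonzero, so it is the leading
  -- coefficient of M, namely 1: the degrees add up and the two leading coefficients are inverse to
  -- each other.
  monic-factors : ∀ {A B M δ} → Monic δ M → M ≋ mul A B → MonicFactors A B δ
  monic-factors {A} {B} {M} {δ} (monic D t) e with degree A | degree B
  ... | inj₁ z       | _            = contradiction
      (trans (sym t) (at (≋-trans e (mul-cong {A} {[]} {B} {B} z ≋-refl)) δ)) 1≉0
  ... | inj₂ _       | inj₁ z       = contradiction
      (trans (sym t) (at (≋-trans e (≋-trans (mul-congˡ A z) (mul-zeroʳ A))) δ)) 1≉0
  ... | inj₂ (a , h) | inj₂ (b , k) = cases (ℕₚ.<-cmp (a ℕ.+ b) δ)
    where
    top : coeff M (a ℕ.+ b) ≈ coeff A a * coeff B b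
    top = trans (at e (a ℕ.+ b)) (coeff-mul-top A B a b (proj₁ h) (proj₁ k))
    cases : Tri (a ℕ.+ b < δ) (a ℕ.+ b ≡ δ) (δ < a ℕ.+ b) → MonicFactors A B δ
    cases (tri< l _ _) = contradiction (trans (sym t) (trans (at e δ) (Deg<-mul A B a b (proj₁ h) (proj₁ k) δ l))) 1≉0
    cases (tri≈ _ q _) = record { a = a ; b = b ; deg-A = proj₁ h ; deg-B = proj₁ k ; a+b≡δ = q
                                ; tops = trans (sym top) (trans (reflexive (≡.cong (coeff M) q)) t) }
    cases (tri> _ _ l) = contradiction (trans (sym top) (D (a ℕ.+ b) l)) (coeff-top≉0 {A} {B} h k)

-- The inner variable is y, evaluated at 1 by eval₁.
module Nested (R : CR) where
  open RingTheory R
  open Polynomial R using (Poly; polyRing; coeff; _≋_; at; ext; coeff-add)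
  module P = RingTheory polyRing
  module PP = Polynomial polyRing
  module S = Summation R
  open S using (sumCoeffs; sumCoeffs-cong; sumCoeffs-+; sumCoeffs-*)
  module SP = Summation polyRing

  coeff-∑≤ : ∀ n (h : ℕ → Poly) i → coeff (P.∑≤ n h) i ≈ ∑≤ n (λ a → coeff (h a) i)
  coeff-∑≤ zero    h i = refl
  coeff-∑≤ (suc n) h i = trans (coeff-add (P.∑≤ n h) (h (suc n)) i) (+-congʳ (coeff-∑≤ n h i))

  eval₁ : PP.Poly → Poly
  eval₁ = map sumCoeffs

  coeff-eval₁ : ∀ A i → coeff (eval₁ A) i ≈ sumCoeffs (PP.coeff A i)
  coeff-eval₁ []      i       = refl
  coeff-eval₁ (a ∷ A) zero    = refl
  coeff-eval₁ (a ∷ A) (suc i) = coeff-eval₁ A i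

  eval₁-cong : ∀ {A B} → A PP.≋ B → eval₁ A ≋ eval₁ B
  eval₁-cong {A} {B} e = ext λ i → trans (coeff-eval₁ A i) (trans (sumCoeffs-cong (PP.at e i)) (sym (coeff-eval₁ B i)))

  eval₁-* : ∀ A B → eval₁ (PP.mul A B) ≋ eval₁ A P.* eval₁ B
  eval₁-* []      B = P.refl
  eval₁-* (a ∷ A) B = ext λ i → begin
    coeff (eval₁ (PP.mul (a ∷ A) B)) i                              ≈⟨ coeff-eval₁ (PP.mul (a ∷ A) B) i ⟩
    sumCoeffs (PP.coeff (PP.mul (a ∷ A) B) i)                       ≈⟨ sumCoeffs-cong (PP.coeff-mul a A B i) ⟩
    sumCoeffs (a P.* PP.coeff B i P.+ PP.coeff ([] ∷ PP.mul A B) i)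
      ≈⟨ trans (sumCoeffs-+ (a P.* PP.coeff B i) _)
          (+-cong (sumCoeffs-* a (PP.coeff B i)) (sym (coeff-eval₁ ([] ∷ PP.mul A B) i))) ⟩
    sumCoeffs a * sumCoeffs (PP.coeff B i) + coeff (0# ∷ eval₁ (PP.mul A B)) i
      ≈⟨ +-cong (*-congˡ (sym (coeff-eval₁ B i))) (at (∷-cong refl (eval₁-* A B)) i) ⟩
    sumCoeffs a * coeff (eval₁ B) i + coeff (0# ∷ (eval₁ A P.* eval₁ B)) i
      ≈⟨ coeff-mul (sumCoeffs a) (eval₁ A) (eval₁ B) i ⟨
    coeff (eval₁ (a ∷ A) P.* eval₁ B) i                             ∎
    where
    open import Relation.Binary.Reasoning.Setoid setoid
    open Polynomial R using (∷-cong; coeff-mul)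

module FieldDomain {p : ℕ} (K : PrimeField p) where
  open PrimeField K using (R; _≟_; inverse; 1≉0)
  open RingTheory R
  open Polynomial R using (polyRing; at)

  field-no-zero-divisors : ∀ {a b} → a * b ≈ 0# → a ≈ 0# ⊎ b ≈ 0#
  field-no-zero-divisors {a} {b} e with a ≟ 0#
  ... | yes z = inj₁ z
  ... | no nz with inverse a nz
  ...   | c , ca≈1 = inj₂ (trans (sym (*-identityˡ b)) (trans (*-congʳ (sym ca≈1))
          (trans (*-assoc c a b) (trans (*-congˡ e) (zeroʳ c)))))

  field-domain : DecidableDomain R
  field-domain = record { 0? = λ a → a ≟ 0# ; 1≉0 = 1≉0 ; no-zero-divisors = field-no-zero-divisors }

  polynomial-domain : DecidableDomain polyRing
  polynomial-domain = record
    { 0? = FieldPolynomial.zero? K ; 1≉0 = λ e → 1≉0 (at e 0)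
    ; no-zero-divisors = λ {A} {B} → DomainPolynomial.poly-no-zero-divisors field-domain {A} {B} }

-- The degree is an argument because a list does not determine it: its last entries may vanish
-- modulo p.
homogenise : ℕ → UPoly → Coeffs
homogenise d f i j with i ℕ.+ j ℕ.≟ d
... | yes _ = coeffU f i
... | no  _ = 0ℤ

homogenise-on : ∀ {d} f {i j} → i ℕ.+ j ≡ d → homogenise d f i j ≡ coeffU f i
homogenise-on {d} f {i} {j} e with i ℕ.+ j ℕ.≟ d
... | yes _ = ≡.refl
... | no  n = contradiction e n

homogenise-off : ∀ {d} f {i j} → i ℕ.+ j ≢ d → homogenise d f i j ≡ 0ℤ
homogenise-off {d} f {i} {j} n with i ℕ.+ j ℕ.≟ d
... | yes e = contradiction e n
... | no  _ = ≡.refl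

IsPoly-homogenise : ∀ d f → IsPoly (homogenise d f)
IsPoly-homogenise d f = d , λ i j l → homogenise-off f {i} {j} (ℕₚ.<⇒≢ l ∘ ≡.sym)

Ψ₂≡homogenise : ∀ {n} → 1 < n → ∀ i j → Ψ₂ n i j ≡ homogenise (φ n) (Ψ n) i j
Ψ₂≡homogenise {n} 1<n i j with n ℕ.≤? 1
... | yes n≤1 = contradiction n≤1 (ℕₚ.<⇒≱ 1<n)
... | no  _ with i ℕ.+ j ℕ.≟ φ n
...   | yes _ = ≡.refl
...   | no  _ = ≡.refl

sumTo≡∑≤ : ∀ n h → sumTo n h ≡ ℤR.∑≤ n h
sumTo≡∑≤ zero    h = ≡.refl
sumTo≡∑≤ (suc n) h = ≡.cong (ℤ._+ h (suc n)) (sumTo≡∑≤ n h)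

-- Multiplicativity of homogenisation, and passage to nested polynomials

module Bivariate {p : ℕ} (pr : Prime p) where
  open ModP pr hiding (fib)
  open Summation (PrimeField.R K)
    using (∑≤-cong; ∑≤-zero; ∑≤-single; coeff-mul-∑≤; tabulate; coeff-tabulate; coeff-tabulate-≥)
  open Nested (PrimeField.R K) using (module PP; module SP; coeff-∑≤)

  open K using (∑≤)

  infix 4 _≈₂_
  record _≈₂_ (f g : Coeffs) : Set where
    constructor ext₂
    field
      at₂ : ∀ i j → f i j K.≈ g i j
  open _≈₂_ public

  ≈₂-refl : ∀ {f} → f ≈₂ f
  ≈₂-refl = ext₂ λ i j → K.refl

  ≈₂-sym : ∀ {f g} → f ≈₂ g → g ≈₂ f
  ≈₂-sym e = ext₂ λ i j → K.sym (at₂ e i j)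

  ≈₂-trans : ∀ {f g h} → f ≈₂ g → g ≈₂ h → f ≈₂ h
  ≈₂-trans e e′ = ext₂ λ i j → K.trans (at₂ e i j) (at₂ e′ i j)

  ≈₂⇒≡[] : ∀ {f g} → f ≈₂ g → f ≡[ p ] g
  ≈₂⇒≡[] e i j = ≈⇒IntCong (at₂ e i j)

  ≡[]⇒≈₂ : ∀ {f g} → f ≡[ p ] g → f ≈₂ g
  ≡[]⇒≈₂ e = ext₂ λ i j → IntCong⇒≈ (e i j)

  *P-∑≤ : ∀ f g i j → (f *P g) i j K.≈ ∑≤ i (λ a → ∑≤ j (λ b → f a b K.* g (i ℕ.∸ a) (j ℕ.∸ b)))
  *P-∑≤ f g i j = K.trans (K.reflexive (sumTo≡∑≤ i _))
    (∑≤-cong i λ a _ → K.reflexive (sumTo≡∑≤ j (λ b → f a b ℤ.* g (i ℕ.∸ a) (j ℕ.∸ b))))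

  *P-cong : ∀ {f g h k} → f ≈₂ g → h ≈₂ k → f *P h ≈₂ g *P k
  *P-cong {f} {g} {h} {k} e e′ = ext₂ λ i j → K.trans (*P-∑≤ f h i j) (K.trans
    (∑≤-cong i λ a _ → ∑≤-cong j λ b _ → K.*-cong (at₂ e a b) (at₂ e′ (i ℕ.∸ a) (j ℕ.∸ b))) (K.sym (*P-∑≤ g k i j)))

  hom-on : ∀ {d} f i j → i ℕ.+ j ≡ d → homogenise d f i j K.≈ coeff f i
  hom-on {d} f i j e = K.reflexive (≡.trans (homogenise-on f {i} {j} e) (coeffU≡coeff f i))

  hom-off : ∀ {d} f i j → i ℕ.+ j ≢ d → homogenise d f i j K.≈ K.0#
  hom-off f i j n = K.reflexive (homogenise-off f {i} {j} n)

  hom-cong : ∀ d {f g} → f ≋ g → homogenise d f ≈₂ homogenise d g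
  hom-cong d {f} {g} e = ext₂ λ i j → cases i j (i ℕ.+ j ℕ.≟ d)
    where
    cases : ∀ i j → Dec (i ℕ.+ j ≡ d) → homogenise d f i j K.≈ homogenise d g i j
    cases i j (yes q) = K.trans (hom-on f i j q) (K.trans (at e i) (K.sym (hom-on g i j q)))
    cases i j (no n)  = K.trans (hom-off f i j n) (K.sym (hom-off g i j n))

  private
    sub-sum : ∀ {i j a b} → a ≤ i → b ≤ j → (i ℕ.∸ a) ℕ.+ (j ℕ.∸ b) ℕ.+ (a ℕ.+ b) ≡ i ℕ.+ j
    sub-sum {i} {j} {a} {b} a≤i b≤j = ≡.trans
      (N.solve 4 (λ x y a b → (x N.:+ y) N.:+ (a N.:+ b) N.:= (x N.:+ a) N.:+ (y N.:+ b)) ≡.refl (i ℕ.∸ a) (j ℕ.∸ b) a b)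
      (≡.cong₂ ℕ._+_ (ℕₚ.m∸n+n≡m a≤i) (ℕₚ.m∸n+n≡m b≤j))
      where module N = +-*-Solver

  module _ {d e : ℕ} {f g : Poly} (Df : Deg< f (suc d)) (Dg : Deg< g (suc e)) where
    private
      term : ∀ i j a b → ℤ
      term i j a b = homogenise d f a b K.* homogenise e g (i ℕ.∸ a) (j ℕ.∸ b)

      term-off : ∀ i j a b → a ℕ.+ b ≢ d → term i j a b K.≈ K.0#
      term-off i j a b n = K.trans (K.*-congʳ {homogenise e g (i ℕ.∸ a) (j ℕ.∸ b)} (hom-off f a b n))
          (K.zeroˡ (homogenise e g (i ℕ.∸ a) (j ℕ.∸ b)))

      inner-off : ∀ i j → i ℕ.+ j ≢ d ℕ.+ e → ∀ a → a ≤ i → ∀ b → b ≤ j → term i j a b K.≈ K.0#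
      inner-off i j n a a≤i b b≤j = cases (a ℕ.+ b ℕ.≟ d)
        where
        cases : Dec (a ℕ.+ b ≡ d) → term i j a b K.≈ K.0#
        cases (no m)  = term-off i j a b m
        cases (yes q) = K.trans (K.*-congˡ {homogenise d f a b} (hom-off g (i ℕ.∸ a) (j ℕ.∸ b) λ r →
          n (≡.trans (≡.sym (sub-sum a≤i b≤j)) (≡.trans (≡.cong₂ ℕ._+_ r q) (ℕₚ.+-comm e d))))) (K.zeroʳ (homogenise d f a b))

      -- For fixed a the sum over b has at most one nonzero term, at b = d - a, which collapses the
      -- double convolution to a single one.
      inner-on : ∀ i j → i ℕ.+ j ≡ d ℕ.+ e → ∀ a → a ≤ i → ∑≤ j (term i j a) K.≈ coeff f a K.* coeff g (i ℕ.∸ a)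
      inner-on i j q a a≤i = cases (a ℕ.≤? d)
        where
        -- When d - a exceeds j, the surviving index b is out of range; then i - a exceeds e, so the
        -- coefficient of g on the other side is 0 too.
        far : a ≤ d → j < d ℕ.∸ a → suc e ≤ i ℕ.∸ a
        far a≤d j<d∸a = ℕₚ.+-cancelʳ-≤ (a ℕ.+ j) (suc e) (i ℕ.∸ a) (≡.subst₂ _≤_ (≡.cong suc (ℕₚ.+-comm (a ℕ.+ j) e))
          (≡.trans (≡.sym q) (≡.trans (≡.cong (ℕ._+ j) (≡.sym (ℕₚ.m∸n+n≡m a≤i))) (ℕₚ.+-assoc (i ℕ.∸ a) a j)))
          (ℕₚ.+-monoˡ-≤ e (ℕₚ.≤-trans (≡.subst (a ℕ.+ j <_) (ℕₚ.m+[n∸m]≡n a≤d) (ℕₚ.+-monoʳ-< a j<d∸a)) ℕₚ.≤-refl)))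
        cases : Dec (a ≤ d) → ∑≤ j (term i j a) K.≈ coeff f a K.* coeff g (i ℕ.∸ a)
        cases (no a≰d) = K.trans (∑≤-zero j λ b _ → term-off i j a b λ r → a≰d (≡.subst (a ≤_) r (ℕₚ.m≤m+n a b)))
          (K.sym (K.trans (K.*-congʳ {coeff g (i ℕ.∸ a)} (Df a (ℕₚ.≰⇒> a≰d))) (K.zeroˡ (coeff g (i ℕ.∸ a)))))
        cases (yes a≤d) = cases′ (d ℕ.∸ a ℕ.≤? j)
          where
          b₀ = d ℕ.∸ a
          a+b₀ : a ℕ.+ b₀ ≡ d
          a+b₀ = ℕₚ.m+[n∸m]≡n a≤d
          cases′ : Dec (b₀ ≤ j) → ∑≤ j (term i j a) K.≈ coeff f a K.* coeff g (i ℕ.∸ a)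
          cases′ (yes b₀≤j) = K.trans (∑≤-single j b₀ b₀≤j λ b _ b≢ → term-off i j a b λ r →
              b≢ (ℕₚ.+-cancelˡ-≡ a b b₀ (≡.trans r (≡.sym a+b₀))))
            (K.*-cong (hom-on f a b₀ a+b₀) (hom-on g (i ℕ.∸ a) (j ℕ.∸ b₀)
                (ℕₚ.+-cancelʳ-≡ d _ e (≡.trans (≡.cong ((i ℕ.∸ a) ℕ.+ (j ℕ.∸ b₀) ℕ.+_) (≡.sym a+b₀))
              (≡.trans (sub-sum a≤i b₀≤j) (≡.trans q (ℕₚ.+-comm d e)))))))
          cases′ (no b₀≰j) = K.trans (∑≤-zero j λ b b≤j → term-off i j a b λ r →
              b₀≰j (≡.subst (_≤ j) (≡.sym (≡.trans (≡.cong (ℕ._∸ a) (≡.sym r)) (ℕₚ.m+n∸m≡n a b))) b≤j))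
            (K.sym (K.trans (K.*-congˡ {coeff f a} (Dg (i ℕ.∸ a) (far a≤d (ℕₚ.≰⇒> b₀≰j)))) (K.zeroʳ (coeff f a))))

    hom-* : homogenise d f *P homogenise e g ≈₂ homogenise (d ℕ.+ e) (f P.* g)
    hom-* = ext₂ λ i j → K.trans (*P-∑≤ (homogenise d f) (homogenise e g) i j) (cases i j (i ℕ.+ j ℕ.≟ d ℕ.+ e))
      where
      cases : ∀ i j → Dec (i ℕ.+ j ≡ d ℕ.+ e) → ∑≤ i (λ a → ∑≤ j (term i j a)) K.≈ homogenise (d ℕ.+ e) (f P.* g) i j
      cases i j (yes q) = K.trans (∑≤-cong i (inner-on i j q))
          (K.trans (K.sym (coeff-mul-∑≤ f g i)) (K.sym (hom-on (f P.* g) i j q)))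
      cases i j (no n)  = K.trans (∑≤-zero i λ a a≤i → ∑≤-zero j (inner-off i j n a a≤i)) (K.sym (hom-off (f P.* g) i j n))

  hom-1 : oneP ≈₂ homogenise 0 P.1#
  hom-1 = ext₂ one
    where
    one : ∀ i j → oneP i j K.≈ homogenise 0 P.1# i j
    one zero    zero    = K.refl
    one zero    (suc j) = K.refl
    one (suc i) j       = K.refl

  Deg<-^ : ∀ {f d} n → Deg< f (suc d) → Deg< (f P.^ n) (suc (n ℕ.* d))
  Deg<-^ zero          D = Deg<-length P.1#
  Deg<-^ {f} {d} (suc n) D = Deg<-mul f (f P.^ n) d (n ℕ.* d) D (Deg<-^ n D)

  hom-^ : ∀ {d f} n → Deg< f (suc d) → homogenise d f ^P n ≈₂ homogenise (n ℕ.* d) (f P.^ n)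
  hom-^ zero    D = hom-1
  hom-^ {d} {f} (suc n) D = ≈₂-trans
    (*P-cong {homogenise d f} {homogenise d f} {homogenise d f ^P n} ≈₂-refl (hom-^ {d} {f} n D))
        (hom-* {d} {n ℕ.* d} {f} {f P.^ n} D (Deg<-^ {f} n D))

  hom-prod : ∀ {δ} e fs → All (Monic δ) fs →
    prodP (map (λ f → f ^P e) (map (homogenise δ) fs)) ≈₂ homogenise (length fs ℕ.* (e ℕ.* δ)) (product fs P.^ e)
  hom-prod e []       []       = ≈₂-trans hom-1 (hom-cong 0 (P.sym (P.1^ e)))
  hom-prod {δ} e (f ∷ fs) (M ∷ Ms) = ≈₂-trans (*P-cong (hom-^ e (Monic.deg M)) (hom-prod e fs Ms))
    (≈₂-trans (hom-* (Deg<-^ {f} e (Monic.deg M))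
        (≡.subst (λ k → Deg< (product fs P.^ e) (suc k)) (deg-eq (length fs))
        (Deg<-^ {product fs} e (Monic.deg (Monic-product Ms)))))
      (hom-cong (e ℕ.* δ ℕ.+ length fs ℕ.* (e ℕ.* δ)) (P.sym (P.^-distrib-* f (product fs) e))))
    where
    Monic-product : ∀ {fs} → All (Monic δ) fs → Monic (length fs ℕ.* δ) (product fs)
    Monic-product []       = Monic-1
    Monic-product (M ∷ Ms) = Monic-mul M (Monic-product Ms)
    deg-eq : ∀ n → e ℕ.* (n ℕ.* δ) ≡ n ℕ.* (e ℕ.* δ)
    deg-eq n = N.solve 3 (λ e n d → e N.:* (n N.:* d) N.:= n N.:* (e N.:* d)) ≡.refl e n δ
      where module N = +-*-Solver

  -- A polynomial in x and y as a polynomial in x over polynomials in y.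
  toNested : ∀ g → IsPoly g → PP.Poly
  toNested g (N , _) = SP.tabulate (suc N) (λ i → tabulate (suc N) (g i))

  coeff-toNested : ∀ g (G : IsPoly g) i j → coeff (PP.coeff (toNested g G) i) j K.≈ g i j
  coeff-toNested g (N , z) i j = cases (i ℕ.<? suc N) (j ℕ.<? suc N)
    where
    rows = λ i → tabulate (suc N) (g i)
    row : i < suc N → PP.coeff (SP.tabulate (suc N) rows) i ≡ rows i
    row l = SP.coeff-tabulate (suc N) rows i l
    cases : Dec (i < suc N) → Dec (j < suc N) → coeff (PP.coeff (SP.tabulate (suc N) rows) i) j K.≈ g i j
    cases (yes l) (yes k) = K.reflexive (≡.trans (≡.cong (λ r → coeff r j) (row l)) (coeff-tabulate (suc N) (g i) j k))
    cases (yes l) (no ¬k) = K.reflexive (≡.trans (≡.cong (λ r → coeff r j) (row l))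
        (≡.trans (coeff-tabulate-≥ (suc N) (g i) j (ℕₚ.≮⇒≥ ¬k))
      (≡.sym (z i j (ℕₚ.≤-trans (ℕₚ.≮⇒≥ ¬k) (ℕₚ.m≤n+m j i))))))
    cases (no ¬l) _       = K.reflexive (≡.trans (≡.cong (λ r → coeff r j) (SP.coeff-tabulate-≥ (suc N) rows i (ℕₚ.≮⇒≥ ¬l)))
      (≡.sym (z i j (ℕₚ.≤-trans (ℕₚ.≮⇒≥ ¬l) (ℕₚ.m≤m+n i j)))))

  fromNested : PP.Poly → Coeffs
  fromNested A i j = coeff (PP.coeff A i) j

  IsPoly-fromNested : ∀ A → IsPoly (fromNested A)
  IsPoly-fromNested A = bound A , vanish A
    where
    bound : PP.Poly → ℕ
    bound []      = 0
    bound (r ∷ A) = suc (length r ℕ.+ bound A)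
    coeff-≥ : ∀ (r : Poly) j → length r ≤ j → coeff r j ≡ 0ℤ
    coeff-≥ []      j       l       = ≡.refl
    coeff-≥ (a ∷ r) (suc j) (s≤s l) = coeff-≥ r j l
    vanish : ∀ A i j → bound A < i ℕ.+ j → fromNested A i j ≡ 0ℤ
    vanish []      i       j l = ≡.refl
    vanish (r ∷ A) zero    j l = coeff-≥ r j (ℕₚ.≤-trans (ℕₚ.m≤m+n (length r) (bound A)) (ℕₚ.≤-trans (ℕₚ.n≤1+n _) (ℕₚ.<⇒≤ l)))
    vanish (r ∷ A) (suc i) j (s≤s l) = vanish A i j (ℕₚ.≤-trans (s≤s (ℕₚ.m≤n+m (bound A) (length r))) l)

  fromNested-* : ∀ A B → fromNested (PP.mul A B) ≈₂ fromNested A *P fromNested B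
  fromNested-* A B = ext₂ λ i j → K.trans (at (SP.coeff-mul-∑≤ A B i) j) (K.trans (coeff-∑≤ i _ j)
    (K.trans (∑≤-cong i λ a _ → coeff-mul-∑≤ (PP.coeff A a) (PP.coeff B (i ℕ.∸ a)) j)
        (K.sym (*P-∑≤ (fromNested A) (fromNested B) i j))))

  nested-ext : ∀ {A B} → fromNested A ≈₂ fromNested B → A PP.≋ B
  nested-ext e = PP.ext λ i → ext λ j → at₂ e i j

  fromNested-to : ∀ g (G : IsPoly g) → fromNested (toNested g G) ≈₂ g
  fromNested-to g G = ext₂ (coeff-toNested g G)

  toNested-* : ∀ {f g h} (F : IsPoly f) (G : IsPoly g) (H : IsPoly h) → f ≡[ p ] (g *P h) →
               toNested f F PP.≋ PP.mul (toNested g G) (toNested h H)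
  toNested-* {f} {g} {h} F G H e = nested-ext (≈₂-trans (fromNested-to f F) (≈₂-trans (≡[]⇒≈₂ e)
    (≈₂-trans (*P-cong (≈₂-sym (fromNested-to g G)) (≈₂-sym (fromNested-to h H)))
        (≈₂-sym (fromNested-* (toNested g G) (toNested h H))))))

-- Irreducibility after homogenisation

module HomogeneousIrreducible {p : ℕ} (pr : Prime p) where
  open ModP pr hiding (fib)
  open Bivariate pr
  open Summation (PrimeField.R K)
    using (∑≤-single; tabulate; sumCoeffs; sumCoeffs-tabulate; sumCoeffs-cong; sumCoeffs-*)
  open Nested (PrimeField.R K) using (module PP; module SP; eval₁; coeff-eval₁; eval₁-cong; eval₁-*)

  module DomainP = DomainPolynomial (FieldDomain.polynomial-domain K)

  IsPoly-oneP : IsPoly oneP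
  IsPoly-oneP = 0 , λ { zero (suc j) _ → ≡.refl ; (suc i) j _ → ≡.refl ; zero zero () }

  fromNested-1 : fromNested (P.1# ∷ []) ≈₂ oneP
  fromNested-1 = ext₂ λ { zero zero → K.refl ; zero (suc j) → K.refl ; (suc i) j → K.refl }

  Monic-toNested-oneP : PP.Monic 0 (toNested oneP IsPoly-oneP)
  Monic-toNested-oneP = PP.Monic-cong (nested-ext
      (≈₂-trans fromNested-1 (≈₂-sym (fromNested-to oneP IsPoly-oneP)))) PP.Monic-1

  -- If A B is monic in x and A does not involve x, then the leading
  -- coefficient of B inverts A.
  unit : ∀ {g} (G : IsPoly g) {b} → PP.Deg< (toNested g G) 1 → PP.coeff (toNested g G) 0 P.* b ≋ P.1# → IsUnitMod p g
  unit {g} G {b} D e = fromNested (b ∷ []) , IsPoly-fromNested (b ∷ []) , ≈₂⇒≡[] (≈₂-trans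
    (*P-cong {g} {fromNested A} {fromNested (b ∷ [])} {fromNested (b ∷ [])} (≈₂-sym (fromNested-to g G))
        ≈₂-refl) (≈₂-trans (≈₂-sym (fromNested-* A (b ∷ [])))
      (≈₂-trans (ext₂ λ i j → at (PP.at A*b≋1 i) j) fromNested-1)))
    where
    A = toNested g G
    A≋ : A PP.≋ PP.coeff A 0 ∷ []
    A≋ = PP.ext λ { zero → P.refl ; (suc i) → D (suc i) (s≤s z≤n) }
    A*b≋1 : PP.mul A (b ∷ []) PP.≋ P.1# ∷ []
    A*b≋1 = PP.≋-trans (PP.mul-cong A≋ (PP.≋-refl {b ∷ []}))
        (PP.≋-trans (PP.≋-sym (PP.const-*-const (PP.coeff A 0) b)) (PP.const-cong e))

  module _ {δ : ℕ} {f : Poly} (irr : Irreducible δ f) where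
    private
      h = homogenise δ f
      H = IsPoly-homogenise δ f
      M = Irreducible.isMonic irr
      f̂ = toNested h H

      δ+ : ∀ {j} → 0 < j → δ ℕ.+ j ≢ δ
      δ+ {j} 0<j e = ℕₚ.<⇒≢ (ℕₚ.m<m+n δ 0<j) (≡.sym e)

      Monic-f̂ : PP.Monic δ f̂
      Monic-f̂ = PP.monic
        (λ i l → ext λ j → K.trans (coeff-toNested h H i j)
            (hom-off f i j (λ e → ℕₚ.<⇒≱ l (≡.subst (i ≤_) e (ℕₚ.m≤m+n i j)))))
        (ext λ { zero → K.trans (coeff-toNested h H δ 0) (K.trans (hom-on f δ 0 (ℕₚ.+-identityʳ δ)) (Monic.top M))
               ; (suc j) → K.trans (coeff-toNested h H δ (suc j)) (hom-off f δ (suc j) (δ+ (s≤s z≤n))) })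

      eval-f̂ : eval₁ f̂ ≋ f
      eval-f̂ = ext λ i → K.trans (coeff-eval₁ f̂ i) (cases i (i ℕ.<? suc δ))
        where
        rows = λ i → tabulate (suc δ) (h i)
        cases : ∀ i → Dec (i < suc δ) → sumCoeffs (PP.coeff f̂ i) K.≈ coeff f i
        cases i (yes l) = K.trans (K.reflexive (≡.cong sumCoeffs (SP.coeff-tabulate (suc δ) rows i l)))
          (K.trans (sumCoeffs-tabulate δ (h i)) (K.trans (∑≤-single δ (δ ℕ.∸ i) (ℕₚ.m∸n≤m δ i) λ j _ j≢ → hom-off f i j λ e →
              j≢ (≡.trans (≡.sym (ℕₚ.m+n∸m≡n i j)) (≡.cong (ℕ._∸ i) e))) (hom-on f i (δ ℕ.∸ i) (ℕₚ.m+[n∸m]≡n (ℕₚ.≤-pred l)))))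
        cases i (no ¬l) = K.trans (K.reflexive (≡.cong sumCoeffs (SP.coeff-tabulate-≥ (suc δ) rows i (ℕₚ.≮⇒≥ ¬l))))
          (K.sym (Monic.deg M i (ℕₚ.≮⇒≥ ¬l)))

      Deg<-eval₁ : ∀ A {n} → PP.Deg< A n → Deg< (eval₁ A) n
      Deg<-eval₁ A D i l = K.trans (coeff-eval₁ A i) (sumCoeffs-cong (D i l))

    -- 1 is monic of degree 0 in x, so by additivity of degrees its factors have degree 0 in x,
    -- whereas `h` has positive degree δ.
    not-unit : ¬ IsUnitMod p h
    not-unit (g , G , e) = ℕₚ.<⇒≢ (Irreducible.positive irr) (≡.sym δ≡0)
      where
      MF = DomainP.monic-factors {f̂} {toNested g G} Monic-toNested-oneP
             (toNested-* IsPoly-oneP H G (≈₂⇒≡[] {oneP} {h *P g} (≈₂-sym (≡[]⇒≈₂ {h *P g} {oneP} e))))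
      open DomainP.MonicFactors MF
      a≡0 : a ≡ 0
      a≡0 = ℕₚ.m+n≡0⇒m≡0 a a+b≡δ
      δ≡0 : δ ≡ 0
      δ≡0 = ℕₚ.n≤0⇒n≡0 (ℕₚ.≮⇒≥ (λ 0<δ → 1≉0 (at (P.trans (P.sym (PP.Monic.top Monic-f̂))
          (deg-A δ (≡.subst (_< δ) (≡.sym a≡0) 0<δ))) 0)))

    irreducibleMod : IrreducibleMod p h
    irreducibleMod = (λ e → 1≉0 (K.trans (K.sym (K.trans (hom-on f δ 0 (ℕₚ.+-identityʳ δ)) (Monic.top M)))
        (IntCong⇒≈ (e δ 0)))) , not-unit , factor
      where
      factor : ∀ g k → IsPoly g → IsPoly k → h ≡[ p ] (g *P k) → IsUnitMod p g ⊎ IsUnitMod p k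
      factor g k G L e = cases (a ℕ.≟ 0) (b ℕ.≟ 0)
        where
        A = toNested g G
        B = toNested k L
        f̂≋ = toNested-* H G L e
        MF = DomainP.monic-factors {A} {B} Monic-f̂ f̂≋
        open DomainP.MonicFactors MF
        c = sumCoeffs (PP.coeff A a)
        c′ = sumCoeffs (PP.coeff B b)
        c*c′ : c K.* c′ K.≈ K.1#
        c*c′ = K.trans (K.sym (sumCoeffs-* (PP.coeff A a) (PP.coeff B b)))
            (K.trans (sumCoeffs-cong tops) (K.+-identityʳ K.1#))
        -- The value of A at y = 1, made monic: c and c′ are inverse because the leading
        -- coefficients of A and B are inverse in 𝔽_p[y]. Evaluation therefore does not lower the
        -- degree in x.
        g′ = map (c′ K.*_) (eval₁ A)
        Monic-g′ : Monic a g′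
        Monic-g′ = monic (Deg<-scale {eval₁ A} c′ (Deg<-eval₁ A deg-A))
          (K.trans (coeff-scale c′ (eval₁ A) a) (K.trans (K.*-congˡ {c′} (coeff-eval₁ A a)) (K.trans (K.*-comm c′ c) c*c′)))
        f≋ : f ≋ (const c P.* eval₁ B) P.* g′
        f≋ = P.trans (P.sym eval-f̂) (P.trans (eval₁-cong f̂≋) (P.trans (eval₁-* A B) (P.sym (P.trans
          (P.*-congˡ {const c P.* eval₁ B} (P.sym (const-* c′ (eval₁ A))))
          (P.trans (P.solve 4 (λ c b d a → (c P.:* b) P.:* (d P.:* a) P.:= (c P.:* d) P.:* (a P.:* b)) P.refl
              (const c) (eval₁ B) (const c′) (eval₁ A))
            (P.trans (P.*-congʳ {eval₁ A P.* eval₁ B} (P.trans (P.sym (const-*-const c c′)) (const-cong c*c′)))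
                (P.*-identityˡ (eval₁ A P.* eval₁ B))))))))
        cases : Dec (a ≡ 0) → Dec (b ≡ 0) → IsUnitMod p g ⊎ IsUnitMod p k
        cases (yes a≡0) _ = inj₁ (unit G {PP.coeff B b} (≡.subst (λ a → PP.Deg< A (suc a)) a≡0 deg-A)
          (≡.subst (λ a → PP.coeff A a P.* PP.coeff B b ≋ P.1#) a≡0 tops))
        cases (no _) (yes b≡0) = inj₂ (unit L {PP.coeff A a} (≡.subst (λ b → PP.Deg< B (suc b)) b≡0 deg-B)
          (≡.subst (λ b → PP.coeff B b P.* PP.coeff A a ≋ P.1#) b≡0 (P.trans (P.*-comm (PP.coeff B b) (PP.coeff A a)) tops)))
        cases (no a≢0) (no b≢0) = contradiction (const c P.* eval₁ B , f≋)
          (Irreducible.no-divisor irr Monic-g′ (ℕₚ.n≢0⇒n>0 a≢0) (≡.subst (a <_) a+b≡δ (ℕₚ.m<m+n a (ℕₚ.n≢0⇒n>0 b≢0))))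

    monicInX : MonicInXMod p h δ
    monicInX = (λ i j l → ≈⇒IntCong (hom-off f i j (λ e → ℕₚ.<⇒≱ l (≡.subst (i ≤_) e (ℕₚ.m≤m+n i j)))))
             , ≈⇒IntCong (K.trans (hom-on f δ 0 (ℕₚ.+-identityʳ δ)) (Monic.top M))
             , (λ j 0<j → ≈⇒IntCong (hom-off f δ j (δ+ 0<j)))

    totalDeg : TotalDegMod p h δ
    totalDeg = (λ i j l → ≈⇒IntCong (hom-off f i j (ℕₚ.<⇒≢ l ∘ ≡.sym))) , δ , 0 , ℕₚ.+-identityʳ δ ,
      λ z → 1≉0 (K.trans (K.sym (K.trans (hom-on f δ 0 (ℕₚ.+-identityʳ δ)) (Monic.top M))) (IntCong⇒≈ z))

  homogenise-injective : ∀ {δ f g} → Irreducible δ f → Irreducible δ g → homogenise δ f ≡[ p ] homogenise δ g → f ≋ g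
  homogenise-injective {δ} {f} {g} I J e = ext λ i → cases i (i ℕ.≤? δ)
    where
    cases : ∀ i → Dec (i ≤ δ) → coeff f i K.≈ coeff g i
    cases i (yes l) = K.trans (K.sym (hom-on f i (δ ℕ.∸ i) (ℕₚ.m+[n∸m]≡n l)))
        (K.trans (IntCong⇒≈ (e i (δ ℕ.∸ i))) (hom-on g i (δ ℕ.∸ i) (ℕₚ.m+[n∸m]≡n l)))
    cases i (no ¬l) = K.trans (Monic.deg (Irreducible.isMonic I) i (ℕₚ.≰⇒> ¬l))
        (K.sym (Monic.deg (Irreducible.isMonic J) i (ℕₚ.≰⇒> ¬l)))

  Ψ₂≈ : ∀ {n d g} → 1 < n → φ n ≡ d → Ψ n ≋ g → Ψ₂ n ≈₂ homogenise d g
  Ψ₂≈ {n} {d} {g} 1<n ≡.refl e = ≈₂-trans (ext₂ λ i j → K.reflexive (Ψ₂≡homogenise 1<n i j)) (hom-cong (φ n) e)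

  open Splitting pr

  factorization : ∀ {N δ G n E} → 1 < N → φ N ≡ E ℕ.* n → Ψ N ≋ G P.^ E → (S : Split δ G n) →
                  Factorization p N (length (Split.factors S)) δ E
  factorization {N} {δ} {G} {n} {E} 1<N φN≡ ΨN≋ S = map (homogenise δ) fs , length-map (homogenise δ) fs ,
      Allₚ.map⁺ (All.map (λ {f} I → IsPoly-homogenise δ f , irreducibleMod I , monicInX I , totalDeg I) irr) ,
      AllPairsₚ.map⁺ (distinct′ irr distinct) ,
      ≈₂⇒≡[] (≈₂-trans (Ψ₂≈ 1<N (≡.trans φN≡ exponent) (P.trans ΨN≋ (P.^-congˡ E splits)))
        (≈₂-sym (hom-prod E fs (All.map Irreducible.isMonic irr))))
    where
    open Split S renaming (factors to fs)
    exponent : E ℕ.* n ≡ length fs ℕ.* (E ℕ.* δ)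
    exponent = ≡.trans (≡.cong (E ℕ.*_) degree) (N.solve 3 (λ e l d → e N.:* (l N.:* d) N.:= l N.:* (e N.:* d))
        ≡.refl E (length fs) δ)
      where module N = +-*-Solver
    distinct′ : ∀ {gs} → All (Irreducible δ) gs → AllPairs (λ f g → ¬ f ≋ g) gs →
                AllPairs (λ f g → ¬ homogenise δ f ≡[ p ] homogenise δ g) gs
    distinct′ []       []       = []
    distinct′ (I ∷ Is) (n ∷ ns) = All.map (λ (J , f≉g) e → f≉g (homogenise-injective I J e)) (All.zip (Is , n))
        ∷ distinct′ Is ns

  xP≈ : xP ≈₂ homogenise 1 X
  xP≈ = ext₂ x
    where
    x : ∀ i j → xP i j K.≈ homogenise 1 X i j
    x zero          zero          = K.refl
    x zero          (suc zero)    = K.refl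
    x zero          (suc (suc j)) = K.refl
    x (suc zero)    zero          = K.refl
    x (suc zero)    (suc j)       = K.refl
    x (suc (suc i)) j             = K.refl

  4y²≈ : mono (+ 4) 0 2 ≈₂ homogenise 2 (const (+ 4))
  4y²≈ = ext₂ m
    where
    m : ∀ i j → mono (+ 4) 0 2 i j K.≈ homogenise 2 (const (+ 4)) i j
    m zero    zero                = K.refl
    m zero    (suc zero)          = K.refl
    m zero    (suc (suc zero))    = K.refl
    m zero    (suc (suc (suc j))) = K.refl
    m (suc i) j                   = K.sym (cases (suc i ℕ.+ j ℕ.≟ 2))
      where
      cases : Dec (suc i ℕ.+ j ≡ 2) → homogenise 2 (const (+ 4)) (suc i) j K.≈ K.0#
      cases (yes e) = hom-on (const (+ 4)) (suc i) j e
      cases (no n)  = hom-off (const (+ 4)) (suc i) j n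

  hom-+ : ∀ d f g → homogenise d f +P homogenise d g ≈₂ homogenise d (f P.+ g)
  hom-+ d f g = ext₂ λ i j → cases i j (i ℕ.+ j ℕ.≟ d)
    where
    cases : ∀ i j → Dec (i ℕ.+ j ≡ d) → homogenise d f i j K.+ homogenise d g i j K.≈ homogenise d (f P.+ g) i j
    cases i j (yes e) = K.trans (K.+-cong (hom-on f i j e) (hom-on g i j e))
        (K.trans (K.sym (coeff-add f g i)) (K.sym (hom-on (f P.+ g) i j e)))
    cases i j (no n)  = K.trans (K.+-cong (hom-off f i j n) (hom-off g i j n))
        (K.trans (K.+-identityˡ K.0#) (K.sym (hom-off (f P.+ g) i j n)))

  x²≈ : xP *P xP ≈₂ homogenise 2 (X P.* X)
  x²≈ = ≈₂-trans {xP *P xP} {homogenise 1 X *P homogenise 1 X} {homogenise 2 (X P.* X)}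
    (*P-cong {xP} {homogenise 1 X} {xP} {homogenise 1 X} xP≈ xP≈)
        (hom-* {1} {1} {X} {X} (Monic.deg Monic-X) (Monic.deg Monic-X))

  disc≋ : X P.* X P.+ const (+ 4) ≋ disc
  disc≋ = P.+-congˡ {X P.* X} {const (+ 4)} {P.ι 4} (P.sym {P.ι 4} {const (+ 4)} (const-ι 4))

  x²+4y²≈ : xP *P xP +P mono (+ 4) 0 2 ≈₂ homogenise 2 disc
  x²+4y²≈ = ≈₂-trans {xP *P xP +P mono (+ 4) 0 2} {homogenise 2 (X P.* X) +P homogenise 2 (const (+ 4))} {homogenise 2 disc}
    (ext₂ λ i j → K.+-cong (at₂ x²≈ i j) (at₂ 4y²≈ i j))
    (≈₂-trans {homogenise 2 (X P.* X) +P homogenise 2 (const (+ 4))} {homogenise 2 (X P.* X P.+ const (+ 4))}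
        {homogenise 2 disc}
      (hom-+ 2 (X P.* X) (const (+ 4))) (hom-cong 2 {X P.* X P.+ const (+ 4)} {disc} disc≋))

  ^P-cong : ∀ {f g} n → f ≈₂ g → f ^P n ≈₂ g ^P n
  ^P-cong zero    e = ≈₂-refl
  ^P-cong (suc n) e = *P-cong e (^P-cong n e)

-- Assembly of the four cases

module OddPrime {p m u δ : ℕ} (pr : Prime p) (2<p : 2 < p) (2<m : 2 < m) (cop : Coprime p m)
                (ord : IsMultOrder p (2 ℕ.* m) u) (Δ : Delta3 p m u δ) where
  open ModP pr
  open Splitting pr

  private
    1<m : 1 < m
    1<m = ℕₚ.<⇒≤ 2<m

    mod4 : Is1Mod4 p ⊎ Is3Mod4 p
    mod4 = cases (odd-prime-mod4 pr 2<p)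
      where
      cases : p ℕ.% 4 ≡ 1 ⊎ p ℕ.% 4 ≡ 3 → Is1Mod4 p ⊎ Is3Mod4 p
      cases (inj₁ e) = inj₁ (1mod4⇒ {p} e)
      cases (inj₂ e) = inj₂ (3mod4⇒ {p} e)

    ^mod4 : ∀ w → Is1Mod4 (p ℕ.^ w) ⊎ Is3Mod4 (p ℕ.^ w)
    ^mod4 w = cases mod4 (parity w)
      where
      cases : Is1Mod4 p ⊎ Is3Mod4 p → (∃[ c ] w ≡ c ℕ.+ c) ⊎ (∃[ c ] w ≡ suc (c ℕ.+ c)) → Is1Mod4 (p ℕ.^ w) ⊎
          Is3Mod4 (p ℕ.^ w)
      cases (inj₁ h) _                     = inj₁ (1mod4^ h w)
      cases (inj₂ h) (inj₁ (c , ≡.refl)) = inj₁ (3mod4^even h c)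
      cases (inj₂ h) (inj₂ (c , ≡.refl)) = inj₂ (3mod4^odd h c)

  factor-degree : ∀ {d f} → Irreducible d f → f P.∣ Ψ m → d ≡ δ
  factor-degree irr f∣Ψ = Rk.degree-is-least-fixed δ (proj₁ least) (to-fixed δ (proj₁ (proj₂ least)))
      (λ w 0<w w<δ fix → proj₂ (proj₂ least) w 0<w w<δ (from-fixed w fix))
    where
    module Rk = Rank pr 1<m cop irr f∣Ψ
    module Od = Rk.Odd (proj₁ (odd-prime-form pr 2<p)) (proj₂ (odd-prime-form pr 2<p))
    least = Delta3-least pr 2<p 2<m ord Δ
    to-fixed : ∀ w → Condition m (p ℕ.^ w) → Rk.Fixed w
    to-fixed w (even r t q≡ r≡ c) = Od.even⇒fixed w r t q≡ r≡ c
    to-fixed w (odd r t q≡ r≡ c)  = Od.odd⇒fixed w r t q≡ r≡ c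
    -- The residue of p^w modulo 4 is the parity of r, and so selects the factorisation of x^q - x
    -- from which the condition is read.
    from-fixed : ∀ w → Rk.Fixed w → Condition m (p ℕ.^ w)
    from-fixed w fix = cases (^mod4 w)
      where
      cases : Is1Mod4 (p ℕ.^ w) ⊎ Is3Mod4 (p ℕ.^ w) → Condition m (p ℕ.^ w)
      cases (inj₁ (t , q≡)) = even (2 ℕ.* t) t q≡ ≡.refl (Od.fixed⇒even w (2 ℕ.* t) t q≡ ≡.refl fix)
      cases (inj₂ (t , q≡)) = odd (suc (2 ℕ.* t)) t q≡ ≡.refl (Od.fixed⇒odd w (suc (2 ℕ.* t)) t q≡ ≡.refl fix)

  Ψ-split : Split δ (Ψ m) (φ m)
  Ψ-split = split (Monic-Ψₚ 1<m) λ irr f∣Ψ → factor-degree irr f∣Ψ ,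
    SquarefreeOdd.squarefree pr 1<m u (proj₁ w) (proj₁ ord) (proj₂ w) irr
    where w = order-witness pr 2<p 2<m ord

  factorization-odd : ∀ k → Factorization p (p ℕ.^ k ℕ.* m) (φ m div δ) δ (φ (p ℕ.^ k))
  factorization-odd k = ≡.subst (λ c → Factorization p (p ℕ.^ k ℕ.* m) c δ (φ (p ℕ.^ k)))
      (count (proj₁ (Delta3-least pr 2<p 2<m ord Δ)) (Split.degree Ψ-split))
    (HomogeneousIrreducible.factorization pr {p ℕ.^ k ℕ.* m} {δ} {Ψ m} {φ m} {φ (p ℕ.^ k)} (1<p^k*m k 1<m)
        (φ-p^-* k m 1<m cop) (Ψ-p^-reduction k m 1<m cop) Ψ-split)
    where
    count : ∀ {δ n l} → 0 < δ → n ≡ l ℕ.* δ → l ≡ n div δ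
    count {suc δ} {l = l} _ ≡.refl = ≡.sym (m*n/n≡m l (suc δ))

module PrimeTwo {m u δ : ℕ} (2<m : 2 < m) (cop : Coprime 2 m) (ord : IsMultOrder 2 m u) (Δ : Delta4 m u δ) where
  open ModP prime[2]
  open Splitting prime[2]
  open SquareRoot

  private
    1<m : 1 < m
    1<m = ℕₚ.<⇒≤ 2<m
    least = Delta4-least ord Δ
    -- m is prime to 2, hence odd, so Ψ_m is a square Φ². The halved degree accounts for the 2 in
    -- φ(m)/(2δ), and the square for the 2 in the exponent.
    root = Monic-square-root (Monic-Ψₚ 1<m) (D-Ψ-odd m λ 2∣m → ℕₚ.<⇒≢ (s≤s (s≤s z≤n)) (≡.sym (cop (ℕᵈ.∣-refl , 2∣m))))
    c = proj₁ root
    Φ = proj₁ (proj₂ root)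

    φm≡ : φ m ≡ c ℕ.+ c
    φm≡ = proj₁ (proj₂ (proj₂ root))

    Monic-Φ : Monic c Φ
    Monic-Φ = proj₁ (proj₂ (proj₂ (proj₂ root)))

    Ψ≋Φ² : Ψ m ≋ Φ P.* Φ
    Ψ≋Φ² = proj₂ (proj₂ (proj₂ (proj₂ root)))

  factor-degree : ∀ {d f} → Irreducible d f → f P.∣ Φ → d ≡ δ
  factor-degree irr f∣Φ = Rk.degree-is-least-fixed δ (proj₁ least) (to-fixed δ (proj₁ (proj₂ least)))
      (λ w 0<w w<δ fix → proj₂ (proj₂ least) w 0<w w<δ (from-fixed w fix))
    where
    module Rk = Rank prime[2] 1<m cop irr (P.∣-respʳ (P.sym Ψ≋Φ²) (P.∣-*ˡ Φ f∣Φ))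
    module Tw = Rk.Two ≡.refl 2<m
    to-fixed : ∀ w → TwoCondition m w → Rk.Fixed w
    to-fixed w (q , q≡ , d) = Tw.two⇒fixed w q q≡ d
    from-fixed : ∀ w → Rk.Fixed w → TwoCondition m w
    from-fixed w fix = ℕ.pred (2 ℕ.^ w) , q≡ , Tw.fixed⇒two w (ℕ.pred (2 ℕ.^ w)) q≡ fix
      where
      q≡ : 2 ℕ.^ w ≡ suc (ℕ.pred (2 ℕ.^ w))
      q≡ = ≡.sym (ℕₚ.suc-pred (2 ℕ.^ w) {{ℕ.>-nonZero (ℕₚ.m^n>0 2 w)}})

  Φ-split : Split δ Φ c
  Φ-split = split Monic-Φ λ irr f∣Φ → factor-degree irr f∣Φ ,
    squarefree-root 2<m cop Ψ≋Φ² u (ℕ.pred (2 ℕ.^ u)) (proj₁ ord)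
        (≡.sym (ℕₚ.suc-pred (2 ℕ.^ u) {{ℕ.>-nonZero (ℕₚ.m^n>0 2 u)}}))
      (two-order-witness ord) irr f∣Φ

  factorization-two : ∀ k → Factorization 2 (2 ℕ.^ k ℕ.* m) (φ m div (2 ℕ.* δ)) δ (2 ℕ.* φ (2 ℕ.^ k))
  factorization-two k = ≡.subst (λ l → Factorization 2 (2 ℕ.^ k ℕ.* m) l δ (2 ℕ.* φ (2 ℕ.^ k))) (count (proj₁ least) φm≡2)
    (HomogeneousIrreducible.factorization prime[2] {2 ℕ.^ k ℕ.* m} {δ} {Φ} {c} {2 ℕ.* φ (2 ℕ.^ k)}
        (1<p^k*m k 1<m) exponent Ψ≋ Φ-split)
    where
    module N = +-*-Solver
    l = length (Split.factors Φ-split)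
    exponent : φ (2 ℕ.^ k ℕ.* m) ≡ (2 ℕ.* φ (2 ℕ.^ k)) ℕ.* c
    exponent = ≡.trans (φ-p^-* k m 1<m cop) (≡.trans (≡.cong (φ (2 ℕ.^ k) ℕ.*_) φm≡)
      (N.solve 2 (λ e c → e N.:* (c N.:+ c) N.:= (N.con 2 N.:* e) N.:* c) ≡.refl (φ (2 ℕ.^ k)) c))
    Ψ≋ : Ψ (2 ℕ.^ k ℕ.* m) ≋ Φ P.^ (2 ℕ.* φ (2 ℕ.^ k))
    Ψ≋ = P.trans (Ψ-p^-reduction k m 1<m cop) (P.trans
        (P.^-congˡ (φ (2 ℕ.^ k)) (P.trans Ψ≋Φ² (P.*-congˡ {Φ} (P.sym (P.*-identityʳ Φ)))))
      (P.^-assoc Φ 2 (φ (2 ℕ.^ k))))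
    φm≡2 : φ m ≡ l ℕ.* (2 ℕ.* δ)
    φm≡2 = ≡.trans φm≡ (≡.trans (≡.cong₂ ℕ._+_ (Split.degree Φ-split) (Split.degree Φ-split))
      (N.solve 2 (λ l d → l N.:* d N.:+ l N.:* d N.:= l N.:* (N.con 2 N.:* d)) ≡.refl l δ))
    count : ∀ {δ n l} → 0 < δ → n ≡ l ℕ.* (2 ℕ.* δ) → l ≡ n div (2 ℕ.* δ)
    count {suc δ} {l = l} _ ≡.refl = ≡.sym (m*n/n≡m l (2 ℕ.* suc δ))

module _ {p : ℕ} (pr : Prime p) where
  open ModP pr
  open Bivariate pr
  open HomogeneousIrreducible pr

  two? : p ≡ 2 ⊎ 2 < p
  two? with p ℕ.≟ 2
  ... | yes e = inj₁ e
  ... | no n  = inj₂ (ℕₚ.≤∧≢⇒< 1<p (n ∘ ≡.sym))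

  -- Evenness of φ(p^k) fails only for p^k = 2. When p = 2, the power of X found for 2^k is
  -- rewritten through disc = X².
  Ψ-disc : ∀ j → 2 ℕᵈ.∣ φ (p ℕ.^ suc j) → Ψ (p ℕ.^ suc j) ≋ disc P.^ (φ (p ℕ.^ suc j) ℕ./ 2)
  Ψ-disc j (divides c φ≡) = cases two?
    where
    half≡c : φ (p ℕ.^ suc j) ℕ./ 2 ≡ c
    half≡c = ≡.trans (≡.cong (ℕ._/ 2) φ≡) (m*n/n≡m c 2)
    cases : p ≡ 2 ⊎ 2 < p → Ψ (p ℕ.^ suc j) ≋ disc P.^ (φ (p ℕ.^ suc j) ℕ./ 2)
    cases (inj₂ 2<p) = P.trans (proj₂ (proj₂ O)) (P.reflexive (≡.cong (disc P.^_) (≡.trans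
        (ℕₚ.*-cancelˡ-≡ (proj₁ O) c 2 (≡.trans (≡.sym (proj₁ (proj₂ O))) (≡.trans φ≡ (ℕₚ.*-comm c 2)))) (≡.sym half≡c))))
      where O = Ψ-prime-power-odd (proj₁ (odd-prime-form pr 2<p)) (proj₂ (odd-prime-form pr 2<p)) j
    cases (inj₁ ≡.refl) = P.trans (reduce′ (Mod2.Ψ-2^ j))
        (P.trans (P.reflexive (≡.cong (X P.^_) (≡.trans φ≡ (ℕₚ.*-comm c 2))))
        (P.trans (P.sym (P.^-assoc X 2 c)) (P.trans (P.^-congˡ c (P.sym disc≋X²))
            (P.reflexive (≡.cong (disc P.^_) (≡.sym half≡c))))))
      where
      -- Equality in ℤ/2 does not depend on the proof that 2 is prime.
      module M₂ = ModP prime[2]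
      reduce′ : ∀ {f g} → f M₂.≋ g → f ≋ g
      reduce′ e = ext λ i → M₂.at e i
      disc≋X² : disc ≋ X P.^ 2
      disc≋X² = reduce′ Mod2.disc≋X²

  part-i : ∀ k → 1 ≤ k → 2 ℕᵈ.∣ φ (p ℕ.^ k) →
           Ψ₂ (p ℕ.^ k ℕ.* 1) ≡[ p ] ((xP *P xP +P mono (+ 4) 0 2) ^P (φ (p ℕ.^ k) ℕ./ 2))
  part-i (suc j) _ 2∣φ = ≈₂⇒≡[] (≈₂-trans (Ψ₂≈ 1<q φ≡ Ψ≋)
      (≈₂-sym (≈₂-trans (^P-cong h x²+4y²≈) (hom-^ h (Monic.deg Monic-disc)))))
    where
    q = p ℕ.^ suc j
    h = φ q ℕ./ 2
    1<q : 1 < q ℕ.* 1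
    1<q = ≡.subst (1 <_) (≡.sym (ℕₚ.*-identityʳ q))
        (ℕₚ.<-≤-trans 1<p (≡.subst (_≤ q) (ℕₚ.*-identityʳ p)
        (ℕₚ.*-monoʳ-≤ p (ℕₚ.m^n>0 p {{prime⇒nonZero pr}} j))))
    φ≡ : φ (q ℕ.* 1) ≡ h ℕ.* 2
    φ≡ = ≡.trans (≡.cong φ (ℕₚ.*-identityʳ q)) (≡.sym (m/n*n≡m 2∣φ))
    Ψ≋ : Ψ (q ℕ.* 1) ≋ disc P.^ h
    Ψ≋ = P.trans (P.reflexive (≡.cong Ψ (ℕₚ.*-identityʳ q))) (Ψ-disc j 2∣φ)

  -- `φ 2` and `Ψ 2` compute to 1 and `X`, so the reduction formula at m = 2 is already a power of
  -- `X`.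
  part-ii : Coprime p 2 → ∀ k → Ψ₂ (p ℕ.^ k ℕ.* 2) ≡[ p ] (xP ^P φ (p ℕ.^ k))
  part-ii cop k = ≈₂⇒≡[] (≈₂-trans (Ψ₂≈ (1<p^k*m k (s≤s (s≤s z≤n))) (φ-p^-* k 2 (s≤s (s≤s z≤n)) cop)
      (Ψ-p^-reduction k 2 (s≤s (s≤s z≤n)) cop))
    (≈₂-sym (≈₂-trans (^P-cong (φ (p ℕ.^ k)) xP≈) (hom-^ (φ (p ℕ.^ k)) (Monic.deg Monic-X)))))

open import Data.Nat using (ℕ; _≤_; _<_; _*_; _^_; _/_)
open import Data.Nat.Primality using (Prime)
open import Data.Nat.Coprimality using (Coprime)
open import Data.Nat.Divisibility using (_∣_)
open import Data.Integer using (+_; _+_)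
open import Data.Product using (_×_)
open import Relation.Binary.PropositionalEquality using (_≡_)

theorem1p4 : ∀ (p : ℕ) → Prime p → ∀ (m : ℕ) → 1 ≤ m → Coprime p m → ∀ (k : ℕ) →
    (m ≡ 1 → 1 ≤ k → 2 ∣ φ (p ^ k) →
    Ψ₂ (p ^ k * m) ≡[ p ] ((xP *P xP +P mono (+ 4) 0 2) ^P (φ (p ^ k) / 2)))
    ×
    (m ≡ 2 → Ψ₂ (p ^ k * m) ≡[ p ] (xP ^P φ (p ^ k)))
    ×
    (3 ≤ m → 2 < p → ∀ u δ → IsMultOrder p (2 * m) u → Delta3 p m u δ →
    Factorization p (p ^ k * m) (φ m div δ) δ (φ (p ^ k)))
    ×
    (3 ≤ m → p ≡ 2 → ∀ u δ → IsMultOrder 2 m u → Delta4 m u δ →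
    Factorization p (p ^ k * m) (φ m div (2 * δ)) δ (2 * φ (2 ^ k)))
theorem1p4 p pr m 1≤m cop k =
    (λ { ≡.refl → part-i pr k })
  , (λ { ≡.refl → part-ii pr cop k })
  , (λ 3≤m 2<p u δ ord Δ → OddPrime.factorization-odd pr 2<p 3≤m cop ord Δ k)
  , (λ { 3≤m ≡.refl u δ ord Δ → PrimeTwo.factorization-two 3≤m cop ord Δ k })
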